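{- Let $\lambda/\mu$ be a skew shape with $\ell$ rows such that no column of $\lambda/\mu$ contains more than two boxes. Let $\alpha=(\alpha_1,\dots,\alpha_\ell)$ be given by $\alpha_i=\lambda_i-\mu_i$, and let $\boldsymbol\nu=(\boldsymbol\nu^1,\dots,\boldsymbol\nu^\ell)$ be the tuple of skew shapes in which $\boldsymbol\nu^j$ is the vertical strip $1^{\lambda_j}/1^{\mu_j}$. Then $$\mathrm{LLT}_{\boldsymbol\nu}(\mathbf{x};q)=q^{\mathrm{mininv}(\boldsymbol\nu)}\sum_{\rho\vdash|\lambda'/\mu'|}\mathrm{s}_{\rho'}(\mathbf{x})\sum_{T\in\mathrm{SSYT}(\rho,\alpha)}q^{\mathrm{charge}_\mu(T)}.$$
   Context: $\lambda'$ denotes the conjugate partition; $\mathrm{s}_\rho$ is the Schur function in variables $\mathbf{x}=(x_1,x_2,\dots)$; $1^a/1^b$ (with $a\ge b\ge 0$) is a single column of height $a$ with the boxes in rows $1,\dots,b$ removed. $\mathrm{SSYT}(\lambda/\mu)$ is the set of (skew) semistandard Young tableaux of shape $\lambda/\mu$ (rows weakly increasing, columns strictly increasing in the direction of increasing row index). $\mathrm{SSYT}(\rho,\alpha)$ is the set of semistandard Young tableaux of shape $\rho$ in which the number of entries equal to $i$ is $\alpha_i$ for each $i$ ($\alpha$ may be a weak composition). LLT polynomials. For a $k$-tuple $\boldsymbol\nu=(\boldsymbol\nu^1,\dots,\boldsymbol\nu^k)$ of skew shapes let $\mathrm{SSYT}(\boldsymbol\nu)=\mathrm{SSYT}(\boldsymbol\nu^1)\times\cdots\times\mathrm{SSYT}(\boldsymbol\nu^k)$,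 and for $T=(T^1,\dots,T^k)\in \mathrm{SSYT}(\boldsymbol\nu)$ let $\mathbf{x}^T=\prod_i\mathbf{x}^{T^i}$, the product of $x_e$ over all entries $e$. The content of a cell $u=(r,c)$ (row $r$, column $c$) is $c(u)=c-r$. Entries $T^i(u)>T^j(v)$ form an inversion if and only if ($i<j$ and $c(u)=c(v)$) or ($i>j$ and $c(u)=c(v)-1$). Let $\mathrm{inv}(T)$ be the total number of inversions of $T$, and $$\mathrm{LLT}_{\boldsymbol\nu}(\mathbf{x};q)=\sum_{T\in\mathrm{SSYT}(\boldsymbol\nu)}q^{\mathrm{inv}(T)}\mathbf{x}^T,\qquad \mathrm{mininv}(\boldsymbol\nu)=\min_{T\in\mathrm{SSYT}(\boldsymbol\nu)}\mathrm{inv}(T).$$ Charge. For a permutation $\sigma\in S_k$ let $\mathrm{Des}(\sigma)=\{i\in[k-1]:\sigma_{i+1}<\sigma_i\}$ and $\mathrm{charge}(\sigma)=\sum_{i\in[k-1],\,i\notin\mathrm{Des}(\sigma^{ -1})}(k-i)$. For a word $w$ whose content $\kappa$ is a partition ($\kappa_i$ letters equal to $i$), extract standard subwords as follows: scanning from the right end of $w$, mark the first $1$; continue to the left and mark the first $2$ encountered, then the first $3$, and so on, wrapping around cyclically from the left end to the right end when necessary, until $\kappa'_1$ letters (one of each value $1,\dots,\kappa'_1$) are marked; the marked letters, in their order in $w$, form the first standard subword (a permutation). Delete them and repeat to get the second standard subword (of length $\kappa'_2$), etc. Then $\mathrm{charge}(w)$ is the sum of the charges of the standard subwords. For a partition $\mu$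 and a word $w$ of content $\beta$ such that $\mu+\beta$ is a partition, $\mathrm{charge}_\mu(w)=\mathrm{charge}(w\cdot \ell^{\mu_\ell}\cdots 2^{\mu_2}1^{\mu_1})$ (concatenation, where $i^{\mu_i}$ is the letter $i$ repeated $\mu_i$ times and $\ell$ here is the number of parts of $\mu$). For a semistandard tableau $T$, $\mathrm{charge}_\mu(T)=\mathrm{charge}_\mu(\mathrm{rw}(T))$, where the reading word $\mathrm{rw}(T)$ reads the rows of $T$ (English notation) from bottom to top, each row from left to right. -}

module Defs where

open import Data.Bool using (if_then_else_)
open import Data.Fin using (Fin; toℕ)
import Data.Fin as Fin using (_<_; _>_)
import Data.Fin.Properties as Fin using (_<?_)
open import Data.Integer using (ℤ; _⊖_; pred)
import Data.Integer as ℤ using (_≟_)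
open import Data.List using
  ( List; []; _∷_; _++_; map; filter; break; length; foldr; concatMap; replicate; reverse; zip
  ; upTo; allFin; cartesianProduct; cartesianProductWith)
open import Data.List.Membership.Propositional using (_∈_)
import Data.List.Membership.DecPropositional as DecMembership
open import Data.List.Relation.Unary.All using (All; all?)
open import Data.Nat using
  (ℕ; zero; suc; _+_; _∸_; _⊔_; _≤_; _<_; _>_; _≟_; _≤?_; _<?_; _>?_)
open import Data.Nat.ListAction using (sum)
open import Data.Product using (_×_; _,_; proj₁; proj₂; ∃₂)
import Data.Product.Properties as Product using (≡-dec)
open import Data.Sum using (_⊎_)
open import Data.Vec using (Vec; []; _∷_; lookup; tabulate; zipWith; toList)
import Data.Vec as Vec using (replicate)
import Data.Vec.Properties as Vec using (≡-dec)
open import Relation.Binary.PropositionalEquality using (_≡_)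
open import Relation.Nullary using (Dec; does)
open import Relation.Nullary.Decidable using (_×-dec_; _⊎-dec_; _→-dec_; ¬?)
open import Relation.Unary using (Decidable)

open DecMembership _≟_ using (_∈?_)

-- The integers a+1, …, b.
interval : ℕ → ℕ → List ℕ
interval a b = map (λ k → suc (a + k)) (upTo (b ∸ a))

count : ℕ → List ℕ → ℕ
count a w = length (filter (a ≟_) w)

-- A partition is a weakly decreasing list; trailing zeros are harmless
-- in everything below.

conjugate : List ℕ → List ℕ
conjugate ρ = map (λ j → length (filter (j ≤?_) ρ)) (interval 0 (foldr _⊔_ 0 ρ))

-- Weakly decreasing lists of at most k parts, each between 1 and m.
inBox : ℕ → ℕ → List (List ℕ)
inBox zero    m = [] ∷ []
inBox (suc k) m = [] ∷ concatMap (λ a → map (a ∷_) (inBox k a)) (interval 0 m)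

-- Each partition of n into positive parts, listed exactly once.
partitions : ℕ → List (List ℕ)
partitions n = filter (λ ρ → sum ρ ≟ n) (inBox n n)

-- The diagram outer / inner; the inner list is implicitly padded with zeros.  That it is contained in
-- the outer one and that both are partitions is not part of the record.
infix 5 _╱_
record SkewShape : Set where
  constructor _╱_
  field
    outer inner : List ℕ

open SkewShape public

-- (row , column), both counted from 1.
Cell : Set
Cell = ℕ × ℕ

row column : Cell → ℕ
row    = proj₁
column = proj₂

content : Cell → ℤ
content (r , c) = c ⊖ r

-- Cells are listed in reading order: rows from bottom to top, each row
-- from left to right.
cellsFrom : ℕ → List ℕ → List ℕ → List Cell
cellsFrom r []      _       = []
cellsFrom r (a ∷ o) []      = cellsFrom (suc r) o [] ++ map (r ,_) (interval 0 a)
cellsFrom r (a ∷ o) (b ∷ i) = cellsFrom (suc r) o i ++ map (r ,_) (interval b a)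

cells : SkewShape → List Cell
cells (o ╱ i) = cellsFrom 1 o i

size : SkewShape → ℕ
size S = length (cells S)

columnSize : SkewShape → ℕ → ℕ
columnSize S c = count c (map column (cells S))

-- 1ᵃ/1ᵇ, for b ≤ a.
verticalStrip : ℕ → ℕ → SkewShape
verticalStrip a b = replicate a 1 ╱ replicate b 1

-- A filling of a shape S is a list of entries whose cells are, in order,
-- cells S.
Entry : Set
Entry = Cell × ℕ

Filling : Set
Filling = List Entry

readingWord : Filling → List ℕ
readingWord = map proj₂

Compatible : Entry → Entry → Set
Compatible (u , a) (v , b) =
  (row u ≡ row v → column u < column v → a ≤ b) ×
  (column u ≡ column v → row u < row v → a < b)

compatible? : ∀ x y → Dec (Compatible x y)
compatible? (u , a) (v , b) =
  (row u ≟ row v →-dec (column u <? column v →-dec a ≤? b)) ×-dec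
  (column u ≟ column v →-dec (row u <? row v →-dec a <? b))

Semistandard : Filling → Set
Semistandard T = All (λ x → All (Compatible x) T) T

semistandard? : Decidable Semistandard
semistandard? T = all? (λ x → all? (compatible? x) T) T

-- All fillings with entries in 1, …, N.
fillings : ℕ → List Cell → List Filling
fillings N []       = [] ∷ []
fillings N (u ∷ us) =
  cartesianProductWith (λ a T → (u , a) ∷ T) (interval 0 N) (fillings N us)

-- The elements of SSYT(S) with entries in 1, …, N, each listed once.
ssyt : ℕ → SkewShape → List Filling
ssyt N S = filter semistandard? (fillings N (cells S))

weight : ∀ N → List ℕ → Vec ℕ N
weight N w = tabulate (λ i → count (suc (toℕ i)) w)

-- The elements of SSYT(ρ, α).  Entries beyond ℓ cannot occur, as α has length ℓ.
ssytOfWeight : ∀ {ℓ} → List ℕ → Vec ℕ ℓ → List Filling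
ssytOfWeight {ℓ} ρ α =
  filter (λ T → Vec.≡-dec _≟_ (weight ℓ (readingWord T)) α) (ssyt ℓ (ρ ╱ []))

-- The elements of SSYT(ν¹) × ⋯ × SSYT(νᵏ) with entries in 1, …, N.
ssytTuples : ∀ {k} → ℕ → Vec SkewShape k → List (Vec Filling k)
ssytTuples N []      = [] ∷ []
ssytTuples N (S ∷ ν) = cartesianProductWith _∷_ (ssyt N S) (ssytTuples N ν)

indexedEntries : ∀ {k} → Vec Filling k → List (Fin k × Entry)
indexedEntries {k} T = concatMap (λ i → map (i ,_) (lookup T i)) (allFin k)

Inversion : ∀ {k} → (Fin k × Entry) × (Fin k × Entry) → Set
Inversion ((i , u , a) , (j , v , b)) =
  a > b ×
  ((i Fin.< j × content u ≡ content v) ⊎ (i Fin.> j × content u ≡ pred (content v)))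

inversion? : ∀ {k} → Decidable (Inversion {k})
inversion? ((i , u , a) , (j , v , b)) =
  (a >? b) ×-dec
  (((i Fin.<? j) ×-dec (content u ℤ.≟ content v)) ⊎-dec
   ((j Fin.<? i) ×-dec (content u ℤ.≟ pred (content v))))

inv : ∀ {k} → Vec Filling k → ℕ
inv T = length (filter inversion? (cartesianProduct (indexedEntries T) (indexedEntries T)))

-- m is the minimum of inv over SSYT(ν), with no bound on the entries.
IsMinInv : ∀ {k} → Vec SkewShape k → ℕ → Set
IsMinInv ν m =
  (∃₂ λ N T → T ∈ ssytTuples N ν × inv T ≡ m) ×
  (∀ N T → T ∈ ssytTuples N ν → m ≤ inv T)

-- For a permutation σ in one-line notation, position a σ = σ⁻¹(a).
position : ℕ → List ℕ → ℕ
position a []      = 0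
position a (b ∷ w) = if does (a ≟ b) then 1 else suc (position a w)

InverseDescent : List ℕ → ℕ → Set
InverseDescent σ i = position (suc i) σ < position i σ

inverseDescent? : ∀ σ → Decidable (InverseDescent σ)
inverseDescent? σ i = position (suc i) σ <? position i σ

permCharge : List ℕ → ℕ
permCharge σ =
  sum (map (length σ ∸_)
           (filter (λ i → ¬? (inverseDescent? σ i)) (interval 0 (length σ ∸ 1))))

-- Positions of the marked letters.  The second argument holds the unmarked
-- (position , letter) pairs in the order in which the cyclic leftward scan
-- meets them, starting just after the letter marked last.
mark : List ℕ → List (ℕ × ℕ) → List ℕ
mark []       V = []
mark (a ∷ as) V with break (λ x → proj₂ x ≟ a) V
... | skipped , []           = []
... | skipped , (p , _) ∷ V′ = p ∷ mark as (V′ ++ skipped)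

-- The standard subword on the letters 1, …, m, and the word that is left
-- once it has been deleted.
extract : ℕ → List ℕ → List ℕ × List ℕ
extract m w = map proj₂ (filter (λ x → proj₁ x ∈? marked) indexed)
            , map proj₂ (filter (λ x → ¬? (proj₁ x ∈? marked)) indexed)
  where
  indexed : List (ℕ × ℕ)
  indexed = zip (upTo (length w)) w

  marked : List ℕ
  marked = mark (interval 0 m) (reverse indexed)

wordContent : List ℕ → List ℕ
wordContent w = map (λ a → count a w) (interval 0 (foldr _⊔_ 0 w))

-- The first argument lists the lengths of the standard subwords.
subwordCharges : List ℕ → List ℕ → ℕ
subwordCharges []       w = 0
subwordCharges (m ∷ ms) w =
  permCharge (proj₁ (extract m w)) + subwordCharges ms (proj₂ (extract m w))

-- Meaningful for words whose content is a partition.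
charge : List ℕ → ℕ
charge w = subwordCharges (conjugate (wordContent w)) w

-- descendingWord i (m₀ , m₁ , …) = ⋯ (i+1)^m₁ i^m₀
descendingWord : ℕ → List ℕ → List ℕ
descendingWord i []      = []
descendingWord i (m ∷ μ) = descendingWord (suc i) μ ++ replicate m i

chargeWord : List ℕ → List ℕ → ℕ
chargeWord μ w = charge (w ++ descendingWord 1 μ)

chargeTableau : List ℕ → Filling → ℕ
chargeTableau μ T = chargeWord μ (readingWord T)

-- (d , κ) is the monomial q^d x^κ; a polynomial is a formal sum of
-- monomials, and two are equal when all their coefficients agree.
Monomial : ℕ → Set
Monomial N = ℕ × Vec ℕ N

Poly : ℕ → Set
Poly N = List (Monomial N)

coefficient : ∀ {N} → Monomial N → Poly N → ℕ
coefficient t p = length (filter (Product.≡-dec _≟_ (Vec.≡-dec _≟_) t) p)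

infix 4 _≈_
_≈_ : ∀ {N} → Poly N → Poly N → Set
p ≈ r = ∀ t → coefficient t p ≡ coefficient t r

infixr 7 _⊗_
_⊗_ : ∀ {N} → Poly N → Poly N → Poly N
_⊗_ = cartesianProductWith (λ (d , κ) (e , η) → d + e , zipWith _+_ κ η)

q^_ : ∀ {N} → ℕ → Poly N
q^_ {N} d = (d , Vec.replicate N 0) ∷ []

infixr 6 sumOver
sumOver : ∀ {N} {A : Set} → List A → (A → Poly N) → Poly N
sumOver xs f = concatMap f xs

syntax sumOver xs (λ x → p) = ∑[ x ← xs ] p

-- A symmetric function is given by its restrictions to x₁, …, x_N
-- (x_i = 0 for i > N), for all N; these contain all of its coefficients.

schur : ∀ N → List ℕ → Poly N
schur N ρ = map (λ T → 0 , weight N (readingWord T)) (ssyt N (ρ ╱ []))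

LLT : ∀ {k} N → Vec SkewShape k → Poly N
LLT N ν = map (λ T → inv T , weight N (concatMap readingWord (toList T))) (ssytTuples N ν)

{-# OPTIONS --safe #-}
-- Let S₁, …, S_ℓ be the sets of letters in the ℓ vertical strips.  As no column of λ/μ has three boxes, only neighbouring
-- strips interact.  Reading the letters in increasing order, with a step up for S_{j+1} and a step down for S_j, the pair
-- (S_j , S_{j+1}) becomes a lattice path from height μ_{j+1} − μ_j to height λ_{j+1} − λ_j, and its number of inversions
-- exceeds the minimum by the number of steps from height 0 to height 1.  Reflecting the excursions above height 0 turns
-- this number into the maximal height; the change stays inside a part of the path that does not matter for the
-- neighbouring pairs, so that all pairs can be treated in turn.  The maximal height, cut off at 0, is φ_j ∸ (λ_j − λ_{j+1}),
-- where φ_j counts the unmatched letters j in the bracketing of the letters j + 1 and j of the word of all pairs (letter,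
-- row).  As φ_j is invariant under Knuth moves, the dual RSK correspondence carries it over to the tableaux T.  On the
-- other side, charge_μ(T) is also the sum of the numbers φ_j ∸ (λ_j − λ_{j+1}): each column of λ gives one standard subword,
-- which takes at most two letters from the word of T, and their order decides whether it has charge 0 or 1.

module Submission where

open import Defs
open import Data.Nat
open import Data.Bool using (Bool; true; false; if_then_else_)
open import Data.Empty using (⊥; ⊥-elim)
open import Data.Fin using (Fin; toℕ; zero; suc)
open import Data.List using
  ( List; []; _∷_; _++_; map; filter; break; length; foldr; concatMap; concat; replicate; reverse; zip
  ; upTo; applyUpTo; allFin; cartesianProduct; cartesianProductWith)
import Data.List.Properties as List
import Data.Fin as Fin
import Data.Fin.Properties as Fin
open import Data.List.Membership.Propositional using (_∈_; _∉_; find; lose)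
open import Data.List.Membership.Propositional.Properties using
  ( ∈-map⁺; ∈-map⁻; ∈-filter⁺; ∈-filter⁻; ∈-concatMap⁺; ∈-concatMap⁻; ∈-cartesianProductWith⁺; ∈-cartesianProductWith⁻
  ; ∈-∃++; ∈-applyUpTo⁻; ∈-applyUpTo⁺)
open import Data.List.Membership.DecPropositional _≟_ using (_∈?_)
open import Data.List.Relation.Unary.Unique.Propositional using (Unique)
import Data.List.Relation.Unary.Unique.Propositional.Properties as Unique
open import Data.List.Membership.Propositional.Properties.WithK using (unique∧set⇒bag)
open import Data.List.Relation.Binary.BagAndSetEquality using (∼bag⇒↭)
import Data.List.Relation.Binary.Pointwise as Pointwise
open import Data.List.Relation.Binary.Pointwise using (_∷_; [])
open import Data.List.Relation.Unary.All using (All; []; _∷_)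
import Data.List.Relation.Unary.All as All
import Data.List.Relation.Unary.All.Properties as All
open import Data.List.Relation.Unary.Any using (Any; here; there)
import Data.List.Relation.Unary.Any.Properties as Any
open import Data.List.Relation.Unary.AllPairs using (AllPairs; []; _∷_)
import Data.List.Relation.Unary.AllPairs as AllPairs
import Data.List.Relation.Unary.AllPairs.Properties as AllPairs
open import Data.List.Relation.Binary.Permutation.Propositional as Perm using (_↭_; ↭-refl; ↭-reflexive; ↭-sym; ↭-trans; prep; swap)
import Data.List.Relation.Binary.Permutation.Propositional.Properties as Perm
open import Data.Nat.Properties
open import Data.Nat.ListAction using (sum)
open import Data.Nat.ListAction.Properties using (sum-↭)
import Data.Integer as ℤ
import Data.Integer.Properties as ℤ
open import Data.Nat.Tactic.RingSolver using (solve-∀)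
open import Data.Product using (_×_; _,_; proj₁; proj₂; ∃; ∃₂; map₁; map₂)
import Data.Product.Properties as Product
open import Data.Sum using (_⊎_; inj₁; inj₂)
open import Data.Unit using (⊤; tt)
open import Data.Vec using (Vec; []; _∷_; lookup; tabulate; zipWith; toList)
import Data.Vec as Vec
import Data.Vec.Properties as Vec
open import Data.Vec.Relation.Unary.Linked using (Linked; []; [-]; _∷_)
open import Data.Vec.Relation.Binary.Pointwise.Inductive using (Pointwise; []; _∷_)
open import Relation.Binary.Definitions using (tri<; tri≈; tri>)
open import Function using (_∘_; id; mk⇔)
open import Relation.Binary.PropositionalEquality
open import Relation.Nullary using (¬_; Dec; yes; no; does)
open import Relation.Nullary.Decidable using (_×-dec_; ¬?; dec-true; dec-false)
open import Relation.Nullary.Negation using (contradiction)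
open import Relation.Unary using (Pred; Decidable)

-- The number of steps from height 0 to height 1 is not constant on Knuth classes, whereas the
-- maximal height is determined by a bracketing; so the rows have to be changed before they are
-- inserted. The change must keep the multiplicity of each letter (for the powers of x) and the size
-- of each row (for α): it only exchanges ↗ and ↘ and keeps the end points of the paths. Heights and
-- φ_j are linked as follows. If ε_j letters j + 1 remain unmatched, then φ_j - ε_j = |S_j| -
-- |S_{j+1}|, hence φ_j - (λ_j - λ_{j+1}) = ε_j - (μ_j - μ_{j+1}), and ε_j is the climb of the path
-- above its start. Three rows interact only through λ_{j+2} ≤ μ_j. Once the path of (S_j , S_{j+1})
-- reaches height 1, too few letters of S_{j+2} are left for the next path to do so. Until it has
-- last returned to height 0, so many letters of S_j are still to come that the previous path cannot
-- have exceeded 0. With letters bounded by N all sets are finite, so an injective change of the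
-- rows is enough.

-- Lattice paths of two neighbouring rows

-- Reduces an equation that follows linearly from a hypothesis to an identity for the ring solver.
linear : ∀ {a b l r} → l ≡ r → a + r ≡ b + l → a ≡ b
linear {a} {b} {l} l≡r eq = +-cancelʳ-≡ l a b (trans (cong (a +_) l≡r) eq)

bit : Bool → ℕ
bit false = 0
bit true  = 1

ones : ∀ {n} → Vec Bool n → ℕ
ones []      = 0
ones (b ∷ v) = bit b + ones v

-- The step at the letter e says whether e lies in the upper and in the lower one of two rows.
Step : Set
Step = Bool × Bool

pattern ○ = false , false
pattern ● = true  , true
pattern ↘ = true  , false
pattern ↗ = false , true

uppers lowers : ∀ {n} → Vec Step n → Vec Bool n
uppers = Vec.map proj₁
lowers = Vec.map proj₂

-- The number of steps from height 0 to height 1 of a path that starts at height − d, resp. 1 + d.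
crossings⁻ crossings⁺ : ∀ {n} → ℕ → Vec Step n → ℕ
crossings⁻ d       []      = 0
crossings⁻ d       (○ ∷ p) = crossings⁻ d p
crossings⁻ d       (● ∷ p) = crossings⁻ d p
crossings⁻ d       (↘ ∷ p) = crossings⁻ (suc d) p
crossings⁻ zero    (↗ ∷ p) = suc (crossings⁺ 0 p)
crossings⁻ (suc d) (↗ ∷ p) = crossings⁻ d p
crossings⁺ d       []      = 0
crossings⁺ d       (○ ∷ p) = crossings⁺ d p
crossings⁺ d       (● ∷ p) = crossings⁺ d p
crossings⁺ d       (↗ ∷ p) = crossings⁺ (suc d) p
crossings⁺ zero    (↘ ∷ p) = crossings⁻ 0 p
crossings⁺ (suc d) (↘ ∷ p) = crossings⁺ d p

-- The starting point counts, hence the truncated subtraction at ↘. The value is also the number of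
-- steps ↗ that find no earlier ↘ to cancel, which is how it meets the bracketing.
peak : ∀ {n} → Vec Step n → ℕ
peak []      = 0
peak (○ ∷ p) = peak p
peak (● ∷ p) = peak p
peak (↘ ∷ p) = peak p ∸ 1
peak (↗ ∷ p) = suc (peak p)

-- Reflects the part of the path above height 1/2 and turns every step between 0 and 1 upwards.
reflect⁻ reflect⁺ : ∀ {n} → ℕ → Vec Step n → Vec Step n
reflect⁻ d       []      = []
reflect⁻ d       (○ ∷ p) = ○ ∷ reflect⁻ d p
reflect⁻ d       (● ∷ p) = ● ∷ reflect⁻ d p
reflect⁻ d       (↘ ∷ p) = ↘ ∷ reflect⁻ (suc d) p
reflect⁻ zero    (↗ ∷ p) = ↗ ∷ reflect⁺ 0 p
reflect⁻ (suc d) (↗ ∷ p) = ↗ ∷ reflect⁻ d p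
reflect⁺ d       []      = []
reflect⁺ d       (○ ∷ p) = ○ ∷ reflect⁺ d p
reflect⁺ d       (● ∷ p) = ● ∷ reflect⁺ d p
reflect⁺ d       (↗ ∷ p) = ↘ ∷ reflect⁺ (suc d) p
reflect⁺ zero    (↘ ∷ p) = ↗ ∷ reflect⁻ 0 p
reflect⁺ (suc d) (↘ ∷ p) = ↗ ∷ reflect⁺ d p

-- The number of new maxima above d of a path, and its final distance from the maximum.
records finalDepth : ∀ {n} → ℕ → Vec Step n → ℕ
records d       []      = 0
records d       (○ ∷ p) = records d p
records d       (● ∷ p) = records d p
records d       (↘ ∷ p) = records (suc d) p
records zero    (↗ ∷ p) = suc (records 0 p)
records (suc d) (↗ ∷ p) = records d p
finalDepth d       []      = d
finalDepth d       (○ ∷ p) = finalDepth d p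
finalDepth d       (● ∷ p) = finalDepth d p
finalDepth d       (↘ ∷ p) = finalDepth (suc d) p
finalDepth zero    (↗ ∷ p) = finalDepth 0 p
finalDepth (suc d) (↗ ∷ p) = finalDepth d p

-- The first i new maxima are kept and all later ones are turned downwards. New maxima are the steps
-- ↗ not cancelled by an earlier ↘ or by the initial depth d, so this is a power of a crystal
-- operator. The depth d is that of the path read, not of the path produced.
descend : ∀ {n} → ℕ → ℕ → Vec Step n → Vec Step n
descend i       d       []      = []
descend i       d       (○ ∷ p) = ○ ∷ descend i d p
descend i       d       (● ∷ p) = ● ∷ descend i d p
descend i       d       (↘ ∷ p) = ↘ ∷ descend i (suc d) p
descend i       (suc d) (↗ ∷ p) = ↗ ∷ descend i d p
descend (suc i) zero    (↗ ∷ p) = ↗ ∷ descend i 0 p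
descend zero    zero    (↗ ∷ p) = ↘ ∷ descend 0 0 p

-- Cut at its k crossings of the level 1/2 in each direction, a path is N₀ ↗ X₁ ↘ N₁ ↗ ⋯ X_k ↘ N_k.  The
-- pieces X_i are reflected, and the separating steps ↗ ↘ ↗ ↘ ⋯ become k times ↗ followed by k times ↘.
straighten : ∀ {n} → ℕ → Vec Step n → Vec Step n
straighten d p = descend (crossings⁻ d p) d (reflect⁻ d p)

-- The path from height - d, resp. 1 + d, ends at height - s.
Balanced⁻ Balanced⁺ : ∀ {n} → ℕ → ℕ → Vec Step n → Set
Balanced⁻ d s p = ones (lowers p) + s ≡ ones (uppers p) + d
Balanced⁺ d s p = suc (ones (lowers p) + s + d) ≡ ones (uppers p)

module _ {n} (p : Vec Step n) (d s : ℕ) where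

  private
    l u : ℕ
    l = ones (lowers p)
    u = ones (uppers p)

  balanced⁻-● : Balanced⁻ d s (● ∷ p) → Balanced⁻ d s p
  balanced⁻-● = suc-injective

  balanced⁻-↘ : Balanced⁻ d s (↘ ∷ p) → Balanced⁻ (suc d) s p
  balanced⁻-↘ h = trans h (sym (+-suc u d))

  balanced⁻-↗ : Balanced⁻ (suc d) s (↗ ∷ p) → Balanced⁻ d s p
  balanced⁻-↗ h = suc-injective (trans h (+-suc u d))

  balanced⁻-↗₀ : Balanced⁻ 0 s (↗ ∷ p) → Balanced⁺ 0 s p
  balanced⁻-↗₀ h = trans (cong suc (+-identityʳ (l + s))) (trans h (+-identityʳ u))

  balanced⁺-● : Balanced⁺ d s (● ∷ p) → Balanced⁺ d s p
  balanced⁺-● = suc-injective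

  balanced⁺-↗ : Balanced⁺ d s (↗ ∷ p) → Balanced⁺ (suc d) s p
  balanced⁺-↗ h = trans (cong suc (+-suc (l + s) d)) h

  balanced⁺-↘ : Balanced⁺ (suc d) s (↘ ∷ p) → Balanced⁺ d s p
  balanced⁺-↘ h = trans (sym (+-suc (l + s) d)) (suc-injective h)

  balanced⁺-↘₀ : Balanced⁺ 0 s (↘ ∷ p) → Balanced⁻ 0 s p
  balanced⁺-↘₀ h = trans (sym (+-identityʳ (l + s))) (trans (suc-injective h) (sym (+-identityʳ u)))

-- The depth of the reflected path below its maximum follows the distance of the old path from the
-- level 1/2, so every crossing of that level, in either direction, becomes a new maximum. A path
-- from below that ends at - s crosses equally often in both directions.
records-reflect⁻ : ∀ {n} d s (p : Vec Step n) → Balanced⁻ d s p →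
                   records d (reflect⁻ d p) ≡ crossings⁻ d p + crossings⁻ d p
records-reflect⁺ : ∀ {n} d s (p : Vec Step n) → Balanced⁺ d s p →
                   records d (reflect⁺ d p) ≡ suc (crossings⁺ d p + crossings⁺ d p)
records-reflect⁻ d       s []      h = refl
records-reflect⁻ d       s (○ ∷ p) h = records-reflect⁻ d s p h
records-reflect⁻ d       s (● ∷ p) h = records-reflect⁻ d s p (balanced⁻-● p d s h)
records-reflect⁻ d       s (↘ ∷ p) h = records-reflect⁻ (suc d) s p (balanced⁻-↘ p d s h)
records-reflect⁻ zero    s (↗ ∷ p) h =
  cong suc (trans (records-reflect⁺ 0 s p (balanced⁻-↗₀ p 0 s h)) (sym (+-suc _ _)))
records-reflect⁻ (suc d) s (↗ ∷ p) h = records-reflect⁻ d s p (balanced⁻-↗ p d s h)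
records-reflect⁺ d       s []      ()
records-reflect⁺ d       s (○ ∷ p) h = records-reflect⁺ d s p h
records-reflect⁺ d       s (● ∷ p) h = records-reflect⁺ d s p (balanced⁺-● p d s h)
records-reflect⁺ d       s (↗ ∷ p) h = records-reflect⁺ (suc d) s p (balanced⁺-↗ p d s h)
records-reflect⁺ zero    s (↘ ∷ p) h = cong suc (records-reflect⁻ 0 s p (balanced⁺-↘₀ p 0 s h))
records-reflect⁺ (suc d) s (↘ ∷ p) h = records-reflect⁺ d s p (balanced⁺-↘ p d s h)

finalDepth-reflect⁻ : ∀ {n} d s (p : Vec Step n) → Balanced⁻ d s p → finalDepth d (reflect⁻ d p) ≡ s
finalDepth-reflect⁺ : ∀ {n} d s (p : Vec Step n) → Balanced⁺ d s p → finalDepth d (reflect⁺ d p) ≡ s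
finalDepth-reflect⁻ d       s []      h = sym h
finalDepth-reflect⁻ d       s (○ ∷ p) h = finalDepth-reflect⁻ d s p h
finalDepth-reflect⁻ d       s (● ∷ p) h = finalDepth-reflect⁻ d s p (balanced⁻-● p d s h)
finalDepth-reflect⁻ d       s (↘ ∷ p) h = finalDepth-reflect⁻ (suc d) s p (balanced⁻-↘ p d s h)
finalDepth-reflect⁻ zero    s (↗ ∷ p) h = finalDepth-reflect⁺ 0 s p (balanced⁻-↗₀ p 0 s h)
finalDepth-reflect⁻ (suc d) s (↗ ∷ p) h = finalDepth-reflect⁻ d s p (balanced⁻-↗ p d s h)
finalDepth-reflect⁺ d       s []      ()
finalDepth-reflect⁺ d       s (○ ∷ p) h = finalDepth-reflect⁺ d s p h
finalDepth-reflect⁺ d       s (● ∷ p) h = finalDepth-reflect⁺ d s p (balanced⁺-● p d s h)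
finalDepth-reflect⁺ d       s (↗ ∷ p) h = finalDepth-reflect⁺ (suc d) s p (balanced⁺-↗ p d s h)
finalDepth-reflect⁺ zero    s (↘ ∷ p) h = finalDepth-reflect⁻ 0 s p (balanced⁺-↘₀ p 0 s h)
finalDepth-reflect⁺ (suc d) s (↘ ∷ p) h = finalDepth-reflect⁺ d s p (balanced⁺-↘ p d s h)

-- From height - d the path q ends at `records d q` - `finalDepth d q`, and turning a new maximum
-- downwards lowers the end by 2.
descend-balance : ∀ {n} i d (q : Vec Step n) → i ≤ records d q →
  ones (lowers (descend i d q)) + finalDepth d q + records d q ≡
  ones (uppers (descend i d q)) + d + (i + i)
descend-balance zero    d       []      h = refl
descend-balance i       d       (○ ∷ q) h = descend-balance i d q h
descend-balance i       d       (● ∷ q) h = cong suc (descend-balance i d q h)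
descend-balance i       d       (↘ ∷ q) h =
  trans (descend-balance i (suc d) q h)
        (cong (_+ (i + i)) (+-suc (ones (uppers (descend i (suc d) q))) d))
descend-balance i       (suc d) (↗ ∷ q) h =
  trans (cong suc (descend-balance i d q h))
        (cong (_+ (i + i)) (sym (+-suc (ones (uppers (descend i d q))) d)))
descend-balance (suc i) zero    (↗ ∷ q) (s≤s h) = 
  step (ones (lowers r)) (finalDepth 0 q) (records 0 q) (ones (uppers r)) i (descend-balance i 0 q h)
  where
  r = descend i 0 q

  step : ∀ l f t u i → l + f + t ≡ u + 0 + (i + i) → suc l + f + suc t ≡ u + 0 + (suc i + suc i)
  step l f t u i e = linear {l = l + f + t} e (identity l f t u i)
    where
    identity : ∀ l f t u i →
      suc l + f + suc t + (u + 0 + (i + i)) ≡ u + 0 + (suc i + suc i) + (l + f + t)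
    identity = solve-∀
descend-balance zero    zero    (↗ ∷ q) h       = 
  step (ones (lowers r)) (finalDepth 0 q) (records 0 q) (ones (uppers r)) (descend-balance 0 0 q z≤n)
  where
  r = descend 0 0 q

  step : ∀ l f t u → l + f + t ≡ u + 0 + 0 → l + f + suc t ≡ suc u + 0 + 0
  step l f t u e = linear {l = l + f + t} e (identity l f t u)
    where
    identity : ∀ l f t u → l + f + suc t + (u + 0 + 0) ≡ suc u + 0 + 0 + (l + f + t)
    identity = solve-∀

peak-descend : ∀ {n} i d (q : Vec Step n) → i ≤ records d q → peak (descend i d q) ∸ d ≡ i
peak-descend zero    d       []      h = 0∸n≡0 d
peak-descend i       d       (○ ∷ q) h = peak-descend i d q h
peak-descend i       d       (● ∷ q) h = peak-descend i d q h
peak-descend i       d       (↘ ∷ q) h =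
  trans (∸-+-assoc (peak (descend i (suc d) q)) 1 d) (peak-descend i (suc d) q h)
peak-descend i       (suc d) (↗ ∷ q) h = peak-descend i d q h
peak-descend (suc i) zero    (↗ ∷ q) (s≤s h) = cong suc (peak-descend i 0 q h)
peak-descend zero    zero    (↗ ∷ q) h = cong (_∸ 1) (peak-descend 0 0 q z≤n)

-- The first new maximum is preceded by a return to the old one, and up to there no step is turned.
≤-peak-descend : ∀ {n} i d (q : Vec Step n) → i < records d q → d ≤ peak (descend i d q)
≤-peak-descend i       d       (○ ∷ q) h = ≤-peak-descend i d q h
≤-peak-descend i       d       (● ∷ q) h = ≤-peak-descend i d q h
≤-peak-descend i       d       (↘ ∷ q) h = ∸-monoˡ-≤ 1 (≤-peak-descend i (suc d) q h)
≤-peak-descend i       (suc d) (↗ ∷ q) h = s≤s (≤-peak-descend i d q h)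
≤-peak-descend (suc i) zero    (↗ ∷ q) h = z≤n
≤-peak-descend zero    zero    (↗ ∷ q) h = z≤n

peak-straighten : ∀ {n} d s (p : Vec Step n) → Balanced⁻ d s p →
                  peak (straighten d p) ∸ d ≡ crossings⁻ d p
peak-straighten d s p h = peak-descend (crossings⁻ d p) d (reflect⁻ d p)
  (≤-trans (m≤m+n _ _) (≤-reflexive (sym (records-reflect⁻ d s p h))))

straighten-balanced : ∀ {n} d s (p : Vec Step n) → Balanced⁻ d s p → Balanced⁻ d s (straighten d p)
straighten-balanced d s p h = +-cancelʳ-≡ (k + k) _ _ (begin
  l + s + (k + k)                      ≡⟨ cong₂ (λ a b → l + a + b) (finalDepth-reflect⁻ d s p h)
                                                                     (records-reflect⁻ d s p h) ⟨
  l + finalDepth d q + records d q     ≡⟨ descend-balance k d q k≤ ⟩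
  ones (uppers (descend k d q)) + d + (k + k) ∎)
  where
  open ≡-Reasoning
  k = crossings⁻ d p
  q = reflect⁻ d p
  l = ones (lowers (descend k d q))
  k≤ : k ≤ records d q
  k≤ = ≤-trans (m≤m+n k k) (≤-reflexive (sym (records-reflect⁻ d s p h)))

total : Step → ℕ
total (a , b) = bit a + bit b

total-reflect⁻ : ∀ {n} d (p : Vec Step n) → Vec.map total (reflect⁻ d p) ≡ Vec.map total p
total-reflect⁺ : ∀ {n} d (p : Vec Step n) → Vec.map total (reflect⁺ d p) ≡ Vec.map total p
total-reflect⁻ d       []      = refl
total-reflect⁻ d       (○ ∷ p) = cong (0 ∷_) (total-reflect⁻ d p)
total-reflect⁻ d       (● ∷ p) = cong (2 ∷_) (total-reflect⁻ d p)
total-reflect⁻ d       (↘ ∷ p) = cong (1 ∷_) (total-reflect⁻ (suc d) p)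
total-reflect⁻ zero    (↗ ∷ p) = cong (1 ∷_) (total-reflect⁺ 0 p)
total-reflect⁻ (suc d) (↗ ∷ p) = cong (1 ∷_) (total-reflect⁻ d p)
total-reflect⁺ d       []      = refl
total-reflect⁺ d       (○ ∷ p) = cong (0 ∷_) (total-reflect⁺ d p)
total-reflect⁺ d       (● ∷ p) = cong (2 ∷_) (total-reflect⁺ d p)
total-reflect⁺ d       (↗ ∷ p) = cong (1 ∷_) (total-reflect⁺ (suc d) p)
total-reflect⁺ zero    (↘ ∷ p) = cong (1 ∷_) (total-reflect⁻ 0 p)
total-reflect⁺ (suc d) (↘ ∷ p) = cong (1 ∷_) (total-reflect⁺ d p)

total-descend : ∀ {n} i d (p : Vec Step n) → Vec.map total (descend i d p) ≡ Vec.map total p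
total-descend i       d       []      = refl
total-descend i       d       (○ ∷ p) = cong (0 ∷_) (total-descend i d p)
total-descend i       d       (● ∷ p) = cong (2 ∷_) (total-descend i d p)
total-descend i       d       (↘ ∷ p) = cong (1 ∷_) (total-descend i (suc d) p)
total-descend i       (suc d) (↗ ∷ p) = cong (1 ∷_) (total-descend i d p)
total-descend (suc i) zero    (↗ ∷ p) = cong (1 ∷_) (total-descend i 0 p)
total-descend zero    zero    (↗ ∷ p) = cong (1 ∷_) (total-descend 0 0 p)

total-straighten : ∀ {n} d (p : Vec Step n) → Vec.map total (straighten d p) ≡ Vec.map total p
total-straighten d p = trans (total-descend _ d (reflect⁻ d p)) (total-reflect⁻ d p)

sum-total : ∀ {n} (p : Vec Step n) → Vec.sum (Vec.map total p) ≡ ones (uppers p) + ones (lowers p)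
sum-total []            = refl
sum-total ((a , b) ∷ p) = trans (cong (total (a , b) +_) (sum-total p)) (interchange (bit a) _ _ _)
  where
  interchange : ∀ a b c d → a + b + (c + d) ≡ a + c + (b + d)
  interchange = solve-∀

-- The sum of the two row sizes is kept letter by letter, their difference by the end points of the
-- path.
ones-straighten : ∀ {n} d s (p : Vec Step n) → Balanced⁻ d s p →
  ones (uppers (straighten d p)) ≡ ones (uppers p) × ones (lowers (straighten d p)) ≡ ones (lowers p)
ones-straighten d s p h = u′≡u , +-cancelˡ-≡ u′ _ _ (trans sums (cong (_+ _) (sym u′≡u)))
  where
  u′ = ones (uppers (straighten d p))
  sums : u′ + ones (lowers (straighten d p)) ≡ ones (uppers p) + ones (lowers p)
  sums = trans (sym (sum-total (straighten d p))) (trans (cong Vec.sum (total-straighten d p)) (sum-total p))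
  double : ∀ u l u′ l′ → l + s ≡ u + d → l′ + s ≡ u′ + d → u′ + l′ ≡ u + l → u′ + u′ ≡ u + u
  double u l u′ l′ e e′ f =
    linear {l = l + s} e (linear {l = u′ + d} (sym e′) (linear {l = u′ + l′} f (identity u l u′ l′ s d)))
    where
    identity : ∀ u l u′ l′ s d →
      ((u′ + u′ + (u + d)) + (l′ + s)) + (u + l) ≡ ((u + u + (l + s)) + (u′ + d)) + (u′ + l′)
    identity = solve-∀
  halve : ∀ a b → a + a ≡ b + b → a ≡ b
  halve zero    zero    e = refl
  halve (suc a) (suc b) e =
    cong suc (halve a b (suc-injective (trans (sym (+-suc a a)) (trans (suc-injective e) (+-suc b b)))))
  u′≡u = halve _ _ (double _ (ones (lowers p)) _ _ h (straighten-balanced d s p h) sums)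

reflect⁻-injective : ∀ {n} d (p p′ : Vec Step n) → reflect⁻ d p ≡ reflect⁻ d p′ → p ≡ p′
reflect⁺-injective : ∀ {n} d (p p′ : Vec Step n) → reflect⁺ d p ≡ reflect⁺ d p′ → p ≡ p′
reflect⁻-injective d       []      []       e = refl
reflect⁻-injective d       (○ ∷ p) (○ ∷ p′) e = cong (○ ∷_) (reflect⁻-injective d p p′ (Vec.∷-injectiveʳ e))
reflect⁻-injective d       (● ∷ p) (● ∷ p′) e = cong (● ∷_) (reflect⁻-injective d p p′ (Vec.∷-injectiveʳ e))
reflect⁻-injective d       (↘ ∷ p) (↘ ∷ p′) e = cong (↘ ∷_) (reflect⁻-injective (suc d) p p′ (Vec.∷-injectiveʳ e))
reflect⁻-injective zero    (↗ ∷ p) (↗ ∷ p′) e = cong (↗ ∷_) (reflect⁺-injective 0 p p′ (Vec.∷-injectiveʳ e))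
reflect⁻-injective (suc d) (↗ ∷ p) (↗ ∷ p′) e = cong (↗ ∷_) (reflect⁻-injective d p p′ (Vec.∷-injectiveʳ e))
reflect⁻-injective zero    (↗ ∷ p) (○ ∷ p′) ()
reflect⁻-injective zero    (↗ ∷ p) (● ∷ p′) ()
reflect⁻-injective zero    (↗ ∷ p) (↘ ∷ p′) ()
reflect⁻-injective zero    (○ ∷ p) (↗ ∷ p′) ()
reflect⁻-injective zero    (● ∷ p) (↗ ∷ p′) ()
reflect⁻-injective zero    (↘ ∷ p) (↗ ∷ p′) ()
reflect⁻-injective (suc d) (↗ ∷ p) (○ ∷ p′) ()
reflect⁻-injective (suc d) (↗ ∷ p) (↘ ∷ p′) ()
reflect⁺-injective d       []      []       e = refl
reflect⁺-injective d       (○ ∷ p) (○ ∷ p′) e = cong (○ ∷_) (reflect⁺-injective d p p′ (Vec.∷-injectiveʳ e))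
reflect⁺-injective d       (● ∷ p) (● ∷ p′) e = cong (● ∷_) (reflect⁺-injective d p p′ (Vec.∷-injectiveʳ e))
reflect⁺-injective d       (↗ ∷ p) (↗ ∷ p′) e = cong (↗ ∷_) (reflect⁺-injective (suc d) p p′ (Vec.∷-injectiveʳ e))
reflect⁺-injective zero    (↘ ∷ p) (↘ ∷ p′) e = cong (↘ ∷_) (reflect⁻-injective 0 p p′ (Vec.∷-injectiveʳ e))
reflect⁺-injective (suc d) (↘ ∷ p) (↘ ∷ p′) e = cong (↘ ∷_) (reflect⁺-injective d p p′ (Vec.∷-injectiveʳ e))
reflect⁺-injective zero    (↘ ∷ p) (○ ∷ p′) ()
reflect⁺-injective zero    (↘ ∷ p) (● ∷ p′) ()
reflect⁺-injective zero    (↘ ∷ p) (↗ ∷ p′) ()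
reflect⁺-injective zero    (○ ∷ p) (↘ ∷ p′) ()
reflect⁺-injective zero    (● ∷ p) (↘ ∷ p′) ()
reflect⁺-injective zero    (↗ ∷ p) (↘ ∷ p′) ()
reflect⁺-injective (suc d) (↘ ∷ p) (○ ∷ p′) ()
reflect⁺-injective (suc d) (↘ ∷ p) (● ∷ p′) ()

-- A downward step at a maximum is a converted record exactly if the maximum is not attained again.
converted-record : ∀ {n} (q q′ : Vec Step n) → descend 0 0 q ≡ descend 0 1 q′ → suc (records 0 q) ≡ records 1 q′ → ⊥
converted-record q q′ e f = 1+n≰n (begin
  1                       ≤⟨ ≤-peak-descend 0 1 q′ (≤-trans (s≤s z≤n) (≤-reflexive f)) ⟩
  peak (descend 0 1 q′)   ≡⟨ cong peak e ⟨
  peak (descend 0 0 q)    ≡⟨ peak-descend 0 0 q z≤n ⟩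
  0                       ∎)
  where open ≤-Reasoning

-- With i = 0 and depth 0, a step ↘ of the image may be an old ↘ or a turned maximum. By
-- `converted-record` the number of maxima still to come decides, whence the hypothesis on
-- `records`.
descend-injective : ∀ {n} i d (q q′ : Vec Step n) → descend i d q ≡ descend i d q′ → records d q ≡ records d q′ →
  q ≡ q′
descend-injective i       d       []      []       e f = refl
descend-injective i       d       (○ ∷ q) (○ ∷ q′) e f =
  cong (○ ∷_) (descend-injective i d q q′ (Vec.∷-injectiveʳ e) f)
descend-injective i       d       (● ∷ q) (● ∷ q′) e f =
  cong (● ∷_) (descend-injective i d q q′ (Vec.∷-injectiveʳ e) f)
descend-injective i       d       (↘ ∷ q) (↘ ∷ q′) e f =
  cong (↘ ∷_) (descend-injective i (suc d) q q′ (Vec.∷-injectiveʳ e) f)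
descend-injective i       (suc d) (↗ ∷ q) (↗ ∷ q′) e f =
  cong (↗ ∷_) (descend-injective i d q q′ (Vec.∷-injectiveʳ e) f)
descend-injective (suc i) zero    (↗ ∷ q) (↗ ∷ q′) e f =
  cong (↗ ∷_) (descend-injective i 0 q q′ (Vec.∷-injectiveʳ e) (suc-injective f))
descend-injective zero    zero    (↗ ∷ q) (↗ ∷ q′) e f =
  cong (↗ ∷_) (descend-injective 0 0 q q′ (Vec.∷-injectiveʳ e) (suc-injective f))
descend-injective zero    zero    (↗ ∷ q) (↘ ∷ q′) e f = ⊥-elim (converted-record q q′ (Vec.∷-injectiveʳ e) f)
descend-injective zero    zero    (↘ ∷ q) (↗ ∷ q′) e f =
  ⊥-elim (converted-record q′ q (sym (Vec.∷-injectiveʳ e)) (sym f))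
descend-injective zero    zero    (↗ ∷ q) (○ ∷ q′) () f
descend-injective zero    zero    (↗ ∷ q) (● ∷ q′) () f
descend-injective zero    zero    (○ ∷ q) (↗ ∷ q′) () f
descend-injective zero    zero    (● ∷ q) (↗ ∷ q′) () f
descend-injective i       (suc d) (↗ ∷ q) (○ ∷ q′) () f
descend-injective i       (suc d) (↗ ∷ q) (↘ ∷ q′) () f
descend-injective (suc i) zero    (↗ ∷ q) (○ ∷ q′) () f
descend-injective (suc i) zero    (↗ ∷ q) (● ∷ q′) () f
descend-injective (suc i) zero    (↗ ∷ q) (↘ ∷ q′) () f
descend-injective (suc i) zero    (○ ∷ q) (↗ ∷ q′) () f
descend-injective (suc i) zero    (● ∷ q) (↗ ∷ q′) () f
descend-injective (suc i) zero    (↘ ∷ q) (↗ ∷ q′) () f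

-- The number k of crossings can be read off from the peak of the image; this fixes both the number
-- 2k of new maxima and how many of them were kept.
straighten-injective : ∀ {n} d s (p p′ : Vec Step n) → Balanced⁻ d s p → Balanced⁻ d s p′ →
                       straighten d p ≡ straighten d p′ → p ≡ p′
straighten-injective d s p p′ h h′ e = reflect⁻-injective d p p′ (descend-injective k d (reflect⁻ d p) (reflect⁻ d p′)
  (trans e (cong (λ k → descend k d (reflect⁻ d p′)) (sym k≡k′)))
  (trans (records-reflect⁻ d s p h) (trans (cong₂ _+_ k≡k′ k≡k′) (sym (records-reflect⁻ d s p′ h′)))))
  where
  k = crossings⁻ d p
  k≡k′ : k ≡ crossings⁻ d p′
  k≡k′ = trans (sym (peak-straighten d s p h)) (trans (cong (λ q → peak q ∸ d) e) (peak-straighten d s p′ h′))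

-- The neighbouring pairs under straightening

crossings-deep : ∀ {n} d (p : Vec Step n) → ones (lowers p) ≤ d → crossings⁻ d p ≡ 0
crossings-deep d       []      h = refl
crossings-deep d       (○ ∷ p) h = crossings-deep d p h
crossings-deep d       (● ∷ p) h = crossings-deep d p (<⇒≤ h)
crossings-deep d       (↘ ∷ p) h = crossings-deep (suc d) p (m≤n⇒m≤1+n h)
crossings-deep (suc d) (↗ ∷ p) h = crossings-deep d p (s≤s⁻¹ h)

lowers-zip : ∀ {n} (xs ys : Vec Bool n) → lowers (Vec.zip xs ys) ≡ ys
lowers-zip []       []       = refl
lowers-zip (x ∷ xs) (y ∷ ys) = cong (y ∷_) (lowers-zip xs ys)

uppers-zip : ∀ {n} (xs ys : Vec Bool n) → uppers (Vec.zip xs ys) ≡ xs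
uppers-zip []       []       = refl
uppers-zip (x ∷ xs) (y ∷ ys) = cong (x ∷_) (uppers-zip xs ys)

zip-uppers-lowers : ∀ {n} (p : Vec Step n) → Vec.zip (uppers p) (lowers p) ≡ p
zip-uppers-lowers []      = refl
zip-uppers-lowers (_ ∷ p) = cong (_ ∷_) (zip-uppers-lowers p)

-- Before its first crossing a path is not changed by straighten, and after it the next path stays below 1.
module _ (i : ℕ) where

  crossings-lower⁻ : ∀ {n} d e (p : Vec Step n) (zs : Vec Bool n) → ones zs ≤ e + d →
    crossings⁻ e (Vec.zip (lowers p) zs) ≡ crossings⁻ e (Vec.zip (lowers (descend i d (reflect⁻ d p))) zs)
  crossings-lower⁺ : ∀ {n} d e (p : Vec Step n) (zs : Vec Bool n) → suc (e + ones zs) ≤ d →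
    crossings⁺ e (Vec.zip (lowers p) zs) ≡ crossings⁺ e (Vec.zip (lowers (descend i d (reflect⁻ d p))) zs)
  crossings-lower⁻ d       e       []      []           h = refl
  crossings-lower⁻ d       e       (○ ∷ p) (false ∷ zs) h = crossings-lower⁻ d e p zs h
  crossings-lower⁻ d       zero    (○ ∷ p) (true ∷ zs)  h = cong suc (crossings-lower⁺ d 0 p zs h)
  crossings-lower⁻ d       (suc e) (○ ∷ p) (true ∷ zs)  h = crossings-lower⁻ d e p zs (s≤s⁻¹ h)
  crossings-lower⁻ d       e       (● ∷ p) (false ∷ zs) h = crossings-lower⁻ d (suc e) p zs (m≤n⇒m≤1+n h)
  crossings-lower⁻ d       e       (● ∷ p) (true ∷ zs)  h = crossings-lower⁻ d e p zs (<⇒≤ h)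
  crossings-lower⁻ d       e       (↘ ∷ p) (false ∷ zs) h =
    crossings-lower⁻ (suc d) e p zs (≤-trans (m≤n⇒m≤1+n h) (≤-reflexive (sym (+-suc e d))))
  crossings-lower⁻ d       zero    (↘ ∷ p) (true ∷ zs)  h = cong suc (crossings-lower⁺ (suc d) 0 p zs (m≤n⇒m≤1+n h))
  crossings-lower⁻ d       (suc e) (↘ ∷ p) (true ∷ zs)  h =
    crossings-lower⁻ (suc d) e p zs (≤-trans (<⇒≤ h) (≤-reflexive (sym (+-suc e d))))
  crossings-lower⁻ (suc d) e       (↗ ∷ p) (false ∷ zs) h =
    crossings-lower⁻ d (suc e) p zs (≤-trans h (≤-reflexive (+-suc e d)))
  crossings-lower⁻ (suc d) e       (↗ ∷ p) (true ∷ zs)  h =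
    crossings-lower⁻ d e p zs (s≤s⁻¹ (≤-trans h (≤-reflexive (+-suc e d))))
  -- At the first crossing of the straightened pair at most e letters of `zs` are left, too few for
  -- the next path to climb from - e to 1, whatever its upper row is from here on.
  crossings-lower⁻ zero    e       (↗ ∷ p) zs           h =
    trans (deep (↗ ∷ p)) (sym (deep (descend i 0 (reflect⁻ 0 (↗ ∷ p)))))
    where
    deep : ∀ q → crossings⁻ e (Vec.zip (lowers q) zs) ≡ 0
    deep q =
      crossings-deep e (Vec.zip (lowers q) zs)
        (≤-trans (≤-reflexive (cong ones (lowers-zip (lowers q) zs))) (≤-trans h (≤-reflexive (+-identityʳ e))))
  crossings-lower⁺ d       e       []      []           h = refl
  crossings-lower⁺ d       e       (○ ∷ p) (false ∷ zs) h = crossings-lower⁺ d e p zs h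
  crossings-lower⁺ d       e       (○ ∷ p) (true ∷ zs)  h =
    crossings-lower⁺ d (suc e) p zs (≤-trans (≤-reflexive (cong suc (sym (+-suc e _)))) h)
  crossings-lower⁺ d       zero    (● ∷ p) (false ∷ zs) h = crossings-lower⁻ d 0 p zs (<⇒≤ h)
  crossings-lower⁺ d       (suc e) (● ∷ p) (false ∷ zs) h = crossings-lower⁺ d e p zs (<⇒≤ h)
  crossings-lower⁺ d       e       (● ∷ p) (true ∷ zs)  h =
    crossings-lower⁺ d e p zs (≤-trans (s≤s (+-monoʳ-≤ e (n≤1+n _))) h)
  crossings-lower⁺ d       e       (↘ ∷ p) (false ∷ zs) h = crossings-lower⁺ (suc d) e p zs (m≤n⇒m≤1+n h)
  crossings-lower⁺ d       e       (↘ ∷ p) (true ∷ zs)  h =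
    crossings-lower⁺ (suc d) (suc e) p zs (≤-trans (≤-reflexive (cong suc (sym (+-suc e _)))) (m≤n⇒m≤1+n h))
  crossings-lower⁺ (suc d) zero    (↗ ∷ p) (false ∷ zs) h = crossings-lower⁻ d 0 p zs (s≤s⁻¹ h)
  crossings-lower⁺ (suc d) (suc e) (↗ ∷ p) (false ∷ zs) h = crossings-lower⁺ d e p zs (s≤s⁻¹ h)
  crossings-lower⁺ (suc d) e       (↗ ∷ p) (true ∷ zs)  h =
    crossings-lower⁺ d e p zs (≤-trans (≤-reflexive (sym (+-suc e _))) (s≤s⁻¹ h))

crossings-straighten : ∀ {n} d e (p : Vec Step n) (zs : Vec Bool n) → ones zs ≤ e + d →
  crossings⁻ e (Vec.zip (lowers p) zs) ≡ crossings⁻ e (Vec.zip (lowers (straighten d p)) zs)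
crossings-straighten d e p = crossings-lower⁻ (crossings⁻ d p) d e p

-- The rows may differ before a common end, and this end contains at least s letters. The bound is
-- what makes the earlier part invisible in `peak-agree`.
data Agree (s : ℕ) : ∀ {n} → Vec Bool n → Vec Bool n → Set where
  same : ∀ {n} {xs : Vec Bool n} → s ≤ ones xs → Agree s xs xs
  step : ∀ {n} {xs xs′ : Vec Bool n} b b′ → Agree s xs xs′ → Agree s (b ∷ xs) (b′ ∷ xs′)

no-records⁻ : ∀ {n} i d (p : Vec Step n) → records d (reflect⁻ d p) ≡ 0 → descend i d (reflect⁻ d p) ≡ p
no-records⁻ i d       []      h = refl
no-records⁻ i d       (○ ∷ p) h = cong (○ ∷_) (no-records⁻ i d p h)
no-records⁻ i d       (● ∷ p) h = cong (● ∷_) (no-records⁻ i d p h)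
no-records⁻ i d       (↘ ∷ p) h = cong (↘ ∷_) (no-records⁻ i (suc d) p h)
no-records⁻ i (suc d) (↗ ∷ p) h = cong (↗ ∷_) (no-records⁻ i d p h)

-- All changes happen up to the last return to height 0. From there the path descends to - s, which
-- takes at least s letters of the upper row.
agree⁻ : ∀ {n} i d s (p : Vec Step n) → Balanced⁻ d s p → 0 < records d (reflect⁻ d p) →
         Agree s (uppers p) (uppers (descend i d (reflect⁻ d p)))
agree⁺ : ∀ {n} i d s (p : Vec Step n) → Balanced⁺ d s p → Agree s (uppers p) (uppers (descend i d (reflect⁺ d p)))
agree⁻ i       d       s (○ ∷ p) h r = step false false (agree⁻ i d s p h r)
agree⁻ i       d       s (● ∷ p) h r = step true true (agree⁻ i d s p (balanced⁻-● p d s h) r)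
agree⁻ i       d       s (↘ ∷ p) h r = step true true (agree⁻ i (suc d) s p (balanced⁻-↘ p d s h) r)
agree⁻ i       (suc d) s (↗ ∷ p) h r = step false false (agree⁻ i d s p (balanced⁻-↗ p d s h) r)
agree⁻ zero    zero    s (↗ ∷ p) h r = step false true (agree⁺ 0 0 s p (balanced⁻-↗₀ p 0 s h))
agree⁻ (suc i) zero    s (↗ ∷ p) h r = step false false (agree⁺ i 0 s p (balanced⁻-↗₀ p 0 s h))
agree⁺ i       d       s (○ ∷ p) h = step false false (agree⁺ i d s p h)
agree⁺ i       d       s (● ∷ p) h = step true true (agree⁺ i d s p (balanced⁺-● p d s h))
agree⁺ i       d       s (↗ ∷ p) h = step false true (agree⁺ i (suc d) s p (balanced⁺-↗ p d s h))
agree⁺ i       (suc d) s (↘ ∷ p) h = step true false (agree⁺ i d s p (balanced⁺-↘ p d s h))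
agree⁺ i       zero    s (↘ ∷ p) h = last i (balanced⁺-↘₀ p 0 s h)
  where
  rest : ∀ i → Balanced⁻ 0 s p → Agree s (uppers p) (uppers (descend i 0 (reflect⁻ 0 p)))
  rest i b with records 0 (reflect⁻ 0 p) in eq
  ... | zero  = subst (Agree s (uppers p)) (cong uppers (sym (no-records⁻ i 0 p eq)))
                  (same (≤-trans (m≤n+m s _) (≤-reflexive (trans b (+-identityʳ _)))))
  ... | suc _ = agree⁻ i 0 s p b (≤-trans (s≤s z≤n) (≤-reflexive (sym eq)))
  last : ∀ i → Balanced⁻ 0 s p → Agree s (true ∷ uppers p) (uppers (descend i 0 (↗ ∷ reflect⁻ 0 p)))
  last zero    b = step true true (rest 0 b)
  last (suc i) b = step true false (rest i b)

agree-straighten : ∀ {n} d s (p : Vec Step n) → Balanced⁻ d s p →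
  uppers (straighten d p) ≡ uppers p ⊎ Agree s (uppers p) (uppers (straighten d p))
agree-straighten d s p h with records d (reflect⁻ d p) in eq
... | zero  = inj₁ (cong uppers (no-records⁻ _ d p eq))
... | suc _ = inj₂ (agree⁻ _ d s p h (≤-trans (s≤s z≤n) (≤-reflexive (sym eq))))

agree-ones : ∀ {s n} {xs xs′ : Vec Bool n} → Agree s xs xs′ → s ≤ ones xs × s ≤ ones xs′
agree-ones (same h)      = h , h
agree-ones (step b b′ a) =
  map₁ (λ h → ≤-trans h (m≤n+m _ (bit b))) (map₂ (λ h → ≤-trans h (m≤n+m _ (bit b′))) (agree-ones a))

-- The hypothesis excludes only the step from height 0 to height 1; any other first step can be
-- absorbed in the starting height.
peak-∷ : ∀ {n} y b d (p : Vec Step n) → bit b ≤ d + bit y →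
  ∃ λ d′ → (peak ((y , b) ∷ p) ∸ d ≡ peak p ∸ d′) × (d′ + bit b ≡ d + bit y)
peak-∷ false false d       p h = d , refl , refl
peak-∷ true  true  d       p h = d , refl , refl
peak-∷ true  false d       p h = suc d , ∸-+-assoc (peak p) 1 d , trans (+-identityʳ (suc d)) (sym (+-comm d 1))
peak-∷ false true  (suc d) p h = d , refl , trans (+-comm d 1) (sym (+-identityʳ (suc d)))

-- As long as the rows may differ, at least s of their letters are to come, so at most d, resp. d′,
-- have been read and both paths are still at heights ≤ 0, where the maximum cut off at 0 does not
-- see them. Both enter the common end at the same height.
peak-agree : ∀ {n s} {xs xs′ : Vec Bool n} → Agree s xs xs′ → ∀ (ys : Vec Bool n) d d′ →
  d + ones xs′ ≡ d′ + ones xs → ones xs ≤ d + s → ones xs′ ≤ d′ + s →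
  peak (Vec.zip ys xs) ∸ d ≡ peak (Vec.zip ys xs′) ∸ d′
peak-agree {xs = xs} (same _) ys d d′ e h h′ = cong (peak (Vec.zip ys xs) ∸_) (+-cancelʳ-≡ (ones xs) d d′ e)
peak-agree {s = s} {xs = _ ∷ xs} {xs′ = _ ∷ xs′} (step b b′ a) (y ∷ ys) d d′ e h h′
  with peak-∷ y b d (Vec.zip ys xs) (bound xs b d (proj₁ (agree-ones a)) h)
     | peak-∷ y b′ d′ (Vec.zip ys xs′) (bound xs′ b′ d′ (proj₂ (agree-ones a)) h′)
  where
  bound : ∀ {n} (xs : Vec Bool n) b d → s ≤ ones xs → bit b + ones xs ≤ d + s → bit b ≤ d + bit y
  bound xs b d s≤ h = ≤-trans (+-cancelʳ-≤ s (bit b) d (≤-trans (+-monoʳ-≤ (bit b) s≤) h)) (m≤m+n d _)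
... | d₁ , f , g | d₁′ , f′ , g′ =
  trans f
    (trans (peak-agree a ys d₁ d₁′ (balance (bit b) (bit b′) (bit y) d d′ d₁ d₁′ (ones xs) (ones xs′) e g g′) (room (bit b) (bit y) d d₁ (ones xs) h g)
    (room (bit b′) (bit y) d′ d₁′ (ones xs′) h′ g′)) (sym f′))
  where
  balance : ∀ b b′ y d d′ d₁ d₁′ o o′ → d + (b′ + o′) ≡ d′ + (b + o) → d₁ + b ≡ d + y → d₁′ + b′ ≡ d′ + y →
            d₁ + o′ ≡ d₁′ + o
  balance b b′ y d d′ d₁ d₁′ o o′ e g g′ =
    linear {l = d + (b′ + o′)} e
      (linear {l = d₁ + b} g (linear {l = d′ + y} (sym g′) (identity b b′ y d d′ d₁ d₁′ o o′)))
    where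
    identity : ∀ b b′ y d d′ d₁ d₁′ o o′ →
      d₁ + o′ + (d′ + (b + o)) + (d + y) + (d₁′ + b′) ≡ d₁′ + o + (d + (b′ + o′)) + (d₁ + b) + (d′ + y)
    identity = solve-∀
  room : ∀ b y d d₁ o → b + o ≤ d + s → d₁ + b ≡ d + y → o ≤ d₁ + s
  room b y d d₁ o h g =
    +-cancelˡ-≤ b o (d₁ + s) (≤-trans h (≤-trans (+-monoˡ-≤ s (≤-trans (m≤m+n d y) (≤-reflexive (sym g))))
    (≤-reflexive (trans (cong (_+ s) (+-comm d₁ b)) (+-assoc b d₁ s)))))

-- Straightening all rows

head₀ : ∀ {n} → Vec ℕ n → ℕ
head₀ []      = 0
head₀ (x ∷ _) = x

-- The condition head₀ ls ≤ m₁ says that no column of the skew shape has boxes in three consecutive rows.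
data Thin : ∀ {n} → Vec ℕ n → Vec ℕ n → Set where
  []  : Thin [] []
  [-] : ∀ {l m} → m ≤ l → Thin (l ∷ []) (m ∷ [])
  _∷_ : ∀ {n l₁ l₂ m₁ m₂} {ls ms : Vec ℕ n} →
        m₁ ≤ l₁ × l₂ ≤ l₁ × m₂ ≤ m₁ × head₀ ls ≤ m₁ → Thin (l₂ ∷ ls) (m₂ ∷ ms) →
        Thin (l₁ ∷ l₂ ∷ ls) (m₁ ∷ m₂ ∷ ms)

module _ {N : ℕ} where

  Row : Set
  Row = Vec Bool N

  data HasRows : ∀ {n} → Vec ℕ n → Vec ℕ n → Vec Row n → Set where
    []  : HasRows [] [] []
    _∷_ : ∀ {n l m} {ls ms : Vec ℕ n} {v vs} → ones v + m ≡ l → HasRows ls ms vs → HasRows (l ∷ ls) (m ∷ ms) (v ∷ vs)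

  sumAdjacent : (ℕ → Vec Step N → ℕ) → ∀ {n} → Vec ℕ n → Vec Row n → ℕ
  sumAdjacent f (m₁ ∷ m₂ ∷ ms) (v₁ ∷ v₂ ∷ vs) =
    f (m₁ ∸ m₂) (Vec.zip v₁ v₂) + sumAdjacent f (m₂ ∷ ms) (v₂ ∷ vs)
  sumAdjacent f _              _              = 0

  crossingSum peakSum : ∀ {n} → Vec ℕ n → Vec Row n → ℕ
  crossingSum = sumAdjacent crossings⁻
  peakSum     = sumAdjacent (λ d p → peak p ∸ d)

  straightenRows : ∀ {n} → Vec ℕ n → Vec Row n → Vec Row n
  straightenRows (m₁ ∷ m₂ ∷ ms) (v₁ ∷ v₂ ∷ vs) = uppers q ∷ straightenRows (m₂ ∷ ms) (lowers q ∷ vs)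
    where q = straighten (m₁ ∸ m₂) (Vec.zip v₁ v₂)
  straightenRows (m ∷ [])       vs             = vs
  straightenRows []             vs             = vs

  letterTotals : ∀ {n} → Vec Row n → Vec ℕ N
  letterTotals []       = Vec.replicate N 0
  letterTotals (v ∷ vs) = zipWith _+_ (Vec.map bit v) (letterTotals vs)

  rows-balanced : ∀ {l₁ l₂ m₁ m₂} (v₁ v₂ : Row) → l₂ ≤ l₁ → m₂ ≤ m₁ → ones v₁ + m₁ ≡ l₁ → ones v₂ + m₂ ≡ l₂ →
                  Balanced⁻ (m₁ ∸ m₂) (l₁ ∸ l₂) (Vec.zip v₁ v₂)
  rows-balanced {l₁} {l₂} {m₁} {m₂} v₁ v₂ l₂≤l₁ m₂≤m₁ h₁ h₂ rewrite uppers-zip v₁ v₂ | lowers-zip v₁ v₂ =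
    +-cancelʳ-≡ m₂ _ _ (begin
      ones v₂ + (l₁ ∸ l₂) + m₂   ≡⟨ exchange (ones v₂) (l₁ ∸ l₂) m₂ ⟩
      ones v₂ + m₂ + (l₁ ∸ l₂)   ≡⟨ cong (_+ (l₁ ∸ l₂)) h₂ ⟩
      l₂ + (l₁ ∸ l₂)             ≡⟨ m+[n∸m]≡n l₂≤l₁ ⟩
      l₁                         ≡⟨ h₁ ⟨
      ones v₁ + m₁               ≡⟨ cong (ones v₁ +_) (m∸n+n≡m m₂≤m₁) ⟨
      ones v₁ + (m₁ ∸ m₂ + m₂)   ≡⟨ +-assoc (ones v₁) (m₁ ∸ m₂) m₂ ⟨
      ones v₁ + (m₁ ∸ m₂) + m₂   ∎)
    where
    open ≡-Reasoning
    exchange : ∀ a b c → a + b + c ≡ a + c + b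
    exchange = solve-∀

  module Pair {n} {l₁ l₂ m₁ m₂ : ℕ} {ls : Vec ℕ n} (v₁ v₂ : Row)
              (c : m₁ ≤ l₁ × l₂ ≤ l₁ × m₂ ≤ m₁ × head₀ ls ≤ m₁) (h₁ : ones v₁ + m₁ ≡ l₁)
                (h₂ : ones v₂ + m₂ ≡ l₂) where

    p q : Vec Step N
    p = Vec.zip v₁ v₂
    q = straighten (m₁ ∸ m₂) p

    balanced : Balanced⁻ (m₁ ∸ m₂) (l₁ ∸ l₂) p
    balanced = rows-balanced v₁ v₂ (proj₁ (proj₂ c)) (proj₁ (proj₂ (proj₂ c))) h₁ h₂

    upper : ones (uppers q) + m₁ ≡ l₁
    upper =
      trans (cong (_+ m₁) (trans (proj₁ (ones-straighten (m₁ ∸ m₂) _ p balanced)) (cong ones (uppers-zip v₁ v₂)))) h₁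

    lower : ones (lowers q) + m₂ ≡ l₂
    lower =
      trans (cong (_+ m₂) (trans (proj₂ (ones-straighten (m₁ ∸ m₂) _ p balanced)) (cong ones (lowers-zip v₁ v₂)))) h₂

  straightenRows-hasRows : ∀ {n} {ls ms : Vec ℕ n} {vs} → Thin ls ms → HasRows ls ms vs →
    HasRows ls ms (straightenRows ms vs)
  straightenRows-hasRows []      []             = []
  straightenRows-hasRows ([-] _) (h ∷ [])       = h ∷ []
  straightenRows-hasRows (_∷_ {ls = ls} c t) (_∷_ {v = v₁} h₁ (_∷_ {v = v₂} h₂ hs)) =
    P.upper ∷ straightenRows-hasRows t (P.lower ∷ hs)
    where module P = Pair {ls = ls} v₁ v₂ c h₁ h₂

  straightenRows-injective : ∀ {n} {ls ms : Vec ℕ n} {vs vs′} → Thin ls ms → HasRows ls ms vs → HasRows ls ms vs′ →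
    straightenRows ms vs ≡ straightenRows ms vs′ → vs ≡ vs′
  straightenRows-injective []      []       []         e = refl
  straightenRows-injective ([-] _) (_ ∷ []) (_ ∷ []) e = e
  straightenRows-injective (_∷_ {l₁ = l₁} {l₂} {m₁} {m₂} {ls} c t)
    (_∷_ {v = v₁} h₁ (_∷_ {v = v₂} h₂ hs)) (_∷_ {v = v₁′} h₁′ (_∷_ {v = v₂′} h₂′ hs′)) e =
    cong₂ _∷_ (trans (sym (uppers-zip v₁ v₂)) (trans (cong uppers p≡p′) (uppers-zip v₁′ v₂′)))
              (cong₂ _∷_ (trans (sym (lowers-zip v₁ v₂)) (trans (cong lowers p≡p′) (lowers-zip v₁′ v₂′)))
                         (Vec.∷-injectiveʳ rest))
    where
    module L = Pair {ls = ls} v₁ v₂ c h₁ h₂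
    module R = Pair {ls = ls} v₁′ v₂′ c h₁′ h₂′
    rest : lowers L.q ∷ _ ≡ lowers R.q ∷ _
    rest = straightenRows-injective t (L.lower ∷ hs) (R.lower ∷ hs′) (Vec.∷-injectiveʳ e)
    p≡p′ : L.p ≡ R.p
    p≡p′ = straighten-injective (m₁ ∸ m₂) (l₁ ∸ l₂) L.p R.p L.balanced R.balanced
      (trans (sym (zip-uppers-lowers L.q)) (trans (cong₂ Vec.zip (Vec.∷-injectiveˡ e) (Vec.∷-injectiveˡ rest)) (zip-uppers-lowers R.q)))

  letterTotals-straightenRows : ∀ {n} (ms : Vec ℕ n) vs → letterTotals (straightenRows ms vs) ≡ letterTotals vs
  letterTotals-straightenRows []             vs             = refl
  letterTotals-straightenRows (m ∷ [])       vs             = refl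
  letterTotals-straightenRows (m₁ ∷ m₂ ∷ ms) (v₁ ∷ v₂ ∷ vs) = begin
    zipWith _+_ (Vec.map bit (uppers q)) (letterTotals (straightenRows (m₂ ∷ ms) (lowers q ∷ vs)))
      ≡⟨ cong (zipWith _+_ _) (letterTotals-straightenRows (m₂ ∷ ms) (lowers q ∷ vs)) ⟩
    zipWith _+_ (Vec.map bit (uppers q)) (zipWith _+_ (Vec.map bit (lowers q)) x)
      ≡⟨ merge q x ⟩
    zipWith _+_ (Vec.map total q) x
      ≡⟨ cong (λ t → zipWith _+_ t x) (total-straighten (m₁ ∸ m₂) (Vec.zip v₁ v₂)) ⟩
    zipWith _+_ (Vec.map total (Vec.zip v₁ v₂)) x
      ≡⟨ merge (Vec.zip v₁ v₂) x ⟨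
    zipWith _+_ (Vec.map bit (uppers (Vec.zip v₁ v₂))) (zipWith _+_ (Vec.map bit (lowers (Vec.zip v₁ v₂))) x)
      ≡⟨ cong₂
        (λ a b → zipWith _+_ (Vec.map bit a) (zipWith _+_ (Vec.map bit b) x)) (uppers-zip v₁ v₂) (lowers-zip v₁ v₂) ⟩
    zipWith _+_ (Vec.map bit v₁) (zipWith _+_ (Vec.map bit v₂) x) ∎
    where
    open ≡-Reasoning
    q = straighten (m₁ ∸ m₂) (Vec.zip v₁ v₂)
    x = letterTotals vs
    merge : ∀ {n} (q : Vec Step n) (x : Vec ℕ n) →
      zipWith _+_ (Vec.map bit (uppers q)) (zipWith _+_ (Vec.map bit (lowers q)) x) ≡ zipWith _+_ (Vec.map total q) x
    merge []            []      = refl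
    merge ((a , b) ∷ q) (k ∷ x) = cong₂ _∷_ (sym (+-assoc (bit a) (bit b) k)) (merge q x)

  -- A third row has at most m₁ - m₃ letters by `head₀ ls ≤ m₁`. This is the sum of the starting
  -- depths m₁ - m₂ and m₂ - m₃ of the two paths, as `crossings-straighten` demands.
  crossingSum-lower : ∀ {n m₁ m₂} {l₂} {v₁ v₂ : Row} {ls ms : Vec ℕ n} {vs} → m₂ ≤ m₁ → head₀ ls ≤ m₁ →
    Thin (l₂ ∷ ls) (m₂ ∷ ms) → HasRows ls ms vs →
    crossingSum (m₂ ∷ ms) (v₂ ∷ vs) ≡ crossingSum (m₂ ∷ ms) (lowers (straighten (m₁ ∸ m₂) (Vec.zip v₁ v₂)) ∷ vs)
  crossingSum-lower _ _ ([-] _) [] = refl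
  crossingSum-lower {m₁ = m₁} {m₂} {v₁ = v₁} {v₂} m₂≤m₁ l₃≤m₁ (_∷_ {l₂ = l₃} {m₂ = m₃} (_ , _ , m₃≤m₂ , _) t)
    (_∷_ {v = v₃} h hs) =
    cong (_+ _) (trans (cong (λ v → crossings⁻ (m₂ ∸ m₃) (Vec.zip v v₃)) (sym (lowers-zip v₁ v₂)))
                       (crossings-straighten (m₁ ∸ m₂) (m₂ ∸ m₃) (Vec.zip v₁ v₂) v₃ bound))
    where
    bound : ones v₃ ≤ (m₂ ∸ m₃) + (m₁ ∸ m₂)
    bound = +-cancelʳ-≤ m₃ _ _ (begin
      ones v₃ + m₃                       ≡⟨ h ⟩
      l₃                                 ≤⟨ l₃≤m₁ ⟩
      m₁                                 ≡⟨ m∸n+n≡m m₂≤m₁ ⟨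
      (m₁ ∸ m₂) + m₂                     ≡⟨ cong ((m₁ ∸ m₂) +_) (m∸n+n≡m m₃≤m₂) ⟨
      (m₁ ∸ m₂) + ((m₂ ∸ m₃) + m₃)       ≡⟨ rotate (m₁ ∸ m₂) (m₂ ∸ m₃) m₃ ⟩
      (m₂ ∸ m₃) + (m₁ ∸ m₂) + m₃         ∎)
      where
      open ≤-Reasoning
      rotate : ∀ a b c → a + (b + c) ≡ b + a + c
      rotate = solve-∀

  -- The counterpart for the pair above: straightening the rows below keeps an end of `v₂` with at
  -- least l₂ - l₃ letters, and l₃ ≤ m₁ gives l₂ - m₂ ≤ (m₁ - m₂) + (l₂ - l₃), the bound of
  -- `peak-agree`.
  peakSum-∷ : ∀ {n m₁ m₂} {l₂} {v₁ v₂ : Row} {ls ms : Vec ℕ n} {vs} → m₂ ≤ m₁ → head₀ ls ≤ m₁ →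
    Thin (l₂ ∷ ls) (m₂ ∷ ms) → HasRows (l₂ ∷ ls) (m₂ ∷ ms) (v₂ ∷ vs) →
    peakSum (m₁ ∷ m₂ ∷ ms) (v₁ ∷ straightenRows (m₂ ∷ ms) (v₂ ∷ vs)) ≡
    (peak (Vec.zip v₁ v₂) ∸ (m₁ ∸ m₂)) + peakSum (m₂ ∷ ms) (straightenRows (m₂ ∷ ms) (v₂ ∷ vs))
  peakSum-∷ _ _ ([-] _) (_ ∷ []) = refl
  peakSum-∷ {m₁ = m₁} {m₂} {l₂} {v₁} {v₂} m₂≤m₁ l₃≤m₁ (_∷_ {l₂ = l₃} {m₂ = m₃} {ls = ls} {ms} c t)
    (h₂ ∷ (_∷_ {v = v₃} {vs} h₃ hs)) =
    cong (_+ peakSum (m₂ ∷ m₃ ∷ ms) (straightenRows (m₂ ∷ m₃ ∷ ms) (v₂ ∷ v₃ ∷ vs)))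
      (sym (helper (agree-straighten _ _ _ P.balanced)))
    where
    module P = Pair {ls = ls} v₂ v₃ c h₂ h₃
    l₃≤l₂ = proj₁ (proj₂ c)
    bound : ∀ o → o + m₂ ≡ l₂ → o ≤ (m₁ ∸ m₂) + (l₂ ∸ l₃)
    bound o e = +-cancelʳ-≤ m₂ _ _ (begin
      o + m₂                            ≡⟨ e ⟩
      l₂                                ≡⟨ m∸n+n≡m l₃≤l₂ ⟨
      (l₂ ∸ l₃) + l₃                    ≤⟨ +-monoʳ-≤ (l₂ ∸ l₃) l₃≤m₁ ⟩
      (l₂ ∸ l₃) + m₁                    ≡⟨ cong ((l₂ ∸ l₃) +_) (m∸n+n≡m m₂≤m₁) ⟨
      (l₂ ∸ l₃) + ((m₁ ∸ m₂) + m₂)      ≡⟨ rotate (l₂ ∸ l₃) (m₁ ∸ m₂) m₂ ⟩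
      (m₁ ∸ m₂) + (l₂ ∸ l₃) + m₂        ∎)
      where
      open ≤-Reasoning
      rotate : ∀ a b c → a + (b + c) ≡ b + a + c
      rotate = solve-∀
    helper : uppers P.q ≡ uppers P.p ⊎ Agree (l₂ ∸ l₃) (uppers P.p) (uppers P.q) →
             peak (Vec.zip v₁ v₂) ∸ (m₁ ∸ m₂) ≡ peak (Vec.zip v₁ (uppers P.q)) ∸ (m₁ ∸ m₂)
    helper (inj₁ e) = cong (λ v → peak (Vec.zip v₁ v) ∸ (m₁ ∸ m₂)) (sym (trans e (uppers-zip v₂ v₃)))
    helper (inj₂ a) =
      peak-agree (subst (λ v → Agree (l₂ ∸ l₃) v (uppers P.q)) (uppers-zip v₂ v₃) a) v₁ (m₁ ∸ m₂) (m₁ ∸ m₂)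
      (cong ((m₁ ∸ m₂) +_) (+-cancelʳ-≡ m₂ _ _ (trans P.upper (sym h₂)))) (bound _ h₂) (bound _ P.upper)

  -- Going from top to bottom, the pairs still to be treated keep their crossings and the pairs
  -- already treated keep their peaks.
  crossingSum≡peakSum : ∀ {n} {ls ms : Vec ℕ n} {vs} → Thin ls ms → HasRows ls ms vs →
    crossingSum ms vs ≡ peakSum ms (straightenRows ms vs)
  crossingSum≡peakSum []      []       = refl
  crossingSum≡peakSum ([-] _) (_ ∷ []) = refl
  crossingSum≡peakSum (_∷_ {m₁ = m₁} {m₂} {ls} {ms} c@(_ , _ , m₂≤m₁ , l₃≤m₁) t) (_∷_ {v = v₁} h₁ (_∷_ {v = v₂} {vs} h₂ hs)) =
    begin
    crossings⁻ (m₁ ∸ m₂) P.p + crossingSum (m₂ ∷ ms) (v₂ ∷ vs)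
      ≡⟨ cong₂ _+_ (sym (peak-straighten _ _ P.p P.balanced)) (crossingSum-lower {v₁ = v₁} m₂≤m₁ l₃≤m₁ t hs) ⟩
    (peak P.q ∸ (m₁ ∸ m₂)) + crossingSum (m₂ ∷ ms) (lowers P.q ∷ vs)
      ≡⟨ cong₂ _+_
        (cong (λ q → peak q ∸ (m₁ ∸ m₂)) (sym (zip-uppers-lowers P.q))) (crossingSum≡peakSum t (P.lower ∷ hs)) ⟩
    (peak (Vec.zip (uppers P.q) (lowers P.q)) ∸ (m₁ ∸ m₂)) + peakSum (m₂ ∷ ms)
      (straightenRows (m₂ ∷ ms) (lowers P.q ∷ vs))
      ≡⟨ peakSum-∷ {v₁ = uppers P.q} m₂≤m₁ l₃≤m₁ t (P.lower ∷ hs) ⟨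
    peakSum (m₁ ∷ m₂ ∷ ms) (uppers P.q ∷ straightenRows (m₂ ∷ ms) (lowers P.q ∷ vs)) ∎
    where
    open ≡-Reasoning
    module P = Pair {ls = ls} v₁ v₂ c h₁ h₂

-- Column insertion

-- A line of a tableau against the next one, which must not be longer; thus the relation contains
-- the condition on the shape.
data Over (R : ℕ → ℕ → Set) : List ℕ → List ℕ → Set where
  []  : ∀ {xs} → Over R xs []
  _∷_ : ∀ {x y xs ys} → R x y → Over R xs ys → Over R (x ∷ xs) (y ∷ ys)

infix 4 _⊴_
_⊴_ : List ℕ → List ℕ → Set
_⊴_ = Over _≤_

Increasing : List ℕ → Set
Increasing = AllPairs _<_

over-length : ∀ {R xs ys} → Over R xs ys → length ys ≤ length xs
over-length []       = z≤n
over-length (_ ∷ os) = s≤s (over-length os)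

over? : ∀ {R : ℕ → ℕ → Set} → (∀ x y → Dec (R x y)) → ∀ xs ys → Dec (Over R xs ys)
over? R? xs       []       = yes []
over? R? []       (y ∷ ys) = no λ ()
over? R? (x ∷ xs) (y ∷ ys) with R? x y | over? R? xs ys
... | yes r | yes os = yes (r ∷ os)
... | no ¬r | _      = no λ { (r ∷ _) → ¬r r }
... | yes _ | no ¬os = no λ { (_ ∷ os) → ¬os os }

⊴-refl : ∀ {xs} → xs ⊴ xs
⊴-refl {[]}     = []
⊴-refl {x ∷ xs} = ≤-refl ∷ ⊴-refl

⊴-trans : ∀ {xs ys zs} → xs ⊴ ys → ys ⊴ zs → xs ⊴ zs
⊴-trans o       []       = []
⊴-trans (a ∷ o) (b ∷ o′) = ≤-trans a b ∷ ⊴-trans o o′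

⊴-tail : ∀ {x xs} → Increasing (x ∷ xs) → (x ∷ xs) ⊴ xs
⊴-tail {xs = []}     _                = []
⊴-tail {xs = y ∷ xs} ((x<y ∷ _) ∷ is) = <⇒≤ x<y ∷ ⊴-tail is

-- Column insertion of a column D into a column C: the smallest letter goes first, and every letter replaces the
-- smallest letter that is not smaller.  The result is C′ and the column D′ of the replaced letters.
data Insert : (D C C′ D′ : List ℕ) → Set where
  none : ∀ {C} → Insert [] C C []
  new  : ∀ {d D} → Insert (d ∷ D) [] (d ∷ D) []
  bump : ∀ {d D c C C′ D′} → d ≤ c → Insert D C C′ D′ → Insert (d ∷ D) (c ∷ C) (d ∷ C′) (c ∷ D′)
  skip : ∀ {d D c C C′ D′} → c < d → Insert (d ∷ D) C C′ D′ → Insert (d ∷ D) (c ∷ C) (c ∷ C′) D′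

insert : ∀ D C → ∃₂ (Insert D C)
insert []      C       = _ , _ , none
insert (d ∷ D) []      = _ , _ , new
insert (d ∷ D) (c ∷ C) with d ≤? c
... | yes d≤c = let _ , _ , i = insert D C in _ , _ , bump d≤c i
... | no  d≰c = let _ , _ , i = insert (d ∷ D) C in _ , _ , skip (≰⇒> d≰c) i

module _ {ℓ} {P : Pred ℕ ℓ} where

  insert-all : ∀ {D C C′ D′} → Insert D C C′ D′ → All P D → All P C → All P C′
  insert-all none       ds       cs       = cs
  insert-all new        ds       cs       = ds
  insert-all (bump _ i) (d ∷ ds) (c ∷ cs) = d ∷ insert-all i ds cs
  insert-all (skip _ i) ds       (c ∷ cs) = c ∷ insert-all i ds cs

  bumped-all : ∀ {D C C′ D′} → Insert D C C′ D′ → All P C → All P D′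
  bumped-all none       cs       = []
  bumped-all new        cs       = []
  bumped-all (bump _ i) (c ∷ cs) = c ∷ bumped-all i cs
  bumped-all (skip _ i) (c ∷ cs) = bumped-all i cs

  inserted-all : ∀ {D C C′ D′} → Insert D C C′ D′ → All P C′ → All P D
  inserted-all none       cs       = []
  inserted-all new        cs       = cs
  inserted-all (bump _ i) (c ∷ cs) = c ∷ inserted-all i cs
  inserted-all (skip _ i) (c ∷ cs) = inserted-all i cs

  into-all : ∀ {D C C′ D′} → Insert D C C′ D′ → All P C′ → All P D′ → All P C
  into-all none       cs       ds       = cs
  into-all new        cs       ds       = []
  into-all (bump _ i) (_ ∷ cs) (d ∷ ds) = d ∷ into-all i cs ds
  into-all (skip _ i) (c ∷ cs) ds       = c ∷ into-all i cs ds

insert-increasing : ∀ {D C C′ D′} → Insert D C C′ D′ → Increasing D → Increasing C → Increasing C′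
insert-increasing none         _          is         = is
insert-increasing new          is         _          = is
insert-increasing (bump d≤c i) (d< ∷ ds)  (c< ∷ cs)  =
  insert-all i d< (All.map (≤-<-trans d≤c) c<) ∷ insert-increasing i ds cs
insert-increasing (skip c<d i) (d< ∷ ds)  (c< ∷ cs)  =
  insert-all i (c<d ∷ All.map (<-trans c<d) d<) c< ∷ insert-increasing i (d< ∷ ds) cs

bumped-increasing : ∀ {D C C′ D′} → Insert D C C′ D′ → Increasing C → Increasing D′
bumped-increasing none       _         = []
bumped-increasing new        _         = []
bumped-increasing (bump _ i) (c< ∷ cs) = bumped-all i c< ∷ bumped-increasing i cs
bumped-increasing (skip _ i) (_ ∷ cs)  = bumped-increasing i cs

inserted-increasing : ∀ {D C C′ D′} → Insert D C C′ D′ → Increasing C′ → Increasing D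
inserted-increasing none       _         = []
inserted-increasing new        is        = is
inserted-increasing (bump _ i) (d< ∷ is) = inserted-all i d< ∷ inserted-increasing i is
inserted-increasing (skip _ i) (_ ∷ is)  = inserted-increasing i is

⊴-all : ∀ {x xs ys} → xs ⊴ ys → All (x <_) xs → All (x <_) ys
⊴-all []       _          = []
⊴-all (a ∷ o) (x< ∷ xs<) = <-≤-trans x< a ∷ ⊴-all o xs<

insert-⊴-old : ∀ {D C C′ D′} → Insert D C C′ D′ → C′ ⊴ C
insert-⊴-old none         = ⊴-refl
insert-⊴-old new          = []
insert-⊴-old (bump d≤c i) = d≤c ∷ insert-⊴-old i
insert-⊴-old (skip _ i)   = ≤-refl ∷ insert-⊴-old i

old-⊴-bumped : ∀ {D C C′ D′} → Increasing C → Insert D C C′ D′ → C ⊴ D′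
old-⊴-bumped _           none       = []
old-⊴-bumped _           new        = []
old-⊴-bumped (_ ∷ is)    (bump _ i) = ≤-refl ∷ old-⊴-bumped is i
old-⊴-bumped is@(_ ∷ is′) (skip _ i) = ⊴-trans (⊴-tail is) (old-⊴-bumped is′ i)

insert-⊴-bumped : ∀ {D C C′ D′} → Increasing C → Insert D C C′ D′ → C′ ⊴ D′
insert-⊴-bumped is i = ⊴-trans (insert-⊴-old i) (old-⊴-bumped is i)

insert-⊴-inserted : ∀ {D C C′ D′} → Increasing D → Increasing C → Insert D C C′ D′ → C′ ⊴ D
insert-⊴-inserted _        _        none         = []
insert-⊴-inserted _        _        new          = ⊴-refl
insert-⊴-inserted (_ ∷ ds) (_ ∷ cs) (bump d≤c i) = ≤-refl ∷ insert-⊴-inserted ds cs i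
insert-⊴-inserted ds       (c< ∷ cs) (skip c<d i) =
  ⊴-trans (⊴-tail (insert-all i (c<d ∷ All.map (<-trans c<d) (heads ds)) c< ∷ insert-increasing i ds cs))
    (insert-⊴-inserted ds cs i)
  where
  heads : ∀ {x xs} → Increasing (x ∷ xs) → All (x <_) xs
  heads (h ∷ _) = h

insert-deterministic : ∀ {D C X X′ Y Y′} → Insert D C X X′ → Insert D C Y Y′ → X ≡ Y × X′ ≡ Y′
insert-deterministic none       none        = refl , refl
insert-deterministic new        new         = refl , refl
insert-deterministic (bump _ i) (bump _ j)  with refl , refl ← insert-deterministic i j = refl , refl
insert-deterministic (bump a i) (skip b j)  = contradiction a (<⇒≱ b)
insert-deterministic (skip a i) (bump b j)  = contradiction b (<⇒≱ a)
insert-deterministic (skip _ i) (skip _ j)  with refl , refl ← insert-deterministic i j = refl , refl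

-- For `insert-next`: when a letter stays in the first column while the second column takes one in,
-- the induction hypothesis speaks of one inserted letter too many.
insert-drop : ∀ {e D C X X′ Y Y′} → Increasing (e ∷ D) → Increasing C →
              Insert (e ∷ D) C X X′ → Insert D C Y Y′ → X ⊴ Y
insert-drop is               cs         new          none          = []
insert-drop is               cs         new          new           = ⊴-tail is
insert-drop _                cs         (bump e≤c none) none       = e≤c ∷ ⊴-refl
insert-drop ((e<d ∷ _) ∷ ds) (_ ∷ cs)   (bump e≤c i) (bump _ j)    = <⇒≤ e<d ∷ insert-drop ds cs i j
insert-drop {D = d ∷ D} ((e<d ∷ _) ∷ ds) (_ ∷ cs) (bump e≤c i) (skip c<d j)
  with refl , _ ← insert-deterministic i j = e≤c ∷ ⊴-refl
insert-drop _                _          (skip c<e i) none          = ≤-refl ∷ insert-⊴-old i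
insert-drop ((e<d ∷ _) ∷ _)  _          (skip c<e i) (bump d≤c j)  = contradiction d≤c (<⇒≱ (<-trans c<e e<d))
insert-drop is               (_ ∷ cs)   (skip c<e i) (skip _ j)    = ≤-refl ∷ insert-drop is cs i j

-- The new second column does not outgrow the old first one, so each row gains at most one box: the
-- new boxes form a vertical strip.
insert-next : ∀ {D C₁ C₁′ D₁ C₂ C₂′ D₂} → Increasing C₁ → Increasing C₂ → C₁ ⊴ C₂ →
              Insert D C₁ C₁′ D₁ → Insert D₁ C₂ C₂′ D₂ → C₁ ⊴ C₂′
insert-next _         _        o        none        none       = o
insert-next _         _        []       new         none       = []
insert-next is        _        _        i@(bump _ _) new       = old-⊴-bumped is i
insert-next (_ ∷ cs)  (_ ∷ es) (_ ∷ o)  (bump _ i)  (bump _ j) = ≤-refl ∷ insert-next cs es o i j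
insert-next _         _        (a ∷ o)  (bump _ i)  (skip b j) = contradiction a (<⇒≱ b)
insert-next _         _        o        (skip _ i)  none       = o
insert-next is        _        _        i@(skip _ _) new       = old-⊴-bumped is i
insert-next (c< ∷ cs) (_ ∷ es) (_ ∷ o)  (skip _ i)  (bump _ j) =
  <⇒≤ (All.head (bumped-all i c<)) ∷
  ⊴-trans (insert-next cs es o i k) (insert-drop (bumped-increasing i cs) es k j)
  where k = proj₂ (proj₂ (insert _ _))
insert-next (_ ∷ cs)  (_ ∷ es) (a ∷ o)  (skip _ i)  (skip _ j) = a ∷ insert-next cs es o i j

-- This tells the letters of C that were replaced from those that stayed in place.
not-⊴-bumped : ∀ {c D C C′ D′} → Increasing C → Insert D C C′ D′ → All (c <_) C → length D′ < length C →
               ¬ (C′ ⊴ c ∷ D′)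
not-⊴-bumped _         none       (c< ∷ _) h       (a ∷ _) = <⇒≱ c< a
not-⊴-bumped _         new        _        ()      _
not-⊴-bumped (c< ∷ is) (bump _ i) _        (s≤s h) (_ ∷ o) = not-⊴-bumped is i c< h o
not-⊴-bumped _         (skip _ i) (c< ∷ _) h       (a ∷ _) = <⇒≱ c< a

-- The length of the old column fixes how many of its letters stayed, and `not-⊴-bumped` then tells
-- which.
insert-injective : ∀ {D C D₁ C₁ C′ D′} → Increasing C → Increasing C₁ → Insert D C C′ D′ → Insert D₁ C₁ C′ D′ →
                   length C ≡ length C₁ → D ≡ D₁ × C ≡ C₁
insert-injective is        js        none       none       e = refl , refl
insert-injective (_ ∷ is)  (_ ∷ js)  none      
  (skip _ j) e with () ← proj₁ (insert-injective is js none j (suc-injective e))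
insert-injective is        js        new        new        e = refl , refl
insert-injective (_ ∷ is)  (_ ∷ js) 
  (skip _ i) none       e with () ← proj₁ (insert-injective is js i none (suc-injective e))
insert-injective (_ ∷ is)  (_ ∷ js)  (bump _ i) (bump _ j) e with refl , refl ← insert-injective is js i j (suc-injective e) =
  refl , refl
insert-injective (_ ∷ is)  (_ ∷ js)  (skip _ i) (skip _ j) e with refl , refl ← insert-injective is js i j (suc-injective e) =
  refl , refl
insert-injective (c< ∷ is) (_ ∷ js)  (bump _ i) (skip _ j) e =
  ⊥-elim
    (not-⊴-bumped is i c< (≤-trans (over-length (old-⊴-bumped js j)) (≤-reflexive (sym (suc-injective e)))) (insert-⊴-bumped js j))
insert-injective (_ ∷ is)  (c< ∷ js) (skip _ i) (bump _ j) e =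
  ⊥-elim
    (not-⊴-bumped js j c< (≤-trans (over-length (old-⊴-bumped is i)) (≤-reflexive (suc-injective e))) (insert-⊴-bumped is i))

-- Here k is the number of letters of the old column that stayed in place. While k > 0, the first
-- letter x stayed if the rest of the column still lies over all of `D′`; otherwise x replaced the
-- first letter of `D′`.
uninsert : ∀ k {C′ D′} → Increasing C′ → Increasing D′ → C′ ⊴ D′ → k + length D′ ≤ length C′ →
           ∃₂ λ D C → Insert D C C′ D′ × Increasing C × length C ≡ k + length D′
uninsert zero    is js o _ = _ , _ , all-bumped o , js , refl
  where
  all-bumped : ∀ {C D} → C ⊴ D → Insert C D C D
  all-bumped {[]}    []      = none
  all-bumped {_ ∷ _} []      = new
  all-bumped         (a ∷ o) = bump a (all-bumped o)
uninsert (suc k) {x ∷ C′} {D′} (x< ∷ is) js o h with over? _≤?_ C′ D′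
... | yes o′ with _ , C , i , cs , e ← uninsert k is js o′ (s≤s⁻¹ h) =
  _ , x ∷ C , stay i , into-all i x< (⊴-all o′ x<) ∷ cs , cong suc e
  where
  stay : ∀ {D} → Insert D C C′ D′ → Insert D (x ∷ C) (x ∷ C′) D′
  stay         none         = none
  stay {d ∷ D} i            = skip (All.head (inserted-all i x<)) i
uninsert (suc k) {x ∷ C′} {[]}     (x< ∷ is) js        o       h | no ¬o = contradiction [] ¬o
uninsert (suc k) {x ∷ C′} {y ∷ D′} (x< ∷ is) (y< ∷ js) (a ∷ o) h | no ¬o
  with _ , C , i , cs , e ← uninsert (suc k) is js o (≤-trans (≤-reflexive (sym (+-suc k _))) (s≤s⁻¹ h)) =
  _ , y ∷ C , bump a i , larger y< ¬o cs i ∷ cs , trans (cong suc e) (cong suc (sym (+-suc k _)))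
  where
  larger : ∀ {y D C C′ D′} → All (y <_) D′ → ¬ (C′ ⊴ y ∷ D′) → Increasing C → Insert D C C′ D′ → All (y <_) C
  larger {C = []}                 _  _  _         _ = []
  larger {y} {C = z ∷ C} {C′} {D′} y< ¬o (z< ∷ cs) i = y<z i y< ¬o ∷ All.map (<-trans (y<z i y< ¬o)) z<
    where
    y<z : ∀ {D C′ D′} → Insert D (z ∷ C) C′ D′ → All (y <_) D′ → ¬ (C′ ⊴ y ∷ D′) → y < z
    y<z none       _         ¬o = ≰⇒> λ z≤y → ¬o (z≤y ∷ [])
    y<z (bump _ _) (y<z ∷ _) ¬o = y<z
    y<z (skip _ i) _         ¬o = ≰⇒> λ z≤y → ¬o (z≤y ∷ insert-⊴-bumped cs i)

-- The induction removes letters E from the middle column that are already known to precede all of C₂.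
uninsert-⊴ : ∀ E {D D₁ C₁ C₁′ C₂ C₂′ D₂ L} → L ≡ E ++ D₁ → Increasing C₁ → Increasing C₂ →
  All (λ e → All (e <_) C₂) E → Insert D C₁ C₁′ L → Insert D₁ C₂ C₂′ D₂ →
  C₁′ ⊴ C₂′ → length C₂′ ≤ length C₁ → C₁ ⊴ C₂
uninsert-⊴ E {C₂ = []} _ _ _ _ _ _ _ _ = []
uninsert-⊴ []       refl cs       es _ none       none       o       h = o
uninsert-⊴ []       {C₂ = _ ∷ _} refl cs es _ new none o ()
uninsert-⊴ []       refl (_ ∷ cs) (_ ∷ es) _ (bump _ i) (bump b j) (_ ∷ o) (s≤s h) =
  b ∷ uninsert-⊴ [] refl cs es [] i j o h
uninsert-⊴ []       refl (c< ∷ cs) (_ ∷ es) _ (bump {D′ = D′} _ i) (skip b j) (_ ∷ o) (s≤s h) =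
  ⊥-elim (not-⊴-bumped cs i c< (≤-trans (over-length below) h) (⊴-trans o below))
  where below = insert-⊴-inserted (bumped-all i c< ∷ bumped-increasing i cs) es j
uninsert-⊴ (e ∷ E)  refl (c< ∷ cs) (_ ∷ es) ((e<c ∷ e<) ∷ E<) (bump _ i) none (_ ∷ o) (s≤s h) =
  <⇒≤ e<c ∷ uninsert-⊴ E refl cs es (All.map All.tail E<) i none o h
uninsert-⊴ (e ∷ E)  {D₁ = d ∷ D₁} refl (c< ∷ cs) (f< ∷ es) ((e<c ∷ e<) ∷ E<) (bump _ i) (bump b j) (_ ∷ o) (s≤s h) =
  <⇒≤ e<c ∷ uninsert-⊴ (E ++ d ∷ []) (sym (List.++-assoc E (d ∷ []) D₁)) cs es
    (All.++⁺ (All.map All.tail E<) (All.map (≤-<-trans b) f< ∷ [])) i j o h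
uninsert-⊴ (e ∷ E)  refl (c< ∷ cs) (_ ∷ es) ((e<c ∷ e<) ∷ E<) (bump _ i) (skip _ j) (_ ∷ o) (s≤s h) =
  <⇒≤ e<c ∷ uninsert-⊴ E refl cs es (All.map All.tail E<) i j o h
uninsert-⊴ E        refl (c< ∷ cs) (_ ∷ es) E< (skip _ i) none (a ∷ o) (s≤s h) =
  a ∷ uninsert-⊴ E refl cs es (All.map All.tail E<) i none o h
uninsert-⊴ E        {D₁ = d ∷ D₁} refl (c< ∷ cs) (f< ∷ es) E< (skip _ i) (bump b j) (_ ∷ o) (s≤s h) =
  <⇒≤ (<-≤-trans (All.head (All.++⁻ʳ E (bumped-all i c<))) b) ∷
  uninsert-⊴ (E ++ d ∷ []) (sym (List.++-assoc E (d ∷ []) D₁)) cs es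
    (All.++⁺ (All.map All.tail E<) (All.map (≤-<-trans b) f< ∷ [])) i j o h
uninsert-⊴ E        refl (c< ∷ cs) (_ ∷ es) E< (skip _ i) (skip _ j) (a ∷ o) (s≤s h) =
  a ∷ uninsert-⊴ E refl cs es (All.map All.tail E<) i j o h

firstLine : List (List ℕ) → List ℕ
firstLine []      = []
firstLine (C ∷ _) = C

-- Lines whose entries are related by R along each line, and by S from each line to the next.
data Array (R S : ℕ → ℕ → Set) : List (List ℕ) → Set where
  []   : Array R S []
  line : ∀ {C T} → AllPairs R C → Over S C (firstLine T) → Array R S T → Array R S (C ∷ T)

Columns Rows : List (List ℕ) → Set
Columns = Array _<_ _≤_
Rows    = Array _≤_ _<_

columns-first : ∀ {R S T} → Array R S T → AllPairs R (firstLine T)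
columns-first []          = []
columns-first (line is _ _) = is

-- Every insertion appends a last column, which may be empty. The number of columns is therefore the
-- number of insertions, whatever the shape.
data InsertAll : List ℕ → List (List ℕ) → List (List ℕ) → Set where
  last : ∀ {D} → InsertAll D [] (D ∷ [])
  next : ∀ {D C C′ D′ T T′} → Insert D C C′ D′ → InsertAll D′ T T′ → InsertAll D (C ∷ T) (C′ ∷ T′)

insertAll : ∀ D T → ∃ (InsertAll D T)
insertAll D []      = _ , last
insertAll D (C ∷ T) = let _ , D′ , i = insert D C in _ , next i (proj₂ (insertAll D′ T))

insertAll-deterministic : ∀ {D T T₁ T₂} → InsertAll D T T₁ → InsertAll D T T₂ → T₁ ≡ T₂
insertAll-deterministic last       last       = refl
insertAll-deterministic (next i r) (next j s) with refl , refl ← insert-deterministic i j =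
  cong (_ ∷_) (insertAll-deterministic r s)

insertAll-next : ∀ {D C C′ D′ T T′} → Columns (C ∷ T) → Insert D C C′ D′ → InsertAll D′ T T′ → C ⊴ firstLine T′
insertAll-next (line is o t) i last       = old-⊴-bumped is i
insertAll-next (line is o t) i (next j _) = insert-next is (columns-first t) o i j

insertAll-columns : ∀ {D T T′} → Increasing D → Columns T → InsertAll D T T′ → Columns T′
insertAll-columns ds []               last       = line ds [] []
insertAll-columns ds t@(line is o t′) (next i r) =
  line (insert-increasing i ds is) (⊴-trans (insert-⊴-old i) (insertAll-next t i r))
       (insertAll-columns (bumped-increasing i is) t′ r)

-- Shapes that differ by a vertical strip, in terms of their column lengths. Read as row lengths, as
-- for the recording tableau, they differ by a horizontal strip.
data Interlace : List ℕ → List ℕ → Set where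
  [-] : ∀ {a} → Interlace [] (a ∷ [])
  _∷_ : ∀ {c a a₂ cs as} → a₂ ≤ c × c ≤ a → Interlace cs (a₂ ∷ as) → Interlace (c ∷ cs) (a ∷ a₂ ∷ as)

insertAll-interlace : ∀ {D T T′} → Columns T → InsertAll D T T′ → Interlace (map length T) (map length T′)
insertAll-interlace []               last                  = [-]
insertAll-interlace t@(line is o t′) (next i r@last)       =
  (over-length (insertAll-next t i r) , over-length (insert-⊴-old i)) ∷ insertAll-interlace t′ r
insertAll-interlace t@(line is o t′) (next i r@(next _ _)) =
  (over-length (insertAll-next t i r) , over-length (insert-⊴-old i)) ∷ insertAll-interlace t′ r

insertAll-injective : ∀ {D D₁ T T₁ T′} → Columns T → Columns T₁ → InsertAll D T T′ → InsertAll D₁ T₁ T′ →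
                      map length T ≡ map length T₁ → D ≡ D₁ × T ≡ T₁
insertAll-injective _            _            last       last       e = refl , refl
insertAll-injective (line is _ t) (line js _ u) (next i r) (next j s) e
  with refl , refl ← insertAll-injective t u r s (List.∷-injectiveʳ e)
  with refl , refl ← insert-injective is js i j (List.∷-injectiveˡ e) = refl , refl

first-⊴-inserted : ∀ {D T T′} → Increasing D → Columns T → InsertAll D T T′ → firstLine T′ ⊴ D
first-⊴-inserted ds _            last       = ⊴-refl
first-⊴-inserted ds (line is _ _) (next i _) = insert-⊴-inserted ds is i

-- The letters pushed out of a column are those inserted into the next, so the columns are restored
-- from the last one backwards; the old lengths `cs` determine how many letters stayed in each.
uninsertAll : ∀ {cs T′} → Columns T′ → Interlace cs (map length T′) →
              ∃₂ λ D T → InsertAll D T T′ × Increasing D × Columns T × map length T ≡ cs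
uninsertAll {[]} {D ∷ []}           (line ds _ _) [-] = D , [] , last , ds , [] , refl
uninsertAll {c ∷ cs} {C′ ∷ C₂′ ∷ T′} (line is o t) ((a₂≤c , c≤a) ∷ h)
  with D′ , T , r , ds , t′ , refl ← uninsertAll t h
  with D′⊵ ← first-⊴-inserted ds t′ r
  with k ← m∸n+n≡m (≤-trans (over-length D′⊵) a₂≤c)
  with D , C , i , js , e ← uninsert (c ∸ length D′) is ds (⊴-trans o D′⊵) (≤-trans (≤-reflexive k) c≤a)
  with e ← trans e k =
  D , C ∷ T , next i r , inserted-increasing i is , line js (below js r t′ i e) t′ , cong (_∷ _) e
  where
  below : ∀ {D′ T D C} → Increasing C → InsertAll D′ T (C₂′ ∷ T′) → Columns T → Insert D C C′ D′ →
          length C ≡ c → C ⊴ firstLine T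
  below js last       _             i e = []
  below js (next j _) (line es _ _) i e = uninsert-⊴ [] refl js es [] i j o (≤-trans a₂≤c (≤-reflexive (sym e)))

insert-↭ : ∀ {D C C′ D′} → Insert D C C′ D′ → C′ ++ D′ ↭ D ++ C
insert-↭ {C = C} none     = Perm.++-comm C []
insert-↭ new              = ↭-refl
insert-↭ {d ∷ D} {c ∷ C} {_ ∷ C′} {_ ∷ D′} (bump _ i) =
  prep d (↭-trans (Perm.shift c C′ D′) (↭-trans (prep c (insert-↭ i)) (↭-sym (Perm.shift c D C))))
insert-↭ {d ∷ D} {c ∷ C} (skip _ i) = ↭-trans (prep c (insert-↭ i)) (↭-sym (Perm.shift c (d ∷ D) C))

insertAll-↭ : ∀ {D T T′} → InsertAll D T T′ → concat T′ ↭ D ++ concat T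
insertAll-↭ last = ↭-refl
insertAll-↭ {D} (next {C = C} {C′} {D′} {T} {T′} i r) = begin
  C′ ++ concat T′          ↭⟨ Perm.++⁺ˡ C′ (insertAll-↭ r) ⟩
  C′ ++ D′ ++ concat T     ≡⟨ List.++-assoc C′ D′ (concat T) ⟨
  (C′ ++ D′) ++ concat T   ↭⟨ Perm.++⁺ʳ (concat T) (insert-↭ i) ⟩
  (D ++ C) ++ concat T     ≡⟨ List.++-assoc D C (concat T) ⟩
  D ++ C ++ concat T       ∎
  where open Perm.PermutationReasoning

-- Recording tableaux

-- The number of letters e added to a row is left open; that they form a horizontal strip is
-- expressed separately, by `Interlace` for the lengths.
data Extend (e : ℕ) : List (List ℕ) → List (List ℕ) → Set where
  last : ∀ k → Extend e [] (replicate k e ∷ [])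
  next : ∀ {r P P′} k → Extend e P P′ → Extend e (r ∷ P) ((r ++ replicate k e) ∷ P′)

length-++-replicate : ∀ {e : ℕ} r k → length (r ++ replicate k e) ≡ length r + k
length-++-replicate r k = trans (List.length-++ r) (cong (length r +_) (List.length-replicate k))

extend : ∀ e P {cs} → Interlace (map length P) cs → ∃ λ P′ → Extend e P P′ × map length P′ ≡ cs
extend e []      ([-] {a})          = _ , last a , cong (_∷ []) (List.length-replicate a)
extend e (r ∷ P) ((_ , r≤a) ∷ h) with P′ , x , eq ← extend e P h =
  _ , next _ x , cong₂ _∷_ (trans (length-++-replicate r _) (m+[n∸m]≡n r≤a)) eq

extend-deterministic : ∀ {e P P₁ P₂} → Extend e P P₁ → Extend e P P₂ → map length P₁ ≡ map length P₂ → P₁ ≡ P₂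
extend-deterministic {e} (last k) (last j) eq =
  cong
    (λ k → replicate k e ∷ []) (trans (sym (List.length-replicate k)) (trans (List.∷-injectiveˡ eq) (List.length-replicate j)))
extend-deterministic {e} (next {r = r} k x) (next j y) eq =
  cong₂ _∷_ (cong (λ k → r ++ replicate k e) (+-cancelˡ-≡ (length r) k j
      (trans (sym (length-++-replicate r k)) (trans (List.∷-injectiveˡ eq) (length-++-replicate r j)))))
    (extend-deterministic x y (List.∷-injectiveʳ eq))

++-replicate-injective : ∀ {e} r s k j → All (_< e) r → All (_< e) s → r ++ replicate k e ≡ s ++ replicate j e → r ≡ s
++-replicate-injective []      []      k       j       _        _        eq = refl
++-replicate-injective []      (y ∷ s) (suc k) j       _        (y< ∷ _) eq =
  contradiction (sym (List.∷-injectiveˡ eq)) (<⇒≢ y<)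
++-replicate-injective (x ∷ r) []      k       (suc j) (x< ∷ _) _        eq =
  contradiction (List.∷-injectiveˡ eq) (<⇒≢ x<)
++-replicate-injective (x ∷ r) (y ∷ s) k       j       (_ ∷ r<) (_ ∷ s<) eq =
  cong₂ _∷_ (List.∷-injectiveˡ eq) (++-replicate-injective r s k j r< s< (List.∷-injectiveʳ eq))

extend-injective : ∀ {e P P₁ Q} → All (All (_< e)) P → All (All (_< e)) P₁ → Extend e P Q → Extend e P₁ Q → P ≡ P₁
extend-injective ps        qs        x y = go ps qs x y refl
  where
  go : ∀ {e P P₁ Q Q₁} → All (All (_< e)) P → All (All (_< e)) P₁ → Extend e P Q → Extend e P₁ Q₁ → Q ≡ Q₁ → P ≡ P₁
  go []        []        (last k)   (last j)   eq = refl
  go []        (_ ∷ _)   (last k)   (next j (last _)) ()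
  go []        (_ ∷ _)   (last k)   (next j (next _ _)) ()
  go (_ ∷ _)   []        (next k (last _)) (last j)  ()
  go (_ ∷ _)   []        (next k (next _ _)) (last j)  ()
  go (p ∷ ps)  (q ∷ qs)  (next k x) (next j y) eq =
    cong₂ _∷_ (++-replicate-injective _ _ k j p q (List.∷-injectiveˡ eq)) (go ps qs x y (List.∷-injectiveʳ eq))

extend-≤ : ∀ {e P Q} → All (All (_< e)) P → Extend e P Q → All (All (_≤ e)) Q
extend-≤ []       (last k)   = All.replicate⁺ k ≤-refl ∷ []
extend-≤ (p ∷ ps) (next k x) = All.++⁺ (All.map <⇒≤ p) (All.replicate⁺ k ≤-refl) ∷ extend-≤ ps x

extend-all : ∀ {p} {R : Pred ℕ p} {e P Q} → R e → All (All R) P → Extend e P Q → All (All R) Q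
extend-all re []       (last k)   = All.replicate⁺ k re ∷ []
extend-all re (p ∷ ps) (next k x) = All.++⁺ p (All.replicate⁺ k re) ∷ extend-all re ps x

unextend-all : ∀ {p} {R : Pred ℕ p} {e P Q} → All (All R) Q → Extend e P Q → All (All R) P
unextend-all _        (last k)   = []
unextend-all (q ∷ qs) (next k x) = All.++⁻ˡ _ q ∷ unextend-all qs x

extend-length : ∀ {e P Q} → Extend e P Q → length Q ≡ suc (length P)
extend-length (last k)   = refl
extend-length (next k x) = cong suc (extend-length x)

replicate-sorted : ∀ k e → AllPairs _≤_ (replicate k e)
replicate-sorted zero    e = []
replicate-sorted (suc k) e = All.replicate⁺ k ≤-refl ∷ replicate-sorted k e

++-replicate-sorted : ∀ {e} r k → AllPairs _≤_ r → All (_< e) r → AllPairs _≤_ (r ++ replicate k e)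
++-replicate-sorted r k is r< =
  AllPairs.++⁺ is (replicate-sorted k _) (All.map (λ x<e → All.replicate⁺ k (<⇒≤ x<e)) r<)

over-extend : ∀ {e r s X} m → Over _<_ r s → All (_< e) r → length (s ++ replicate m e) ≤ length r →
              Over _<_ (r ++ X) (s ++ replicate m e)
over-extend         zero    []      _        h       = []
over-extend {r = []}    (suc m) []  _        ()
over-extend {r = _ ∷ _} (suc m) []  (p ∷ ps) (s≤s h) = p ∷ over-extend m [] ps h
over-extend         m       (a ∷ o) (_ ∷ ps) (s≤s h) = a ∷ over-extend m o ps h

-- By interlacing, every new letter below the first row stands under an old one, which is smaller.
extend-rows : ∀ {e P Q} → Rows P → All (All (_< e)) P → Extend e P Q → Interlace (map length P) (map length Q) →
  Rows Q
extend-rows {e} []            _        (last k)     _             = line (replicate-sorted k e) [] []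
extend-rows     (line is o t) (p ∷ ps) (next k x@(last j)) ((h , _) ∷ i) =
  line (++-replicate-sorted _ k is p) (over-extend {s = []} j [] p h) (extend-rows t ps x i)
extend-rows     (line is o t) (p ∷ ps) (next k x@(next {r = s} j _)) ((h , _) ∷ i) =
  line (++-replicate-sorted _ k is p) (over-extend {s = s} j o p h) (extend-rows t ps x i)

replicate-++ : ∀ {e : ℕ} k j → replicate k e ++ replicate j e ≡ replicate (k + j) e
replicate-++ zero    j = refl
replicate-++ (suc k) j = cong (_ ∷_) (replicate-++ k j)

extend-↭ : ∀ {e P Q} → Extend e P Q → ∃ λ k → concat Q ↭ concat P ++ replicate k e
extend-↭ {e} (last k) = k , ↭-reflexive (List.++-identityʳ (replicate k e))
extend-↭ {e} (next {r = r} {P} {Q} k x) with j , eq ← extend-↭ x = k + j , (begin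
  (r ++ replicate k e) ++ concat Q                     ↭⟨ Perm.++⁺ˡ (r ++ replicate k e) eq ⟩
  (r ++ replicate k e) ++ concat P ++ replicate j e    ≡⟨ List.++-assoc r (replicate k e) _ ⟩
  r ++ replicate k e ++ concat P ++ replicate j e      ≡⟨ cong (r ++_) (List.++-assoc (replicate k e) (concat P) _) ⟨
  r ++ (replicate k e ++ concat P) ++ replicate j e
    ↭⟨ Perm.++⁺ˡ r (Perm.++⁺ʳ _ (Perm.++-comm (replicate k e) (concat P))) ⟩
  r ++ (concat P ++ replicate k e) ++ replicate j e    ≡⟨ cong (r ++_) (List.++-assoc (concat P) _ _) ⟩
  r ++ concat P ++ replicate k e ++ replicate j e      ≡⟨ cong (λ z → r ++ concat P ++ z) (replicate-++ k j) ⟩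
  r ++ concat P ++ replicate (k + j) e                 ≡⟨ List.++-assoc r (concat P) _ ⟨
  (r ++ concat P) ++ replicate (k + j) e               ∎)
  where open Perm.PermutationReasoning

split-row : ∀ {e} r → AllPairs _≤_ r → All (_≤ e) r → ∃₂ λ s k →
  r ≡ s ++ replicate k e × AllPairs _≤_ s × All (_< e) s
split-row         []      _         _        = [] , 0 , refl , [] , []
split-row {e} (x ∷ r) (x≤ ∷ is) (p ∷ ps) with x <? e
... | no x≮e = [] , suc (length r) , cong₂ _∷_ x≡e (constant r x≤ ps) , [] , []
  where
  x≡e = ≤-antisym p (≮⇒≥ x≮e)
  constant : ∀ r → All (x ≤_) r → All (_≤ e) r → r ≡ replicate (length r) e
  constant []      _        _        = refl
  constant (y ∷ r) (a ∷ as) (b ∷ bs) = cong₂ _∷_ (≤-antisym b (≤-trans (≮⇒≥ x≮e) a)) (constant r as bs)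
... | yes x<e with s , k , refl , js , s< ← split-row r is ps = x ∷ s , k , refl , All.++⁻ˡ s x≤ ∷ js , x<e ∷ s<

over-cut : ∀ {e} s k {r} → Over _<_ (s ++ replicate k e) r → All (_≤ e) r → Over _<_ s r
over-cut s       k       {[]}    _       _        = []
over-cut []      zero    {_ ∷ _} ()      _
over-cut []      (suc k) {_ ∷ _} (a ∷ _) (b ∷ _)  = contradiction a (≤⇒≯ b)
over-cut (x ∷ s) k       {_ ∷ _} (a ∷ o) (_ ∷ bs) = a ∷ over-cut s k o bs

over-prefix : ∀ {R r} s {X} → Over R r (s ++ X) → Over R r s
over-prefix []      _       = []
over-prefix (x ∷ s) (a ∷ o) = a ∷ over-prefix s o

over-all : ∀ {i r s} → Over _<_ r s → All (i ≤_) r → All (suc i ≤_) s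
over-all []      _        = []
over-all (a ∷ o) (b ∷ bs) = ≤-<-trans b a ∷ over-all o bs

-- The entries of row i are at least i, so the last row has no entry but e.
unextend : ∀ {e} n i {Q} → Rows Q → length Q ≡ suc n → i + n ≡ e → All (i ≤_) (firstLine Q) → All (All (_≤ e)) Q →
           ∃ λ P → Extend e P Q × Rows P × All (All (_< e)) P × Interlace (map length P) (map length Q)
unextend {e} zero i {r ∷ []} (line is _ _) _ refl i≤ (≤e ∷ []) =
  [] , subst (λ r → Extend (i + 0) [] (r ∷ [])) (sym (constant r i≤ ≤e)) (last (length r)) , [] , [] , [-]
  where
  constant : ∀ r → All (i ≤_) r → All (_≤ i + 0) r → r ≡ replicate (length r) (i + 0)
  constant []      _        _        = refl
  constant (y ∷ r) (a ∷ as) (b ∷ bs) =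
    cong₂ _∷_ (≤-antisym b (≤-trans (≤-reflexive (+-identityʳ i)) a)) (constant r as bs)
unextend {e} (suc n) i {r ∷ r₂ ∷ Q} (line is o t) len refl i≤ (≤e ∷ ≤es@(≤e₂ ∷ _))
  with s , k , refl , js , s< ← split-row r is ≤e
  with P , x , t′ , p , h ← unextend n (suc i) t (suc-injective len) (sym (+-suc i n)) (over-all o i≤) ≤es
  with o′ ← over-cut s k o ≤e₂ =
  s ∷ P , next k x , line js (below x o′) t′ , s< ∷ p ,
  (over-length o′ , ≤-trans (m≤m+n _ k) (≤-reflexive (sym (length-++-replicate s k)))) ∷ h
  where
  below : ∀ {P s} → Extend (i + suc n) P (r₂ ∷ Q) → Over _<_ s r₂ → Over _<_ s (firstLine P)
  below (last _)           o = []
  below (next {r = r} _ _) o = over-prefix r o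

-- Knuth equivalence

-- In the bracketing of the letters j + 1 (opening) and j (closing), w followed by a unmatched letters j leaves
-- act j w a letters j unmatched.
act₁ : ℕ → ℕ → ℕ → ℕ
act₁ j x = effect (x ≟ j) (x ≟ suc j)
  where
  effect : ∀ {P Q : Set} → Dec P → Dec Q → ℕ → ℕ
  effect (yes _) _       = suc
  effect (no _)  (yes _) = pred
  effect (no _)  (no _)  = id

act : ℕ → List ℕ → ℕ → ℕ
act j w a = foldr (act₁ j) a w

act-++ : ∀ j u v a → act j (u ++ v) a ≡ act j u (act j v a)
act-++ j u v a = List.foldr-++ (act₁ j) a u v

infix 4 _∼_
-- Knuth equivalence enters only through the bracketings, so it is replaced by equality of their
-- effects. Asking for this at every a, not only at 0, gives a congruence for concatenation.
record _∼_ (u v : List ℕ) : Set where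
  constructor equivalent
  field
    act-≡ : ∀ j a → act j u a ≡ act j v a

open _∼_

∼-refl : ∀ {u} → u ∼ u
∼-refl = equivalent λ j a → refl

∼-reflexive : ∀ {u v} → u ≡ v → u ∼ v
∼-reflexive refl = ∼-refl

∼-sym : ∀ {u v} → u ∼ v → v ∼ u
∼-sym p = equivalent λ j a → sym (act-≡ p j a)

∼-trans : ∀ {u v w} → u ∼ v → v ∼ w → u ∼ w
∼-trans p q = equivalent λ j a → trans (act-≡ p j a) (act-≡ q j a)

∼-++ : ∀ {u u′ v v′} → u ∼ u′ → v ∼ v′ → u ++ v ∼ u′ ++ v′
∼-++ {u} {u′} {v} {v′} p q = equivalent λ j a →
  trans (act-++ j u v a)
    (trans (act-≡ p j (act j v a)) (trans (cong (act j u′) (act-≡ q j a)) (sym (act-++ j u′ v′ a))))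

∼-++ˡ : ∀ u {v v′} → v ∼ v′ → u ++ v ∼ u ++ v′
∼-++ˡ u = ∼-++ {u} ∼-refl

module ∼-Reasoning where
  infix  3 _∎
  infixr 2 step-∼ step-≡∼
  infix  1 begin_
  begin_ : ∀ {u v} → u ∼ v → u ∼ v
  begin p = p
  step-∼ : ∀ u {v w} → v ∼ w → u ∼ v → u ∼ w
  step-∼ u q p = ∼-trans p q
  step-≡∼ : ∀ u {v w} → v ∼ w → u ≡ v → u ∼ w
  step-≡∼ u q refl = q
  _∎ : ∀ u → u ∼ u
  u ∎ = ∼-refl
  syntax step-∼ u q p = u ∼⟨ p ⟩ q
  syntax step-≡∼ u q p = u ≡⟨ p ⟩ q

act₁-up : ∀ j a → act₁ j j a ≡ suc a
act₁-up j a with j ≟ j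
... | yes _  = refl
... | no j≢j = contradiction refl j≢j

act₁-down : ∀ j a → act₁ j (suc j) a ≡ pred a
act₁-down j a with suc j ≟ j | suc j ≟ suc j
... | yes e | _      = contradiction e 1+n≢n
... | no _  | yes _  = refl
... | no _  | no s≢s = contradiction refl s≢s

act₁-other : ∀ {j x} a → x ≢ j → x ≢ suc j → act₁ j x a ≡ a
act₁-other {j} {x} a x≢j x≢1+j with x ≟ j | x ≟ suc j
... | yes e | _     = contradiction e x≢j
... | no _  | yes e = contradiction e x≢1+j
... | no _  | no _  = refl

-- Besides the identity there are only the effects `suc` and `pred`, and for x < z they meet only in
-- the excluded case.
commute : ∀ {j x z} a → x < z → ¬ (x ≡ j × z ≡ suc j) → act₁ j x (act₁ j z a) ≡ act₁ j z (act₁ j x a)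
commute {j} {x} {z} a x<z h with x ≟ j | x ≟ suc j | z ≟ j | z ≟ suc j
... | yes refl | _        | yes refl | _        = refl
... | yes e    | _        | no _     | yes f    = contradiction (e , f) h
... | yes _    | _        | no _     | no _     = refl
... | no _     | yes refl | yes refl | _        = contradiction (n≤1+n z) (<⇒≱ x<z)
... | no _     | yes _    | no _     | yes _    = refl
... | no _     | yes _    | no _     | no _     = refl
... | no _     | no _     | yes _    | _        = refl
... | no _     | no _     | no _     | yes _    = refl
... | no _     | no _     | no _     | no _     = refl

-- In the case excluded from `commute` the inequalities force y = z, and the additional `pred` of y
-- wipes out the difference between `pred ∘ suc` and `suc ∘ pred`. In `knuth₂` they force y = x, and
-- the additional `suc` does the same.
knuth₁ : ∀ {x y z} w → x < y → y ≤ z → y ∷ z ∷ x ∷ w ∼ y ∷ x ∷ z ∷ w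
knuth₁ {x} {y} {z} w x<y y≤z = equivalent go
  where
  go : ∀ j a → act j (y ∷ z ∷ x ∷ w) a ≡ act j (y ∷ x ∷ z ∷ w) a
  go j a with x ≟ j ×-dec z ≟ suc j
  ... | no h = cong (act₁ j y) (sym (commute (act j w a) (<-≤-trans x<y y≤z) h))
  ... | yes (refl , refl) with refl ← ≤-antisym y≤z x<y =
    trans (cong (act₁ j (suc j)) (trans (act₁-down j _) (cong pred (act₁-up j _))))
          (trans (act₁-down j (act j w a))
                 (sym (trans (act₁-down j _) (trans (cong pred (act₁-up j _)) (act₁-down j _)))))

knuth₂ : ∀ {x y z} w → x ≤ y → y < z → x ∷ z ∷ y ∷ w ∼ z ∷ x ∷ y ∷ w
knuth₂ {x} {y} {z} w x≤y y<z = equivalent go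
  where
  go : ∀ j a → act j (x ∷ z ∷ y ∷ w) a ≡ act j (z ∷ x ∷ y ∷ w) a
  go j a with x ≟ j ×-dec z ≟ suc j
  ... | no h = commute _ (≤-<-trans x≤y y<z) h
  ... | yes (refl , refl) with refl ← ≤-antisym x≤y (s≤s⁻¹ y<z) =
    trans (act₁-up j _) (trans (cong suc (trans (act₁-down j _) (cong pred (act₁-up j _))))
          (sym (trans (act₁-down j _) (trans (cong pred (act₁-up j _)) (act₁-up j _)))))

Decreasing : List ℕ → Set
Decreasing = AllPairs _>_

-- Every exchange is a `knuth₂` whose middle letter y is the next letter of the column, and c at the
-- end.
pass-column : ∀ {d c} Z w → Decreasing Z → All (c <_) Z → d ≤ c → d ∷ Z ++ c ∷ w ∼ Z ++ d ∷ c ∷ w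
pass-column []          w _                _         d≤c = ∼-refl
pass-column (z ∷ [])    w _                (c<z ∷ _) d≤c = knuth₂ w d≤c c<z
pass-column (z ∷ y ∷ Z) w ((z>y ∷ _) ∷ is) (_ ∷ c<@(c<y ∷ _)) d≤c =
  ∼-trans (knuth₂ (Z ++ _ ∷ w) (≤-trans d≤c (<⇒≤ c<y)) z>y) (∼-++ˡ (z ∷ []) (pass-column (y ∷ Z) w is c< d≤c))

pass-letter : ∀ {c z} X w → Decreasing (c ∷ X) → c ≤ z → c ∷ z ∷ X ++ w ∼ c ∷ X ++ z ∷ w
pass-letter []      w _                  c≤z = ∼-refl
pass-letter (x ∷ X) w ((c>x ∷ _) ∷ is) c≤z =
  ∼-trans (knuth₁ (X ++ w) c>x c≤z) (∼-++ˡ (_ ∷ []) (pass-letter X w is (≤-trans (<⇒≤ c>x) c≤z)))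

pass-row : ∀ {c} r X w → AllPairs _≤_ (c ∷ r) → Decreasing (c ∷ X) → c ∷ r ++ X ++ w ∼ c ∷ X ++ r ++ w
pass-row         []      X w _                 _          = ∼-refl
pass-row {c} (z ∷ r) X w ((c≤z ∷ _) ∷ is) d@(c>X ∷ ds) =
  ∼-trans (∼-++ˡ (c ∷ []) (pass-row r X w is (All.map (λ x<c → <-≤-trans x<c c≤z) c>X ∷ ds)))
          (pass-letter X (r ++ w) d c≤z)

reverse-∷ : ∀ {A : Set} (x : A) xs w → reverse (x ∷ xs) ++ w ≡ reverse xs ++ x ∷ w
reverse-∷ x xs w = trans (cong (_++ w) (List.unfold-reverse x xs)) (List.++-assoc (reverse xs) (x ∷ []) w)

reverse-all : ∀ {A : Set} {p} {P : Pred A p} {xs} → All P xs → All P (reverse xs)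
reverse-all {xs = xs} = Perm.All-resp-↭ (↭-sym (Perm.↭-reverse xs))

reverse-decreasing : ∀ {xs} → Increasing xs → Decreasing (reverse xs)
reverse-decreasing []                    = []
reverse-decreasing {x ∷ xs} (x< ∷ is) rewrite List.unfold-reverse x xs =
  AllPairs.++⁺ (reverse-decreasing is) ([] ∷ []) (All.map (_∷ []) (reverse-all x<))

-- The row word of the tableau with the columns C and D, followed by w. It is the common
-- intermediate of two column words in `insert-∼`.
rowWord₂ : List ℕ → List ℕ → List ℕ → List ℕ
rowWord₂ []      D       w = w
rowWord₂ (c ∷ C) []      w = reverse (c ∷ C) ++ w
rowWord₂ (c ∷ C) (d ∷ D) w = rowWord₂ C D (c ∷ d ∷ w)

-- X is the part of the first column above C, collected from the rows already taken apart.
rowWord₂-∼ : ∀ {C D} X w → Increasing C → C ⊴ D → Decreasing X → All (λ x → All (x <_) C) X →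
             rowWord₂ C D (X ++ w) ∼ reverse C ++ X ++ reverse D ++ w
rowWord₂-∼ {[]}    {[]}    X w _         _       _  _  = ∼-refl
rowWord₂-∼ {c ∷ C} {[]}    X w _         _       _  _  = ∼-refl
rowWord₂-∼ {c ∷ C} {d ∷ D} X w (c< ∷ is) (c≤d ∷ o) ds X< = begin
  rowWord₂ C D (c ∷ d ∷ X ++ w)                ∼⟨ congruent C D (pass-letter X w c>X c≤d) ⟩
  rowWord₂ C D (c ∷ X ++ d ∷ w)                ∼⟨ rowWord₂-∼ (c ∷ X) (d ∷ w) is o c>X (c< ∷ All.map All.tail X<) ⟩
  reverse C ++ c ∷ X ++ reverse D ++ d ∷ w     ≡⟨ cong (λ z → reverse C ++ c ∷ X ++ z) (sym (reverse-∷ d D w)) ⟩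
  reverse C ++ c ∷ X ++ reverse (d ∷ D) ++ w   ≡⟨ sym (reverse-∷ c C _) ⟩
  reverse (c ∷ C) ++ X ++ reverse (d ∷ D) ++ w ∎
  where
  open ∼-Reasoning
  c>X : Decreasing (c ∷ X)
  c>X = All.map All.head X< ∷ ds
  congruent : ∀ C D {u v} → u ∼ v → rowWord₂ C D u ∼ rowWord₂ C D v
  congruent []      D       p = p
  congruent (c ∷ C) []      p = ∼-++ˡ (reverse (c ∷ C)) p
  congruent (c ∷ C) (d ∷ D) p = congruent C D (∼-++ˡ (c ∷ d ∷ []) p)

insert-∼ : ∀ {D C C′ D′} → Increasing D → Increasing C → Insert D C C′ D′ → ∀ w →
           reverse D ++ reverse C ++ w ∼ reverse C′ ++ reverse D′ ++ w
insert-∼ _         _         none w = ∼-refl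
insert-∼ _         _         new  w = ∼-refl
insert-∼ {d ∷ D} {c ∷ C} {_ ∷ C′} {_ ∷ D′} (_ ∷ ds) (c< ∷ cs) (bump d≤c i) w = begin
  reverse (d ∷ D) ++ reverse (c ∷ C) ++ w     ≡⟨ cong (reverse (d ∷ D) ++_) (reverse-∷ c C w) ⟩
  reverse (d ∷ D) ++ reverse C ++ c ∷ w       ≡⟨ reverse-∷ d D _ ⟩
  reverse D ++ d ∷ reverse C ++ c ∷ w
    ∼⟨ ∼-++ˡ (reverse D) (pass-column (reverse C) w (reverse-decreasing cs) (reverse-all c<) d≤c) ⟩
  reverse D ++ reverse C ++ d ∷ c ∷ w         ∼⟨ insert-∼ ds cs i (d ∷ c ∷ w) ⟩
  reverse C′ ++ reverse D′ ++ d ∷ c ∷ w       ∼⟨ ∼-++ˡ (reverse C′) (∼-sym (pass-column (reverse D′) w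
                                                   (reverse-decreasing (bumped-increasing i cs))
                                                     (reverse-all (bumped-all i c<)) d≤c)) ⟩
  reverse C′ ++ d ∷ reverse D′ ++ c ∷ w       ≡⟨ sym (reverse-∷ d C′ _) ⟩
  reverse (d ∷ C′) ++ reverse D′ ++ c ∷ w     ≡⟨ cong (reverse (d ∷ C′) ++_) (sym (reverse-∷ c D′ w)) ⟩
  reverse (d ∷ C′) ++ reverse (c ∷ D′) ++ w   ∎
  where open ∼-Reasoning
insert-∼ {D} {c ∷ C} {_ ∷ C′} {D′} ds@(d< ∷ _) (c< ∷ cs) (skip c<d i) w = begin
  reverse D ++ reverse (c ∷ C) ++ w           ≡⟨ cong (reverse D ++_) (reverse-∷ c C w) ⟩
  reverse D ++ reverse C ++ c ∷ w             ∼⟨ insert-∼ ds cs i (c ∷ w) ⟩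
  -- The letter c is smaller than all of `C′`. It gets from behind `D′` to its front by way of the
  -- row word of `C′` and `D′`, to which c belongs first as part of what follows and then as the top
  -- of the first column.
  reverse C′ ++ reverse D′ ++ c ∷ w           ∼⟨ ∼-sym (rowWord₂-∼ [] (c ∷ w) is (insert-⊴-bumped cs i) [] []) ⟩
  rowWord₂ C′ D′ (c ∷ w)
    ∼⟨ rowWord₂-∼ (c ∷ []) w is (insert-⊴-bumped cs i) ([] ∷ []) (c<C′ ∷ []) ⟩
  reverse C′ ++ c ∷ reverse D′ ++ w           ≡⟨ sym (reverse-∷ c C′ _) ⟩
  reverse (c ∷ C′) ++ reverse D′ ++ w         ∎
  where
  open ∼-Reasoning
  is = insert-increasing i ds cs
  c<C′ = insert-all i (c<d ∷ All.map (<-trans c<d) d<) c<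

columnWord : List (List ℕ) → List ℕ
columnWord = concatMap reverse

insertAll-∼ : ∀ {D T T′} → Increasing D → Columns T → InsertAll D T T′ → reverse D ++ columnWord T ∼ columnWord T′
insertAll-∼ ds []                last = ∼-refl
insertAll-∼ {D} {C ∷ T} {C′ ∷ T′} ds (line is _ t) (next {D′ = D′} i r) = begin
  reverse D ++ reverse C ++ columnWord T       ∼⟨ insert-∼ ds is i (columnWord T) ⟩
  reverse C′ ++ reverse D′ ++ columnWord T     ∼⟨ ∼-++ˡ (reverse C′) (insertAll-∼ (bumped-increasing i is) t r) ⟩
  reverse C′ ++ columnWord T′                  ∎
  where open ∼-Reasoning

-- The dual RSK correspondence

-- The columns D are listed last first; the k-th of them to be inserted is recorded by letters k.
data RSK : List (List ℕ) → List (List ℕ) → List (List ℕ) → Set where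
  []   : RSK [] [] []
  step : ∀ {D Ds P P′ T T′} → RSK Ds P T → InsertAll D T T′ → Extend (suc (length Ds)) P P′ →
         map length P′ ≡ map length T′ → RSK (D ∷ Ds) P′ T′

record Recording (e : ℕ) (P : List (List ℕ)) : Set where
  constructor recording
  field
    rows     : Rows P
    height   : length P ≡ e
    positive : All (All (1 ≤_)) P
    bounded  : All (All (_≤ e)) P

record Paired (e : ℕ) (P T : List (List ℕ)) : Set where
  constructor paired
  field
    isRecording : Recording e P
    columns     : Columns T
    lengths     : map length P ≡ map length T

all-≤⇒< : ∀ {e} {P : List (List ℕ)} → All (All (_≤ e)) P → All (All (_< suc e)) P
all-≤⇒< = All.map (All.map s≤s)

rsk : ∀ Ds → All Increasing Ds → ∃₂ λ P T → RSK Ds P T × Paired (length Ds) P T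
rsk []       []        = [] , [] , [] , paired (recording [] refl [] []) [] refl
rsk (D ∷ Ds) (ds ∷ dss)
  with P , T , r , paired (recording rs h p b) t eq ← rsk Ds dss
  with T′ , i ← insertAll D T
  with l ← subst (λ cs → Interlace cs (map length T′)) (sym eq) (insertAll-interlace t i)
  with P′ , x , eq′ ← extend (suc (length Ds)) P l =
  P′ , T′ , step r i x eq′ , paired
    (recording (extend-rows rs (all-≤⇒< b) x (subst (Interlace _) (sym eq′) l))
               (trans (extend-length x) (cong suc h))
               (extend-all (s≤s z≤n) p x)
               (extend-≤ (all-≤⇒< b) x))
    (insertAll-columns ds t i) eq′

RSK-deterministic : ∀ {Ds P P₁ T T₁} → RSK Ds P T → RSK Ds P₁ T₁ → P ≡ P₁ × T ≡ T₁
RSK-deterministic []              []              = refl , refl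
RSK-deterministic (step r i x eq) (step s j y eq′)
  with refl , refl ← RSK-deterministic r s
  with refl ← insertAll-deterministic i j = extend-deterministic x y (trans eq (sym eq′)) , refl

RSK-paired : ∀ {Ds P T} → All Increasing Ds → RSK Ds P T → Paired (length Ds) P T
RSK-paired {Ds} dss r with P , T , s , p ← rsk Ds dss with refl , refl ← RSK-deterministic r s = p

RSK-injective : ∀ {Ds Ds₁ P T} → All Increasing Ds → All Increasing Ds₁ → length Ds ≡ length Ds₁ →
                RSK Ds P T → RSK Ds₁ P T → Ds ≡ Ds₁
RSK-injective {[]}     {[]}     _          _          _ _ _ = refl
RSK-injective {D ∷ Ds} {D₁ ∷ Ds₁} (_ ∷ dss) (_ ∷ dss₁) eq (step r i x e) (step s j y e₁)
  with l ← suc-injective eq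
  with paired (recording _ _ _ b) t lens ← RSK-paired dss r | paired (recording _ _ _ b₁) t₁ lens₁ ← RSK-paired dss₁ s
  with refl ← extend-injective (all-≤⇒< b) (all-≤⇒< (subst (λ n → All (All (_≤ n)) _) (sym l) b₁)) x (subst (λ n → Extend (suc n) _ _) (sym l) y)
  with refl , refl ← insertAll-injective t t₁ i j (trans (sym lens) lens₁) =
  cong (D ∷_) (RSK-injective dss dss₁ l r s)

all-first : ∀ {p} {Q : Pred ℕ p} {P} → All (All Q) P → All Q (firstLine P)
all-first []      = []
all-first (q ∷ _) = q

-- The largest label marks the boxes added by the last insertion. Without them P shows the column
-- lengths before it, and these allow the insertion to be undone.
unrsk : ∀ e {P T} → Paired e P T → ∃ λ Ds → RSK Ds P T × All Increasing Ds × length Ds ≡ e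
unrsk zero    {[]} {[]} _ = [] , [] , [] , refl
unrsk (suc e) {P′} {T′} (paired (recording rs h p b) t eq)
  with P , x , rs′ , b′ , l ← unextend e 1 rs h refl (all-first p) b
  with D , T , i , ds , t′ , eq′ ← uninsertAll t (subst (Interlace (map length P)) eq l)
  with Ds , r , dss , refl ← unrsk e (paired (recording rs′ (suc-injective (trans (sym (extend-length x)) h)) (unextend-all p x) (All.map (All.map s≤s⁻¹) b′)) t′ (sym eq′)) =
  D ∷ Ds , step r i x eq , ds ∷ dss , refl

RSK-letters : ∀ {Ds P T} → RSK Ds P T → concat T ↭ concat Ds
RSK-letters []             = ↭-refl
RSK-letters (step {D} r i _ _) = ↭-trans (insertAll-↭ i) (Perm.++⁺ˡ D (RSK-letters r))

labels : List (List ℕ) → List ℕ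
labels []       = []
labels (D ∷ Ds) = labels Ds ++ replicate (length D) (suc (length Ds))

length-concat : ∀ (P : List (List ℕ)) → length (concat P) ≡ sum (map length P)
length-concat []      = refl
length-concat (r ∷ P) = trans (List.length-++ r) (cong (length r +_) (length-concat P))

length-labels : ∀ Ds → length (labels Ds) ≡ length (concat Ds)
length-labels []       = refl
length-labels (D ∷ Ds) = begin
  length (labels Ds ++ replicate (length D) e)            ≡⟨ length-++-replicate (labels Ds) (length D) ⟩
  length (labels Ds) + length D                           ≡⟨ cong (_+ length D) (length-labels Ds) ⟩
  length (concat Ds) + length D                           ≡⟨ +-comm (length (concat Ds)) (length D) ⟩
  length D + length (concat Ds)                           ≡⟨ List.length-++ D ⟨
  length (D ++ concat Ds)                                 ∎
  where
  open ≡-Reasoning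
  e = suc (length Ds)

RSK-labels : ∀ {Ds P T} → RSK Ds P T → concat P ↭ labels Ds
RSK-labels []                                    = ↭-refl
RSK-labels (step {D} {Ds} {P} {P′} {T} {T′} r i x eq) with k , q ← extend-↭ x =
  ↭-trans q (↭-trans (Perm.++⁺ʳ _ (RSK-labels r)) (↭-reflexive (cong (λ k → labels Ds ++ replicate k e) k≡)))
  where
  open ≡-Reasoning
  e = suc (length Ds)
  -- `Extend` leaves the number of new labels open. It follows from the sizes: P′ is as large as T′,
  -- which has gained the letters of D.
  k≡ : k ≡ length D
  k≡ = +-cancelˡ-≡ (length (labels Ds)) k (length D) (begin
    length (labels Ds) + k                        ≡⟨ cong (_+ k) (Perm.↭-length (RSK-labels r)) ⟨
    length (concat P) + k                         ≡⟨ length-++-replicate (concat P) k ⟨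
    length (concat P ++ replicate k e)            ≡⟨ Perm.↭-length q ⟨
    length (concat P′)                            ≡⟨ length-concat P′ ⟩
    sum (map length P′)                           ≡⟨ cong sum eq ⟩
    sum (map length T′)                           ≡⟨ length-concat T′ ⟨
    length (concat T′)                            ≡⟨ Perm.↭-length (RSK-letters (step r i x eq)) ⟩
    length (concat (D ∷ Ds))                      ≡⟨ length-labels (D ∷ Ds) ⟨
    length (labels (D ∷ Ds))                      ≡⟨ length-++-replicate (labels Ds) (length D) ⟩
    length (labels Ds) + length D                 ∎)

RSK-∼ : ∀ {Ds P T} → All Increasing Ds → RSK Ds P T → columnWord Ds ∼ columnWord T
RSK-∼ _          []              = ∼-refl
RSK-∼ (ds ∷ dss) (step {D} r i _ _) =
  ∼-trans (∼-++ˡ (reverse D) (RSK-∼ dss r)) (insertAll-∼ ds (Paired.columns (RSK-paired dss r)) i)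

-- Transposes and conjugate partitions

heads : List (List ℕ) → List ℕ
heads []            = []
heads ([] ∷ X)      = []
heads ((x ∷ _) ∷ X) = x ∷ heads X

tails : List (List ℕ) → List (List ℕ)
tails []            = []
tails ([] ∷ X)      = []
tails ((_ ∷ r) ∷ X) = r ∷ tails X

-- The number of lines to be produced is prescribed. If it exceeds the width of the array, the last
-- lines are empty, like the last columns made by `InsertAll`.
transpose : ℕ → List (List ℕ) → List (List ℕ)
transpose zero    X = []
transpose (suc k) X = heads X ∷ transpose k (tails X)

length-transpose : ∀ k X → length (transpose k X) ≡ k
length-transpose zero    X = refl
length-transpose (suc k) X = cong suc (length-transpose k (tails X))

heads-transpose : ∀ k r X → length r ≤ k → heads (transpose k (r ∷ X)) ≡ r
heads-transpose zero    []      X _       = refl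
heads-transpose (suc k) []      X _       = refl
heads-transpose (suc k) (x ∷ r) X (s≤s h) = cong (x ∷_) (heads-transpose k r (tails X) h)

tails-transpose : ∀ k r X → length r ≤ k → tails (transpose k (r ∷ X)) ≡ transpose (length r) X
tails-transpose zero    []      X _       = refl
tails-transpose (suc k) []      X _       = refl
tails-transpose (suc k) (x ∷ r) X (s≤s h) = cong (heads X ∷_) (tails-transpose k r (tails X) h)

module _ {R S : ℕ → ℕ → Set} where

  transpose-involutive : ∀ k {X} → Array R S X → length (firstLine X) ≤ k → transpose (length X) (transpose k X) ≡ X
  transpose-involutive k []                       h = refl
  transpose-involutive k (line {C = r} {X} _ o a) h =
    cong₂ _∷_ (heads-transpose k r X h)
      (trans (cong (transpose (length X)) (tails-transpose k r X h)) (transpose-involutive (length r) a (over-length o)))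

  over-tail : ∀ {x r} X → Over S (x ∷ r) (firstLine X) → Over S r (firstLine (tails X))
  over-tail []            o       = []
  over-tail ([] ∷ X)      o       = []
  over-tail ((_ ∷ _) ∷ X) (_ ∷ o) = o

  tails-array : ∀ {X} → Array R S X → Array R S (tails X)
  tails-array []                                        = []
  tails-array (line {[]}    _        _ a)               = []
  tails-array (line {_ ∷ _} {X} (_ ∷ is) o a)           = line is (over-tail X o) (tails-array a)

  heads-over : ∀ {X} → Array R S X → Over R (heads X) (heads (tails X))
  heads-over []                                         = []
  heads-over (line {[]}        _             _ a)       = []
  heads-over (line {_ ∷ []}    _             _ a)       = []
  heads-over (line {_ ∷ _ ∷ _} ((r ∷ _) ∷ _) _ a)       = r ∷ heads-over a

  module _ (S-trans : ∀ {x y z} → S x y → S y z → S x z) where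

    heads-related : ∀ {X} → Array R S X → AllPairs S (heads X)
    heads-related []                    = []
    heads-related (line {[]}    _ _ _)  = []
    heads-related (line {x ∷ _} _ o a)  = below o a ∷ heads-related a
      where
      below : ∀ {x r X} → Over S (x ∷ r) (firstLine X) → Array R S X → All (S x) (heads X)
      below {X = []}          _       _            = []
      below {X = [] ∷ X}      _       _            = []
      below {X = (_ ∷ _) ∷ X} (s ∷ _) (line _ o a) = s ∷ All.map (S-trans s) (below o a)

    transpose-array : ∀ k {X} → Array R S X → Array S R (transpose k X)
    transpose-array zero    a = []
    transpose-array (suc k) a =
      line (heads-related a) (over-first k (heads-over a)) (transpose-array k (tails-array a))
      where
      over-first : ∀ k {C X} → Over R C (heads X) → Over R C (firstLine (transpose k X))
      over-first zero    o = []
      over-first (suc k) o = o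

  empty-first : ∀ {X} → Array R S X → length (firstLine X) ≤ 0 → concat X ≡ []
  empty-first                 []             _ = refl
  empty-first {X = [] ∷ X}    (line _ o a)   h = empty-first a (over-length o)

  first-tails : ∀ {k} X → length (firstLine X) ≤ suc k → length (firstLine (tails X)) ≤ k
  first-tails []            h       = z≤n
  first-tails ([] ∷ X)      h       = z≤n
  first-tails ((_ ∷ _) ∷ X) (s≤s h) = h

  heads-tails-↭ : ∀ {X} → Array R S X → concat X ↭ heads X ++ concat (tails X)
  heads-tails-↭ []                             = ↭-refl
  heads-tails-↭ (line {[]} {X} _ o a)          = ↭-reflexive (empty-first a (over-length o))
  heads-tails-↭ (line {x ∷ r} {X} _ o a)       = prep x (begin
    r ++ concat X                        ↭⟨ Perm.++⁺ˡ r (heads-tails-↭ a) ⟩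
    r ++ heads X ++ concat (tails X)     ↭⟨ Perm.shifts r (heads X) ⟩
    heads X ++ r ++ concat (tails X)     ∎)
    where open Perm.PermutationReasoning

  transpose-↭ : ∀ k {X} → Array R S X → length (firstLine X) ≤ k → concat X ↭ concat (transpose k X)
  transpose-↭ zero    a h = ↭-reflexive (empty-first a h)
  transpose-↭ (suc k) {X} a h =
    ↭-trans (heads-tails-↭ a) (Perm.++⁺ˡ (heads X) (transpose-↭ k (tails-array a) (first-tails X h)))

rowWord : List (List ℕ) → List ℕ
rowWord []      = []
rowWord (r ∷ X) = rowWord X ++ r

rowWord-↭ : ∀ X → rowWord X ↭ concat X
rowWord-↭ []      = ↭-refl
rowWord-↭ (r ∷ X) = ↭-trans (Perm.++-comm (rowWord X) r) (Perm.++⁺ˡ r (rowWord-↭ X))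

rowWord-empty : ∀ X → concat X ≡ [] → rowWord X ≡ []
rowWord-empty X e = Perm.↭-empty-inv (↭-trans (rowWord-↭ X) (↭-reflexive e))

-- The rows are taken from the top, and Z is the part of the first column collected so far;
-- `pass-row` moves it past the rest of the next row.
rowWord-column : ∀ {X} Z w → Rows X → Decreasing Z → All (λ z → All (z <_) (heads X)) Z →
                 rowWord X ++ Z ++ w ∼ reverse (heads X) ++ Z ++ rowWord (tails X) ++ w
rowWord-column Z w []                             _  _  = ∼-refl
rowWord-column Z w (line {[]} {X} _ o a)          _  _  =
  ∼-reflexive
    (cong (_++ Z ++ w) (trans (List.++-identityʳ (rowWord X)) (rowWord-empty X (empty-first a (over-length o)))))
rowWord-column Z w (line {x ∷ r} {X} is o a)      ds Z< = begin
  (rowWord X ++ x ∷ r) ++ Z ++ w                     ≡⟨ List.++-assoc (rowWord X) (x ∷ r) _ ⟩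
  rowWord X ++ x ∷ r ++ Z ++ w                       ∼⟨ ∼-++ˡ (rowWord X) (pass-row r Z w is x>Z) ⟩
  rowWord X ++ x ∷ Z ++ r ++ w
    ∼⟨ rowWord-column (x ∷ Z) (r ++ w) a x>Z (x< ∷ All.map All.tail Z<) ⟩
  reverse (heads X) ++ x ∷ Z ++ rowWord (tails X) ++ r ++ w
    ≡⟨ cong (λ u → reverse (heads X) ++ x ∷ Z ++ u) (sym (List.++-assoc (rowWord (tails X)) r w)) ⟩
  reverse (heads X) ++ x ∷ Z ++ rowWord (r ∷ tails X) ++ w ≡⟨ sym (reverse-∷ x (heads X) _) ⟩
  reverse (x ∷ heads X) ++ Z ++ rowWord (r ∷ tails X) ++ w ∎
  where
  open ∼-Reasoning
  x>Z : Decreasing (x ∷ Z)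
  x>Z = All.map All.head Z< ∷ ds
  x< : All (x <_) (heads X)
  x< with h ∷ _ ← heads-related <-trans (line is o a) = h

rowWord-∼ : ∀ k {X} → Rows X → length (firstLine X) ≤ k → rowWord X ∼ columnWord (transpose k X)
rowWord-∼ zero    {X} a h = ∼-reflexive (rowWord-empty X (empty-first a h))
rowWord-∼ (suc k) {X} a h = begin
  rowWord X                                          ≡⟨ sym (List.++-identityʳ (rowWord X)) ⟩
  rowWord X ++ []                                    ∼⟨ rowWord-column [] [] a [] [] ⟩
  reverse (heads X) ++ rowWord (tails X) ++ []       ≡⟨ cong (reverse (heads X) ++_) (List.++-identityʳ _) ⟩
  reverse (heads X) ++ rowWord (tails X)
    ∼⟨ ∼-++ˡ (reverse (heads X)) (rowWord-∼ k (tails-array a) (first-tails {R = _≤_} {_<_} X h)) ⟩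
  reverse (heads X) ++ columnWord (transpose k (tails X)) ∎
  where open ∼-Reasoning

-- Conjugate partitions, one column at a time

atLeast : ℕ → List ℕ → ℕ
atLeast j ρ = length (filter (j ≤?_) ρ)

largest : List ℕ → ℕ
largest = foldr _⊔_ 0

atLeast-pred : ∀ j ρ → atLeast (suc (suc j)) ρ ≡ atLeast (suc j) (map pred ρ)
atLeast-pred j []          = refl
atLeast-pred j (zero ∷ ρ)  = atLeast-pred j ρ
atLeast-pred j (suc x ∷ ρ) with j <ᵇ x
... | true  = cong suc (atLeast-pred j ρ)
... | false = atLeast-pred j ρ

-- The conjugate partition in the form that suits the induction over standard subwords: `pred` on
-- all parts removes the first column.
columnLengths : ℕ → List ℕ → List ℕ
columnLengths zero    ρ = []
columnLengths (suc k) ρ = atLeast 1 ρ ∷ columnLengths k (map pred ρ)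

columnLengths-interval : ∀ k ρ → map (λ j → atLeast j ρ) (interval 0 k) ≡ columnLengths k ρ
columnLengths-interval zero    ρ = refl
columnLengths-interval (suc k) ρ = cong (atLeast 1 ρ ∷_) (begin
  map (λ j → atLeast j ρ) (map suc (applyUpTo suc k))
    ≡⟨ cong (map (λ j → atLeast j ρ) ∘ map suc) (List.map-applyUpTo id suc k) ⟨
  map (λ j → atLeast j ρ) (map suc (map suc (upTo k)))             ≡⟨ List.map-∘ (map suc (upTo k)) ⟨
  map (λ j → atLeast (suc j) ρ) (map suc (upTo k))                 ≡⟨ List.map-∘ (upTo k) ⟨
  map (λ i → atLeast (suc (suc i)) ρ) (upTo k)
    ≡⟨ List.map-cong (λ i → atLeast-pred i ρ) (upTo k) ⟩
  map (λ i → atLeast (suc i) (map pred ρ)) (upTo k)                ≡⟨ List.map-∘ (upTo k) ⟩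
  map (λ j → atLeast j (map pred ρ)) (interval 0 k)                ≡⟨ columnLengths-interval k (map pred ρ) ⟩
  columnLengths k (map pred ρ)                                     ∎)
  where open ≡-Reasoning

conjugate-columnLengths : ∀ ρ → conjugate ρ ≡ columnLengths (largest ρ) ρ
conjugate-columnLengths ρ = columnLengths-interval (largest ρ) ρ

columnLengths-cong : ∀ k {ρ σ} → (∀ j → atLeast (suc j) ρ ≡ atLeast (suc j) σ) → columnLengths k ρ ≡ columnLengths k σ
columnLengths-cong zero    h = refl
columnLengths-cong (suc k) {ρ} {σ} h =
  cong₂ _∷_ (h 0) (columnLengths-cong k (λ j → trans (sym (atLeast-pred j ρ)) (trans (h (suc j)) (atLeast-pred j σ))))

module _ {R S : ℕ → ℕ → Set} where

  atLeast-none : ∀ {X} j → Array R S X → length (firstLine X) ≤ 0 → atLeast (suc j) (map length X) ≡ 0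
  atLeast-none {[]}     j []           h = refl
  atLeast-none {[] ∷ X} j (line _ o a) h = atLeast-none j a (over-length o)

  atLeast-heads : ∀ {X} → Array R S X → atLeast 1 (map length X) ≡ length (heads X)
  atLeast-heads []                     = refl
  atLeast-heads (line {[]}    _ o a)   = atLeast-none 0 a (over-length o)
  atLeast-heads (line {_ ∷ _} _ _ a)   = cong suc (atLeast-heads a)

  atLeast-tails : ∀ {X} j → Array R S X →
    atLeast (suc j) (map pred (map length X)) ≡ atLeast (suc j) (map length (tails X))
  atLeast-tails j []                   = refl
  atLeast-tails j (line {[]} {X} _ o a) =
    trans (sym (atLeast-pred j (map length X))) (atLeast-none (suc j) a (over-length o))
  atLeast-tails j (line {_ ∷ r} _ _ a) with j <ᵇ length r
  ... | true  = cong suc (atLeast-tails j a)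
  ... | false = atLeast-tails j a

  columnLengths-transpose : ∀ k {X} → Array R S X → columnLengths k (map length X) ≡ map length (transpose k X)
  columnLengths-transpose zero    a = refl
  columnLengths-transpose (suc k) {X} a = cong₂ _∷_ (atLeast-heads a)
    (trans (columnLengths-cong k (λ j → atLeast-tails j a)) (columnLengths-transpose k (tails-array a)))

  largest-lengths : ∀ {X} → Array R S X → largest (map length X) ≡ length (firstLine X)
  largest-lengths []               = refl
  largest-lengths (line {C} {X} _ o a) = m≥n⇒m⊔n≡m (≤-trans (≤-reflexive (largest-lengths a)) (over-length o))

  conjugate-lengths : ∀ {X} → Array R S X → conjugate (map length X) ≡ map length (transpose (length (firstLine X)) X)
  conjugate-lengths {X} a = trans (conjugate-columnLengths (map length X))
    (trans (cong (λ k → columnLengths k (map length X)) (largest-lengths a)) (columnLengths-transpose (length (firstLine X)) a))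

-- Standard subwords and charge

-- The third list is a shuffle of the first two.
data Split {A : Set} : List A → List A → List A → Set where
  []    : Split [] [] []
  left  : ∀ {x xs ys zs} → Split xs ys zs → Split (x ∷ xs) ys (x ∷ zs)
  right : ∀ {y xs ys zs} → Split xs ys zs → Split xs (y ∷ ys) (y ∷ zs)

module _ {A : Set} where

  split-++ : ∀ {xs ys zs xs′ ys′ zs′ : List A} → Split xs ys zs → Split xs′ ys′ zs′ →
             Split (xs ++ xs′) (ys ++ ys′) (zs ++ zs′)
  split-++ []        t = t
  split-++ (left s)  t = left (split-++ s t)
  split-++ (right s) t = right (split-++ s t)

  split-right : ∀ (xs : List A) → Split [] xs xs
  split-right []       = []
  split-right (x ∷ xs) = right (split-right xs)

  split-↭ : ∀ {xs ys zs : List A} → Split xs ys zs → zs ↭ xs ++ ys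
  split-↭ []                                  = ↭-refl
  split-↭ (left s)                            = prep _ (split-↭ s)
  split-↭ (right {y} {xs} {ys} s)             = ↭-trans (prep y (split-↭ s)) (↭-sym (Perm.shift y xs ys))

Marks : Set
Marks = List (ℕ × ℕ)

positions letters : Marks → List ℕ
positions = map proj₁
letters   = map proj₂

NoLetter : ℕ → Marks → Set
NoLetter a = All (λ x → proj₂ x ≢ a)

break-at : ∀ {A : Set} {P : A → Set} (P? : Decidable P) S {x R} → All (¬_ ∘ P) S → P x →
           break P? (S ++ x ∷ R) ≡ (S , x ∷ R)
break-at P? []      {x} []       px with P? x
... | yes _  = refl
... | no ¬px = contradiction px ¬px
break-at P? (y ∷ S) {x} {R} (¬py ∷ h) px with P? y | break-at P? S {R = R} h px
... | yes py | _ = contradiction py ¬py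
... | no _   | e rewrite e = refl

mark-at : ∀ {a as} S {p R} → NoLetter a S → mark (a ∷ as) (S ++ (p , a) ∷ R) ≡ p ∷ mark as (R ++ S)
mark-at {a} {as} S {p} {R} h rewrite break-at (λ x → proj₂ x ≟ a) S {p , a} {R} h refl = refl

indices : List ℕ → Marks
indices u = zip (upTo (length u)) u

positions-indices : ∀ u → positions (indices u) ≡ upTo (length u)
positions-indices u = go (upTo (length u)) u (List.length-applyUpTo id (length u))
  where
  go : ∀ ps u → length ps ≡ length u → positions (zip ps u) ≡ ps
  go []       []      e = refl
  go (p ∷ ps) (x ∷ u) e = cong (p ∷_) (go ps u (suc-injective e))

letters-indices : ∀ u → letters (indices u) ≡ u
letters-indices u = go (upTo (length u)) u (List.length-applyUpTo id (length u))
  where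
  go : ∀ ps u → length ps ≡ length u → letters (zip ps u) ≡ u
  go []       []      e = refl
  go (p ∷ ps) (x ∷ u) e = cong (x ∷_) (go ps u (suc-injective e))

filter-split : ∀ {A : Set} {P : A → Set} (P? : Decidable P) {xs ys zs} → Split xs ys zs → All P xs → All (¬_ ∘ P) ys →
               filter P? zs ≡ xs × filter (¬? ∘ P?) zs ≡ ys
filter-split P? []        _        _        = refl , refl
filter-split P? (left {x} s)  (p ∷ ps) ns   with e , f ← filter-split P? s ps ns =
  trans (List.filter-accept P? p) (cong (_ ∷_) e) , trans (List.filter-reject (¬? ∘ P?) (λ ¬p → ¬p p)) f
filter-split P? (right s) ps       (n ∷ ns) with e , f ← filter-split P? s ps ns =
  trans (List.filter-reject P? n) e , trans (List.filter-accept (¬? ∘ P?) n) (cong (_ ∷_) f)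

unique-↭ : ∀ {A : Set} {xs ys : List A} → xs ↭ ys → AllPairs _≢_ xs → AllPairs _≢_ ys
unique-↭ Perm.refl           u                    = u
unique-↭ (Perm.prep x p)     (h ∷ u)              = Perm.All-resp-↭ p h ∷ unique-↭ p u
unique-↭ (Perm.swap x y p)   ((x≢y ∷ h) ∷ g ∷ u)  =
  (≢-sym x≢y ∷ Perm.All-resp-↭ p g) ∷ Perm.All-resp-↭ p h ∷ unique-↭ p u
unique-↭ (Perm.trans p q)    u                    = unique-↭ q (unique-↭ p u)

-- Positions are distinct, so the set of marked positions alone determines the subword; the order of
-- marking need only be known up to permutation.
extract-split : ∀ {m u sel rest} → Split sel rest (indices u) →
  mark (interval 0 m) (reverse (indices u)) ↭ positions sel →
                extract m u ≡ (letters sel , letters rest)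
extract-split {m} {u} {sel} {rest} s marked↭ =
  cong₂ (λ xs ys → letters xs , letters ys) (proj₁ filters) (proj₂ filters)
  where
  marked = mark (interval 0 m) (reverse (indices u))
  selected : All (λ x → proj₁ x ∈ marked) sel
  selected = All.tabulate (λ x∈ → Perm.∈-resp-↭ (↭-sym marked↭) (∈-map⁺ proj₁ x∈))
  distinct : AllPairs _≢_ (positions sel ++ positions rest)
  distinct = unique-↭
    (↭-trans (↭-reflexive (sym (positions-indices u))) (↭-trans (Perm.map⁺ proj₁ (split-↭ s)) (↭-reflexive (List.map-++ proj₁ sel rest))))
    (Unique.upTo⁺ (length u))
  disjoint : ∀ xs {ys : List ℕ} {p} → AllPairs _≢_ (xs ++ ys) → p ∈ xs → p ∉ ys
  disjoint (x ∷ xs) (h ∷ _) (here refl) p∈ = All.lookup (All.++⁻ʳ xs h) p∈ refl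
  disjoint (x ∷ xs) (_ ∷ d) (there q)   p∈ = disjoint xs d q p∈
  remaining : All (λ x → ¬ proj₁ x ∈ marked) rest
  remaining = All.tabulate (λ x∈ p∈ → disjoint (positions sel) distinct (Perm.∈-resp-↭ marked↭ p∈) (∈-map⁺ proj₁ x∈))
  filters = filter-split (λ x → proj₁ x ∈? marked) s selected remaining

-- Indices start at 0, and the default value 0 makes trailing zeros invisible.
part : List ℕ → ℕ → ℕ
part []      i       = 0
part (x ∷ ρ) zero    = x
part (x ∷ ρ) (suc i) = part ρ i

WeaklyDecreasing : List ℕ → Set
WeaklyDecreasing ρ = ∀ i → part ρ (suc i) ≤ part ρ i

part-pred : ∀ ρ i → part (map pred ρ) i ≡ pred (part ρ i)
part-pred []      i       = refl
part-pred (x ∷ ρ) zero    = refl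
part-pred (x ∷ ρ) (suc i) = part-pred ρ i

zeros : ∀ {ρ} → WeaklyDecreasing (0 ∷ ρ) → All (_≡ 0) ρ
zeros {[]}    h = []
zeros {x ∷ ρ} h with refl ← n≤0⇒n≡0 (h 0) = refl ∷ zeros (h ∘ suc)

descendingWord-zeros : ∀ i {ρ} → All (_≡ 0) ρ → descendingWord i ρ ≡ []
descendingWord-zeros i []         = refl
descendingWord-zeros i (refl ∷ z) = trans (List.++-identityʳ _) (descendingWord-zeros (suc i) z)

descendingWord-pred-zeros : ∀ i {ρ} → All (_≡ 0) ρ → descendingWord i (map pred ρ) ≡ []
descendingWord-pred-zeros i []         = refl
descendingWord-pred-zeros i (refl ∷ z) = trans (List.++-identityʳ _) (descendingWord-pred-zeros (suc i) z)

atLeast-zeros : ∀ {ρ} → All (_≡ 0) ρ → atLeast 1 ρ ≡ 0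
atLeast-zeros []         = refl
atLeast-zeros (refl ∷ z) = atLeast-zeros z

up down : ℕ → ℕ → List ℕ
up i zero      = []
up i (suc t)   = i ∷ up (suc i) t
down i zero    = []
down i (suc t) = i + t ∷ down i t

interval-up : ∀ m → interval 0 m ≡ up 1 m
interval-up m = trans (List.map-applyUpTo id suc m) (applyUpTo-up suc 1 m (λ _ → refl))
  where
  applyUpTo-up : ∀ f i n → (∀ k → f k ≡ i + k) → applyUpTo f n ≡ up i n
  applyUpTo-up f i zero    h = refl
  applyUpTo-up f i (suc n) h =
    cong₂ _∷_ (trans (h 0) (+-identityʳ i)) (applyUpTo-up (f ∘ suc) (suc i) n (λ k → trans (h (suc k)) (+-suc i k)))

up-++ : ∀ i t s → up i (t + s) ≡ up i t ++ up (i + t) s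
up-++ i zero    s = cong (λ i → up i s) (sym (+-identityʳ i))
up-++ i (suc t) s = cong (i ∷_) (trans (up-++ (suc i) t s) (cong (λ k → up (suc i) t ++ up k s) (sym (+-suc i t))))

down-snoc : ∀ i t → down i (suc t) ≡ down (suc i) t ++ i ∷ []
down-snoc i zero    = cong (_∷ []) (+-identityʳ i)
down-snoc i (suc t) = cong₂ _∷_ (+-suc i t) (down-snoc i t)

length-down : ∀ i t → length (down i t) ≡ t
length-down i zero    = refl
length-down i (suc t) = cong suc (length-down i t)

map-++⁻ : ∀ {A B : Set} (f : A → B) xs {ys zs} → map f xs ≡ ys ++ zs →
          ∃₂ λ us vs → xs ≡ us ++ vs × map f us ≡ ys × map f vs ≡ zs
map-++⁻ f xs       {[]}     e = [] , xs , refl , refl , e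
map-++⁻ f (x ∷ xs) {y ∷ ys} e with us , vs , refl , g , h ← map-++⁻ f xs (List.∷-injectiveʳ e) =
  x ∷ us , vs , refl , cong₂ _∷_ (List.∷-injectiveˡ e) g , h

replicate-snoc : ∀ k (i : ℕ) → replicate (suc k) i ≡ replicate k i ++ i ∷ []
replicate-snoc zero    i = refl
replicate-snoc (suc k) i = cong (i ∷_) (replicate-snoc k i)

-- J is the part of the suffix with the letters i, i + 1, ...; the scan meets S before it and R
-- after it. Once t letters are marked, the scan goes on with `before`, R and `after`, where
-- `before` and `after` have only letters below i + t.
record MarkedBlocks (i t : ℕ) (μ : List ℕ) (J : Marks) (as : List ℕ) (S R : Marks) : Set where
  constructor markedBlocks
  field
    {sel rest before after} : Marks
    split         : Split sel rest J
    sel-letters   : letters sel ≡ down i t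
    rest-letters  : letters rest ≡ descendingWord i (map pred μ)
    marks         : mark (up i t ++ as) (S ++ reverse J ++ R) ≡
                    positions (reverse sel) ++ mark as (before ++ R ++ after)
    before-small  : All (λ x → proj₂ x < i + t) before
    after-small   : All (λ x → proj₂ x < i + t) after

noBlocks : ∀ {i μ J as S R} → descendingWord i (map pred μ) ≡ [] → letters J ≡ [] → All (λ x → proj₂ x < i) S →
           MarkedBlocks i 0 μ J as S R
noBlocks {i} {J = []} {as} {S} {R} d _ h =
  markedBlocks [] refl (sym d) (cong (λ z → mark as (S ++ z)) (sym (List.++-identityʳ R)))
  (All.map (λ x< → ≤-trans x< (m≤m+n i 0)) h) []

equal-letters : ∀ {i} K k → letters K ≡ replicate k i → All (λ x → proj₂ x < suc i) K
equal-letters []      k       e = []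
equal-letters (x ∷ K) (suc k) e =
  ≤-reflexive (cong suc (List.∷-injectiveˡ e)) ∷ equal-letters K k (List.∷-injectiveʳ e)

markBlocks : ∀ i μ J → WeaklyDecreasing μ → letters J ≡ descendingWord i μ → ∀ as S R →
             All (λ x → proj₂ x < i) S → MarkedBlocks i (atLeast 1 μ) μ J as S R
markBlocks i []            J d e as S R h = noBlocks {μ = []} refl e h
markBlocks i (zero ∷ μ)    J d e as S R h =
  subst (λ t → MarkedBlocks i t (zero ∷ μ) J as S R) (sym (atLeast-zeros (zeros d)))
    (noBlocks {μ = zero ∷ μ} (trans (List.++-identityʳ _) (descendingWord-pred-zeros (suc i) (zeros d)))
              (trans e (trans (List.++-identityʳ _) (descendingWord-zeros (suc i) (zeros d)))) h)
markBlocks i (suc k ∷ μ)   J d e as S R h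
  with J′ , K , refl , e′ , f ← map-++⁻ proj₂ J {descendingWord (suc i) μ} e
  -- The last letter i of its block is the first one scanned, hence marked; the others, `K′`, are
  -- skipped on the way to i + 1.
  with K′ , (p , _) ∷ [] , refl , g , refl ← map-++⁻ proj₂ K {replicate k i} (trans f (replicate-snoc k i))
  with markedBlocks {sel} {rest} {before} {after} s sl rl m b a ←
    markBlocks (suc i) μ J′ (d ∘ suc) e′ as (reverse K′) (R ++ S) (reverse-all (equal-letters K′ k g)) =
  markedBlocks (split-++ s (split-++ (split-right K′) (left []))) sel≡ rest≡ marks≡
    (subst (λ n → All (λ x → proj₂ x < n) before) (sym (+-suc i _)) b)
    (All.++⁺ (All.map (λ x< → <-≤-trans x< (m≤m+n i _)) h) (subst (λ n → All (λ x → proj₂ x < n) after) (sym (+-suc i _)) a))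
  where
  t = atLeast 1 μ
  open ≡-Reasoning
  sel≡ : letters (sel ++ (p , i) ∷ []) ≡ down i (suc t)
  sel≡ = trans (List.map-++ proj₂ sel _) (trans (cong (_++ i ∷ []) sl) (sym (down-snoc i t)))
  rest≡ : letters (rest ++ K′ ++ []) ≡ descendingWord (suc i) (map pred μ) ++ replicate k i
  rest≡ = trans (List.map-++ proj₂ rest _) (cong₂ _++_ rl (trans (cong letters (List.++-identityʳ K′)) g))
  marks≡ : mark (i ∷ up (suc i) t ++ as) (S ++ reverse (J′ ++ K′ ++ (p , i) ∷ []) ++ R) ≡
           positions (reverse (sel ++ (p , i) ∷ [])) ++ mark as (before ++ R ++ S ++ after)
  marks≡ = begin
    mark (i ∷ up (suc i) t ++ as) (S ++ reverse (J′ ++ K′ ++ (p , i) ∷ []) ++ R)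
      ≡⟨ cong (λ z → mark (i ∷ up (suc i) t ++ as) (S ++ z ++ R))
              (trans (List.reverse-++ J′ _) (cong (_++ reverse J′) (List.reverse-++ K′ _))) ⟩
    mark (i ∷ up (suc i) t ++ as) (S ++ (p , i) ∷ (reverse K′ ++ reverse J′) ++ R)
      ≡⟨ mark-at S (All.map <⇒≢ h) ⟩
    p ∷ mark (up (suc i) t ++ as) (((reverse K′ ++ reverse J′) ++ R) ++ S)
      ≡⟨ cong
        (λ z → p ∷ mark (up (suc i) t ++ as) z) (trans (List.++-assoc (reverse K′ ++ reverse J′) R S) (List.++-assoc (reverse K′) (reverse J′) _)) ⟩
    p ∷ mark (up (suc i) t ++ as) (reverse K′ ++ reverse J′ ++ R ++ S)
      ≡⟨ cong (p ∷_) m ⟩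
    p ∷ positions (reverse sel) ++ mark as (before ++ (R ++ S) ++ after)
      ≡⟨ cong₂
        (λ x y → positions x ++ mark as (before ++ y)) (sym (List.reverse-++ sel ((p , i) ∷ []))) (List.++-assoc R S after) ⟩
    positions (reverse (sel ++ (p , i) ∷ [])) ++ mark as (before ++ R ++ S ++ after) ∎

-- The standard subword of w ⋯ 2^μ₂ 1^μ₁ consists of letters σ of w, given by as, and of the letters t, …, 1 of
-- the suffix.
extract-column : ∀ {m as} μ w {σ w′} → WeaklyDecreasing μ → interval 0 m ≡ up 1 (atLeast 1 μ) ++ as →
  (∀ I → letters I ≡ w → ∃₂ λ sel rest → Split sel rest I × letters sel ≡ σ × letters rest ≡ w′ ×
    (∀ {S Z} → All (λ x → proj₂ x < suc (atLeast 1 μ)) S → All (λ x → proj₂ x < suc (atLeast 1 μ)) Z →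
      mark as (S ++ reverse I ++ Z) ↭ positions sel)) →
  extract m (w ++ descendingWord 1 μ) ≡ (σ ++ down 1 (atLeast 1 μ) , w′ ++ descendingWord 1 (map pred μ))
extract-column {m} {as} μ w {σ} {w′} d m≡ choose
  with I , J , eq , eI , eJ ← map-++⁻ proj₂ (indices (w ++ descendingWord 1 μ)) {w} (letters-indices _)
  with selI , restI , sI , eσ , ew , marksI ← choose I eI
  with markedBlocks {sel} {rest} s sl rl marks b a ← markBlocks 1 μ J d eJ as [] (reverse I) [] =
  trans (extract-split {m} (subst (Split _ _) (sym eq) (split-++ sI s)) marked)
        (cong₂ _,_ (trans (List.map-++ proj₂ selI sel) (cong₂ _++_ eσ sl))
                   (trans (List.map-++ proj₂ restI rest) (cong₂ _++_ ew rl)))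
  where
  open Perm.PermutationReasoning
  marked : mark (interval 0 m) (reverse (indices (w ++ descendingWord 1 μ))) ↭ positions (selI ++ sel)
  marked = begin
    mark (interval 0 m) (reverse (indices (w ++ descendingWord 1 μ)))
      ≡⟨ cong₂ mark m≡ (trans (cong reverse eq) (List.reverse-++ I J)) ⟩
    mark (up 1 (atLeast 1 μ) ++ as) (reverse J ++ reverse I)    ≡⟨ marks ⟩
    positions (reverse sel) ++ mark as _
      ↭⟨ Perm.++⁺ (Perm.map⁺ proj₁ (Perm.↭-reverse sel)) (marksI b a) ⟩
    positions sel ++ positions selI                             ↭⟨ Perm.++-comm (positions sel) _ ⟩
    positions selI ++ positions sel                             ≡⟨ List.map-++ proj₁ selI sel ⟨
    positions (selI ++ sel)                                     ∎

-- The letters of a standard subword taken from the word in front of the suffix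

NoOccurrence : ℕ → List ℕ → Set
NoOccurrence a = All (_≢ a)

no-letter : ∀ {a} I {w} → letters I ≡ w → NoOccurrence a w → NoLetter a I
no-letter []      refl []      = []
no-letter (x ∷ I) refl (h ∷ n) = h ∷ no-letter I refl n

small-no-letter : ∀ {t a} {S : Marks} → All (λ x → proj₂ x < suc t) S → t < a → NoLetter a S
small-no-letter h t<a = All.map (λ x≤t → <⇒≢ (≤-<-trans (s≤s⁻¹ x≤t) t<a)) h

scan : ∀ (S A : Marks) x B Z → S ++ reverse (A ++ x ∷ B) ++ Z ≡ (S ++ reverse B) ++ x ∷ reverse A ++ Z
scan S A x B Z = begin
  S ++ reverse (A ++ x ∷ B) ++ Z
    ≡⟨ cong (λ u → S ++ u ++ Z) (trans (List.reverse-++ A (x ∷ B)) (reverse-∷ x B (reverse A))) ⟩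
  S ++ (reverse B ++ x ∷ reverse A) ++ Z       ≡⟨ cong (S ++_) (List.++-assoc (reverse B) (x ∷ reverse A) Z) ⟩
  S ++ reverse B ++ x ∷ reverse A ++ Z         ≡⟨ List.++-assoc S (reverse B) _ ⟨
  (S ++ reverse B) ++ x ∷ reverse A ++ Z       ∎
  where open ≡-Reasoning

-- w ↦ w′ removes the letters t + 1, …, m that the subword takes from w; c is the charge of the subword.
data Removed (t : ℕ) : (m c : ℕ) (σ w w′ : List ℕ) → Set where
  none : ∀ {w} → Removed t t 0 [] w w
  one  : ∀ {X Y} → NoOccurrence (suc t) Y → Removed t (1 + t) 0 (suc t ∷ []) (X ++ suc t ∷ Y) (X ++ Y)
  two  : ∀ {X Y Z} → NoOccurrence (2 + t) Y → NoOccurrence (suc t) Z →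
         Removed t (2 + t) 0 (2 + t ∷ suc t ∷ []) (X ++ 2 + t ∷ Y ++ suc t ∷ Z) (X ++ Y ++ Z)
  wrap : ∀ {X Y Z} → NoOccurrence (2 + t) X → NoOccurrence (suc t) Y → NoOccurrence (suc t) Z →
    NoOccurrence (2 + t) Z →
         Removed t (2 + t) 1 (suc t ∷ 2 + t ∷ []) (X ++ suc t ∷ Y ++ 2 + t ∷ Z) (X ++ Y ++ Z)

interval-split : ∀ t s → interval 0 (s + t) ≡ up 1 t ++ up (suc t) s
interval-split t s = trans (interval-up (s + t)) (trans (cong (up 1) (+-comm s t)) (up-++ 1 t s))

-- In the case `wrap` the scan for t + 2 leaves the word at the left end and crosses the suffix once
-- more; the letters left there are at most t, so it comes back to the right end of the word.
extract-removed : ∀ {m c} μ {σ w w′} → WeaklyDecreasing μ → Removed (atLeast 1 μ) m c σ w w′ →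
  extract m (w ++ descendingWord 1 μ) ≡ (σ ++ down 1 (atLeast 1 μ) , w′ ++ descendingWord 1 (map pred μ))
extract-removed μ {w = w} d none = extract-column μ w d (interval-split _ 0) λ I e →
  [] , I , split-right I , refl , e , λ _ _ → ↭-refl
extract-removed μ d (one {X} {Y} nY) = extract-column μ _ d (interval-split _ 1) choose
  where
  choose : ∀ I → letters I ≡ X ++ suc (atLeast 1 μ) ∷ Y → _
  choose I e with I₁ , x@(p , _) ∷ I₂ , refl , e₁ , refl ← map-++⁻ proj₂ I {X} {suc (atLeast 1 μ) ∷ Y} e =
    x ∷ [] , I₁ ++ I₂ , split-++ (split-right I₁) (left (split-right I₂)) , refl ,
    trans (List.map-++ proj₂ I₁ I₂) (cong (_++ _) e₁) , λ {S} {Z} hS hZ →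
      ↭-reflexive (trans (cong (mark (suc (atLeast 1 μ) ∷ [])) (scan S I₁ x I₂ Z))
                         (mark-at (S ++ reverse I₂) (All.++⁺ (small-no-letter hS ≤-refl) (reverse-all (no-letter I₂ refl nY)))))
extract-removed μ d (two {X} {Y} {Z} nY nZ) = extract-column μ _ d (interval-split _ 2) choose
  where
  t = atLeast 1 μ
  choose : ∀ I → letters I ≡ X ++ 2 + t ∷ Y ++ suc t ∷ Z → _
  choose I e
    with I₁ , x@(p , _) ∷ I′ , refl , e₁ , e′ ← map-++⁻ proj₂ I {X} {2 + t ∷ Y ++ suc t ∷ Z} e
    with refl ← List.∷-injectiveˡ e′
    with I₂ , y@(q , _) ∷ I₃ , refl , e₂ , refl ← map-++⁻ proj₂ I′ {Y} {suc t ∷ Z} (List.∷-injectiveʳ e′) =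
    x ∷ y ∷ [] , I₁ ++ I₂ ++ I₃ ,
    split-++ (split-right I₁) (left (split-++ (split-right I₂) (left (split-right I₃)))) , refl ,
    trans (List.map-++ proj₂ I₁ _)
      (cong₂ _++_ e₁ (trans (List.map-++ proj₂ I₂ I₃) (cong (_++ _) e₂))) , λ {S} {Z′} hS hZ →
      ↭-trans (↭-reflexive (marks S Z′ hS)) (swap q p ↭-refl)
    where
    open ≡-Reasoning
    marks : ∀ S Z′ → All (λ x → proj₂ x < suc t) S →
            mark (up (suc t) 2) (S ++ reverse (I₁ ++ x ∷ I₂ ++ y ∷ I₃) ++ Z′) ≡ q ∷ p ∷ []
    marks S Z′ hS = begin
      mark (up (suc t) 2) (S ++ reverse (I₁ ++ x ∷ I₂ ++ y ∷ I₃) ++ Z′)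
        ≡⟨ cong (λ I → mark (up (suc t) 2) (S ++ reverse I ++ Z′)) (List.++-assoc I₁ (x ∷ I₂) (y ∷ I₃)) ⟨
      mark (up (suc t) 2) (S ++ reverse ((I₁ ++ x ∷ I₂) ++ y ∷ I₃) ++ Z′)
        ≡⟨ cong (mark (up (suc t) 2)) (scan S (I₁ ++ x ∷ I₂) y I₃ Z′) ⟩
      mark (up (suc t) 2) ((S ++ reverse I₃) ++ y ∷ reverse (I₁ ++ x ∷ I₂) ++ Z′)
        ≡⟨ mark-at (S ++ reverse I₃) (All.++⁺ (small-no-letter hS ≤-refl) (reverse-all (no-letter I₃ refl nZ))) ⟩
      q ∷ mark (2 + t ∷ []) ((reverse (I₁ ++ x ∷ I₂) ++ Z′) ++ S ++ reverse I₃)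
        ≡⟨ cong
          (λ I → q ∷ mark (2 + t ∷ []) I) (trans (List.++-assoc (reverse (I₁ ++ x ∷ I₂)) Z′ _) (scan [] I₁ x I₂ _)) ⟩
      q ∷ mark (2 + t ∷ []) (reverse I₂ ++ x ∷ reverse I₁ ++ Z′ ++ S ++ reverse I₃)
        ≡⟨ cong (q ∷_) (mark-at (reverse I₂) (reverse-all (no-letter I₂ e₂ nY))) ⟩
      q ∷ p ∷ [] ∎
extract-removed μ d (wrap {X} {Y} {Z} nX nY nZ nZ′) = extract-column μ _ d (interval-split _ 2) choose
  where
  t = atLeast 1 μ
  choose : ∀ I → letters I ≡ X ++ suc t ∷ Y ++ 2 + t ∷ Z → _
  choose I e
    with I₁ , x@(p , _) ∷ I′ , refl , e₁ , e′ ← map-++⁻ proj₂ I {X} {suc t ∷ Y ++ 2 + t ∷ Z} e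
    with refl ← List.∷-injectiveˡ e′
    with I₂ , y@(q , _) ∷ I₃ , refl , e₂ , refl ← map-++⁻ proj₂ I′ {Y} {2 + t ∷ Z} (List.∷-injectiveʳ e′) =
    x ∷ y ∷ [] , I₁ ++ I₂ ++ I₃ ,
    split-++ (split-right I₁) (left (split-++ (split-right I₂) (left (split-right I₃)))) , refl ,
    trans (List.map-++ proj₂ I₁ _)
      (cong₂ _++_ e₁ (trans (List.map-++ proj₂ I₂ I₃) (cong (_++ _) e₂))) , λ {S} {Z′} hS hZ →
      ↭-reflexive (marks S Z′ hS hZ)
    where
    open ≡-Reasoning
    marks : ∀ S Z′ → All (λ x → proj₂ x < suc t) S → All (λ x → proj₂ x < suc t) Z′ →
            mark (up (suc t) 2) (S ++ reverse (I₁ ++ x ∷ I₂ ++ y ∷ I₃) ++ Z′) ≡ p ∷ q ∷ []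
    marks S Z′ hS hZ = begin
      mark (up (suc t) 2) (S ++ reverse (I₁ ++ x ∷ I₂ ++ y ∷ I₃) ++ Z′)
        ≡⟨ cong (mark (up (suc t) 2)) (scan S I₁ x (I₂ ++ y ∷ I₃) Z′) ⟩
      mark (up (suc t) 2) ((S ++ reverse (I₂ ++ y ∷ I₃)) ++ x ∷ reverse I₁ ++ Z′)
        ≡⟨ mark-at (S ++ reverse (I₂ ++ y ∷ I₃)) (All.++⁺ (small-no-letter hS ≤-refl)
             (reverse-all (All.++⁺ (no-letter I₂ e₂ nY) (1+n≢n ∷ no-letter I₃ refl nZ)))) ⟩
      p ∷ mark (2 + t ∷ []) ((reverse I₁ ++ Z′) ++ S ++ reverse (I₂ ++ y ∷ I₃))
        ≡⟨ cong (λ I → p ∷ mark (2 + t ∷ []) I) (begin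
             (reverse I₁ ++ Z′) ++ S ++ reverse (I₂ ++ y ∷ I₃)
               ≡⟨ List.++-assoc (reverse I₁ ++ Z′) S _ ⟨
             ((reverse I₁ ++ Z′) ++ S) ++ reverse (I₂ ++ y ∷ I₃)
               ≡⟨ cong (((reverse I₁ ++ Z′) ++ S) ++_) (List.++-identityʳ (reverse (I₂ ++ y ∷ I₃))) ⟨
             ((reverse I₁ ++ Z′) ++ S) ++ reverse (I₂ ++ y ∷ I₃) ++ []
               ≡⟨ scan ((reverse I₁ ++ Z′) ++ S) I₂ y I₃ [] ⟩
             (((reverse I₁ ++ Z′) ++ S) ++ reverse I₃) ++ y ∷ reverse I₂ ++ [] ∎) ⟩
      p ∷ mark (2 + t ∷ []) ((((reverse I₁ ++ Z′) ++ S) ++ reverse I₃) ++ y ∷ reverse I₂ ++ [])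
        ≡⟨ cong (p ∷_) (mark-at (((reverse I₁ ++ Z′) ++ S) ++ reverse I₃)
             (All.++⁺ (All.++⁺ (All.++⁺ (reverse-all (no-letter I₁ e₁ nX)) (small-no-letter hZ (n≤1+n _))) (small-no-letter hS (n≤1+n _)))
                      (reverse-all (no-letter I₃ refl nZ′)))) ⟩
      p ∷ q ∷ [] ∎

-- Charges of the standard subwords

position-here : ∀ a w → position a (a ∷ w) ≡ 1
position-here a w = cong (λ c → if c then 1 else suc (position a w)) (dec-true (a ≟ a) refl)

position-there : ∀ {a b} w → a ≢ b → position a (b ∷ w) ≡ suc (position a w)
position-there {a} {b} w a≢b = cong (λ c → if c then 1 else suc (position a w)) (dec-false (a ≟ b) a≢b)

1≤position : ∀ a b w → 1 ≤ position a (b ∷ w)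
1≤position a b w with does (a ≟ b)
... | true  = ≤-refl
... | false = s≤s z≤n

-- The `position` of an absent letter is the length of the word, the same as that of the last
-- letter. With b behind i + 1, the comparison holds also when i does not occur.
inverseDescent : ∀ i A b B → NoOccurrence i A → InverseDescent (A ++ suc i ∷ b ∷ B) i
inverseDescent i []      b B [] = begin
  suc (position (suc i) (suc i ∷ b ∷ B))   ≡⟨ cong suc (position-here (suc i) (b ∷ B)) ⟩
  2                                         ≤⟨ s≤s (1≤position i b B) ⟩
  suc (position i (b ∷ B))                  ≡⟨ position-there (b ∷ B) (<⇒≢ ≤-refl) ⟨
  position i (suc i ∷ b ∷ B)                ∎
  where open ≤-Reasoning
inverseDescent i (a ∷ A) b B (a≢i ∷ n) with suc i ≟ a
... | yes refl = begin
  suc (position (suc i) (suc i ∷ u))   ≡⟨ cong suc (position-here (suc i) u) ⟩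
  2                                    ≤⟨ s≤s (nonempty A) ⟩
  suc (position i u)                   ≡⟨ position-there u (≢-sym a≢i) ⟨
  position i (suc i ∷ u)               ∎
  where
  open ≤-Reasoning
  u = A ++ suc i ∷ b ∷ B
  nonempty : ∀ A → 1 ≤ position i (A ++ suc i ∷ b ∷ B)
  nonempty []      = 1≤position i (suc i) (b ∷ B)
  nonempty (x ∷ A) = 1≤position i x (A ++ suc i ∷ b ∷ B)
... | no i≢a =
  subst₂ _<_ (sym (position-there u i≢a)) (sym (position-there u (≢-sym a≢i))) (s≤s (inverseDescent i A b B n))
  where u = A ++ suc i ∷ b ∷ B

down-at : ∀ {i m} → 1 ≤ i → i < m → ∃₂ λ A b → ∃ λ B → down 1 m ≡ A ++ suc i ∷ b ∷ B × All (i <_) A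
down-at {i} {suc m} 1≤i (s≤s i≤m) with i ≟ m
down-at {_} {suc zero}    () _ | yes refl
down-at {_} {suc (suc m)} _  _ | yes refl = [] , suc m , down 1 m , refl , []
... | no i≢m with A , b , B , e , i<A ← down-at 1≤i (≤∧≢⇒< i≤m i≢m) =
  suc m ∷ A , b , B , cong (suc m ∷_) e , s≤s i≤m ∷ i<A

all-up : ∀ {p} {P : Pred ℕ p} a n → (∀ i → a ≤ i → i < a + n → P i) → All P (up a n)
all-up a zero    h = []
all-up a (suc n) h =
  h a ≤-refl (m<m+n a (s≤s z≤n)) ∷ all-up (suc a) n
    (λ i a<i i< → h i (<⇒≤ a<i) (<-≤-trans i< (≤-reflexive (sym (+-suc a n)))))

prepend-descent : ∀ i {σ} A {b B} → σ ≡ A ++ suc i ∷ b ∷ B → All (i <_) A → InverseDescent σ i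
prepend-descent i A refl h = inverseDescent i A _ _ (All.map >⇒≢ h)

permCharge-down : ∀ m → permCharge (down 1 m) ≡ 0
permCharge-down m = cong (sum ∘ map (length (down 1 m) ∸_))
  (List.filter-none (λ i → ¬? (inverseDescent? (down 1 m) i)) (subst (All _) (sym indices≡) (all-up 1 (m ∸ 1) λ i 1≤i i< ¬d →
    let A , b , B , e , h = down-at 1≤i (i<m m i 1≤i i<) in ¬d (prepend-descent i A e h))))
  where
  indices≡ : interval 0 (length (down 1 m) ∸ 1) ≡ up 1 (m ∸ 1)
  indices≡ = trans (interval-up _) (cong (λ n → up 1 (n ∸ 1)) (length-down 1 m))
  i<m : ∀ m i → 1 ≤ i → i < 1 + (m ∸ 1) → i < m
  i<m zero    (suc i) _ (s≤s ())
  i<m (suc m) i       _ h = h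

-- Only t + 1 stands to the left of its successor, and in a permutation of length t + 2 it
-- contributes (t + 2) - (t + 1).
permCharge-wrap : ∀ t → permCharge (suc t ∷ 2 + t ∷ down 1 t) ≡ 1
permCharge-wrap t = begin
  sum (map (length σ ∸_) (filter ascent? (interval 0 (length σ ∸ 1))))
    ≡⟨ cong (sum ∘ map (length σ ∸_)) (trans (cong (filter ascent?) indices≡) (List.filter-++ ascent? (up 1 t) _)) ⟩
  sum (map (length σ ∸_) (filter ascent? (up 1 t) ++ filter ascent? (suc t ∷ [])))
    ≡⟨ cong₂ (λ x y → sum (map (length σ ∸_) (x ++ y)))
         (List.filter-none ascent? (all-up 1 t λ i 1≤i i≤t ¬d → ¬d (descent i 1≤i (s≤s⁻¹ i≤t)))) (List.filter-accept ascent? last-ascent) ⟩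
  suc (suc (length (down 1 t))) ∸ suc t + 0
    ≡⟨ trans (+-identityʳ _) (cong (λ n → suc n ∸ t) (length-down 1 t)) ⟩
  suc t ∸ t
    ≡⟨ m+n∸n≡m 1 t ⟩
  1 ∎
  where
  open ≡-Reasoning
  σ = suc t ∷ 2 + t ∷ down 1 t
  ascent? = λ i → ¬? (inverseDescent? σ i)
  indices≡ : interval 0 (length σ ∸ 1) ≡ up 1 t ++ suc t ∷ []
  indices≡ = trans (interval-up _) (trans (cong (up 1 ∘ suc) (length-down 1 t))
                   (trans (cong (up 1) (+-comm 1 t)) (up-++ 1 t 1)))
  descent : ∀ i → 1 ≤ i → i ≤ t → InverseDescent σ i
  descent i 1≤i i≤t with i ≟ t
  ... | yes refl = inverseDescent i [] (2 + i) (down 1 i) []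
  ... | no i≢t with A , b , B , e , h ← down-at 1≤i (≤∧≢⇒< i≤t i≢t) =
    prepend-descent i (suc t ∷ 2 + t ∷ A) (cong (λ u → suc t ∷ 2 + t ∷ u) e) (s≤s i≤t ∷ m≤n⇒m≤1+n (s≤s i≤t) ∷ h)
  last-ascent : ¬ InverseDescent σ (suc t)
  last-ascent d =
    <⇒≱ d
      (≤-trans (≤-reflexive (position-here (suc t) (2 + t ∷ down 1 t))) (1≤position (2 + t) (suc t) (2 + t ∷ down 1 t)))

permCharge-removed : ∀ {t m c σ w w′} → Removed t m c σ w w′ → permCharge (σ ++ down 1 t) ≡ c
permCharge-removed {t} none           = permCharge-down t
permCharge-removed {t} (one _)        = permCharge-down (1 + t)
permCharge-removed {t} (two _ _)      = permCharge-down (2 + t)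
permCharge-removed {t} (wrap _ _ _ _) = permCharge-wrap t

-- Bracketings when a standard subword is removed

count-++ : ∀ a u v → count a (u ++ v) ≡ count a u + count a v
count-++ a u v = trans (cong length (List.filter-++ (a ≟_) u v)) (List.length-++ (filter (a ≟_) u))

count-here : ∀ a w → count a (a ∷ w) ≡ suc (count a w)
count-here a w = cong length (List.filter-accept (a ≟_) refl)

count-there : ∀ {a b} w → b ≢ a → count a (b ∷ w) ≡ count a w
count-there w b≢a = cong length (List.filter-reject (_ ≟_) (≢-sym b≢a))

count-none : ∀ {a w} → NoOccurrence a w → count a w ≡ 0
count-none h = cong length (List.filter-none (_ ≟_) (All.map ≢-sym h))

count≡0 : ∀ {a} w → count a w ≡ 0 → NoOccurrence a w
count≡0     []      e = []
count≡0 {a} (b ∷ w) e with b ≟ a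
... | yes refl = contradiction (trans (sym (count-here b w)) e) λ ()
... | no b≢a   = b≢a ∷ count≡0 w (trans (sym (count-there w b≢a)) e)

count-↭ : ∀ {a u v} → u ↭ v → count a u ≡ count a v
count-↭ {a} p = Perm.↭-length (Perm.filter-↭ (a ≟_) p)

data Bracket (j : ℕ) : ℕ → Set where
  closing : Bracket j j
  opening : Bracket j (suc j)
  neutral : ∀ {x} → x ≢ j → x ≢ suc j → Bracket j x

bracket : ∀ j x → Bracket j x
bracket j x with x ≟ j | x ≟ suc j
... | yes refl | _        = closing
... | no _     | yes refl = opening
... | no x≢j   | no x≢1+j = neutral x≢j x≢1+j

act-other : ∀ {j x} w a → x ≢ j → x ≢ suc j → act j (x ∷ w) a ≡ act j w a
act-other w a = act₁-other _

act-remove : ∀ {j x} X Y a → x ≢ j → x ≢ suc j → act j (X ++ x ∷ Y) a ≡ act j (X ++ Y) a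
act-remove {j} {x} X Y a p q = begin
  act j (X ++ x ∷ Y) a         ≡⟨ act-++ j X (x ∷ Y) a ⟩
  act j X (act j (x ∷ Y) a)    ≡⟨ cong (act j X) (act-other Y a p q) ⟩
  act j X (act j Y a)          ≡⟨ act-++ j X Y a ⟨
  act j (X ++ Y) a             ∎
  where open ≡-Reasoning

act-no-opening : ∀ {j} w a → NoOccurrence (suc j) w → act j w a ≡ count j w + a
act-no-opening     []      a []        = refl
act-no-opening {j} (x ∷ w) a (x≢ ∷ n) with bracket j x
... | closing        =
  trans (act₁-up j _) (trans (cong suc (act-no-opening w a n)) (cong (_+ a) (sym (count-here j w))))
... | opening        = contradiction refl x≢
... | neutral x≢j _  =
  trans (act-other w a x≢j x≢) (trans (act-no-opening w a n) (cong (_+ a) (sym (count-there w x≢j))))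

act-no-closing : ∀ {j} w → NoOccurrence j w → act j w 0 ≡ 0
act-no-closing     []      []       = refl
act-no-closing {j} (x ∷ w) (x≢ ∷ n) with bracket j x
... | closing          = contradiction refl x≢
... | opening          = trans (act₁-down j _) (cong pred (act-no-closing w n))
... | neutral _ x≢1+j  = trans (act-other w 0 x≢ x≢1+j) (act-no-closing w n)

-- As long as the closing letters do not outnumber the opening ones by more than s, one opening letter at the right end
-- does not matter.
act-truncated : ∀ {j} X n s → count j X + n ≤ s + count (suc j) X → act j X n ∸ s ≡ act j X (pred n) ∸ s
act-truncated [] n s h = trans (m≤n⇒m∸n≡0 n≤s) (sym (m≤n⇒m∸n≡0 (≤-trans pred[n]≤n n≤s)))
  where n≤s = ≤-trans h (≤-reflexive (+-identityʳ s))
act-truncated {j} (x ∷ X) n s h with bracket j x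
... | closing = trans (cong (_∸ s) (act₁-up j _)) (trans (go s h′) (cong (_∸ s) (sym (act₁-up j _))))
  where
  h′ : suc (count j X + n) ≤ s + count (suc j) X
  h′ = subst₂ (λ a b → a + n ≤ s + b) (count-here j X) (count-there X (≢-sym 1+n≢n)) h
  go : ∀ s → suc (count j X + n) ≤ s + count (suc j) X → suc (act j X n) ∸ s ≡ suc (act j X (pred n)) ∸ s
  go zero    h = cong suc (act-truncated X n 0 (<⇒≤ h))
  go (suc s) h = act-truncated X n s (s≤s⁻¹ h)
... | opening = trans (cong (_∸ s) (act₁-down j _)) (trans (∸-+-assoc (act j X n) 1 s)
                     (trans (act-truncated X n (suc s) h′) (sym (trans (cong (_∸ s) (act₁-down j _)) (∸-+-assoc (act j X (pred n)) 1 s)))))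
  where
  h′ : count j X + n ≤ suc s + count (suc j) X
  h′ =
    ≤-trans (subst₂ (λ a b → a + n ≤ s + b) (count-there X 1+n≢n) (count-here (suc j) X) h) (≤-reflexive (+-suc s _))
... | neutral x≢j x≢1+j =
  trans (cong (_∸ s) (act-other X n x≢j x≢1+j))
    (trans (act-truncated X n s h′) (cong (_∸ s) (sym (act-other X (pred n) x≢j x≢1+j))))
  where
  h′ : count j X + n ≤ s + count (suc j) X
  h′ = subst₂ (λ a b → a + n ≤ s + b) (count-there X x≢j) (count-there X x≢1+j) h

removed-↭ : ∀ {t m c σ w w′} → Removed t m c σ w w′ → w ↭ σ ++ w′
removed-↭     none                     = ↭-refl
removed-↭ {t} (one {X} {Y} _)          = Perm.shift (suc t) X Y
removed-↭ {t} (two {X} {Y} {Z} _ _)    =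
  ↭-trans (Perm.shift (2 + t) X _)
    (prep (2 + t) (↭-trans (Perm.++⁺ˡ X (Perm.shift (suc t) Y Z)) (Perm.shift (suc t) X _)))
removed-↭ {t} (wrap {X} {Y} {Z} _ _ _ _) =
  ↭-trans (Perm.shift (suc t) X _)
    (prep (suc t) (↭-trans (Perm.++⁺ˡ X (Perm.shift (2 + t) Y Z)) (Perm.shift (2 + t) X _)))

removed-once : ∀ {t m c σ w w′} → Removed t m c σ w w′ → ∀ i → t ≤ i → i < m → count (suc i) σ ≡ 1
removed-once {t} none           i t≤i i<m = contradiction t≤i (<⇒≱ i<m)
removed-once {t} (one _)        i t≤i i<m with refl ← ≤-antisym t≤i (s≤s⁻¹ i<m) = count-here (suc t) []
removed-once {t} (two _ _)      i t≤i i<m with i ≟ t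
... | yes refl = trans (count-there {suc t} {2 + t} (suc t ∷ []) 1+n≢n) (count-here (suc t) [])
... | no i≢t with refl ← ≤-antisym (≤∧≢⇒< t≤i (≢-sym i≢t)) (s≤s⁻¹ i<m) =
  trans (count-here (2 + t) (suc t ∷ [])) (cong suc (count-there {2 + t} {suc t} [] (≢-sym 1+n≢n)))
removed-once {t} (wrap _ _ _ _) i t≤i i<m with i ≟ t
... | yes refl = trans (count-here (suc t) (2 + t ∷ [])) (cong suc (count-there {suc t} {2 + t} [] 1+n≢n))
... | no i≢t with refl ← ≤-antisym (≤∧≢⇒< t≤i (≢-sym i≢t)) (s≤s⁻¹ i<m) =
  trans (count-there {2 + t} {suc t} (2 + t ∷ []) (≢-sym 1+n≢n)) (count-here (2 + t) [])

removed-never : ∀ {t m c σ w w′} → Removed t m c σ w w′ → ∀ i → i < t → count (suc i) σ ≡ 0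
removed-never r i i<t = count-none (letters> r)
  where
  letters> : ∀ {m c σ w w′} → Removed _ m c σ w w′ → NoOccurrence (suc i) σ
  letters> none           = []
  letters> (one _)        = >⇒≢ (s≤s i<t) ∷ []
  letters> (two _ _)      = >⇒≢ (m≤n⇒m≤1+n (s≤s i<t)) ∷ >⇒≢ (s≤s i<t) ∷ []
  letters> (wrap _ _ _ _) = >⇒≢ (s≤s i<t) ∷ >⇒≢ (m≤n⇒m≤1+n (s≤s i<t)) ∷ []

HasContent : List ℕ → (ℕ → ℕ) → (ℕ → ℕ) → Set
HasContent w L M = ∀ i → count (suc i) w + M i ≡ L i

-- With `L i` = λ_{i+1} this is φ_{i+1} ∸ (λ_{i+1} - λ_{i+2}).
contribution : List ℕ → (ℕ → ℕ) → ℕ → ℕ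
contribution w L i = act (suc i) w 0 ∸ (L i ∸ L (suc i))

-- There is no letter i + 2 that could match, and there are at most `L i` letters i + 1.
contribution-zero : ∀ {w L M} i → HasContent w L M → L (suc i) ≡ 0 → contribution w L i ≡ 0
contribution-zero {w} {L} {M} i h z = m≤n⇒m∸n≡0 (begin
  act (suc i) w 0              ≡⟨ act-no-opening w 0 (count≡0 w (m+n≡0⇒m≡0 _ (trans (h (suc i)) z))) ⟩
  count (suc i) w + 0          ≤⟨ +-monoʳ-≤ _ z≤n ⟩
  count (suc i) w + M i        ≡⟨ h i ⟩
  L i ∸ 0                      ≡⟨ cong (L i ∸_) z ⟨
  L i ∸ L (suc i)              ∎)
  where open ≤-Reasoning

-- The last opening letter cancels one of the closing letters of Y, if there is any; by
-- `act-truncated` this makes no difference after s is subtracted.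
act-opening-removed : ∀ {j} X Y s → NoOccurrence (suc j) Y → count j (X ++ Y) ≤ s + count (suc j) (X ++ Y) →
  act j (X ++ suc j ∷ Y) 0 ∸ s ≡ act j (X ++ Y) 0 ∸ s
act-opening-removed {j} X Y s n h = begin
  act j (X ++ suc j ∷ Y) 0 ∸ s          ≡⟨ cong (_∸ s) (trans (act-++ j X _ 0) (cong (act j X) (act₁-down j _))) ⟩
  act j X (pred (act j Y 0)) ∸ s        ≡⟨ act-truncated X (act j Y 0) s bound ⟨
  act j X (act j Y 0) ∸ s               ≡⟨ cong (_∸ s) (act-++ j X Y 0) ⟨
  act j (X ++ Y) 0 ∸ s                  ∎
  where
  open ≡-Reasoning
  bound : count j X + act j Y 0 ≤ s + count (suc j) X
  bound = subst₂ (λ a b → a ≤ s + b)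
    (trans (count-++ j X Y) (cong (count j X +_) (sym (trans (act-no-opening Y 0 n) (+-identityʳ _)))))
    (trans (count-++ (suc j) X Y) (trans (cong (count (suc j) X +_) (count-none n)) (+-identityʳ _))) h

-- The letter j + 1 cancels exactly one of the letters j behind it, so as many remain unmatched as
-- when it is removed together with one of them.
act-pair-removed : ∀ {j} X Y Z → NoOccurrence (suc j) Y → NoOccurrence j Z →
  act j (X ++ suc j ∷ Y ++ j ∷ Z) 0 ≡ act j (X ++ Y ++ Z) 0
act-pair-removed {j} X Y Z nY nZ = begin
  act j (X ++ suc j ∷ Y ++ j ∷ Z) 0       ≡⟨ act-++ j X _ 0 ⟩
  act j X (act j (suc j ∷ Y ++ j ∷ Z) 0)  ≡⟨ cong (act j X) (act₁-down j _) ⟩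
  act j X (pred (act j (Y ++ j ∷ Z) 0))   ≡⟨ cong (act j X ∘ pred) (act-++ j Y _ 0) ⟩
  act j X (pred (act j Y (act j (j ∷ Z) 0)))
    ≡⟨ cong (act j X ∘ pred ∘ act j Y) (trans (act₁-up j _) (cong suc (act-no-closing Z nZ))) ⟩
  act j X (pred (act j Y 1))
    ≡⟨ cong (act j X ∘ pred) (trans (act-no-opening Y 1 nY) (+-comm (count j Y) 1)) ⟩
  act j X (count j Y)                     ≡⟨ cong (act j X) (trans (act-no-opening Y 0 nY) (+-identityʳ _)) ⟨
  act j X (act j Y 0)                     ≡⟨ cong (act j X ∘ act j Y) (act-no-closing Z nZ) ⟨
  act j X (act j Y (act j Z 0))           ≡⟨ cong (act j X) (act-++ j Y Z 0) ⟨
  act j X (act j (Y ++ Z) 0)              ≡⟨ act-++ j X _ 0 ⟨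
  act j (X ++ Y ++ Z) 0                   ∎
  where open ≡-Reasoning

act-unmatched : ∀ {j} X W → NoOccurrence (suc j) X → NoOccurrence j W → act j (X ++ W) 0 ≡ count j X
act-unmatched {j} X W nX nW = trans (act-++ j X W 0)
  (trans (cong (act j X) (act-no-closing W nW)) (trans (act-no-opening X 0 nX) (+-identityʳ _)))

act-unmatched-suc : ∀ {j} X W → NoOccurrence (suc j) X → NoOccurrence j W → act j (X ++ j ∷ W) 0 ≡ suc (count j X)
act-unmatched-suc {j} X W nX nW = trans (act-++ j X _ 0)
  (trans (cong (act j X) (trans (act₁-up j _) (cong suc (act-no-closing W nW)))) (trans (act-no-opening X 1 nX) (+-comm _ 1)))

-- One column, with boxes in the rows t + 1, …, m, is removed.
module ColumnStep {t m c σ w w′} (L M : ℕ → ℕ) (decreasing : ∀ i → L (suc i) ≤ L i)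
  (M> : ∀ {i} → i < t → 1 ≤ M i) (M≡0 : ∀ {i} → t ≤ i → M i ≡ 0) (L> : ∀ {i} → i < m → 1 ≤ L i)
    (L≡0 : ∀ {i} → m ≤ i → L i ≡ 0)
  (content : HasContent w L M) (removed : Removed t m c σ w w′) where

  L′ M′ : ℕ → ℕ
  L′ i = pred (L i)
  M′ i = pred (M i)

  counts : ∀ i → count i w ≡ count i σ + count i w′
  counts i = trans (count-↭ (removed-↭ removed)) (count-++ i σ w′)

  content′ : HasContent w′ L′ M′
  content′ i with i <? t | i <? m
  ... | yes i<t | _       =
    shift (M> i<t)
      (trans (cong (_+ M i) (sym (trans (counts (suc i)) (cong (_+ _) (removed-never removed i i<t))))) (content i))
    where
    shift : ∀ {a x y} → 1 ≤ x → a + x ≡ y → a + pred x ≡ pred y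
    shift {a} {suc x} _ refl = cong pred (sym (+-suc a x))
  ... | no i≮t  | yes i<m = begin
    count (suc i) w′ + pred (M i)   ≡⟨ cong (λ x → count (suc i) w′ + pred x) (M≡0 (≮⇒≥ i≮t)) ⟩
    count (suc i) w′ + 0
      ≡⟨ cong (λ x → pred x + 0) (trans (counts (suc i)) (cong (_+ _) (removed-once removed i (≮⇒≥ i≮t) i<m))) ⟨
    pred (count (suc i) w) + 0      ≡⟨ +-identityʳ (pred (count (suc i) w)) ⟩
    pred (count (suc i) w)          ≡⟨ cong pred (+-identityʳ (count (suc i) w)) ⟨
    pred (count (suc i) w + 0)      ≡⟨ cong (λ x → pred (count (suc i) w + x)) (M≡0 (≮⇒≥ i≮t)) ⟨
    pred (count (suc i) w + M i)    ≡⟨ cong pred (content i) ⟩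
    pred (L i)                      ∎
    where open ≡-Reasoning
  ... | no i≮t  | no i≮m  = trans (cong₂ (λ a x → a + pred x) w′≡0 (M≡0 (≮⇒≥ i≮t))) (cong pred (sym (L≡0 (≮⇒≥ i≮m))))
    where
    w′≡0 : count (suc i) w′ ≡ 0
    w′≡0 = m+n≡0⇒n≡0 (count (suc i) σ) (trans (sym (counts (suc i)))
             (m+n≡0⇒m≡0 (count (suc i) w) (trans (content i) (L≡0 (≮⇒≥ i≮m)))))

  gap gap′ : ℕ → ℕ
  gap i  = L i ∸ L (suc i)
  gap′ i = L′ i ∸ L′ (suc i)

  gap≡gap′ : ∀ i → suc i < m → gap i ≡ gap′ i
  gap≡gap′ i 1+i<m = go (L> 1+i<m) (decreasing i)
    where
    go : ∀ {x y} → 1 ≤ y → y ≤ x → x ∸ y ≡ pred x ∸ pred y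
    go {suc x} {suc y} _ _ = refl

  bound : ∀ i → t ≤ suc i → count (suc i) w′ ≤ gap′ i + count (2 + i) w′
  bound i t≤1+i = begin
    count (suc i) w′                  ≤⟨ m≤m+n _ (M′ i) ⟩
    count (suc i) w′ + M′ i           ≡⟨ content′ i ⟩
    L′ i                              ≡⟨ m∸n+n≡m (pred-mono-≤ (decreasing i)) ⟨
    gap′ i + L′ (suc i)               ≡⟨ cong (gap′ i +_) (content′ (suc i)) ⟨
    gap′ i + (count (2 + i) w′ + M′ (suc i))  ≡⟨ cong (λ x → gap′ i + (count (2 + i) w′ + pred x)) (M≡0 t≤1+i) ⟩
    gap′ i + (count (2 + i) w′ + 0)   ≡⟨ cong (gap′ i +_) (+-identityʳ _) ⟩
    gap′ i + count (2 + i) w′         ∎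
    where open ≤-Reasoning

  full : ∀ i → t ≤ i → L′ i ≡ count (suc i) w′
  full i t≤i = trans (sym (content′ i)) (trans (cong (λ x → count (suc i) w′ + pred x) (M≡0 t≤i)) (+-identityʳ _))

-- Only the pair (t + 1, t + 2) may lose a bracket that is not matched.
module _ {t : ℕ} where

  act-other-step : ∀ {m c σ w w′} → Removed t m c σ w w′ → ∀ i s → i ≢ t → suc i < m →
    (suc i ≡ t → count (suc i) w′ ≤ s + count (2 + i) w′) → act (suc i) w 0 ∸ s ≡ act (suc i) w′ 0 ∸ s
  act-other-step none i s i≢t 1+i<m h = refl
  act-other-step (one {X} {Y} nY) i s i≢t 1+i<m h with suc i ≟ t
  -- The pair of letters (t , t + 1) loses the opening letter t + 1 and no closing one.
  ... | yes refl = act-opening-removed X Y s nY (h refl)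
  ... | no 1+i≢t = cong (_∸ s) (act-remove X Y 0 (>⇒≢ 1+i<m) (≢-sym (1+i≢t ∘ suc-injective)))
  act-other-step (two {X} {Y} {Z} nY nZ) i s i≢t 1+i<m h with suc i ≟ t
  ... | yes refl = begin
    act (suc i) (X ++ 3 + i ∷ Y ++ 2 + i ∷ Z) 0 ∸ s    ≡⟨ cong (_∸ s) (act-remove X _ 0 (>⇒≢ 1+i<m) 1+n≢n) ⟩
    act (suc i) (X ++ Y ++ 2 + i ∷ Z) 0 ∸ s            ≡⟨ cong (λ u → act (suc i) u 0 ∸ s) (List.++-assoc X Y _) ⟨
    act (suc i) ((X ++ Y) ++ 2 + i ∷ Z) 0 ∸ s
      ≡⟨ act-opening-removed (X ++ Y) Z s nZ
        (subst (λ u → count (suc i) u ≤ s + count (2 + i) u) (sym (List.++-assoc X Y Z)) (h refl)) ⟩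
    act (suc i) ((X ++ Y) ++ Z) 0 ∸ s                  ≡⟨ cong (λ u → act (suc i) u 0 ∸ s) (List.++-assoc X Y Z) ⟩
    act (suc i) (X ++ Y ++ Z) 0 ∸ s                    ∎
    where open ≡-Reasoning
  ... | no 1+i≢t = cong (_∸ s) (begin
    act (suc i) (X ++ 2 + t ∷ Y ++ suc t ∷ Z) 0
      ≡⟨ act-remove X _ 0 (>⇒≢ 1+i<m) (≢-sym (i≢t ∘ suc-injective ∘ suc-injective)) ⟩
    act (suc i) (X ++ Y ++ suc t ∷ Z) 0                ≡⟨ cong (λ u → act (suc i) u 0) (List.++-assoc X Y _) ⟨
    act (suc i) ((X ++ Y) ++ suc t ∷ Z) 0
      ≡⟨ act-remove (X ++ Y) Z 0 (≢-sym (i≢t ∘ suc-injective)) (≢-sym (1+i≢t ∘ suc-injective)) ⟩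
    act (suc i) ((X ++ Y) ++ Z) 0                      ≡⟨ cong (λ u → act (suc i) u 0) (List.++-assoc X Y Z) ⟩
    act (suc i) (X ++ Y ++ Z) 0                        ∎)
    where open ≡-Reasoning
  act-other-step (wrap {X} {Y} {Z} nX nY nZ nZ′) i s i≢t 1+i<m h with suc i ≟ t
  ... | yes refl = begin
    act (suc i) (X ++ 2 + i ∷ Y ++ 3 + i ∷ Z) 0 ∸ s
      ≡⟨ cong (λ u → act (suc i) u 0 ∸ s) (List.++-assoc X (2 + i ∷ Y) _) ⟨
    act (suc i) ((X ++ 2 + i ∷ Y) ++ 3 + i ∷ Z) 0 ∸ s
      ≡⟨ cong (_∸ s) (act-remove (X ++ 2 + i ∷ Y) Z 0 (>⇒≢ 1+i<m) 1+n≢n) ⟩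
    act (suc i) ((X ++ 2 + i ∷ Y) ++ Z) 0 ∸ s
      ≡⟨ cong (λ u → act (suc i) u 0 ∸ s) (List.++-assoc X (2 + i ∷ Y) Z) ⟩
    act (suc i) (X ++ 2 + i ∷ Y ++ Z) 0 ∸ s            ≡⟨ act-opening-removed X (Y ++ Z) s (All.++⁺ nY nZ) (h refl) ⟩
    act (suc i) (X ++ Y ++ Z) 0 ∸ s                    ∎
    where open ≡-Reasoning
  ... | no 1+i≢t = cong (_∸ s) (begin
    act (suc i) (X ++ suc t ∷ Y ++ 2 + t ∷ Z) 0
      ≡⟨ act-remove X _ 0 (≢-sym (i≢t ∘ suc-injective)) (≢-sym (1+i≢t ∘ suc-injective)) ⟩
    act (suc i) (X ++ Y ++ 2 + t ∷ Z) 0                ≡⟨ cong (λ u → act (suc i) u 0) (List.++-assoc X Y _) ⟨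
    act (suc i) ((X ++ Y) ++ 2 + t ∷ Z) 0
      ≡⟨ act-remove (X ++ Y) Z 0 (>⇒≢ 1+i<m) (≢-sym (i≢t ∘ suc-injective ∘ suc-injective)) ⟩
    act (suc i) ((X ++ Y) ++ Z) 0                      ≡⟨ cong (λ u → act (suc i) u 0) (List.++-assoc X Y Z) ⟩
    act (suc i) (X ++ Y ++ Z) 0                        ∎)
    where open ≡-Reasoning

  -- In the case `wrap` every t + 1 precedes every t + 2, so nothing is matched and the removed t +
  -- 1 accounts for the charge 1. The bound on s keeps the truncated difference from swallowing it.
  act-pair-step : ∀ {m c σ w w′} → Removed t m c σ w w′ → ∀ s → suc t < m → s ≤ count (suc t) w′ →
    act (suc t) w 0 ∸ s ≡ c + (act (suc t) w′ 0 ∸ s)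
  act-pair-step none       s 1+t<m h = contradiction 1+t<m (≤⇒≯ (n≤1+n t))
  act-pair-step (one _)    s 1+t<m h = contradiction 1+t<m (<-irrefl refl)
  act-pair-step (two {X} {Y} {Z} nY nZ) s _ h = cong (_∸ s) (act-pair-removed X Y Z nY nZ)
  act-pair-step {w′ = w′} (wrap {X} {Y} {Z} nX nY nZ nZ′) s _ h = begin
    act (suc t) (X ++ suc t ∷ Y ++ 2 + t ∷ Z) 0 ∸ s
      ≡⟨ cong (_∸ s) (act-unmatched-suc X _ nX (All.++⁺ nY (1+n≢n ∷ nZ))) ⟩
    suc (count (suc t) X) ∸ s             ≡⟨ +-∸-assoc 1 (≤-trans h (≤-reflexive count≡)) ⟩
    suc (count (suc t) X ∸ s)             ≡⟨ cong (λ x → suc (x ∸ s)) (act-unmatched X (Y ++ Z) nX (All.++⁺ nY nZ)) ⟨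
    suc (act (suc t) (X ++ Y ++ Z) 0 ∸ s) ∎
    where
    open ≡-Reasoning
    count≡ : count (suc t) (X ++ Y ++ Z) ≡ count (suc t) X
    count≡ =
      trans (count-++ (suc t) X _) (trans (cong (count (suc t) X +_) (count-none (All.++⁺ nY nZ))) (+-identityʳ _))

sumTo : ℕ → (ℕ → ℕ) → ℕ
sumTo zero    f = 0
sumTo (suc k) f = f 0 + sumTo k (f ∘ suc)

sumTo-cong : ∀ k {f g : ℕ → ℕ} → (∀ i → f i ≡ g i) → sumTo k f ≡ sumTo k g
sumTo-cong zero    h = refl
sumTo-cong (suc k) h = cong₂ _+_ (h 0) (sumTo-cong k (h ∘ suc))

sumTo-point : ∀ k {f g : ℕ → ℕ} {c} t → t < k → f t ≡ c + g t → (∀ i → i ≢ t → f i ≡ g i) → sumTo k f ≡ c + sumTo k g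
sumTo-point (suc k) {f} {g} {c} zero    _ e h =
  trans (cong₂ _+_ e (sumTo-cong k (λ i → h (suc i) λ ()))) (+-assoc c (g 0) _)
sumTo-point (suc k) {f} {g} {c} (suc t) (s≤s t<k) e h =
  trans
    (cong₂ _+_ (h 0 λ ()) (sumTo-point k t t<k e (λ i i≢t → h (suc i) (i≢t ∘ suc-injective)))) (swap-sum (g 0) c _)
  where
  swap-sum : ∀ a b c → a + (b + c) ≡ b + (a + c)
  swap-sum = solve-∀

last-occurrence : ∀ {a} w → count a w ≢ 0 → ∃₂ λ X Y → w ≡ X ++ a ∷ Y × NoOccurrence a Y
last-occurrence {a} []      h = contradiction refl h
last-occurrence {a} (x ∷ w) h with count a w ≟ 0
... | no ≢0 with X , Y , refl , n ← last-occurrence w ≢0 = x ∷ X , Y , refl , n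
... | yes ≡0 with x ≟ a
...   | yes refl = [] , w , refl , count≡0 w ≡0
...   | no x≢a   = contradiction (trans (count-there w x≢a) ≡0) h

-- The scan takes the last t + 1, then the last t + 2 to its left or, if there is none, the last t +
-- 2 of the whole word.
removal : ∀ t m w → t ≤ m → m ≤ 2 + t → (t < m → count (suc t) w ≢ 0) → (suc t < m → count (2 + t) w ≢ 0) →
          ∃₂ λ c σ → ∃ λ w′ → Removed t m c σ w w′
removal t m w t≤m m≤2+t h₁ h₂ with m≤n⇒m<n∨m≡n t≤m
... | inj₂ refl = 0 , [] , w , none
... | inj₁ t<m with X , Z , refl , nZ ← last-occurrence w (h₁ t<m) with m≤n⇒m<n∨m≡n t<m
...   | inj₂ refl = 0 , _ , _ , one nZ
...   | inj₁ 1+t<m with refl ← ≤-antisym m≤2+t 1+t<m with count (2 + t) X ≟ 0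
...     | no ≢0 with X₁ , Y , refl , nY ← last-occurrence X ≢0 =
  0 , _ , _ , subst (λ w → Removed t (2 + t) 0 _ w (X₁ ++ Y ++ Z)) (sym (List.++-assoc X₁ (2 + t ∷ Y) _)) (two nY nZ)
...     | yes ≡0 with Y , Z′ , refl , nZ′ ← last-occurrence Z (λ e → h₂ 1+t<m
  (trans (count-++ (2 + t) X (suc t ∷ Z)) (cong₂ _+_ ≡0 (trans (count-there {2 + t} {suc t} Z (≢-sym 1+n≢n)) e)))) =
  1 , _ , _ , wrap (count≡0 X ≡0) (All.++⁻ˡ Y nZ) (All.tail (All.++⁻ʳ Y nZ)) nZ′

atLeast-part : ∀ ρ → WeaklyDecreasing ρ → ∀ {i} → i < atLeast 1 ρ → 1 ≤ part ρ i
atLeast-part (zero ∷ ρ)  d         h       = contradiction (≤-trans h (≤-reflexive (atLeast-zeros (zeros d)))) λ ()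
atLeast-part (suc x ∷ ρ) d {zero}  h       = s≤s z≤n
atLeast-part (suc x ∷ ρ) d {suc i} (s≤s h) = atLeast-part ρ (d ∘ suc) h

part-beyond : ∀ ρ → WeaklyDecreasing ρ → ∀ {i} → atLeast 1 ρ ≤ i → part ρ i ≡ 0
part-beyond []          d         h       = refl
part-beyond (zero ∷ ρ)  d {i}     h       = part-zeros i (refl ∷ zeros d)
  where
  part-zeros : ∀ {ρ} i → All (_≡ 0) ρ → part ρ i ≡ 0
  part-zeros i       []      = refl
  part-zeros zero    (z ∷ _) = z
  part-zeros (suc i) (_ ∷ z) = part-zeros i z
part-beyond (suc x ∷ ρ) d {suc i} (s≤s h) = part-beyond ρ (d ∘ suc) h

record Shape (lam mu : List ℕ) : Set where
  field
    outer-decreasing : WeaklyDecreasing lam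
    inner-decreasing : WeaklyDecreasing mu
    thin             : ∀ i → part lam (2 + i) ≤ part mu i

shape-pred : ∀ {lam mu} → Shape lam mu → Shape (map pred lam) (map pred mu)
shape-pred {lam} {mu} s = record
  { outer-decreasing = λ i → pred-part lam lam i (suc i) (outer-decreasing i)
  ; inner-decreasing = λ i → pred-part mu mu i (suc i) (inner-decreasing i)
  ; thin             = λ i → pred-part mu lam i (2 + i) (thin i) }
  where
  open Shape s
  pred-part : ∀ ρ σ i k → part σ k ≤ part ρ i → part (map pred σ) k ≤ part (map pred ρ) i
  pred-part ρ σ i k h = subst₂ _≤_ (sym (part-pred σ k)) (sym (part-pred ρ i)) (pred-mono-≤ h)

-- Induction over the columns of λ: removing the first standard subword lowers the sum of the
-- contributions by exactly its charge c. Only the contribution at t can change.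
chargeColumns : ∀ k {lam mu} w → Shape lam mu → HasContent w (part lam) (part mu) → (∀ i → part lam i ≤ k) →
  subwordCharges (columnLengths k lam) (w ++ descendingWord 1 mu) ≡ sumTo (length lam) (contribution w (part lam))
chargeColumns zero {lam} {mu} w s h b = sym (trans
  (sumTo-cong (length lam) {g = λ _ → 0} (λ i → contribution-zero {w} {M = part mu} i h (n≤0⇒n≡0 (b (suc i))))) (sumTo-zero (length lam)))
  where
  sumTo-zero : ∀ n → sumTo n (λ _ → 0) ≡ 0
  sumTo-zero zero    = refl
  sumTo-zero (suc n) = sumTo-zero n
chargeColumns (suc k) {lam} {mu} w s h b = begin
  permCharge (proj₁ (extract m u)) + subwordCharges (columnLengths k (map pred lam)) (proj₂ (extract m u))
    ≡⟨ cong
      (λ (x , y) → permCharge x + subwordCharges (columnLengths k (map pred lam)) y) (extract-removed mu inner-decreasing removed) ⟩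
  permCharge (σ ++ down 1 t) + subwordCharges (columnLengths k (map pred lam)) (w′ ++ descendingWord 1 (map pred mu))
    ≡⟨ cong₂ _+_ (permCharge-removed removed) (chargeColumns k w′ (shape-pred s) content″ bound′) ⟩
  c + sumTo (length (map pred lam)) (contribution w′ (part (map pred lam)))
    ≡⟨ cong (c +_) (trans (cong (λ n → sumTo n (contribution w′ (part (map pred lam)))) (List.length-map pred lam))
                          (sumTo-cong (length lam) pred-contribution)) ⟩
  c + sumTo (length lam) (contribution w′ L′)
    ≡⟨ total-step removed ⟨
  sumTo (length lam) (contribution w L) ∎
  where
  open ≡-Reasoning
  open Shape s
  L = part lam
  M = part mu
  t = atLeast 1 mu
  m = atLeast 1 lam
  u = w ++ descendingWord 1 mu
  L> : ∀ {i} → i < m → 1 ≤ L i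
  L> = atLeast-part lam outer-decreasing
  L≡0 : ∀ {i} → m ≤ i → L i ≡ 0
  L≡0 = part-beyond lam outer-decreasing
  M> : ∀ {i} → i < t → 1 ≤ M i
  M> = atLeast-part mu inner-decreasing
  M≡0 : ∀ {i} → t ≤ i → M i ≡ 0
  M≡0 = part-beyond mu inner-decreasing
  -- The inclusion of μ in λ is contained in the statement h on the content.
  t≤m : t ≤ m
  t≤m =
    ≮⇒≥ λ m<t → contradiction (≤-trans (M> m<t) (≤-trans (m≤n+m (M m) _) (≤-reflexive (trans (h m) (L≡0 ≤-refl))))) λ ()
  m≤2+t : m ≤ 2 + t
  m≤2+t = ≮⇒≥ λ t< → contradiction (≤-trans (L> t<) (≤-trans (thin t) (≤-reflexive (M≡0 ≤-refl)))) λ ()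
  occurs : ∀ i → t ≤ i → i < m → count (suc i) w ≢ 0
  occurs i t≤i i<m e = contradiction (≤-trans (L> i<m) (≤-reflexive (trans (sym (h i)) (cong₂ _+_ e (M≡0 t≤i))))) λ ()
  removal′ = removal t m w t≤m m≤2+t (occurs t ≤-refl) (occurs (suc t) (n≤1+n t))
  c = proj₁ removal′
  σ = proj₁ (proj₂ removal′)
  w′ = proj₁ (proj₂ (proj₂ removal′))
  removed : Removed t m c σ w w′
  removed = proj₂ (proj₂ (proj₂ removal′))
  module C = ColumnStep L M outer-decreasing M> M≡0 L> L≡0 h removed
  open C using (L′; gap≡gap′)
  content″ : HasContent w′ (part (map pred lam)) (part (map pred mu))
  content″ i = trans (cong (count (suc i) w′ +_) (part-pred mu i)) (trans (C.content′ i) (sym (part-pred lam i)))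
  bound′ : ∀ i → part (map pred lam) i ≤ k
  bound′ i = ≤-trans (≤-reflexive (part-pred lam i)) (pred-mono-≤ (b i))
  pred-contribution : ∀ i → contribution w′ (part (map pred lam)) i ≡ contribution w′ L′ i
  pred-contribution i = cong₂ (λ x y → act (suc i) w′ 0 ∸ (x ∸ y)) (part-pred lam i) (part-pred lam (suc i))
  m≤length : m ≤ length lam
  m≤length = List.length-filter (1 ≤?_) lam
  vanishing : ∀ i → m ≤ suc i → contribution w L i ≡ contribution w′ L′ i
  vanishing i m≤ =
    trans (contribution-zero {w} i h (L≡0 m≤)) (sym (contribution-zero {w′} i C.content′ (cong pred (L≡0 m≤))))
  other : ∀ i → i ≢ t → contribution w L i ≡ contribution w′ L′ i
  other i i≢t with suc i <? m
  ... | no ≮m   = vanishing i (≮⇒≥ ≮m)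
  ... | yes i<m =
    trans
      (act-other-step removed i (C.gap i) i≢t i<m λ e → subst (λ s → count (suc i) w′ ≤ s + count (2 + i) w′) (sym (gap≡gap′ i i<m)) (C.bound i (≤-reflexive (sym e))))
                        (cong (act (suc i) w′ 0 ∸_) (gap≡gap′ i i<m))
  here-step : suc t < m → contribution w L t ≡ c + contribution w′ L′ t
  here-step t<m =
    trans
      (act-pair-step removed (C.gap t) t<m (subst₂ _≤_ (sym (gap≡gap′ t t<m)) (C.full t ≤-refl) (m∸n≤m (L′ t) (L′ (suc t)))))
                        (cong (λ s → c + (act (suc t) w′ 0 ∸ s)) (gap≡gap′ t t<m))
  uncharged : c ≡ 0 → m ≤ suc t → sumTo (length lam) (contribution w L) ≡ c + sumTo (length lam) (contribution w′ L′)
  uncharged c≡0 m≤1+t = trans (sumTo-cong (length lam) all-other)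
    (cong (_+ sumTo (length lam) (contribution w′ L′)) (sym c≡0))
    where
    all-other : ∀ i → contribution w L i ≡ contribution w′ L′ i
    all-other i with i ≟ t
    ... | yes refl = vanishing i m≤1+t
    ... | no i≢t   = other i i≢t
  total-step : ∀ {m′ c′} → Removed t m′ c′ σ w w′ →
    sumTo (length lam) (contribution w L) ≡ c + sumTo (length lam) (contribution w′ L′)
  total-step _ with suc t <? m
  ... | yes t<m = sumTo-point (length lam) t (≤-trans (<⇒≤ t<m) m≤length) (here-step t<m) other
  ... | no t≮m  = uncharged (free removed (≮⇒≥ t≮m)) (≮⇒≥ t≮m)
    where
    free : ∀ {m c σ w w′} → Removed t m c σ w w′ → m ≤ suc t → c ≡ 0
    free none           _ = refl
    free (one _)        _ = refl
    free (two _ _)      _ = refl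
    free (wrap _ _ _ _) h = contradiction h (<⇒≱ ≤-refl)

-- The content of the word with its suffix

largest-part : ∀ ρ i → part ρ i ≤ largest ρ
largest-part []      i       = z≤n
largest-part (x ∷ ρ) zero    = m≤m⊔n x _
largest-part (x ∷ ρ) (suc i) = ≤-trans (largest-part ρ i) (m≤n⊔m x _)

atLeast-cong : ∀ j ρ σ → (∀ i → part ρ i ≡ part σ i) → atLeast (suc j) ρ ≡ atLeast (suc j) σ
atLeast-cong j []      []      h = refl
atLeast-cong j []      (y ∷ σ) h with refl ← h 0 = atLeast-cong j [] σ (h ∘ suc)
atLeast-cong j (x ∷ ρ) []      h with refl ← h 0 = atLeast-cong j ρ [] (h ∘ suc)
atLeast-cong j (x ∷ ρ) (y ∷ σ) h with refl ← h 0 with j <ᵇ x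
... | true  = cong suc (atLeast-cong j ρ σ (h ∘ suc))
... | false = atLeast-cong j ρ σ (h ∘ suc)

largest-cong : ∀ ρ σ → (∀ i → part ρ i ≡ part σ i) → largest ρ ≡ largest σ
largest-cong []      []      h = refl
largest-cong []      (y ∷ σ) h with refl ← h 0 = largest-cong [] σ (h ∘ suc)
largest-cong (x ∷ ρ) []      h with refl ← h 0 = largest-cong ρ [] (h ∘ suc)
largest-cong (x ∷ ρ) (y ∷ σ) h = cong₂ _⊔_ (h 0) (largest-cong ρ σ (h ∘ suc))

-- The computed content of a word and λ may differ in trailing zeros.
conjugate-cong : ∀ ρ σ → (∀ i → part ρ i ≡ part σ i) → conjugate ρ ≡ conjugate σ
conjugate-cong ρ σ h = begin
  conjugate ρ                      ≡⟨ conjugate-columnLengths ρ ⟩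
  columnLengths (largest ρ) ρ      ≡⟨ columnLengths-cong (largest ρ) (λ j → atLeast-cong j ρ σ h) ⟩
  columnLengths (largest ρ) σ      ≡⟨ cong (λ k → columnLengths k σ) (largest-cong ρ σ h) ⟩
  columnLengths (largest σ) σ      ≡⟨ conjugate-columnLengths σ ⟨
  conjugate σ                      ∎
  where open ≡-Reasoning

count-replicate : ∀ a k → count a (replicate k a) ≡ k
count-replicate a zero    = refl
count-replicate a (suc k) = trans (count-here a (replicate k a)) (cong suc (count-replicate a k))

descendingWord-above : ∀ {b} i μ → b < i → NoOccurrence b (descendingWord i μ)
descendingWord-above i []      b<i = []
descendingWord-above i (m ∷ μ) b<i =
  All.++⁺ (descendingWord-above (suc i) μ (m≤n⇒m≤1+n b<i)) (All.replicate⁺ m (>⇒≢ b<i))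

count-descendingWord : ∀ a i μ → count (a + i) (descendingWord a μ) ≡ part μ i
count-descendingWord a i       []      = refl
count-descendingWord a zero    (m ∷ μ) rewrite +-identityʳ a = trans (count-++ a (descendingWord (suc a) μ) _)
  (cong₂ _+_ (count-none (descendingWord-above (suc a) μ ≤-refl)) (count-replicate a m))
count-descendingWord a (suc i) (m ∷ μ) rewrite +-suc a i = trans (count-++ (suc (a + i)) (descendingWord (suc a) μ) _)
  (trans (cong₂ _+_ (count-descendingWord (suc a) i μ) (count-none (All.replicate⁺ m (<⇒≢ (s≤s (m≤m+n a i)))))) (+-identityʳ _))

part-up : ∀ (f : ℕ → ℕ) a n i → i < n → part (map f (up a n)) i ≡ f (a + i)
part-up f a (suc n) zero    _       = cong f (sym (+-identityʳ a))
part-up f a (suc n) (suc i) (s≤s h) = trans (part-up f (suc a) n i h) (cong f (sym (+-suc a i)))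

part-up-beyond : ∀ (f : ℕ → ℕ) a n i → n ≤ i → part (map f (up a n)) i ≡ 0
part-up-beyond f a zero    i       _       = refl
part-up-beyond f a (suc n) (suc i) (s≤s h) = part-up-beyond f (suc a) n i h

count-beyond : ∀ {a} u → largest u < a → count a u ≡ 0
count-beyond u h = count-none (go u h)
  where
  go : ∀ {a} u → largest u < a → NoOccurrence a u
  go []      h = []
  go (x ∷ u) h = <⇒≢ (≤-<-trans (m≤m⊔n x _) h) ∷ go u (≤-<-trans (m≤n⊔m x _) h)

part-wordContent : ∀ u i → part (wordContent u) i ≡ count (suc i) u
part-wordContent u i = trans (cong (λ I → part (map (λ a → count a u) I) i) (interval-up (largest u))) go
  where
  go : part (map (λ a → count a u) (up 1 (largest u))) i ≡ count (suc i) u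
  go with i <? largest u
  ... | yes i< = part-up (λ a → count a u) 1 (largest u) i i<
  ... | no i≮  =
    trans (part-up-beyond (λ a → count a u) 1 (largest u) i (≮⇒≥ i≮)) (sym (count-beyond u (s≤s (≮⇒≥ i≮))))

chargeWord-sum : ∀ {lam mu} w → Shape lam mu → HasContent w (part lam) (part mu) →
                 chargeWord mu w ≡ sumTo (length lam) (contribution w (part lam))
chargeWord-sum {lam} {mu} w s h = begin
  subwordCharges (conjugate (wordContent u)) u
    ≡⟨ cong (λ c → subwordCharges c u) (conjugate-cong (wordContent u) lam parts) ⟩
  subwordCharges (conjugate lam) u
    ≡⟨ cong (λ c → subwordCharges c u) (conjugate-columnLengths lam) ⟩
  subwordCharges (columnLengths (largest lam) lam) u       ≡⟨ chargeColumns (largest lam) w s h (largest-part lam) ⟩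
  sumTo (length lam) (contribution w (part lam))           ∎
  where
  open ≡-Reasoning
  u = w ++ descendingWord 1 mu
  parts : ∀ i → part (wordContent u) i ≡ part lam i
  parts i =
    trans (part-wordContent u i)
      (trans (count-++ (suc i) w _) (trans (cong (count (suc i) w +_) (count-descendingWord 1 i mu)) (h i)))

-- Enumerations

record Enumerates {A : Set} (xs : List A) (P : A → Set) : Set where
  field
    unique   : Unique xs
    sound    : ∀ {x} → x ∈ xs → P x
    complete : ∀ {x} → P x → x ∈ xs

open Enumerates

same-elements : ∀ {A : Set} {xs ys : List A} → Unique xs → Unique ys → (∀ {x} → x ∈ xs → x ∈ ys) →
  (∀ {x} → x ∈ ys → x ∈ xs) → xs ↭ ys
same-elements u v f g = ∼bag⇒↭ (unique∧set⇒bag u v (mk⇔ f g))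

images : ∀ {A B : Set} {P : A → Set} {Q : B → Set} (R : A → B → Set) → (∀ {x} → P x → ∃ λ y → Q y × R x y) →
         ∀ {xs} → All P xs → ∃ λ zs → Pointwise.Pointwise R xs zs × All Q zs
images R tot []       = [] , [] , []
images R tot (p ∷ ps) with y , q , r ← tot p | zs , rs , qs ← images R tot ps = y ∷ zs , r ∷ rs , q ∷ qs

-- Bijections are given as relations, the form in which the insertion is available. A bijection that
-- respects the monomials h and k makes the two lists of monomials permutations of each other.
correspond : ∀ {A B C : Set} {xs : List A} {ys : List B} {P Q} (R : A → B → Set) {h : A → C} {k : B → C} →
  Enumerates xs P → Enumerates ys Q →
  (∀ {x} → P x → ∃ λ y → Q y × R x y) → (∀ {y} → Q y → ∃ λ x → P x × R x y) →
  (∀ {x y y′} → P x → R x y → R x y′ → y ≡ y′) → (∀ {x x′ y} → P x → P x′ → R x y → R x′ y → x ≡ x′) →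
  (∀ {x y} → P x → R x y → h x ≡ k y) → map h xs ↭ map k ys
correspond {A} {B} {C} {xs} {ys} {P} {Q} R {h} {k} ex ey tot sur det inj eq
  with zs , rs , qs ← images R tot (All.tabulate (sound ex)) =
  ↭-trans (↭-reflexive (values (All.tabulate (sound ex)) rs))
    (Perm.map⁺ k (same-elements (distinct (All.tabulate (sound ex)) rs (unique ex)) (unique ey)
      (λ z∈ → complete ey (All.lookup qs z∈)) (λ y∈ → covers (sound ey y∈) rs)))
  where
  values : ∀ {xs zs} → All P xs → Pointwise.Pointwise R xs zs → map h xs ≡ map k zs
  values []       []       = refl
  values (p ∷ ps) (r ∷ rs) = cong₂ _∷_ (eq p r) (values ps rs)
  fresh : ∀ {x z xs zs} → P x → R x z → All P xs → Pointwise.Pointwise R xs zs → All (x ≢_) xs → All (z ≢_) zs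
  fresh p r []       []       []       = []
  fresh p r (q ∷ ps) (s ∷ rs) (n ∷ ns) = (λ { refl → n (inj p q r s) }) ∷ fresh p r ps rs ns
  distinct : ∀ {xs zs} → All P xs → Pointwise.Pointwise R xs zs → Unique xs → Unique zs
  distinct []       []       []       = []
  distinct (p ∷ ps) (r ∷ rs) (n ∷ u)  = fresh p r ps rs n ∷ distinct ps rs u
  related : ∀ {x xs zs} → x ∈ xs → Pointwise.Pointwise R xs zs → ∃ λ z → z ∈ zs × R x z
  related (here refl) (r ∷ rs) = _ , here refl , r
  related (there x∈)  (r ∷ rs) with z , z∈ , s ← related x∈ rs = z , there z∈ , s
  covers : ∀ {y zs} → Q y → Pointwise.Pointwise R xs zs → y ∈ zs
  covers q rs with x , p , r ← sur q with z , z∈ , s ← related (complete ex p) rs = subst (_∈ _) (det p s r) z∈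

-- The pigeonhole principle. Through it the injectivity of `straightenRows` suffices, without an
-- inverse.
unique-subset : ∀ {A : Set} {zs xs : List A} → Unique zs → (∀ {z} → z ∈ zs → z ∈ xs) → length zs ≡ length xs → zs ↭ xs
unique-subset {zs = []}     {[]} u       h e = ↭-refl
unique-subset {zs = z ∷ zs} {xs} (n ∷ u) h e with as , bs , refl ← ∈-∃++ (h (here refl)) =
  ↭-trans (prep z (unique-subset u rest (suc-injective (trans e (Perm.↭-length (Perm.shift z as bs))))))
    (↭-sym (Perm.shift z as bs))
  where
  rest : ∀ {y} → y ∈ zs → y ∈ as ++ bs
  rest y∈ with Perm.∈-resp-↭ (Perm.shift z as bs) (h (there y∈))
  ... | here refl = contradiction refl (All.lookup n y∈)
  ... | there y∈′ = y∈′

map-injective-↭ : ∀ {A : Set} {xs : List A} {P} (f : A → A) → Enumerates xs P → (∀ {x} → P x → P (f x)) →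
                  (∀ {x y} → P x → P y → f x ≡ f y → x ≡ y) → map f xs ↭ xs
map-injective-↭ {xs = xs} {P} f e closed inj =
  unique-subset (distinct (All.tabulate (sound e)) (unique e)) into (List.length-map f xs)
  where
  into : ∀ {z} → z ∈ map f xs → z ∈ xs
  into z∈ with x , x∈ , refl ← ∈-map⁻ f z∈ = complete e (closed (sound e x∈))
  distinct : ∀ {xs} → All P xs → Unique xs → Unique (map f xs)
  distinct []       []      = []
  distinct (p ∷ ps) (n ∷ u) =
    All.map⁺ (All.zipWith (λ (q , x≢y) fx≡fy → x≢y (inj p q fx≡fy)) (ps , n)) ∷ distinct ps u

enumerates-resp : ∀ {A : Set} {xs : List A} {P Q} → Enumerates xs P → (∀ {x} → P x → Q x) → (∀ {x} → Q x → P x) →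
  Enumerates xs Q
enumerates-resp e f g = record { unique = unique e ; sound = f ∘ sound e ; complete = complete e ∘ g }

enumerates-filter : ∀ {A : Set} {xs : List A} {P Q} (Q? : Decidable Q) → Enumerates xs P →
  Enumerates (filter Q? xs) (λ x → P x × Q x)
enumerates-filter Q? e = record
  { unique   = Unique.filter⁺ Q? (unique e)
  ; sound    = λ x∈ → map₁ (sound e) (∈-filter⁻ Q? x∈)
  ; complete = λ (p , q) → ∈-filter⁺ Q? (complete e p) q }

data Image₂ {A B C : Set} (f : A → B → C) (P : A → Set) (Q : B → Set) : C → Set where
  image₂ : ∀ {a b} → P a → Q b → Image₂ f P Q (f a b)

enumerates-product : ∀ {A B C : Set} {xs : List A} {ys : List B} {P Q} (f : A → B → C) →
  (∀ {a b c d} → f a b ≡ f c d → a ≡ c × b ≡ d) → Enumerates xs P → Enumerates ys Q →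
  Enumerates (cartesianProductWith f xs ys) (Image₂ f P Q)
enumerates-product {xs = xs} {ys} {P} {Q} f inj ex ey = record
  { unique   = Unique.cartesianProductWith⁺ f inj (unique ex) (unique ey)
  ; sound    = into
  ; complete = λ { (image₂ p q) → ∈-cartesianProductWith⁺ f (complete ex p) (complete ey q) } }
  where
  into : ∀ {z} → z ∈ cartesianProductWith f xs ys → Image₂ f P Q z
  into z∈ with a , b , a∈ , b∈ , refl ← ∈-cartesianProductWith⁻ f xs ys z∈ = image₂ (sound ex a∈) (sound ey b∈)

-- The value of k recovers the index x from an element of f x.
enumerates-concatMap : ∀ {A B : Set} {xs : List A} {P : A → Set} {Q : B → Set} (f : A → List B) (k : B → A) →
  Enumerates xs P → (∀ {x} → P x → Enumerates (f x) (λ y → k y ≡ x × Q y)) →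
  Enumerates (concatMap f xs) (λ y → P (k y) × Q y)
enumerates-concatMap {xs = xs} {P} {Q} f k ex ef = record
  { unique   = distinct (All.tabulate (sound ex)) (unique ex)
  ; sound    = into
  ; complete = λ (p , q) → ∈-concatMap⁺ f (lose (complete ex p) (complete (ef p) (refl , q))) }
  where
  into : ∀ {y} → y ∈ concatMap f xs → P (k y) × Q y
  into y∈ with x , x∈ , y∈fx ← find (∈-concatMap⁻ f {xs = xs} y∈) with refl , q ← sound (ef (sound ex x∈)) y∈fx =
    sound ex x∈ , q
  distinct : ∀ {xs} → All P xs → Unique xs → Unique (concatMap f xs)
  distinct []       []      = []
  distinct {x ∷ xs} (p ∷ ps) (n ∷ u) = Unique.++⁺ (unique (ef p)) (distinct ps u) disjoint
    where
    disjoint : ∀ {y} → ¬ (y ∈ f x × y ∈ concatMap f xs)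
    disjoint (y∈ , y∈′) with x′ , x′∈ , y∈fx′ ← find (∈-concatMap⁻ f {xs = xs} y∈′) =
      All.lookup n x′∈ (trans (sym (proj₁ (sound (ef p) y∈))) (proj₁ (sound (ef (All.lookup ps x′∈)) y∈fx′)))

enumerates-interval : ∀ b → Enumerates (interval 0 b) (λ x → 1 ≤ x × x ≤ b)
enumerates-interval b = record
  { unique   = Unique.map⁺ suc-injective (Unique.upTo⁺ b)
  ; sound    = into
  ; complete = λ { {suc x} (_ , x<b) → ∈-map⁺ suc (∈-applyUpTo⁺ id x<b) } }
  where
  into : ∀ {x} → x ∈ interval 0 b → 1 ≤ x × x ≤ b
  into x∈ with k , k∈ , refl ← ∈-map⁻ suc x∈ with i , i< , refl ← ∈-applyUpTo⁻ id k∈ = s≤s z≤n , i<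

-- Tableaux as lists of rows

Entries : ℕ → ℕ → Set
Entries N a = 1 ≤ a × a ≤ N

enumerates-fillings : ∀ N us → Enumerates (fillings N us) (λ T → map proj₁ T ≡ us × All (Entries N) (readingWord T))
enumerates-fillings N []       = record
  { unique = [] ∷ [] ; sound = λ { (here refl) → refl , [] } ; complete = λ { {[]} _ → here refl } }
enumerates-fillings N (u ∷ us) = enumerates-resp
  (enumerates-product (λ a T → (u , a) ∷ T) (λ { refl → refl , refl }) (enumerates-interval N) (enumerates-fillings N us))
  (λ { (image₂ p (refl , ps)) → refl , p ∷ ps })
  (λ { {(u , a) ∷ T} (refl , p ∷ ps) → image₂ p (refl , ps) })

enumerates-ssyt : ∀ N S → Enumerates (ssyt N S)
  (λ T → (map proj₁ T ≡ cells S × All (Entries N) (readingWord T)) × Semistandard T)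
enumerates-ssyt N S = enumerates-filter semistandard? (enumerates-fillings N (cells S))

rowEntries : ℕ → ℕ → List ℕ → Filling
rowEntries r c []      = []
rowEntries r c (x ∷ l) = ((r , c) , x) ∷ rowEntries r (suc c) l

fillingOf : ℕ → List (List ℕ) → Filling
fillingOf r []      = []
fillingOf r (l ∷ X) = fillingOf (suc r) X ++ rowEntries r 1 l

readingWord-rowEntries : ∀ r c l → readingWord (rowEntries r c l) ≡ l
readingWord-rowEntries r c []      = refl
readingWord-rowEntries r c (x ∷ l) = cong (x ∷_) (readingWord-rowEntries r (suc c) l)

readingWord-fillingOf : ∀ r X → readingWord (fillingOf r X) ≡ rowWord X
readingWord-fillingOf r []      = refl
readingWord-fillingOf r (l ∷ X) = trans (List.map-++ proj₂ (fillingOf (suc r) X) _)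
  (cong₂ _++_ (readingWord-fillingOf (suc r) X) (readingWord-rowEntries r 1 l))

cells-rowEntries : ∀ r c l → map proj₁ (rowEntries r c l) ≡ map (r ,_) (up c (length l))
cells-rowEntries r c []      = refl
cells-rowEntries r c (x ∷ l) = cong (_ ∷_) (cells-rowEntries r (suc c) l)

cells-fillingOf : ∀ r X → map proj₁ (fillingOf r X) ≡ cellsFrom r (map length X) []
cells-fillingOf r []      = refl
cells-fillingOf r (l ∷ X) = trans (List.map-++ proj₁ (fillingOf (suc r) X) _)
  (cong₂ _++_ (cells-fillingOf (suc r) X) (trans (cells-rowEntries r 1 l) (cong (map (r ,_)) (sym (interval-up (length l))))))

rowEntries-surjective : ∀ r c n T → map proj₁ T ≡ map (r ,_) (up c n) → ∃ λ l → T ≡ rowEntries r c l × length l ≡ n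
rowEntries-surjective r c zero    []            e = [] , refl , refl
rowEntries-surjective r c (suc n) ((u , x) ∷ T) e
  with refl ← List.∷-injectiveˡ e
  with l , refl , refl ← rowEntries-surjective r (suc c) n T (List.∷-injectiveʳ e) = x ∷ l , refl , refl

fillingOf-surjective : ∀ r ρ T → map proj₁ T ≡ cellsFrom r ρ [] → ∃ λ X → T ≡ fillingOf r X × map length X ≡ ρ
fillingOf-surjective r []      [] e = [] , refl , refl
fillingOf-surjective r (a ∷ ρ) T  e
  with T₁ , T₂ , refl , e₁ , e₂ ← map-++⁻ proj₁ T {cellsFrom (suc r) ρ []} e
  with X , refl , refl ← fillingOf-surjective (suc r) ρ T₁ e₁
  with l , refl , refl ← rowEntries-surjective r 1 a T₂ (trans e₂ (cong (map (r ,_)) (interval-up a))) = l ∷ X , refl , refl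

++-injective : ∀ {A : Set} (xs us : List A) {ys vs} → length xs ≡ length us → xs ++ ys ≡ us ++ vs → xs ≡ us × ys ≡ vs
++-injective []       []       _ e = refl , e
++-injective (x ∷ xs) (u ∷ us) l e with refl , f ← ++-injective xs us (suc-injective l) (List.∷-injectiveʳ e) =
  cong (_∷ xs) (List.∷-injectiveˡ e) , f

length-rowWord : ∀ X → length (rowWord X) ≡ sum (map length X)
length-rowWord X = trans (Perm.↭-length (rowWord-↭ X)) (length-concat X)

rowWord-injective : ∀ X Y → map length X ≡ map length Y → rowWord X ≡ rowWord Y → X ≡ Y
rowWord-injective []      []      _ _ = refl
rowWord-injective (l ∷ X) (k ∷ Y) h e
  with f , refl ← ++-injective (rowWord X) (rowWord Y) (trans (length-rowWord X) (trans (cong sum (List.∷-injectiveʳ h)) (sym (length-rowWord Y)))) e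
  = cong (l ∷_) (rowWord-injective X Y (List.∷-injectiveʳ h) f)

fillingOf-injective : ∀ r X Y → map length X ≡ map length Y → fillingOf r X ≡ fillingOf r Y → X ≡ Y
fillingOf-injective r X Y h e = rowWord-injective X Y h
  (trans (sym (readingWord-fillingOf r X)) (trans (cong readingWord e) (readingWord-fillingOf r Y)))

data Nth {A : Set} : List A → ℕ → A → Set where
  here  : ∀ {x l} → Nth (x ∷ l) 0 x
  there : ∀ {x y l i} → Nth l i y → Nth (x ∷ l) (suc i) y

nth-unique : ∀ {A : Set} {l : List A} {i x y} → Nth l i x → Nth l i y → x ≡ y
nth-unique here      here      = refl
nth-unique (there p) (there q) = nth-unique p q

-- The entry in row i and column j, both counted from 0.
data At : List (List ℕ) → ℕ → ℕ → ℕ → Set where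
  top   : ∀ {l X j a} → Nth l j a → At (l ∷ X) 0 j a
  below : ∀ {l X i j a} → At X i j a → At (l ∷ X) (suc i) j a

nth⇒∈ : ∀ {l j a} r c → Nth l j a → ((r , c + j) , a) ∈ rowEntries r c l
nth⇒∈                     r c here      = here (cong (λ c → (r , c) , _) (+-identityʳ c))
nth⇒∈ {x ∷ l} {suc j} {a} r c (there p) =
  there (subst (λ c′ → ((r , c′) , a) ∈ rowEntries r (suc c) l) (sym (+-suc c j)) (nth⇒∈ r (suc c) p))

at⇒∈ : ∀ {X i j a} r → At X i j a → ((r + i , suc j) , a) ∈ fillingOf r X
at⇒∈ {l ∷ X} {zero}  {j} {a} r (top p)   = Any.++⁺ʳ (fillingOf (suc r) X)
  (subst (λ r′ → ((r′ , suc j) , a) ∈ rowEntries r 1 l) (sym (+-identityʳ r)) (nth⇒∈ r 1 p))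
at⇒∈ {l ∷ X} {suc i} {j} {a} r (below p) = Any.++⁺ˡ
  (subst (λ r′ → ((r′ , suc j) , a) ∈ fillingOf (suc r) X) (sym (+-suc r i)) (at⇒∈ (suc r) p))

∈⇒nth : ∀ {u a} r c l → (u , a) ∈ rowEntries r c l → ∃ λ j → u ≡ (r , c + j) × Nth l j a
∈⇒nth r c (x ∷ l) (here refl) = 0 , cong (r ,_) (sym (+-identityʳ c)) , here
∈⇒nth r c (x ∷ l) (there x∈) with j , refl , p ← ∈⇒nth r (suc c) l x∈ =
  suc j , cong (r ,_) (sym (+-suc c j)) , there p

∈⇒at : ∀ {u a} r X → (u , a) ∈ fillingOf r X → ∃₂ λ i j → u ≡ (r + i , suc j) × At X i j a
∈⇒at r (l ∷ X) x∈ with Any.++⁻ (fillingOf (suc r) X) x∈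
... | inj₁ x∈′ with i , j , refl , p ← ∈⇒at (suc r) X x∈′ = suc i , j , cong (_, suc j) (sym (+-suc r i)) , below p
... | inj₂ x∈′ with j , refl , p ← ∈⇒nth r 1 l x∈′ = 0 , j , cong (_, suc j) (sym (+-identityʳ r)) , top p

over-nth : ∀ {R l k j b} → Over R l k → Nth k j b → ∃ λ a → Nth l j a × R a b
over-nth (r ∷ o) here      = _ , here , r
over-nth (_ ∷ o) (there p) with a , q , r ← over-nth o p = a , there q , r

over-below : ∀ {l X i j b} → Over _<_ l (firstLine X) → Rows X → At X i j b → ∃ λ a → Nth l j a × a < b
over-below o t              (top p)   = over-nth o p
over-below o (line _ o′ t) (below p) with e , q , e<b ← over-below o′ t p with a , q′ , a<e ← over-nth o q =
  a , q′ , <-trans a<e e<b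

at-row : ∀ {X i j j′ a b} → Rows X → At X i j a → At X i j′ b → j < j′ → a ≤ b
at-row (line is _ _) (top p)   (top q)   h = nth-sorted is p q h
  where
  nth-all : ∀ {P : ℕ → Set} {l j a} → All P l → Nth l j a → P a
  nth-all (p ∷ _)  here      = p
  nth-all (_ ∷ ps) (there q) = nth-all ps q
  nth-sorted : ∀ {l j j′ a b} → AllPairs _≤_ l → Nth l j a → Nth l j′ b → j < j′ → a ≤ b
  nth-sorted (h ∷ _)  here      (there q) _       = nth-all h q
  nth-sorted (_ ∷ is) (there p) (there q) (s≤s h) = nth-sorted is p q h
at-row (line _ _ t)  (below p) (below q) h = at-row t p q h

at-column : ∀ {X i i′ j a b} → Rows X → At X i j a → At X i′ j b → i < i′ → a < b
at-column (line _ o t) (top p)   (below q) _       with a , p′ , a<b ← over-below o t q with refl ← nth-unique p p′ =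
  a<b
at-column (line _ _ t) (below p) (below q) (s≤s h) = at-column t p q h

rows⇒semistandard : ∀ {X} → Rows X → Semistandard (fillingOf 1 X)
rows⇒semistandard {X} t = All.tabulate λ x∈ → All.tabulate λ y∈ → compatible x∈ y∈
  where
  compatible : ∀ {x y} → x ∈ fillingOf 1 X → y ∈ fillingOf 1 X → Compatible x y
  compatible x∈ y∈ with i , j , refl , p ← ∈⇒at 1 X x∈ | i′ , j′ , refl , q ← ∈⇒at 1 X y∈ =
    (λ { refl h → at-row t p q (s≤s⁻¹ h) }) , (λ { refl h → at-column t p q (s≤s⁻¹ h) })

semistandard⇒rows : ∀ X → WeaklyDecreasing (map length X) → Semistandard (fillingOf 1 X) → Rows X
semistandard⇒rows X d s = build X d
  (λ p q h → proj₁ (compatible p q) refl (s≤s h)) (λ p q h → proj₂ (compatible p q) refl (s≤s h))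
  where
  compatible : ∀ {i j i′ j′ a b} → At X i j a → At X i′ j′ b →
    Compatible ((suc i , suc j) , a) ((suc i′ , suc j′) , b)
  compatible p q = All.lookup (All.lookup s (at⇒∈ 1 p)) (at⇒∈ 1 q)
  sorted : ∀ l → (∀ {j j′ a b} → Nth l j a → Nth l j′ b → j < j′ → a ≤ b) → AllPairs _≤_ l
  sorted []      h = []
  sorted (x ∷ l) h =
    first l (λ q → h here (there q) (s≤s z≤n)) ∷ sorted l (λ p q j<j′ → h (there p) (there q) (s≤s j<j′))
    where
    first : ∀ {x} l → (∀ {j b} → Nth l j b → x ≤ b) → All (x ≤_) l
    first []      h = []
    first (y ∷ l) h = h here ∷ first l (h ∘ there)
  over : ∀ l k → length k ≤ length l → (∀ {j a b} → Nth l j a → Nth k j b → a < b) → Over _<_ l k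
  over l       []      _       h = []
  over (x ∷ l) (y ∷ k) (s≤s e) h = h here here ∷ over l k e (λ p q → h (there p) (there q))
  build : ∀ X → WeaklyDecreasing (map length X) → (∀ {i j j′ a b} → At X i j a → At X i j′ b → j < j′ → a ≤ b) →
          (∀ {i i′ j a b} → At X i j a → At X i′ j b → i < i′ → a < b) → Rows X
  build []          d h v = []
  build (l ∷ [])    d h v = line (sorted l (λ p q → h (top p) (top q))) [] []
  build (l ∷ k ∷ X) d h v = line (sorted l (λ p q → h (top p) (top q)))
    (over l k (d 0) (λ p q → v (top p) (below (top q)) (s≤s z≤n)))
    (build (k ∷ X) (d ∘ suc) (λ p q → h (below p) (below q)) (λ p q i<i′ → v (below p) (below q) (s≤s i<i′)))

record Tableau (N : ℕ) (ρ : List ℕ) (T : Filling) : Set where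
  constructor tableau
  field
    {lines}  : List (List ℕ)
    filling  : T ≡ fillingOf 1 lines
    lengths  : map length lines ≡ ρ
    rows     : Rows lines
    entries  : All (All (Entries N)) lines

enumerates-tableaux : ∀ N ρ → WeaklyDecreasing ρ → Enumerates (ssyt N (ρ ╱ [])) (Tableau N ρ)
enumerates-tableaux N ρ d = enumerates-resp (enumerates-ssyt N (ρ ╱ [])) into from
  where
  rowWord-all : ∀ {P : ℕ → Set} X → All P (rowWord X) → All (All P) X
  rowWord-all X = All.concat⁻ ∘ Perm.All-resp-↭ (rowWord-↭ X)
  into : ∀ {T} → (map proj₁ T ≡ cells (ρ ╱ []) × All (Entries N) (readingWord T)) × Semistandard T → Tableau N ρ T
  into {T} ((c , b) , s) with X , refl , refl ← fillingOf-surjective 1 ρ T c =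
    tableau refl refl (semistandard⇒rows X d s)
      (rowWord-all X (subst (All (Entries N)) (readingWord-fillingOf 1 X) b))
  from : ∀ {T} → Tableau N ρ T → (map proj₁ T ≡ cells (ρ ╱ []) × All (Entries N) (readingWord T)) × Semistandard T
  from (tableau {X} refl refl t b) = (cells-fillingOf 1 X ,
    subst (All (Entries N)) (sym (readingWord-fillingOf 1 X))
      (Perm.All-resp-↭ (↭-sym (rowWord-↭ X)) (All.concat⁺ b))) , rows⇒semistandard t

-- Rows of bits as lists of columns

data Partition : ℕ → List ℕ → Set where
  []  : ∀ {m} → Partition m []
  _∷_ : ∀ {m a ρ} → 1 ≤ a × a ≤ m → Partition a ρ → Partition m (a ∷ ρ)

partition-decreasing : ∀ {m ρ} → Partition m ρ → WeaklyDecreasing ρ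
partition-decreasing []              i       = z≤n
partition-decreasing (_ ∷ [])        i       = z≤n
partition-decreasing (_ ∷ (h ∷ _))   zero    = proj₂ h
partition-decreasing (_ ∷ p@(_ ∷ _)) (suc i) = partition-decreasing p i

headOr0 : List ℕ → ℕ
headOr0 []      = 0
headOr0 (a ∷ _) = a

enumerates-inBox : ∀ k m → Enumerates (inBox k m) (λ ρ → length ρ ≤ k × Partition m ρ)
enumerates-inBox zero    m = record
  { unique = [] ∷ [] ; sound = λ { (here refl) → z≤n , [] } ; complete = λ { {[]} _ → here refl } }
enumerates-inBox (suc k) m = record
  { unique   = All.tabulate (λ ρ∈ e → nonempty (subst (_∈ _) (sym e) ρ∈)) ∷ unique longer
  ; sound    = λ { (here refl) → z≤n , [] ; (there ρ∈) → into (sound longer ρ∈) }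
  ; complete = λ { {[]} _ → here refl ; {a ∷ ρ} (s≤s h , b ∷ p) → there (complete longer (b , h , p)) } }
  where
  Longer : List ℕ → Set
  Longer []      = ⊥
  Longer (a ∷ ρ) = length ρ ≤ k × Partition a ρ
  tails-of : ∀ a → Enumerates (map (a ∷_) (inBox k a)) (λ ρ → headOr0 ρ ≡ a × Longer ρ)
  tails-of a = record
    { unique   = Unique.map⁺ List.∷-injectiveʳ (unique (enumerates-inBox k a))
    ; sound    = λ ρ∈ → extract′ (∈-map⁻ (a ∷_) ρ∈)
    ; complete = λ { {_ ∷ ρ} (refl , h) → ∈-map⁺ (a ∷_) (complete (enumerates-inBox k a) h) } }
    where
    extract′ : ∀ {ρ} → (∃ λ σ → σ ∈ inBox k a × ρ ≡ a ∷ σ) → headOr0 ρ ≡ a × Longer ρ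
    extract′ (σ , σ∈ , refl) = refl , sound (enumerates-inBox k a) σ∈
  longer : Enumerates (concatMap (λ a → map (a ∷_) (inBox k a)) (interval 0 m)) (λ ρ → (1 ≤ headOr0 ρ × headOr0 ρ ≤ m) × Longer ρ)
  longer = enumerates-concatMap _ headOr0 (enumerates-interval m) (λ {a} _ → tails-of a)
  nonempty : ¬ ([] ∈ concatMap (λ a → map (a ∷_) (inBox k a)) (interval 0 m))
  nonempty ∈ = proj₂ (sound longer ∈)
  into : ∀ {ρ} → (1 ≤ headOr0 ρ × headOr0 ρ ≤ m) × Longer ρ → length ρ ≤ suc k × Partition m ρ
  into {a ∷ ρ} (b , h , p) = s≤s h , b ∷ p

partition-length : ∀ {m ρ} → Partition m ρ → length ρ ≤ sum ρ
partition-length []      = z≤n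
partition-length (h ∷ p) = +-mono-≤ (proj₁ h) (partition-length p)

partition-head : ∀ {m ρ} → Partition m ρ → Partition (sum ρ) ρ
partition-head []            = []
partition-head ((h , _) ∷ p) = (h , m≤m+n _ _) ∷ p

-- Positive parts with sum n are at most n in number and in size, so the box misses none.
enumerates-partitions : ∀ n → Enumerates (partitions n) (λ ρ → (∃ λ m → Partition m ρ) × sum ρ ≡ n)
enumerates-partitions n = enumerates-resp (enumerates-filter (λ ρ → sum ρ ≟ n) (enumerates-inBox n n))
  (λ ((_ , p) , e) → (n , p) , e)
  (λ { ((m , p) , refl) → (partition-length p , partition-head p) , refl })

conjugate-decreasing : ∀ ρ → WeaklyDecreasing (conjugate ρ)
conjugate-decreasing ρ = subst WeaklyDecreasing (sym (conjugate-columnLengths ρ)) (go (largest ρ) ρ)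
  where
  shrink : ∀ ρ → atLeast 1 (map pred ρ) ≤ atLeast 1 ρ
  shrink []                = z≤n
  shrink (zero ∷ ρ)        = shrink ρ
  shrink (suc zero ∷ ρ)    = m≤n⇒m≤1+n (shrink ρ)
  shrink (suc (suc x) ∷ ρ) = s≤s (shrink ρ)
  go : ∀ k ρ → WeaklyDecreasing (columnLengths k ρ)
  go zero          ρ i       = z≤n
  go (suc zero)    ρ i       = z≤n
  go (suc (suc k)) ρ zero    = shrink ρ
  go (suc (suc k)) ρ (suc i) = go (suc k) (map pred ρ) i

lettersFrom : ∀ {n} → ℕ → Vec Bool n → List ℕ
lettersFrom k []          = []
lettersFrom k (true ∷ b)  = k ∷ lettersFrom (suc k) b
lettersFrom k (false ∷ b) = lettersFrom (suc k) b

lettersFrom-bounds : ∀ {n} k (b : Vec Bool n) → All (λ x → k ≤ x × x < k + n) (lettersFrom k b)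
lettersFrom-bounds         k []      = []
lettersFrom-bounds {suc n} k (c ∷ b) = bounds c
  where
  rest : All (λ x → k ≤ x × x < k + suc n) (lettersFrom (suc k) b)
  rest = All.map (λ (k<x , x<) → <⇒≤ k<x , ≤-trans x< (≤-reflexive (sym (+-suc k n)))) (lettersFrom-bounds (suc k) b)
  bounds : ∀ c → All (λ x → k ≤ x × x < k + suc n) (lettersFrom k (c ∷ b))
  bounds true  = (≤-refl , m<m+n k (s≤s z≤n)) ∷ rest
  bounds false = rest

lettersFrom-above : ∀ {n} k (b : Vec Bool n) → All (k ≤_) (lettersFrom k b)
lettersFrom-above k b = All.map proj₁ (lettersFrom-bounds k b)

lettersFrom-increasing : ∀ {n} k (b : Vec Bool n) → Increasing (lettersFrom k b)
lettersFrom-increasing k []          = []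
lettersFrom-increasing k (true ∷ b)  = lettersFrom-above (suc k) b ∷ lettersFrom-increasing (suc k) b
lettersFrom-increasing k (false ∷ b) = lettersFrom-increasing (suc k) b

lettersFrom-injective : ∀ {n} k (b b′ : Vec Bool n) → lettersFrom k b ≡ lettersFrom k b′ → b ≡ b′
lettersFrom-injective k []          []           e = refl
lettersFrom-injective k (true ∷ b)  (true ∷ b′)  e =
  cong (true ∷_) (lettersFrom-injective (suc k) b b′ (List.∷-injectiveʳ e))
lettersFrom-injective k (false ∷ b) (false ∷ b′) e = cong (false ∷_) (lettersFrom-injective (suc k) b b′ e)
lettersFrom-injective k (true ∷ b)  (false ∷ b′) e =
  contradiction (All.head (subst (All (suc k ≤_)) (sym e) (lettersFrom-above (suc k) b′))) 1+n≰n
lettersFrom-injective k (false ∷ b) (true ∷ b′)  e =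
  contradiction (All.head (subst (All (suc k ≤_)) e (lettersFrom-above (suc k) b))) 1+n≰n

lettersFrom-surjective : ∀ n k E → Increasing E → All (λ x → k ≤ x × x < k + n) E → ∃ λ (b : Vec Bool n) →
  lettersFrom k b ≡ E
lettersFrom-surjective zero    k []      _         _ = [] , refl
lettersFrom-surjective zero    k (x ∷ E) _         ((k≤x , x<k+0) ∷ _) =
  contradiction k≤x (<⇒≱ (≤-trans x<k+0 (≤-reflexive (+-identityʳ k))))
lettersFrom-surjective (suc n) k []      _         _ with b , e ← lettersFrom-surjective n (suc k) [] [] [] =
  false ∷ b , e
lettersFrom-surjective (suc n) k (x ∷ E) (x< ∷ is) (h ∷ hs) with k ≟ x
... | yes refl with b , refl ← lettersFrom-surjective n (suc k) E is
      (All.zipWith (λ (k<y , (_ , y<)) → k<y , ≤-trans y< (≤-reflexive (+-suc k n))) (x< , hs)) = true ∷ b , refl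
... | no k≢x with k<x ← ≤∧≢⇒< (proj₁ h) k≢x with b , e ← lettersFrom-surjective n (suc k) (x ∷ E) (x< ∷ is)
      (All.zipWith (λ (k<y , (_ , y<)) → k<y , ≤-trans y< (≤-reflexive (+-suc k n)))
        (k<x ∷ All.map (<-trans k<x) x< , h ∷ hs)) = false ∷ b , e

-- The column of the 0-1 matrix for the letter e is the set of the strips that contain e. These sets
-- are what the correspondence inserts, so T has the strips as its letters and P the original
-- letters.
columns : ∀ {N n} → Vec (Vec Bool N) n → List (List ℕ)
columns {zero}  V = []
columns {suc N} V = lettersFrom 1 (Vec.map Vec.head V) ∷ columns (Vec.map Vec.tail V)

length-columns : ∀ {N n} (V : Vec (Vec Bool N) n) → length (columns V) ≡ N
length-columns {zero}  V = refl
length-columns {suc N} V = cong suc (length-columns (Vec.map Vec.tail V))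

columns-increasing : ∀ {N n} (V : Vec (Vec Bool N) n) → All Increasing (columns V)
columns-increasing {zero}  V = []
columns-increasing {suc N} V = lettersFrom-increasing 1 (Vec.map Vec.head V) ∷ columns-increasing (Vec.map Vec.tail V)

columns-bounds : ∀ {N n} (V : Vec (Vec Bool N) n) → All (All (Entries n)) (columns V)
columns-bounds {zero}  V = []
columns-bounds {suc N} V =
  All.map (map₂ s≤s⁻¹) (lettersFrom-bounds 1 (Vec.map Vec.head V)) ∷ columns-bounds (Vec.map Vec.tail V)

cons-columns : ∀ {N n} → Vec Bool n → Vec (Vec Bool N) n → Vec (Vec Bool (suc N)) n
cons-columns = zipWith _∷_

head-cons : ∀ {N n} (b : Vec Bool n) (V : Vec (Vec Bool N) n) → Vec.map Vec.head (cons-columns b V) ≡ b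
head-cons []      []      = refl
head-cons (c ∷ b) (v ∷ V) = cong (c ∷_) (head-cons b V)

tail-cons : ∀ {N n} (b : Vec Bool n) (V : Vec (Vec Bool N) n) → Vec.map Vec.tail (cons-columns b V) ≡ V
tail-cons []      []      = refl
tail-cons (c ∷ b) (v ∷ V) = cong (v ∷_) (tail-cons b V)

cons-head-tail : ∀ {N n} (V : Vec (Vec Bool (suc N)) n) → cons-columns (Vec.map Vec.head V) (Vec.map Vec.tail V) ≡ V
cons-head-tail []            = refl
cons-head-tail ((c ∷ v) ∷ V) = cong ((c ∷ v) ∷_) (cons-head-tail V)

columns-injective : ∀ {N n} (V W : Vec (Vec Bool N) n) → columns V ≡ columns W → V ≡ W
columns-injective {zero}  V W e = empty-rows V W
  where
  empty-rows : ∀ {n} (V W : Vec (Vec Bool 0) n) → V ≡ W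
  empty-rows []       []       = refl
  empty-rows ([] ∷ V) ([] ∷ W) = cong ([] ∷_) (empty-rows V W)
columns-injective {suc N} V W e = trans (sym (cons-head-tail V)) (trans (cong₂ cons-columns
  (lettersFrom-injective 1 _ _ (List.∷-injectiveˡ e))
    (columns-injective _ _ (List.∷-injectiveʳ e))) (cons-head-tail W))

columns-surjective : ∀ N n Es → length Es ≡ N → All Increasing Es → All (All (Entries n)) Es →
                     ∃ λ (V : Vec (Vec Bool N) n) → columns V ≡ Es
columns-surjective zero    n []       refl []        []       = Vec.replicate n [] , refl
columns-surjective (suc N) n (E ∷ Es) h    (is ∷ iss) (b ∷ bs)
  with V , refl ← columns-surjective N n Es (suc-injective h) iss bs
  with v , refl ← lettersFrom-surjective n 1 E is (All.map (map₂ s≤s) b) =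
  cons-columns v V , cong₂ (λ b V → lettersFrom 1 b ∷ columns V) (head-cons v V) (tail-cons v V)

count-lettersFrom : ∀ {n} k (b : Vec Bool n) i → count (k + toℕ i) (lettersFrom k b) ≡ bit (lookup b i)
count-lettersFrom k (c ∷ b)     zero rewrite +-identityʳ k = first c
  where
  absent : count k (lettersFrom (suc k) b) ≡ 0
  absent = count-none (All.map >⇒≢ (lettersFrom-above (suc k) b))
  first : ∀ c → count k (lettersFrom k (c ∷ b)) ≡ bit c
  first true  = trans (count-here k _) (cong suc absent)
  first false = absent
count-lettersFrom k (true ∷ b)  (suc i) =
  trans (count-there {k + suc (toℕ i)} {k} (lettersFrom (suc k) b) (<⇒≢ (m<m+n k (s≤s z≤n))))
        (trans (cong (λ a → count a (lettersFrom (suc k) b)) (+-suc k (toℕ i))) (count-lettersFrom (suc k) b i))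
count-lettersFrom k (false ∷ b) (suc i) =
  trans (cong (λ a → count a (lettersFrom (suc k) b)) (+-suc k (toℕ i))) (count-lettersFrom (suc k) b i)

count-columns : ∀ {N n} (V : Vec (Vec Bool N) n) i → count (suc (toℕ i)) (concat (columns V)) ≡ ones (lookup V i)
count-columns {zero}  V i with [] ← lookup V i = refl
count-columns {suc N} V i = begin
  count (suc (toℕ i)) (lettersFrom 1 (Vec.map Vec.head V) ++ concat (columns (Vec.map Vec.tail V)))
    ≡⟨ count-++ (suc (toℕ i)) (lettersFrom 1 (Vec.map Vec.head V)) _ ⟩
  count (suc (toℕ i)) (lettersFrom 1 (Vec.map Vec.head V)) + count (suc (toℕ i))
    (concat (columns (Vec.map Vec.tail V)))
    ≡⟨ cong₂ _+_ (count-lettersFrom 1 (Vec.map Vec.head V) i) (count-columns (Vec.map Vec.tail V) i) ⟩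
  bit (lookup (Vec.map Vec.head V) i) + ones (lookup (Vec.map Vec.tail V) i)
    ≡⟨ cong₂ (λ c v → bit c + ones v) (Vec.lookup-map i Vec.head V) (Vec.lookup-map i Vec.tail V) ⟩
  bit (Vec.head (lookup V i)) + ones (Vec.tail (lookup V i))
    ≡⟨ uncons (lookup V i) ⟩
  ones (lookup V i) ∎
  where
  open ≡-Reasoning
  uncons : ∀ {N} (v : Vec Bool (suc N)) → bit (Vec.head v) + ones (Vec.tail v) ≡ ones v
  uncons (c ∷ v) = refl

weight-columns : ∀ {N n} (V : Vec (Vec Bool N) n) → weight n (concat (columns V)) ≡ Vec.map ones V
weight-columns V =
  trans
    (Vec.tabulate-cong (λ i → trans (count-columns V i) (sym (Vec.lookup-map i ones V)))) (Vec.tabulate∘lookup (Vec.map ones V))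

length-lettersFrom : ∀ {n} k (b : Vec Bool n) → length (lettersFrom k b) ≡ ones b
length-lettersFrom k []          = refl
length-lettersFrom k (true ∷ b)  = cong suc (length-lettersFrom (suc k) b)
length-lettersFrom k (false ∷ b) = length-lettersFrom (suc k) b

letterTotals-∷ : ∀ {N n} (V : Vec (Vec Bool (suc N)) n) →
  letterTotals V ≡ ones (Vec.map Vec.head V) ∷ letterTotals (Vec.map Vec.tail V)
letterTotals-∷ []            = refl
letterTotals-∷ ((c ∷ v) ∷ V) = cong (zipWith _+_ (Vec.map bit (c ∷ v))) (letterTotals-∷ V)

letterTotals-columns : ∀ {N n} (V : Vec (Vec Bool N) n) →
  letterTotals V ≡ tabulate (λ i → part (map length (columns V)) (toℕ i))
letterTotals-columns {zero}  V with [] ← letterTotals V = refl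
letterTotals-columns {suc N} V = trans (letterTotals-∷ V)
  (cong₂ _∷_ (sym (length-lettersFrom 1 (Vec.map Vec.head V))) (letterTotals-columns (Vec.map Vec.tail V)))

part-snoc-< : ∀ xs y {i} → i < length xs → part (xs ++ y ∷ []) i ≡ part xs i
part-snoc-< (x ∷ xs) y {zero}  _       = refl
part-snoc-< (x ∷ xs) y {suc i} (s≤s h) = part-snoc-< xs y h

part-snoc-≡ : ∀ xs y → part (xs ++ y ∷ []) (length xs) ≡ y
part-snoc-≡ []       y = refl
part-snoc-≡ (x ∷ xs) y = part-snoc-≡ xs y

part-length : ∀ xs {i} → length xs ≤ i → part xs i ≡ 0
part-length []       _               = refl
part-length (x ∷ xs) {suc i} (s≤s h) = part-length xs h

-- `Ds` lists the columns last first, so label i + 1 belongs to entry i, counted from 0, of the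
-- reversed list.
count-labels : ∀ Ds i → count (suc i) (labels Ds) ≡ part (map length (reverse Ds)) i
count-labels []       i = refl
count-labels (D ∷ Ds) i = begin
  count (suc i) (labels Ds ++ replicate (length D) (suc (length Ds)))
    ≡⟨ count-++ (suc i) (labels Ds) _ ⟩
  count (suc i) (labels Ds) + count (suc i) (replicate (length D) (suc (length Ds)))
    ≡⟨ cong (_+ count (suc i) (replicate (length D) (suc (length Ds)))) (count-labels Ds i) ⟩
  part ρ i + count (suc i) (replicate (length D) (suc (length Ds)))
    ≡⟨ last-part ⟩
  part (ρ ++ length D ∷ []) i
    ≡⟨ cong
      (λ σ → part σ i) (trans (cong (map length) (List.unfold-reverse D Ds)) (List.map-++ length (reverse Ds) _)) ⟨
  part (map length (reverse (D ∷ Ds))) i ∎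
  where
  open ≡-Reasoning
  ρ = map length (reverse Ds)
  len : length ρ ≡ length Ds
  len = trans (List.length-map length (reverse Ds)) (List.length-reverse Ds)
  last-part : part ρ i + count (suc i) (replicate (length D) (suc (length Ds))) ≡ part (ρ ++ length D ∷ []) i
  last-part with <-cmp i (length Ds)
  ... | tri< i< i≢ _ = trans (cong (part ρ i +_) (count-none (All.replicate⁺ (length D) (i≢ ∘ sym ∘ suc-injective))))
                             (trans (+-identityʳ _) (sym (part-snoc-< ρ (length D) (≤-trans i< (≤-reflexive (sym len))))))
  ... | tri≈ _ refl _ =
    trans (cong₂ _+_ (part-length ρ (≤-reflexive len)) (count-replicate (suc (length Ds)) (length D)))
                              (sym (trans (cong (part (ρ ++ length D ∷ [])) (sym len)) (part-snoc-≡ ρ (length D))))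
  ... | tri> _ i≢ i> =
    trans
      (cong₂ _+_ (part-length ρ (≤-trans (≤-reflexive len) (<⇒≤ i>))) (count-none (All.replicate⁺ (length D) (i≢ ∘ sym ∘ suc-injective))))
                             (sym (part-length (ρ ++ length D ∷ []) (≤-trans (≤-reflexive (trans (List.length-++ ρ) (trans (+-comm (length ρ) 1) (cong suc len)))) i>)))

weight-labels : ∀ {N n} (V : Vec (Vec Bool N) n) → weight N (labels (reverse (columns V))) ≡ letterTotals V
weight-labels V = trans (Vec.tabulate-cong (λ i → trans (count-labels (reverse (columns V)) (toℕ i))
  (cong (λ Es → part (map length Es) (toℕ i)) (List.reverse-involutive (columns V))))) (sym (letterTotals-columns V))

-- Reads the path as brackets, with a unmatched ones already present.
run : ∀ {n} → ℕ → Vec Step n → ℕ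
run a []      = a
run a (○ ∷ p) = run a p
run a (● ∷ p) = run a p
run a (↘ ∷ p) = run (suc a) p
run a (↗ ∷ p) = run (pred a) p

-- All but `peak p ∸ a` of the letters of the lower row cancel one of the a + `ones (uppers p)`
-- closing brackets.
run-peak : ∀ {n} a (p : Vec Step n) → run a p + ones (lowers p) ≡ (peak p ∸ a) + a + ones (uppers p)
run-peak zero    []      = refl
run-peak (suc a) []      = refl
run-peak a       (○ ∷ p) = run-peak a p
run-peak a       (● ∷ p) =
  trans (+-suc (run a p) _) (trans (cong suc (run-peak a p)) (sym (+-suc (peak p ∸ a + a) _)))
run-peak a       (↘ ∷ p) = trans (run-peak (suc a) p)
  (trans (cong (λ x → x + suc a + ones (uppers p)) (sym (∸-+-assoc (peak p) 1 a)))
         (trans (cong (_+ ones (uppers p)) (+-suc (peak p ∸ 1 ∸ a) a)) (sym (+-suc (peak p ∸ 1 ∸ a + a) _))))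
run-peak zero    (↗ ∷ p) = trans (+-suc (run 0 p) _) (cong suc (run-peak 0 p))
run-peak (suc a) (↗ ∷ p) =
  trans (+-suc (run a p) _) (trans (cong suc (run-peak a p)) (cong (_+ ones (uppers p)) (sym (+-suc (peak p ∸ a) a))))

act-reverse-∷ : ∀ j x E a → act j (reverse (x ∷ E)) a ≡ act j (reverse E) (act₁ j x a)
act-reverse-∷ j x E a = trans (cong (λ u → act j u a) (List.unfold-reverse x E)) (act-++ j (reverse E) (x ∷ []) a)

act-neutral : ∀ {j} w a → All (λ x → x ≢ j × x ≢ suc j) w → act j w a ≡ a
act-neutral []      a []             = refl
act-neutral (x ∷ w) a ((p , q) ∷ ps) = trans (act-other w a p q) (act-neutral w a ps)

-- In a reversed column the smallest letter acts first, so j + 1 cancels the j of the same column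
-- and the step ● has no effect.
act-letters : ∀ {N n} k (b : Vec Bool n) p q a (v : Vec Step N) → toℕ q ≡ suc (toℕ p) →
  run (act (k + toℕ p) (reverse (lettersFrom k b)) a) v ≡ run a ((lookup b p , lookup b q) ∷ v)
act-letters k (c ∷ c′ ∷ b) zero    (suc zero) a v _ rewrite +-identityʳ k = go c c′
  where
  E = lettersFrom (2 + k) b
  neutral-rest : ∀ a → act k (reverse E) a ≡ a
  neutral-rest a =
    act-neutral (reverse E) a (reverse-all (All.map (λ h → >⇒≢ (<⇒≤ h) , >⇒≢ h) (lettersFrom-above (2 + k) b)))
  go : ∀ c c′ → run (act k (reverse (lettersFrom k (c ∷ c′ ∷ b))) a) v ≡ run a ((c , c′) ∷ v)
  go false false = cong (λ a → run a v) (neutral-rest a)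
  go true  false = cong (λ a → run a v) (trans (act-reverse-∷ k k E a) (trans (neutral-rest _) (act₁-up k a)))
  go false true  = cong (λ a → run a v) (trans (act-reverse-∷ k (suc k) E a) (trans (neutral-rest _) (act₁-down k a)))
  go true  true  = cong (λ a → run a v) (trans (act-reverse-∷ k k (suc k ∷ E) a) (trans (act-reverse-∷ k (suc k) E _)
    (trans (neutral-rest _) (trans (act₁-down k _) (cong pred (act₁-up k a))))))
act-letters k (false ∷ b)  (suc p) (suc q)    a v e =
  trans
    (cong (λ j → run (act j (reverse (lettersFrom (suc k) b)) a) v) (+-suc k (toℕ p))) (act-letters (suc k) b p q a v (suc-injective e))
act-letters k (true ∷ b)   (suc p) (suc q)    a v e =
  trans (cong (λ a → run a v) (trans (act-reverse-∷ (k + suc (toℕ p)) k (lettersFrom (suc k) b) a)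
          (cong (act (k + suc (toℕ p)) (reverse (lettersFrom (suc k) b)))
                (act₁-other a (<⇒≢ k<) (<⇒≢ (m<n⇒m<1+n k<))))))
        (trans (cong (λ j → run (act j (reverse (lettersFrom (suc k) b)) a) v) (+-suc k (toℕ p))) (act-letters (suc k) b p q a v (suc-injective e)))
  where k< = m<m+n k (s≤s z≤n)

act-columns : ∀ {N n} (V : Vec (Vec Bool N) n) p q a → toℕ q ≡ suc (toℕ p) →
  act (suc (toℕ p)) (columnWord (reverse (columns V))) a ≡ run a (Vec.zip (lookup V p) (lookup V q))
act-columns {zero}  V p q a e with lookup V p | lookup V q
... | [] | [] = refl
act-columns {suc N} V p q a e = begin
  act j (columnWord (reverse (E ∷ Es))) a
    ≡⟨ cong (λ Ds → act j (columnWord Ds) a) (List.unfold-reverse E Es) ⟩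
  act j (columnWord (reverse Es ++ E ∷ [])) a
    ≡⟨ cong
      (λ w → act j w a) (trans (List.concatMap-++ reverse (reverse Es) (E ∷ [])) (cong (columnWord (reverse Es) ++_) (List.++-identityʳ (reverse E)))) ⟩
  act j (columnWord (reverse Es) ++ reverse E) a
    ≡⟨ act-++ j (columnWord (reverse Es)) (reverse E) a ⟩
  act j (columnWord (reverse Es)) (act j (reverse E) a)
    ≡⟨ act-columns (Vec.map Vec.tail V) p q (act j (reverse E) a) e ⟩
  run (act j (reverse E) a) (Vec.zip (lookup (Vec.map Vec.tail V) p) (lookup (Vec.map Vec.tail V) q))
    ≡⟨ act-letters 1 (Vec.map Vec.head V) p q a _ e ⟩
  run a
    ((lookup (Vec.map Vec.head V) p , lookup (Vec.map Vec.head V) q) ∷ Vec.zip (lookup (Vec.map Vec.tail V) p) (lookup (Vec.map Vec.tail V) q))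
    ≡⟨ cong (run a) (cong₂ _∷_ (cong₂ _,_ (Vec.lookup-map p Vec.head V) (Vec.lookup-map q Vec.head V))
                               (cong₂ Vec.zip (Vec.lookup-map p Vec.tail V) (Vec.lookup-map q Vec.tail V))) ⟩
  run a ((Vec.head (lookup V p) , Vec.head (lookup V q)) ∷ Vec.zip (Vec.tail (lookup V p)) (Vec.tail (lookup V q)))
    ≡⟨ cong (run a) (uncons (lookup V p) (lookup V q)) ⟩
  run a (Vec.zip (lookup V p) (lookup V q)) ∎
  where
  open ≡-Reasoning
  j = suc (toℕ p)
  E = lettersFrom 1 (Vec.map Vec.head V)
  Es = columns (Vec.map Vec.tail V)
  uncons : ∀ {N} (v w : Vec Bool (suc N)) →
    (Vec.head v , Vec.head w) ∷ Vec.zip (Vec.tail v) (Vec.tail w) ≡ Vec.zip v w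
  uncons (_ ∷ _) (_ ∷ _) = refl

sumAdjacent-sumTo : ∀ {N n} (f : ℕ → Vec Step N → ℕ) (ms : Vec ℕ n) (V : Vec (Vec Bool N) n) (g : ℕ → ℕ) →
  (∀ p q → toℕ q ≡ suc (toℕ p) → g (toℕ p) ≡ f (lookup ms p ∸ lookup ms q) (Vec.zip (lookup V p) (lookup V q))) →
  (∀ i → suc i ≡ n → g i ≡ 0) → sumTo n g ≡ sumAdjacent f ms V
sumAdjacent-sumTo f []             []            g h z = refl
sumAdjacent-sumTo f (m ∷ [])       (v ∷ [])      g h z = trans (+-identityʳ (g 0)) (z 0 refl)
sumAdjacent-sumTo f (m₁ ∷ m₂ ∷ ms) (v₁ ∷ v₂ ∷ V) g h z = cong₂ _+_ (h zero (suc zero) refl)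
  (sumAdjacent-sumTo f (m₂ ∷ ms) (v₂ ∷ V) (g ∘ suc) (λ p q e → h (suc p) (suc q) (cong suc e)) (λ i e → z (suc i) (cong suc e)))

part-toList : ∀ {n} (ρ : Vec ℕ n) p → part (toList ρ) (toℕ p) ≡ lookup ρ p
part-toList (x ∷ ρ) zero    = refl
part-toList (x ∷ ρ) (suc p) = part-toList ρ p

part-toList-beyond : ∀ {n} (ρ : Vec ℕ n) {i} → n ≤ i → part (toList ρ) i ≡ 0
part-toList-beyond []      _               = refl
part-toList-beyond (x ∷ ρ) {suc i} (s≤s h) = part-toList-beyond ρ h

thin-adjacent : ∀ {n} {ls ms : Vec ℕ n} → Thin ls ms → ∀ p q → toℕ q ≡ suc (toℕ p) →
                lookup ls q ≤ lookup ls p × lookup ms q ≤ lookup ms p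
thin-adjacent ((_ , h , k , _) ∷ t) zero    (suc zero) e = h , k
thin-adjacent (_ ∷ t)               (suc p) (suc q)    e = thin-adjacent t p q (suc-injective e)
thin-adjacent ([-] _)               zero    zero       ()

hasRows-lookup : ∀ {N n} {ls ms : Vec ℕ n} {V : Vec (Vec Bool N) n} → HasRows ls ms V → ∀ p →
  ones (lookup V p) + lookup ms p ≡ lookup ls p
hasRows-lookup (h ∷ hs) zero    = h
hasRows-lookup (h ∷ hs) (suc p) = hasRows-lookup hs p

∸-balance : ∀ {x y l u s r} → x + l ≡ y + u → l + s ≡ u + r → x ∸ s ≡ y ∸ r
∸-balance {x} {y} {l} {u} {s} {r} e f = begin
  x ∸ s              ≡⟨ [m+n]∸[m+o]≡n∸o r x s ⟨
  r + x ∸ (r + s)    ≡⟨ cong₂ _∸_ shifted (+-comm r s) ⟩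
  s + y ∸ (s + r)    ≡⟨ [m+n]∸[m+o]≡n∸o s y r ⟩
  y ∸ r              ∎
  where
  open ≡-Reasoning
  identity : ∀ x y l u s r → r + x + (y + u) + (l + s) ≡ s + y + (x + l) + (u + r)
  identity = solve-∀
  shifted : r + x ≡ s + y
  shifted = linear {l = x + l} e (linear {l = u + r} (sym f) (identity x y l u s r))

-- The unmatched letters j exceed the unmatched letters j + 1 by (λ_j - μ_j) - (λ_{j+1} - μ_{j+1}),
-- and the latter number is the peak. So subtracting λ_j - λ_{j+1} from the one and μ_j - μ_{j+1}
-- from the other gives the same.
contributions-peakSum : ∀ {N n} {lam mu : Vec ℕ n} {V : Vec (Vec Bool N) n} {w} → Thin lam mu → HasRows lam mu V →
  HasContent w (part (toList lam)) (part (toList mu)) → w ∼ columnWord (reverse (columns V)) →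
  sumTo n (contribution w (part (toList lam))) ≡ peakSum mu V
contributions-peakSum {n = n} {lam} {mu} {V} {w} t h c e =
  sumAdjacent-sumTo (λ d p → peak p ∸ d) mu V (contribution w (part (toList lam))) pair
    (λ i 1+i≡n → contribution-zero {w} {M = part (toList mu)} i c (part-toList-beyond lam (≤-reflexive (sym 1+i≡n))))
  where
  pair : ∀ p q → toℕ q ≡ suc (toℕ p) →
         contribution w (part (toList lam)) (toℕ p) ≡ peak (Vec.zip (lookup V p) (lookup V q)) ∸
           (lookup mu p ∸ lookup mu q)
  pair p q q≡1+p = begin
    act (suc (toℕ p)) w 0 ∸ (part (toList lam) (toℕ p) ∸ part (toList lam) (suc (toℕ p)))
      ≡⟨ cong₂ _∸_ (trans (act-≡ e (suc (toℕ p)) 0) (act-columns V p q 0 q≡1+p))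
           (cong₂ _∸_ (part-toList lam p) (trans (cong (part (toList lam)) (sym q≡1+p)) (part-toList lam q))) ⟩
    run 0 v ∸ (lookup lam p ∸ lookup lam q)
      ≡⟨ ∸-balance {l = ones (lowers v)} {u = ones (uppers v)}
        (trans (run-peak 0 v) (cong (_+ ones (uppers v)) (+-identityʳ (peak v))))
           (rows-balanced (lookup V p) (lookup V q) (proj₁ adj) (proj₂ adj) (hasRows-lookup h p) (hasRows-lookup h q)) ⟩
    peak v ∸ (lookup mu p ∸ lookup mu q) ∎
    where
    open ≡-Reasoning
    v = Vec.zip (lookup V p) (lookup V q)
    adj = thin-adjacent t p q q≡1+p

-- Padding with empty rows and columns

NonEmpty : List ℕ → Set
NonEmpty r = 1 ≤ length r

transpose-nonempty : ∀ k {X} → k ≤ length (firstLine X) → All NonEmpty (transpose k X)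
transpose-nonempty zero              h       = []
transpose-nonempty (suc k) {(x ∷ r) ∷ X} (s≤s h) = s≤s z≤n ∷ transpose-nonempty k h

heads-length : ∀ X → length (heads X) ≤ length X
heads-length []            = z≤n
heads-length ([] ∷ X)      = z≤n
heads-length ((_ ∷ _) ∷ X) = s≤s (heads-length X)

heads-length-nonempty : ∀ {X} → All NonEmpty X → length (heads X) ≡ length X
heads-length-nonempty                   []       = refl
heads-length-nonempty {(_ ∷ _) ∷ X} (_ ∷ ns) = cong suc (heads-length-nonempty ns)

first-transpose : ∀ k {X} → length (firstLine X) ≤ k → All NonEmpty X → length (firstLine (transpose k X)) ≡ length X
first-transpose (suc k) h ns            = heads-length-nonempty ns
first-transpose zero    h []            = refl
first-transpose zero    {[] ∷ X} h (() ∷ ns)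

tails-empty : ∀ X → length (firstLine X) ≤ 0 → heads X ≡ [] × tails X ≡ []
tails-empty []       h = refl , refl
tails-empty ([] ∷ X) h = refl , refl

transpose-pad : ∀ c d X → length (firstLine X) ≤ c → transpose (c + d) X ≡ transpose c X ++ replicate d []
transpose-pad zero    zero    X h = refl
transpose-pad zero    (suc d) X h with e , f ← tails-empty X h =
  cong₂ _∷_ e (trans (cong (transpose d) f) (transpose-pad zero d [] z≤n))
transpose-pad (suc c) d       X h = cong (heads X ∷_) (transpose-pad c d (tails X) (first-tails {_≤_} {_<_} X h))

module _ {R S : ℕ → ℕ → Set} where

  array-partition : ∀ {X} → Array R S X → All NonEmpty X → Partition (length (firstLine X)) (map length X)
  array-partition []                   []       = []
  array-partition (line _ o a) (n ∷ ns) = (n , ≤-refl) ∷ weaken (over-length o) (array-partition a ns)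
    where
    weaken : ∀ {m m′ ρ} → m ≤ m′ → Partition m ρ → Partition m′ ρ
    weaken h []            = []
    weaken h ((p , q) ∷ ps) = (p , ≤-trans q h) ∷ ps

  array-prefix : ∀ X {Y} → Array R S (X ++ Y) → Array R S X
  array-prefix []          a              = []
  array-prefix (r ∷ [])    (line is _ _)  = line is [] []
  array-prefix (r ∷ s ∷ X) (line is o a)  = line is o (array-prefix (s ∷ X) a)

  over-empty : ∀ d {C} → Over S C (firstLine (replicate d []))
  over-empty zero    = []
  over-empty (suc d) = []

  array-pad : ∀ {X} d → Array R S X → Array R S (X ++ replicate d [])
  array-pad zero    []                       = []
  array-pad (suc d) []                       = line [] (over-empty d) (array-pad d [])
  array-pad d (line {T = []}    is _ a)      = line is (over-empty d) (array-pad d a)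
  array-pad d (line {T = s ∷ X} is o a)      = line is o (array-pad d a)

partition-positive : ∀ {m} X → Partition m (map length X) → All NonEmpty X
partition-positive []      []            = []
partition-positive (r ∷ X) ((h , _) ∷ p) = h ∷ partition-positive X p

-- The first column increases strictly within i, ..., N and meets every row.
rows-height : ∀ {N} i {P} → i ≤ suc N → Rows P → All NonEmpty P → All (i ≤_) (firstLine P) → All (All (_≤ N)) P →
  i + length P ≤ suc N
rows-height i h []            []       _         _        = ≤-trans (≤-reflexive (+-identityʳ i)) h
rows-height i {_ ∷ P} h (line {x ∷ _} is o t) (n ∷ ns) (i≤x ∷ i≤) ((x≤N ∷ _) ∷ b) =
  ≤-trans (≤-reflexive (+-suc i (length P)))
    (rows-height (suc i) (s≤s (≤-trans i≤x x≤N)) t ns (over-all o (i≤x ∷ i≤)) b)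

zero-lengths : ∀ (P : List (List ℕ)) d → map length P ≡ replicate d 0 → P ≡ replicate d []
zero-lengths []       zero    e = refl
zero-lengths ([] ∷ P) (suc d) e = cong ([] ∷_) (zero-lengths P d (List.∷-injectiveʳ e))

concat-pad : ∀ (X : List (List ℕ)) d → concat (X ++ replicate d []) ≡ concat X
concat-pad []      zero    = refl
concat-pad []      (suc d) = concat-pad [] d
concat-pad (r ∷ X) d       = cong (r ++_) (concat-pad X d)

weight-↭ : ∀ {n u v} → u ↭ v → weight n u ≡ weight n v
weight-↭ p = Vec.tabulate-cong (λ i → count-↭ p)

concat-reverse-↭ : ∀ (Es : List (List ℕ)) → concat (reverse Es) ↭ concat Es
concat-reverse-↭ []       = ↭-refl
concat-reverse-↭ (E ∷ Es) = begin
  concat (reverse (E ∷ Es))            ≡⟨ cong concat (List.unfold-reverse E Es) ⟩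
  concat (reverse Es ++ E ∷ [])        ≡⟨ List.concat-++ (reverse Es) (E ∷ []) ⟨
  concat (reverse Es) ++ E ++ []       ↭⟨ Perm.++-comm (concat (reverse Es)) (E ++ []) ⟩
  (E ++ []) ++ concat (reverse Es)     ≡⟨ cong (_++ concat (reverse Es)) (List.++-identityʳ E) ⟩
  E ++ concat (reverse Es)             ↭⟨ Perm.++⁺ˡ E (concat-reverse-↭ Es) ⟩
  E ++ concat Es                       ∎
  where open Perm.PermutationReasoning

length-concat-columns : ∀ {N n} (V : Vec (Vec Bool N) n) → length (concat (columns V)) ≡ Vec.sum (Vec.map ones V)
length-concat-columns {zero}  V = sym (no-ones V)
  where
  no-ones : ∀ {n} (V : Vec (Vec Bool 0) n) → Vec.sum (Vec.map ones V) ≡ 0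
  no-ones []       = refl
  no-ones ([] ∷ V) = no-ones V
length-concat-columns {suc N} V = trans (List.length-++ (lettersFrom 1 (Vec.map Vec.head V)))
  (trans (cong₂ _+_ (length-lettersFrom 1 (Vec.map Vec.head V)) (length-concat-columns (Vec.map Vec.tail V))) (uncons V))
  where
  exchange : ∀ a b c d → a + b + (c + d) ≡ (a + c) + (b + d)
  exchange = solve-∀
  uncons : ∀ {n} (V : Vec (Vec Bool (suc N)) n) →
    ones (Vec.map Vec.head V) + Vec.sum (Vec.map ones (Vec.map Vec.tail V)) ≡ Vec.sum (Vec.map ones V)
  uncons []            = refl
  uncons ((c ∷ v) ∷ V) =
    trans (exchange (bit c) (ones (Vec.map Vec.head V)) (ones v) _) (cong ((bit c + ones v) +_) (uncons V))

hasRows-weights : ∀ {N n} {lam mu : Vec ℕ n} {V : Vec (Vec Bool N) n} → HasRows lam mu V →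
  Vec.map ones V ≡ zipWith _∸_ lam mu
hasRows-weights []                       = refl
hasRows-weights (_∷_ {m = m} {v = v} h hs) =
  cong₂ _∷_ (sym (trans (cong (_∸ m) (sym h)) (m+n∸n≡m (ones v) m))) (hasRows-weights hs)

weights-hasRows : ∀ {N n} {lam mu : Vec ℕ n} (V : Vec (Vec Bool N) n) → Pointwise _≤_ mu lam →
  Vec.map ones V ≡ zipWith _∸_ lam mu → HasRows lam mu V
weights-hasRows []      []       e = []
weights-hasRows (v ∷ V) (h ∷ hs) e =
  trans (cong (_+ _) (Vec.∷-injectiveˡ e)) (m∸n+n≡m h) ∷ weights-hasRows V hs (Vec.∷-injectiveʳ e)

thin-shape : ∀ {n} {ls ms : Vec ℕ n} → Thin ls ms → Shape (toList ls) (toList ms)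
thin-shape t = record { outer-decreasing = outer-≤ t ; inner-decreasing = inner-≤ t ; thin = thin-≤ t }
  where
  outer-≤ : ∀ {n} {ls ms : Vec ℕ n} → Thin ls ms → WeaklyDecreasing (toList ls)
  outer-≤ []                  i       = z≤n
  outer-≤ ([-] _)             i       = z≤n
  outer-≤ ((_ , h , _) ∷ t)   zero    = h
  outer-≤ (_ ∷ t)             (suc i) = outer-≤ t i
  inner-≤ : ∀ {n} {ls ms : Vec ℕ n} → Thin ls ms → WeaklyDecreasing (toList ms)
  inner-≤ []                    i       = z≤n
  inner-≤ ([-] _)               i       = z≤n
  inner-≤ ((_ , _ , h , _) ∷ t) zero    = h
  inner-≤ (_ ∷ t)               (suc i) = inner-≤ t i
  thin-≤ : ∀ {n} {ls ms : Vec ℕ n} → Thin ls ms → ∀ i → part (toList ls) (2 + i) ≤ part (toList ms) i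
  thin-≤ []                           i       = z≤n
  thin-≤ ([-] _)                      i       = z≤n
  thin-≤ (_∷_ {ls = []} _ _)          zero    = z≤n
  thin-≤ (_∷_ {ls = _ ∷ _} (_ , _ , _ , h) _) zero = h
  thin-≤ (_ ∷ t)                      (suc i) = thin-≤ t i

-- The bijection between rows of bits and triples of a partition and two tableaux

module Correspondence {N n : ℕ} {lam mu : Vec ℕ n} (t : Thin lam mu) (mu≤lam : Pointwise _≤_ mu lam) where

  α : Vec ℕ n
  α = zipWith _∸_ lam mu

  Triple : Set
  Triple = List ℕ × Filling × Filling

  triples : ℕ → List Triple
  triples s =
    concatMap
      (λ ρ → cartesianProductWith (λ P T → ρ , P , T) (ssyt N (conjugate ρ ╱ [])) (ssytOfWeight ρ α)) (partitions s)

  IsTriple : ℕ → Triple → Set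
  IsTriple s (ρ , P , T) =
    ((∃ λ m → Partition m ρ) × sum ρ ≡ s) × Tableau N (conjugate ρ) P × Tableau n ρ T × weight n (readingWord T) ≡ α

  enumerates-triples : ∀ s → Enumerates (triples s) (IsTriple s)
  enumerates-triples s = enumerates-concatMap _ proj₁ (enumerates-partitions s) fibre
    where
    fibre : ∀ {ρ} → (∃ λ m → Partition m ρ) × sum ρ ≡ s →
      Enumerates (cartesianProductWith (λ P T → ρ , P , T) (ssyt N (conjugate ρ ╱ [])) (ssytOfWeight ρ α))
                 (λ (σ , P , T) → σ ≡ ρ × Tableau N (conjugate σ) P × Tableau n σ T × weight n (readingWord T) ≡ α)
    fibre {ρ} ((m , p) , _) = enumerates-resp
      (enumerates-product _ (λ { refl → refl , refl })
        (enumerates-tableaux N (conjugate ρ) (conjugate-decreasing ρ))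
        (enumerates-filter (λ T → Vec.≡-dec _≟_ (weight n (readingWord T)) α) (enumerates-tableaux n ρ (partition-decreasing p))))
      (λ { (image₂ P (T , e)) → refl , P , T , e }) (λ { (refl , P , T , e) → image₂ P (T , e) })

  -- The insertion yields N rows of P and N columns of T, some of them empty. The triple has the
  -- tableaux without padding: P⁺, and X, whose columns are those of T. Nonempty rows make X unique.
  record Related (V : Vec (Vec Bool N) n) (y : Triple) : Set where
    constructor related
    field
      {P P⁺ T X}  : List (List ℕ)
      {empty}     : ℕ
      rsk-rel     : RSK (reverse (columns V)) P T
      P-rows      : P ≡ P⁺ ++ replicate empty []
      P-filling   : proj₁ (proj₂ y) ≡ fillingOf 1 P⁺
      P-lengths   : map length P⁺ ≡ conjugate (proj₁ y)
      T-columns   : T ≡ transpose N X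
      T-filling   : proj₂ (proj₂ y) ≡ fillingOf 1 X
      T-lengths   : map length X ≡ proj₁ y
      X-rows      : Rows X
      X-nonempty  : All NonEmpty X
      X-width     : length (firstLine X) ≤ N

  Ds-increasing : ∀ (V : Vec (Vec Bool N) n) → All Increasing (reverse (columns V))
  Ds-increasing V = reverse-all (columns-increasing V)

  length-Ds : ∀ (V : Vec (Vec Bool N) n) → length (reverse (columns V)) ≡ N
  length-Ds V = trans (List.length-reverse (columns V)) (length-columns V)

  module _ {V y} (r : Related V y) where
    open Related r

    X-letters : rowWord X ↭ concat (columns V)
    X-letters = ↭-trans (rowWord-↭ X) (↭-trans (transpose-↭ N X-rows X-width)
      (↭-trans (↭-reflexive (cong concat (sym T-columns))) (↭-trans (RSK-letters rsk-rel) (concat-reverse-↭ (columns V)))))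

    T-word : readingWord (proj₂ (proj₂ y)) ≡ rowWord X
    T-word = trans (cong readingWord T-filling) (readingWord-fillingOf 1 X)

    T-weight : weight n (readingWord (proj₂ (proj₂ y))) ≡ Vec.map ones V
    T-weight = trans (cong (weight n) T-word) (trans (weight-↭ X-letters) (weight-columns V))

    P-weight : weight N (readingWord (proj₁ (proj₂ y))) ≡ letterTotals V
    P-weight = begin
      weight N (readingWord (proj₁ (proj₂ y)))
        ≡⟨ cong (weight N) (trans (cong readingWord P-filling) (readingWord-fillingOf 1 P⁺)) ⟩
      weight N (rowWord P⁺)                     ≡⟨ weight-↭ (rowWord-↭ P⁺) ⟩
      weight N (concat P⁺)
        ≡⟨ cong (weight N) (trans (sym (concat-pad P⁺ empty)) (cong concat (sym P-rows))) ⟩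
      weight N (concat P)                       ≡⟨ weight-↭ (RSK-labels rsk-rel) ⟩
      weight N (labels (reverse (columns V)))   ≡⟨ weight-labels V ⟩
      letterTotals V                            ∎
      where open ≡-Reasoning

    size-T : sum (proj₁ y) ≡ Vec.sum (Vec.map ones V)
    size-T = begin
      sum (proj₁ y)                   ≡⟨ cong sum T-lengths ⟨
      sum (map length X)              ≡⟨ length-rowWord X ⟨
      length (rowWord X)              ≡⟨ Perm.↭-length X-letters ⟩
      length (concat (columns V))     ≡⟨ length-concat-columns V ⟩
      Vec.sum (Vec.map ones V)        ∎
      where open ≡-Reasoning

    charge-T : HasRows lam mu V → chargeTableau (toList mu) (proj₂ (proj₂ y)) ≡ peakSum mu V
    charge-T h = begin
      chargeWord (toList mu) (readingWord (proj₂ (proj₂ y)))       ≡⟨ cong (chargeWord (toList mu)) T-word ⟩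
      chargeWord (toList mu) (rowWord X)
        ≡⟨ chargeWord-sum (rowWord X) (thin-shape t) content′ ⟩
      sumTo (length (toList lam)) (contribution (rowWord X) (part (toList lam)))
        ≡⟨ cong (λ k → sumTo k (contribution (rowWord X) (part (toList lam)))) (Vec.length-toList lam) ⟩
      sumTo n (contribution (rowWord X) (part (toList lam)))
        ≡⟨ contributions-peakSum t h content′ equivalent-words ⟩
      peakSum mu V                                                 ∎
      where
      open ≡-Reasoning
      equivalent-words : rowWord X ∼ columnWord (reverse (columns V))
      equivalent-words = ∼-trans (rowWord-∼ N X-rows X-width)
        (∼-trans (∼-reflexive (cong columnWord (sym T-columns))) (∼-sym (RSK-∼ (Ds-increasing V) rsk-rel)))
      content′ : HasContent (rowWord X) (part (toList lam)) (part (toList mu))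
      content′ i with i <? n
      ... | yes i<n = begin
        count (suc i) (rowWord X) + part (toList mu) i
          ≡⟨ cong (λ i → count (suc i) (rowWord X) + part (toList mu) i) (sym (Fin.toℕ-fromℕ< i<n)) ⟩
        count (suc (toℕ p)) (rowWord X) + part (toList mu) (toℕ p)
          ≡⟨ cong₂ _+_ (trans (count-↭ X-letters) (count-columns V p)) (part-toList mu p) ⟩
        ones (lookup V p) + lookup mu p     ≡⟨ hasRows-lookup h p ⟩
        lookup lam p                        ≡⟨ part-toList lam p ⟨
        part (toList lam) (toℕ p)           ≡⟨ cong (part (toList lam)) (Fin.toℕ-fromℕ< i<n) ⟩
        part (toList lam) i                 ∎
        where p = Fin.fromℕ< i<n
      ... | no i≮n =
        trans (cong₂ _+_ absent (part-toList-beyond mu (≮⇒≥ i≮n))) (sym (part-toList-beyond lam (≮⇒≥ i≮n)))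
        where
        absent : count (suc i) (rowWord X) ≡ 0
        absent =
          trans (count-↭ X-letters)
            (count-none (All.map (λ (_ , x≤n) → <⇒≢ (s≤s (≤-trans x≤n (≮⇒≥ i≮n)))) (All.concat⁺ (columns-bounds V))))

  padded-lengths : ∀ {X} → length (firstLine X) ≤ N →
    map length (transpose N X) ≡ map length (transpose (length (firstLine X)) X) ++ replicate
      (N ∸ length (firstLine X)) 0
  padded-lengths {X} c≤N = begin
    map length (transpose N X)
      ≡⟨ cong (λ k → map length (transpose k X)) (m+[n∸m]≡n c≤N) ⟨
    map length (transpose (c + d) X)
      ≡⟨ cong (map length) (transpose-pad c d X ≤-refl) ⟩
    map length (transpose c X ++ replicate d [])                      ≡⟨ List.map-++ length (transpose c X) _ ⟩
    map length (transpose c X) ++ map length (replicate d [])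
      ≡⟨ cong (map length (transpose c X) ++_) (List.map-replicate length d []) ⟩
    map length (transpose c X) ++ replicate d 0                       ∎
    where
    open ≡-Reasoning
    c = length (firstLine X)
    d = N ∸ c

  related-total : ∀ {V} → HasRows lam mu V → ∃ λ y → IsTriple (Vec.sum α) y × Related V y
  related-total {V} h
    with P , T , r , paired (recording rows height pos bound) cols lens ← rsk (reverse (columns V)) (Ds-increasing V)
    = build P T r rows (trans height (length-Ds V)) pos bound cols lens
    where
    build : ∀ P T → RSK (reverse (columns V)) P T → Rows P → length P ≡ N → All (All (1 ≤_)) P →
            All (All (_≤ length (reverse (columns V)))) P → Columns T → map length P ≡ map length T →
            ∃ λ y → IsTriple (Vec.sum α) y × Related V y
    build P T r rows height pos bound cols lens =
      assemble (map-++⁻ length P (trans lens (trans (cong (map length) (sym T≡)) (padded-lengths width))))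
      where
      X = transpose (length (firstLine T)) T
      c = length (firstLine X)
      ρ = map length X
      lenT : length T ≡ N
      lenT =
        trans (sym (List.length-map length T))
          (trans (cong length (sym lens)) (trans (List.length-map length P) height))
      T≡ : transpose N X ≡ T
      T≡ = subst (λ k → transpose k X ≡ T) lenT (transpose-involutive _ cols ≤-refl)
      X-rows : Rows X
      X-rows = transpose-array ≤-trans _ cols
      width : c ≤ N
      width = ≤-trans (first-≤ (length (firstLine T))) (≤-reflexive lenT)
        where
        first-≤ : ∀ k → length (firstLine (transpose k T)) ≤ length T
        first-≤ zero    = z≤n
        first-≤ (suc k) = heads-length T
      X-nonempty : All NonEmpty X
      X-nonempty = transpose-nonempty (length (firstLine T)) ≤-refl
      assemble : (∃₂ λ P⁺ P⁻ → P ≡ P⁺ ++ P⁻ × map length P⁺ ≡ map length (transpose c X) × map length P⁻ ≡ replicate (N ∸ c) 0) →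
                 ∃ λ y → IsTriple (Vec.sum α) y × Related V y
      assemble (P⁺ , P⁻ , eP , eP⁺ , eP⁻) = (ρ , fillingOf 1 P⁺ , fillingOf 1 X) , is-triple , rel
        where
        P⁺-lengths : map length P⁺ ≡ conjugate ρ
        P⁺-lengths = trans eP⁺ (sym (conjugate-lengths X-rows))
        rel : Related V (ρ , fillingOf 1 P⁺ , fillingOf 1 X)
        rel =
          related r (trans eP (cong (P⁺ ++_) (zero-lengths P⁻ _ eP⁻))) refl P⁺-lengths
            (sym T≡) refl refl X-rows X-nonempty width
        P⁺-entries : All (All (Entries N)) P⁺
        P⁺-entries = All.zipWith (All.zipWith id)
          ( All.++⁻ˡ P⁺ (subst (All (All (1 ≤_))) eP pos)
          , All.++⁻ˡ P⁺ (subst (All (All (_≤ N))) eP (subst (λ k → All (All (_≤ k)) P) (length-Ds V) bound)))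
        X-entries : All (All (Entries n)) X
        X-entries =
          All.concat⁻
            (Perm.All-resp-↭ (↭-trans (↭-sym (X-letters rel)) (rowWord-↭ X)) (All.concat⁺ (columns-bounds V)))
        is-triple : IsTriple (Vec.sum α) (ρ , fillingOf 1 P⁺ , fillingOf 1 X)
        is-triple =
          ((_ , array-partition X-rows X-nonempty) , trans (size-T rel) (cong Vec.sum (hasRows-weights h))) ,
          tableau refl P⁺-lengths (array-prefix P⁺ (subst Rows eP rows)) P⁺-entries ,
          tableau refl refl X-rows X-entries ,
          trans (T-weight rel) (hasRows-weights h)

  related-surjective : ∀ {s y} → IsTriple s y → ∃ λ V → HasRows lam mu V × Related V y
  related-surjective {y = ρ , _ , _}
    (((m , p) , _) , tableau {P⁺} eP lenP rowsP entP , tableau {X} eT lenT rowsX entX , w)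
    = build (unrsk N (paired (recording P-rows P-height P-pos P-bound) T-columns P-T))
    where
    c = length (firstLine X)
    X-nonempty : All NonEmpty X
    X-nonempty = partition-positive X (subst (Partition m) (sym lenT) p)
    P⁺-lengths : map length P⁺ ≡ map length (transpose c X)
    P⁺-lengths = trans lenP (trans (cong conjugate (sym lenT)) (conjugate-lengths rowsX))
    P⁺-length : length P⁺ ≡ c
    P⁺-length =
      trans (sym (List.length-map length P⁺))
        (trans (cong length P⁺-lengths) (trans (List.length-map length (transpose c X)) (length-transpose c X)))
    P⁺-nonempty : All NonEmpty P⁺
    P⁺-nonempty = All.map⁻ (subst (All (1 ≤_)) (sym P⁺-lengths) (All.map⁺ (transpose-nonempty c ≤-refl)))
    -- The width of X is the height of P⁺, and the columns of P⁺ are strict with entries up to N.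
    width : c ≤ N
    width =
      ≤-trans (≤-reflexive (sym P⁺-length))
        (s≤s⁻¹ (rows-height 1 (s≤s z≤n) rowsP P⁺-nonempty (all-first (All.map (All.map proj₁) entP)) (All.map (All.map proj₂) entP)))
    d = N ∸ c
    P = P⁺ ++ replicate d []
    T = transpose N X
    P-rows : Rows P
    P-rows = array-pad d rowsP
    P-height : length P ≡ N
    P-height = trans (List.length-++ P⁺) (trans (cong₂ _+_ P⁺-length (List.length-replicate d)) (m+[n∸m]≡n width))
    P-all : ∀ {Q : ℕ → Set} → All (All Q) P⁺ → All (All Q) P
    P-all a = All.++⁺ a (All.replicate⁺ d [])
    P-pos : All (All (1 ≤_)) P
    P-pos = P-all (All.map (All.map proj₁) entP)
    P-bound : All (All (_≤ N)) P
    P-bound = P-all (All.map (All.map proj₂) entP)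
    T-columns : Columns T
    T-columns = transpose-array <-trans N rowsX
    P-T : map length P ≡ map length T
    P-T =
      trans (List.map-++ length P⁺ _)
        (trans (cong₂ _++_ P⁺-lengths (List.map-replicate length d [])) (sym (padded-lengths width)))
    build : (∃ λ Ds → RSK Ds P T × All Increasing Ds × length Ds ≡ N) → ∃ λ V →
      HasRows lam mu V × Related V (ρ , _ , _)
    build (Ds , r , incs , lenD)
      with V , e ← columns-surjective N n (reverse Ds) (trans (List.length-reverse Ds) lenD) (reverse-all incs)
        (reverse-all (All.concat⁻ {xss = Ds} (Perm.All-resp-↭ (↭-trans (transpose-↭ N rowsX width) (RSK-letters r)) (All.concat⁺ entX))))
      = V , weights-hasRows V mu≤lam (trans (sym (T-weight rel)) w) , rel
      where
      rel : Related V (ρ , _ , _)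
      rel = related (subst (λ Es → RSK Es P T) (sym (trans (cong reverse e) (List.reverse-involutive Ds))) r)
        refl eP lenP refl eT lenT rowsX X-nonempty width

  transpose-injective : ∀ {X X′} → Rows X → Rows X′ → All NonEmpty X → All NonEmpty X′ →
    length (firstLine X) ≤ N → length (firstLine X′) ≤ N → transpose N X ≡ transpose N X′ → X ≡ X′
  transpose-injective rows rows′ ne ne′ w w′ e = trans (sym (transpose-involutive N rows w))
    (trans (cong₂ transpose (trans (sym (first-transpose N w ne)) (trans (cong (length ∘ firstLine) e) (first-transpose N w′ ne′))) e)
           (transpose-involutive N rows′ w′))

  related-deterministic : ∀ {V y y′} → Related V y → Related V y′ → y ≡ y′
  related-deterministic (related {P⁺ = P⁺} r eP refl lP eT refl refl rows ne w)
    (related {P⁺ = Q⁺} r′ eP′ refl lP′ eT′ refl refl rows′ ne′ w′)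
    with e , f ← RSK-deterministic r r′
    with refl ← transpose-injective rows rows′ ne ne′ w w′ (trans (sym eT) (trans f eT′))
    with refl , _ ← ++-injective P⁺ Q⁺ (trans (sym (List.length-map length P⁺)) (trans (cong length (trans lP (sym lP′))) (List.length-map length Q⁺)))
                      (trans (sym eP) (trans e eP′)) = refl

  -- P has N rows, one for each insertion, so P⁺ determines the padding.
  related-P : ∀ {V y} (r : Related V y) → Related.P r ≡ Related.P⁺ r ++ replicate (N ∸ length (Related.P⁺ r)) []
  related-P {V} (related {P} {P⁺} {empty = d} r eP _ _ _ _ _ _ _ _) =
    trans eP (cong (λ d → P⁺ ++ replicate d []) (sym (begin
    N ∸ length P⁺                          ≡⟨ cong (_∸ length P⁺) (length-Ds V) ⟨
    length (reverse (columns V)) ∸ length P⁺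
      ≡⟨ cong (_∸ length P⁺) (Recording.height (Paired.isRecording (RSK-paired (Ds-increasing V) r))) ⟨
    length P ∸ length P⁺                   ≡⟨ cong (λ P → length P ∸ length P⁺) eP ⟩
    length (P⁺ ++ replicate d []) ∸ length P⁺
      ≡⟨ cong (_∸ length P⁺) (trans (List.length-++ P⁺) (cong (length P⁺ +_) (List.length-replicate d))) ⟩
    length P⁺ + d ∸ length P⁺              ≡⟨ m+n∸m≡n (length P⁺) d ⟩
    d                                      ∎)))
    where open ≡-Reasoning

  related-injective : ∀ {V V′ y} → Related V y → Related V′ y → V ≡ V′
  related-injective {V} {V′} s@(related {P⁺ = P⁺} {X = X} r _ fP lP refl fX lX _ _ _) s′@(related {P⁺ = Q⁺} {X = X′} r′ _ fP′ lP′ refl fX′ lX′ _ _ _)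
    with refl ← fillingOf-injective 1 X X′ (trans lX (sym lX′)) (trans (sym fX) fX′)
    with refl ← fillingOf-injective 1 P⁺ Q⁺ (trans lP (sym lP′)) (trans (sym fP) fP′)
    with refl ← trans (related-P s) (sym (related-P s′)) = columns-injective V V′ (List.reverse-injective
      (RSK-injective (Ds-increasing V) (Ds-increasing V′) (trans (length-Ds V) (sym (length-Ds V′))) r r′))

-- Inversions of vertical strips

∑ : ∀ {A : Set} → (A → ℕ) → List A → ℕ
∑ f xs = sum (map f xs)

indicator : ∀ {P : Set} → Dec P → ℕ
indicator P? = bit (does P?)

indicator-cong : ∀ {P Q : Set} (P? : Dec P) (Q? : Dec Q) → (P → Q) → (Q → P) → indicator P? ≡ indicator Q?
indicator-cong (yes p) (yes q) f g = refl
indicator-cong (yes p) (no ¬q) f g = contradiction (f p) ¬q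
indicator-cong (no ¬p) (yes q) f g = contradiction (g q) ¬p
indicator-cong (no ¬p) (no ¬q) f g = refl

indicator-yes : ∀ {P : Set} (P? : Dec P) → P → indicator P? ≡ 1
indicator-yes P? p = cong bit (dec-true P? p)

indicator-no : ∀ {P : Set} (P? : Dec P) → ¬ P → indicator P? ≡ 0
indicator-no P? ¬p = cong bit (dec-false P? ¬p)

module _ {A : Set} where

  ∑-++ : ∀ (f : A → ℕ) xs ys → ∑ f (xs ++ ys) ≡ ∑ f xs + ∑ f ys
  ∑-++ f []       ys = refl
  ∑-++ f (x ∷ xs) ys = trans (cong (f x +_) (∑-++ f xs ys)) (sym (+-assoc (f x) _ _))

  ∑-cong : ∀ {f g : A → ℕ} {xs} → All (λ x → f x ≡ g x) xs → ∑ f xs ≡ ∑ g xs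
  ∑-cong []       = refl
  ∑-cong (e ∷ es) = cong₂ _+_ e (∑-cong es)

  ∑-cong′ : ∀ {f g : A → ℕ} xs → (∀ x → f x ≡ g x) → ∑ f xs ≡ ∑ g xs
  ∑-cong′ xs h = cong sum (List.map-cong h xs)

  ∑-zero : ∀ {f : A → ℕ} {xs} → All (λ x → f x ≡ 0) xs → ∑ f xs ≡ 0
  ∑-zero []       = refl
  ∑-zero (e ∷ es) = cong₂ _+_ e (∑-zero es)

  ∑-+ : ∀ (f g : A → ℕ) xs → ∑ (λ x → f x + g x) xs ≡ ∑ f xs + ∑ g xs
  ∑-+ f g []       = refl
  ∑-+ f g (x ∷ xs) = trans (cong (f x + g x +_) (∑-+ f g xs)) (exchange (f x) (g x) (∑ f xs) (∑ g xs))
    where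
    exchange : ∀ a b c d → a + b + (c + d) ≡ a + c + (b + d)
    exchange = solve-∀

  ∑-↭ : ∀ (f : A → ℕ) {xs ys} → xs ↭ ys → ∑ f xs ≡ ∑ f ys
  ∑-↭ f p = sum-↭ (Perm.map⁺ f p)

  ∑-map : ∀ {B : Set} (f : A → ℕ) (g : B → A) xs → ∑ f (map g xs) ≡ ∑ (f ∘ g) xs
  ∑-map f g xs = cong sum (sym (List.map-∘ xs))

  length-filter-∑ : ∀ {P : A → Set} (P? : Decidable P) xs → length (filter P? xs) ≡ ∑ (indicator ∘ P?) xs
  length-filter-∑ P? []       = refl
  length-filter-∑ P? (x ∷ xs) with does (P? x)
  ... | true  = cong suc (length-filter-∑ P? xs)
  ... | false = length-filter-∑ P? xs

∑-swap : ∀ {A B : Set} (f : A → B → ℕ) xs ys → ∑ (λ x → ∑ (f x) ys) xs ≡ ∑ (λ y → ∑ (λ x → f x y) xs) ys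
∑-swap f []       ys = sym (∑-zero {xs = ys} (All.tabulate λ _ → refl))
∑-swap f (x ∷ xs) ys = trans (cong (∑ (f x) ys +_) (∑-swap f xs ys)) (sym (∑-+ (f x) (λ y → ∑ (λ x → f x y) xs) ys))

∑-product : ∀ {A B : Set} (f : A × B → ℕ) xs ys → ∑ f (cartesianProduct xs ys) ≡ ∑ (λ x → ∑ (λ y → f (x , y)) ys) xs
∑-product f []       ys = refl
∑-product f (x ∷ xs) ys = trans (∑-++ f (map (x ,_) ys) _) (cong₂ _+_ (∑-map f (x ,_) ys) (∑-product f xs ys))

indexedEntries-∷ : ∀ {k} (T : Filling) (Ts : Vec Filling k) →
  indexedEntries (T ∷ Ts) ≡ map (zero ,_) T ++ map (map₁ suc) (indexedEntries Ts)
indexedEntries-∷ {k} T Ts = cong (map (zero ,_) T ++_) (begin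
  concatMap (λ i → map (i ,_) (lookup (T ∷ Ts) i)) (Data.List.tabulate suc)
    ≡⟨ cong (concatMap (λ i → map (i ,_) (lookup (T ∷ Ts) i))) (List.map-tabulate id suc) ⟨
  concatMap (λ i → map (i ,_) (lookup (T ∷ Ts) i)) (map suc (allFin k))
    ≡⟨ List.concatMap-map _ suc (allFin k) ⟩
  concatMap (λ i → map (suc i ,_) (lookup Ts i)) (allFin k)
    ≡⟨ List.concatMap-cong (λ i → List.map-∘ (lookup Ts i)) (allFin k) ⟩
  concatMap (λ i → map (map₁ suc) (map (i ,_) (lookup Ts i))) (allFin k)
    ≡⟨ List.map-concatMap (map₁ suc) (λ i → map (i ,_) (lookup Ts i)) (allFin k) ⟨
  map (map₁ suc) (indexedEntries Ts) ∎)
  where open ≡-Reasoning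

sameContent? : ∀ (x y : Entry) → Dec (proj₂ x > proj₂ y × content (proj₁ x) ≡ content (proj₁ y))
sameContent? (u , a) (v , b) = a >? b ×-dec content u ℤ.≟ content v

nextContent? : ∀ (x y : Entry) → Dec (proj₂ y > proj₂ x × content (proj₁ y) ≡ ℤ.pred (content (proj₁ x)))
nextContent? (u , a) (v , b) = b >? a ×-dec content v ℤ.≟ ℤ.pred (content u)

-- The contribution to inv of an entry x of a shape and an entry y of a later shape.
inversions : Entry → Entry → ℕ
inversions x y = indicator (sameContent? x y) + indicator (nextContent? x y)

pairInv : Filling → Filling → ℕ
pairInv T T′ = ∑ (λ x → ∑ (inversions x) T′) T

crossInv : ∀ {k} → Filling → Vec Filling k → ℕ
crossInv T []        = 0
crossInv T (T′ ∷ Ts) = pairInv T T′ + crossInv T Ts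

∑-entries : ∀ {k} (f : Entry → ℕ) (Ts : Vec Filling k) →
  ∑ (f ∘ proj₂) (indexedEntries Ts) ≡ Vec.sum (Vec.map (∑ f) Ts)
∑-entries f []       = refl
∑-entries f (T ∷ Ts) = begin
  ∑ (f ∘ proj₂) (indexedEntries (T ∷ Ts))            ≡⟨ cong (∑ (f ∘ proj₂)) (indexedEntries-∷ T Ts) ⟩
  ∑ (f ∘ proj₂) (map (zero ,_) T ++ map (map₁ suc) (indexedEntries Ts))
    ≡⟨ ∑-++ (f ∘ proj₂) (map (zero ,_) T) _ ⟩
  ∑ (f ∘ proj₂) (map (zero ,_) T) + ∑ (f ∘ proj₂) (map (map₁ suc) (indexedEntries Ts))
    ≡⟨ cong₂ _+_ (∑-map (f ∘ proj₂) (zero ,_) T)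
      (trans (∑-map (f ∘ proj₂) (map₁ suc) (indexedEntries Ts)) (∑-entries f Ts)) ⟩
  ∑ f T + Vec.sum (Vec.map (∑ f) Ts)                 ∎
  where open ≡-Reasoning

crossInv-sum : ∀ {k} T (Ts : Vec Filling k) → ∑ (λ x → Vec.sum (Vec.map (∑ (inversions x)) Ts)) T ≡ crossInv T Ts
crossInv-sum T []        = ∑-zero {xs = T} (All.tabulate λ _ → refl)
crossInv-sum T (T′ ∷ Ts) = trans (∑-+ (λ x → ∑ (inversions x) T′) (λ x → Vec.sum (Vec.map (∑ (inversions x)) Ts)) T)
  (cong (pairInv T T′ +_) (crossInv-sum T Ts))

-- Both orders of a pair of entries are counted in `inv`. For x in T and y in a later filling, one
-- order yields `sameContent?` and the other `nextContent?`; inside T there is no inversion, because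
-- the two indices must differ.
inv-∷ : ∀ {k} T (Ts : Vec Filling k) → inv (T ∷ Ts) ≡ crossInv T Ts + inv Ts
inv-∷ {k} T Ts = begin
  inv (T ∷ Ts)
    ≡⟨ trans (length-filter-∑ inversion? (cartesianProduct E E)) (∑-product (indicator ∘ inversion?) E E) ⟩
  ∑ (λ x → ∑ (g x) E) E
    ≡⟨ cong (∑ (λ x → ∑ (g x) E)) (indexedEntries-∷ T Ts) ⟩
  ∑ (λ x → ∑ (g x) E) (map (zero ,_) T ++ map (map₁ suc) E′)
    ≡⟨ trans (∑-++ (λ x → ∑ (g x) E) (map (zero ,_) T) _) (cong₂ _+_ (∑-map _ (zero ,_) T) (∑-map _ (map₁ suc) E′)) ⟩
  ∑ (λ x → ∑ (g (zero , x)) E) T + ∑ (λ x → ∑ (g (map₁ suc x)) E) E′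
    ≡⟨ cong₂ _+_ (∑-cong′ T first) (trans (∑-cong′ E′ later) (∑-+ (λ x → ∑ (λ y → second y (proj₂ x)) T) _ E′)) ⟩
  ∑
    (λ x → ∑ (forward x ∘ proj₂) E′) T + (∑ (λ x → ∑ (λ y → second y (proj₂ x)) T) E′ + ∑ (λ x → ∑ (λ y → indicator (inversion? (x , y))) E′) E′)
    ≡⟨ +-assoc (∑ (λ x → ∑ (forward x ∘ proj₂) E′) T) _ _ ⟨
  (∑ (λ x → ∑ (forward x ∘ proj₂) E′) T + ∑ (λ x → ∑ (λ y → second y (proj₂ x)) T) E′) + ∑ (λ x → ∑ (λ y → indicator (inversion? (x , y))) E′) E′
    ≡⟨ cong₂ _+_ cross
      (trans (sym (∑-product (indicator ∘ inversion?) E′ E′)) (sym (length-filter-∑ inversion? (cartesianProduct E′ E′)))) ⟩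
  crossInv T Ts + inv Ts ∎
  where
  open ≡-Reasoning
  E = indexedEntries (T ∷ Ts)
  E′ = indexedEntries Ts
  g : Fin (suc k) × Entry → Fin (suc k) × Entry → ℕ
  g x y = indicator (inversion? (x , y))
  forward second : Entry → Entry → ℕ
  forward x y = indicator (sameContent? x y)
  second  x y = indicator (nextContent? x y)
  split : ∀ (f : Fin (suc k) × Entry → ℕ) → ∑ f E ≡ ∑ (f ∘ (zero ,_)) T + ∑ (f ∘ map₁ suc) E′
  split f = trans (cong (∑ f) (indexedEntries-∷ T Ts))
    (trans (∑-++ f (map (zero ,_) T) _) (cong₂ _+_ (∑-map f (zero ,_) T) (∑-map f (map₁ suc) E′)))
  first : ∀ x → ∑ (g (zero , x)) E ≡ ∑ (forward x ∘ proj₂) E′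
  first x = trans (split (g (zero , x))) (cong₂ _+_
    (∑-zero {xs = T} (All.tabulate λ {y} _ → indicator-no (inversion? {suc k} ((zero , x) , (zero , y))) λ { (_ , inj₁ (() , _)) ; (_ , inj₂ (() , _)) }))
    (∑-cong′ E′ λ (j , y) → indicator-cong (inversion? {suc k} ((zero , x) , (suc j , y))) (sameContent? x y)
      (λ { (a>b , inj₁ (_ , e)) → a>b , e ; (_ , inj₂ (() , _)) }) (λ (a>b , e) → a>b , inj₁ (s≤s z≤n , e))))
  later : ∀ x → ∑ (g (map₁ suc x)) E ≡ ∑ (λ y → second y (proj₂ x)) T + ∑ (λ y → indicator (inversion? (x , y))) E′
  later (i , x) = trans (split (g (suc i , x))) (cong₂ _+_
    (∑-cong′ T λ y → indicator-cong (inversion? {suc k} ((suc i , x) , (zero , y))) (nextContent? y x)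
      (λ { (b>a , inj₂ (_ , e)) → b>a , e ; (_ , inj₁ (() , _)) }) (λ (b>a , e) → b>a , inj₂ (s≤s z≤n , e)))
    (∑-cong′ E′ λ (j , y) → indicator-cong (inversion? {suc k} ((suc i , x) , (suc j , y))) (inversion? ((i , x) , (j , y)))
      (λ { (h , inj₁ (s≤s p , e)) → h , inj₁ (p , e) ; (h , inj₂ (s≤s p , e)) → h , inj₂ (p , e) })
      (λ { (h , inj₁ (p , e)) → h , inj₁ (s≤s p , e) ; (h , inj₂ (p , e)) → h , inj₂ (s≤s p , e) })))
  cross : ∑ (λ x → ∑ (forward x ∘ proj₂) E′) T + ∑ (λ x → ∑ (λ y → second y (proj₂ x)) T) E′ ≡ crossInv T Ts
  cross = begin
    ∑ (λ x → ∑ (forward x ∘ proj₂) E′) T + ∑ (λ x → ∑ (λ y → second y (proj₂ x)) T) E′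
      ≡⟨ cong (∑ (λ x → ∑ (forward x ∘ proj₂) E′) T +_) (∑-swap (λ x y → second y (proj₂ x)) E′ T) ⟩
    ∑ (λ x → ∑ (forward x ∘ proj₂) E′) T + ∑ (λ x → ∑ (second x ∘ proj₂) E′) T
      ≡⟨ ∑-+ (λ x → ∑ (forward x ∘ proj₂) E′) (λ x → ∑ (second x ∘ proj₂) E′) T ⟨
    ∑ (λ x → ∑ (forward x ∘ proj₂) E′ + ∑ (second x ∘ proj₂) E′) T
      ≡⟨ ∑-cong′ T (λ x → trans (sym (∑-+ (forward x ∘ proj₂) (second x ∘ proj₂) E′)) (∑-entries (inversions x) Ts)) ⟩
    ∑ (λ x → Vec.sum (Vec.map (∑ (inversions x)) Ts)) T
      ≡⟨ crossInv-sum T Ts ⟩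
    crossInv T Ts ∎

-- The cells and letters of a vertical strip from top to bottom, for the rows from m + 1 on and the letters from e on.
ascending : ∀ {n} → ℕ → ℕ → Vec Bool n → Filling
ascending m e []          = []
ascending m e (true ∷ v)  = ((suc m , 1) , e) ∷ ascending (suc m) (suc e) v
ascending m e (false ∷ v) = ascending m (suc e) v

stripFilling : ∀ {n} → ℕ → Vec Bool n → Filling
stripFilling m v = reverse (ascending m 1 v)

sameRow? : ∀ (x y : Entry) → Dec (proj₂ x > proj₂ y × row (proj₁ x) ≡ row (proj₁ y))
sameRow? ((r , _) , a) ((s , _) , b) = a >? b ×-dec r ≟ s

nextRow? : ∀ (x y : Entry) → Dec (proj₂ y > proj₂ x × row (proj₁ y) ≡ suc (row (proj₁ x)))
nextRow? ((r , _) , a) ((s , _) , b) = b >? a ×-dec s ≟ suc r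

stripInversions : Entry → Entry → ℕ
stripInversions x y = indicator (sameRow? x y) + indicator (nextRow? x y)

StripEntry : ℕ → Entry → Set
StripEntry e ((r , c) , a) = 1 ≤ r × c ≡ 1 × e ≤ a

ascending-entries : ∀ {n} m e (v : Vec Bool n) → All (StripEntry e) (ascending m e v)
ascending-entries m e []          = []
ascending-entries m e (true ∷ v)  =
  (s≤s z≤n , refl , ≤-refl) ∷ All.map (map₂ (map₂ <⇒≤)) (ascending-entries (suc m) (suc e) v)
ascending-entries m e (false ∷ v) = All.map (map₂ (map₂ <⇒≤)) (ascending-entries m (suc e) v)

content-strip : ∀ r → content (suc r , 1) ≡ ℤ.- (ℤ.+ r)
content-strip zero    = refl
content-strip (suc r) = refl

-- In column 1 the content is 1 - r, so equal contents mean equal rows and a content smaller by one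
-- means the next row.
inversions-strip : ∀ {e e′ x y} → StripEntry e x → StripEntry e′ y → inversions x y ≡ stripInversions x y
inversions-strip {x = x@((suc r , _) , a)} {y@((suc s , _) , b)} (_ , refl , _) (_ , refl , _) = cong₂ _+_
  (indicator-cong (sameContent? x y) (sameRow? x y) (map₂ same-row) (map₂ λ { refl → refl }))
  (indicator-cong (nextContent? x y) (nextRow? x y) (map₂ next-row) (map₂ λ { refl → next-row′ r }))
  where
  negative-injective : ∀ {r s} → ℤ.- (ℤ.+ r) ≡ ℤ.- (ℤ.+ s) → r ≡ s
  negative-injective e = ℤ.+-injective (ℤ.neg-injective e)
  pred-negative : ∀ r → ℤ.pred (ℤ.- (ℤ.+ r)) ≡ ℤ.- (ℤ.+ suc r)
  pred-negative zero    = refl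
  pred-negative (suc r) = refl
  same-row : content (suc r , 1) ≡ content (suc s , 1) → suc r ≡ suc s
  same-row e = cong suc (negative-injective (trans (sym (content-strip r)) (trans e (content-strip s))))
  next-row : content (suc s , 1) ≡ ℤ.pred (content (suc r , 1)) → suc s ≡ suc (suc r)
  next-row e =
    cong suc
      (negative-injective (trans (sym (content-strip s)) (trans e (trans (cong ℤ.pred (content-strip r)) (pred-negative r)))))
  next-row′ : ∀ r → content (suc (suc r) , 1) ≡ ℤ.pred (content (suc r , 1))
  next-row′ r = trans (content-strip (suc r)) (sym (trans (cong ℤ.pred (content-strip r)) (pred-negative r)))

pairInv-strips : ∀ {n} m m′ (v v′ : Vec Bool n) →
  pairInv (stripFilling m v) (stripFilling m′ v′) ≡ ∑
    (λ x → ∑ (stripInversions x) (ascending m′ 1 v′)) (ascending m 1 v)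
pairInv-strips m m′ v v′ = trans (∑-↭ _ (Perm.↭-reverse (ascending m 1 v)))
  (∑-cong (All.map (λ h → trans (∑-↭ _ (Perm.↭-reverse (ascending m′ 1 v′)))
    (∑-cong (All.map (inversions-strip h) (ascending-entries m′ 1 v′)))) (ascending-entries m 1 v)))

ascending-rows : ∀ {n} m e (v : Vec Bool n) → map proj₁ (ascending m e v) ≡ map (_, 1) (up (suc m) (ones v))
ascending-rows m e []          = refl
ascending-rows m e (true ∷ v)  = cong ((suc m , 1) ∷_) (ascending-rows (suc m) (suc e) v)
ascending-rows m e (false ∷ v) = ascending-rows m (suc e) v

ascending-letters : ∀ {n} m e (v : Vec Bool n) → map proj₂ (ascending m e v) ≡ lettersFrom e v
ascending-letters m e []          = refl
ascending-letters m e (true ∷ v)  = cong (e ∷_) (ascending-letters (suc m) (suc e) v)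
ascending-letters m e (false ∷ v) = ascending-letters m (suc e) v

-- At most one term is not 0: the value tells whether row k + 1 is among the rows still to be
-- filled.
rowIndicator : ∀ {n} → ℕ → ℕ → ℕ → Vec Bool n → ℕ
rowIndicator k m e v = ∑ (λ x → indicator (row (proj₁ x) ≟ suc k)) (ascending m e v)

rowIndicator-above : ∀ {n} k m e (v : Vec Bool n) → k < m → rowIndicator k m e v ≡ 0
rowIndicator-above k m e []          h = refl
rowIndicator-above k m e (true ∷ v)  h =
  cong₂ _+_ (indicator-no (suc m ≟ suc k) (>⇒≢ (s≤s h))) (rowIndicator-above k (suc m) (suc e) v (m≤n⇒m≤1+n h))
rowIndicator-above k m e (false ∷ v) h = rowIndicator-above k m (suc e) v h

rowIndicator-hit : ∀ {n} k m e (v : Vec Bool n) → m ≤ k → k < m + ones v → rowIndicator k m e v ≡ 1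
rowIndicator-hit k m e []          h g =
  contradiction (≤-trans g (≤-trans (≤-reflexive (+-identityʳ m)) h)) (<-irrefl refl)
rowIndicator-hit k m e (true ∷ v)  h g with m ≟ k
... | yes refl = cong₂ _+_ (indicator-yes (suc m ≟ suc m) refl) (rowIndicator-above m (suc m) (suc e) v ≤-refl)
... | no m≢k   = cong₂ _+_ (indicator-no (suc m ≟ suc k) (m≢k ∘ suc-injective))
  (rowIndicator-hit k (suc m) (suc e) v (≤∧≢⇒< h m≢k) (≤-trans g (≤-reflexive (+-suc m (ones v)))))
rowIndicator-hit k m e (false ∷ v) h g = rowIndicator-hit k m (suc e) v h g

rowIndicator-below : ∀ {n} k m e (v : Vec Bool n) → m + ones v ≤ k → rowIndicator k m e v ≡ 0
rowIndicator-below k m e []          h = refl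
rowIndicator-below k m e (true ∷ v)  h = cong₂ _+_
  (indicator-no (suc m ≟ suc k) (<⇒≢ (s≤s (≤-trans (m<m+n m (s≤s z≤n)) h))))
  (rowIndicator-below k (suc m) (suc e) v (≤-trans (≤-reflexive (sym (+-suc m (ones v)))) h))
rowIndicator-below k m e (false ∷ v) h = rowIndicator-below k m (suc e) v h

-- Inversions of two strips, letter by letter

S : ∀ {n} → ℕ → ℕ → ℕ → Vec Bool n → Vec Bool n → ℕ
S m m′ e v v′ = ∑ (λ x → ∑ (stripInversions x) (ascending m′ e v′)) (ascending m e v)

later : ∀ {n} m e (v : Vec Bool n) → All (λ x → e < proj₂ x) (ascending m (suc e) v)
later m e v = All.map (proj₂ ∘ proj₂) (ascending-entries m (suc e) v)

upper-first : ∀ {n} m m′ e (v′ : Vec Bool n) →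
  ∑ (stripInversions ((suc m , 1) , e)) (ascending m′ (suc e) v′) ≡ rowIndicator (suc m) m′ (suc e) v′
upper-first m m′ e v′ = ∑-cong (All.map (λ {y} e<b → cong₂ _+_
  (indicator-no (sameRow? ((suc m , 1) , e) y) λ (a>b , _) → <-asym a>b e<b)
  (indicator-cong (nextRow? ((suc m , 1) , e) y) (row (proj₁ y) ≟ suc (suc m)) proj₂ (e<b ,_))) (later m′ e v′))

lower-first : ∀ {n} m m′ e (v : Vec Bool n) →
  ∑ (λ x → stripInversions x ((suc m′ , 1) , e)) (ascending m (suc e) v) ≡ rowIndicator m′ m (suc e) v
lower-first m m′ e v = ∑-cong (All.map (λ {x} e<a → trans (cong₂ _+_
  (indicator-cong (sameRow? x ((suc m′ , 1) , e)) (row (proj₁ x) ≟ suc m′) proj₂ (e<a ,_))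
  (indicator-no (nextRow? x ((suc m′ , 1) , e)) λ (b>a , _) → <-asym b>a e<a)) (+-identityʳ _)) (later m e v))

module _ {n} (m m′ e : ℕ) (v v′ : Vec Bool n) where

  S-↘ : S m m′ e (true ∷ v) (false ∷ v′) ≡ rowIndicator (suc m) m′ (suc e) v′ + S (suc m) m′ (suc e) v v′
  S-↘ = cong (_+ S (suc m) m′ (suc e) v v′) (upper-first m m′ e v′)

  S-↗ : S m m′ e (false ∷ v) (true ∷ v′) ≡ rowIndicator m′ m (suc e) v + S m (suc m′) (suc e) v v′
  S-↗ = trans (∑-+ (λ x → stripInversions x ((suc m′ , 1) , e)) _ (ascending m (suc e) v))
              (cong (_+ S m (suc m′) (suc e) v v′) (lower-first m m′ e v))

  S-● : S m m′ e (true ∷ v) (true ∷ v′) ≡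
        rowIndicator (suc m) (suc m′)
          (suc e) v′ + (rowIndicator m′ (suc m) (suc e) v + S (suc m) (suc m′) (suc e) v v′)
  S-● = cong₂ _+_ (cong₂ _+_ tie (upper-first m (suc m′) e v′))
    (trans (∑-+ (λ x → stripInversions x ((suc m′ , 1) , e)) _ (ascending (suc m) (suc e) v))
           (cong (_+ S (suc m) (suc m′) (suc e) v v′) (lower-first (suc m) m′ e v)))
    where
    tie : stripInversions ((suc m , 1) , e) ((suc m′ , 1) , e) ≡ 0
    tie =
      cong₂ _+_ (indicator-no (sameRow? x y) (<-irrefl refl ∘ proj₁))
        (indicator-no (nextRow? x y) (<-irrefl refl ∘ proj₁))
      where
      x y : Entry
      x = (suc m , 1) , e
      y = (suc m′ , 1) , e

-- The minimal number of inversions of neighbouring strips, for l′ = λ_{j+1} and m = μ_j. In each of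
-- the rows m + 1, ..., l′ - 1 the entry x of the first strip faces the entries y < y′ of the second
-- one in this row and the next, and x > y or y′ > x.
surplus : ℕ → ℕ → ℕ
surplus l′ m = l′ ∸ m ∸ 1

surplus-suc : ∀ {l m} → suc m < l → surplus l m ≡ suc (surplus l (suc m))
surplus-suc {suc (suc l)} {zero}  _       = refl
surplus-suc {suc l}       {suc m} (s≤s h) = surplus-suc h

surplus-none : ∀ {l m} → l ≤ suc m → surplus l m ≡ 0
surplus-none {l} {m} h = trans (∸-+-assoc l m 1) (m≤n⇒m∸n≡0 (≤-trans h (≤-reflexive (+-comm 1 m))))

-- The upper letter put into row m + 1 is smaller than all lower letters to come. It makes an
-- inversion with the one in row m + 2 if that row exists, and exactly then the surplus drops.
surplus-step : ∀ {n l′} m m′ e (v′ : Vec Bool n) → m′ ≤ suc m → m′ + ones v′ ≡ l′ →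
               rowIndicator (suc m) m′ e v′ + surplus l′ (suc m) ≡ surplus l′ m
surplus-step {l′ = l′} m m′ e v′ h el with suc m <? l′
... | yes g =
  trans (cong (_+ surplus l′ (suc m)) (rowIndicator-hit (suc m) m′ e v′ h (≤-trans g (≤-reflexive (sym el)))))
    (sym (surplus-suc g))
... | no g  =
  trans
    (cong₂ _+_ (rowIndicator-below (suc m) m′ e v′ (≤-trans (≤-reflexive el) (≮⇒≥ g))) (surplus-none (m≤n⇒m≤1+n (≮⇒≥ g))))
                    (sym (surplus-none (≮⇒≥ g)))

-- The rows m and m′ are the numbers of rows passed so far; l and l′ are the final ones.
module _ {l l′ : ℕ} (l′≤l : l′ ≤ l) where

  private
    shift : ∀ m {o k} → m + suc o ≡ k → suc m + o ≡ k
    shift m {o} e = trans (sym (+-suc m o)) e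

    beyond : ∀ {m o} → m + suc o ≡ l′ → m < l
    beyond {m} {o} e = ≤-trans (≤-trans (m<m+n m (s≤s z≤n)) (≤-reflexive e)) l′≤l

    regroup : ∀ {a b c s r} → s ≡ b + c → a + b ≡ r → a + s ≡ r + c
    regroup {a} {b} {c} refl e = trans (sym (+-assoc a b c)) (cong (_+ c) e)

  inversions-crossings⁻ : ∀ {n} d m m′ e (v v′ : Vec Bool n) → m ≡ m′ + d → m + ones v ≡ l → m′ + ones v′ ≡ l′ →
    S m m′ e v v′ ≡ surplus l′ m + crossings⁻ d (Vec.zip v v′)
  -- Above height 1, a lower letter is counted with the upper letter of its row that is still to
  -- come. The summand d stands for these inversions, which have been counted although
  -- `surplus l′ m` still includes them.
  inversions-crossings⁺ : ∀ {n} d m m′ e (v v′ : Vec Bool n) → m′ ≡ suc (m + d) → m + ones v ≡ l → m′ + ones v′ ≡ l′ →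
    S m m′ e v v′ + d ≡ surplus l′ m + crossings⁺ d (Vec.zip v v′)
  inversions-crossings⁻ d m m′ e [] [] refl el el′ =
    sym
      (trans (+-identityʳ _) (surplus-none (≤-trans (≤-reflexive (trans (sym el′) (+-identityʳ m′))) (m≤n⇒m≤1+n (m≤m+n m′ d)))))
  inversions-crossings⁻ d m m′ e (false ∷ v) (false ∷ v′) eq el el′ =
    inversions-crossings⁻ d m m′ (suc e) v v′ eq el el′
  inversions-crossings⁻ d m m′ e (true ∷ v) (true ∷ v′) refl el el′ = trans (S-● m m′ e v v′)
    (regroup (cong₂ _+_ (rowIndicator-above m′ (suc m) (suc e) v (s≤s (m≤m+n m′ d)))
                        (inversions-crossings⁻ d (suc m) (suc m′) (suc e) v v′ refl (shift m el) (shift m′ el′)))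
             (surplus-step m (suc m′) (suc e) v′ (s≤s (m≤m+n m′ d)) (shift m′ el′)))
  inversions-crossings⁻ d m m′ e (true ∷ v) (false ∷ v′) refl el el′ = trans (S-↘ m m′ e v v′)
    (regroup (inversions-crossings⁻ (suc d) (suc m) m′ (suc e) v v′ (sym (+-suc m′ d)) (shift m el) el′)
             (surplus-step m m′ (suc e) v′ (m≤n⇒m≤1+n (m≤m+n m′ d)) el′))
  inversions-crossings⁻ zero m m′ e (false ∷ v) (true ∷ v′) eq el el′ = trans (S-↗ m m′ e v v′)
    (trans (cong₂ _+_ (rowIndicator-hit m′ m (suc e) v (≤-reflexive m≡m′) (≤-trans (beyond el′) (≤-reflexive (sym el))))
             (trans (sym (+-identityʳ _)) (inversions-crossings⁺ 0 m (suc m′) (suc e) v v′ (cong suc (sym (trans (+-identityʳ m) m≡m′))) el (shift m′ el′))))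
           (sym (+-suc _ _)))
    where m≡m′ = trans eq (+-identityʳ m′)
  inversions-crossings⁻ (suc d) m m′ e (false ∷ v) (true ∷ v′) refl el el′ = trans (S-↗ m m′ e v v′)
    (cong₂ _+_ (rowIndicator-above m′ m (suc e) v (m<m+n m′ (s≤s z≤n)))
               (inversions-crossings⁻ d m (suc m′) (suc e) v v′ (+-suc m′ d) el (shift m′ el′)))
  inversions-crossings⁺ d m m′ e [] [] refl el el′ =
    contradiction l′≤l
      (<⇒≱ (≤-trans (≤-reflexive (cong suc (trans (sym el) (+-identityʳ m)))) (≤-trans (s≤s (m≤m+n m d)) (≤-reflexive (trans (sym (+-identityʳ _)) el′)))))
  inversions-crossings⁺ d m m′ e (false ∷ v) (false ∷ v′) eq el el′ =
    inversions-crossings⁺ d m m′ (suc e) v v′ eq el el′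
  inversions-crossings⁺ d m m′ e (true ∷ v) (true ∷ v′) refl el el′ = begin
    S m m′ e (true ∷ v) (true ∷ v′) + d
      ≡⟨ cong (_+ d) (S-● m m′ e v v′) ⟩
    rowIndicator (suc m) (suc m′)
      (suc e) v′ + (rowIndicator m′ (suc m) (suc e) v + S (suc m) (suc m′) (suc e) v v′) + d
      ≡⟨ cong₂ (λ a b → a + (b + S (suc m) (suc m′) (suc e) v v′) + d)
           (rowIndicator-above (suc m) (suc m′) (suc e) v′ (s≤s (s≤s (m≤m+n m d))))
           (rowIndicator-hit m′ (suc m) (suc e) v (s≤s (m≤m+n m d)) (≤-trans (beyond el′) (≤-reflexive (sym (shift m el))))) ⟩
    suc (S (suc m) (suc m′) (suc e) v v′ + d)
      ≡⟨ cong suc (inversions-crossings⁺ d (suc m) (suc m′) (suc e) v v′ refl (shift m el) (shift m′ el′)) ⟩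
    suc (surplus l′ (suc m)) + crossings⁺ d (Vec.zip v v′)
      ≡⟨ cong (_+ crossings⁺ d (Vec.zip v v′))
        (surplus-suc (≤-trans (s≤s (s≤s (m≤m+n m d))) (≤-trans (m≤m+n (suc m′) (ones v′)) (≤-reflexive (shift m′ el′))))) ⟨
    surplus l′ m + crossings⁺ d (Vec.zip v v′) ∎
    where open ≡-Reasoning
  inversions-crossings⁺ d m m′ e (false ∷ v) (true ∷ v′) refl el el′ = begin
    S m m′ e (false ∷ v) (true ∷ v′) + d
      ≡⟨ cong (_+ d) (S-↗ m m′ e v v′) ⟩
    rowIndicator m′ m (suc e) v + S m (suc m′) (suc e) v v′ + d
      ≡⟨ cong (λ a → a + S m (suc m′) (suc e) v v′ + d)
           (rowIndicator-hit m′ m (suc e) v (m≤n⇒m≤1+n (m≤m+n m d)) (≤-trans (beyond el′) (≤-reflexive (sym el)))) ⟩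
    suc (S m (suc m′) (suc e) v v′ + d)
      ≡⟨ +-suc _ d ⟨
    S m (suc m′) (suc e) v v′ + suc d
      ≡⟨ inversions-crossings⁺ (suc d) m (suc m′) (suc e) v v′ (cong suc (sym (+-suc m d))) el (shift m′ el′) ⟩
    surplus l′ m + crossings⁺ (suc d) (Vec.zip v v′) ∎
    where open ≡-Reasoning
  inversions-crossings⁺ zero m m′ e (true ∷ v) (false ∷ v′) eq el el′ = trans (+-identityʳ _) (trans (S-↘ m m′ e v v′)
    (regroup (inversions-crossings⁻ 0 (suc m) m′ (suc e) v v′ (sym (trans (+-identityʳ m′) m′≡1+m)) (shift m el) el′)
             (surplus-step m m′ (suc e) v′ (≤-reflexive m′≡1+m) el′)))
    where m′≡1+m = trans eq (cong suc (+-identityʳ m))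
  inversions-crossings⁺ (suc d) m m′ e (true ∷ v) (false ∷ v′) refl el el′ = begin
    S m m′ e (true ∷ v) (false ∷ v′) + suc d
      ≡⟨ cong (_+ suc d)
        (trans (S-↘ m m′ e v v′) (cong (_+ S (suc m) m′ (suc e) v v′) (rowIndicator-above (suc m) m′ (suc e) v′ 1+m<m′))) ⟩
    S (suc m) m′ (suc e) v v′ + suc d
      ≡⟨ +-suc _ d ⟩
    suc (S (suc m) m′ (suc e) v v′ + d)
      ≡⟨ cong suc (inversions-crossings⁺ d (suc m) m′ (suc e) v v′ (cong suc (+-suc m d)) (shift m el) el′) ⟩
    suc (surplus l′ (suc m)) + crossings⁺ d (Vec.zip v v′)
      ≡⟨ cong (_+ crossings⁺ d (Vec.zip v v′))
        (surplus-suc (≤-trans 1+m<m′ (≤-trans (m≤m+n m′ (ones v′)) (≤-reflexive el′)))) ⟨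
    surplus l′ m + crossings⁺ d (Vec.zip v v′) ∎
    where
    open ≡-Reasoning
    1+m<m′ : suc m < m′
    1+m<m′ = s≤s (m<m+n m (s≤s z≤n))

pairInv-crossings : ∀ {n l l′ m m′} (v v′ : Vec Bool n) → l′ ≤ l → m′ ≤ m → ones v + m ≡ l → ones v′ + m′ ≡ l′ →
  pairInv (stripFilling m v) (stripFilling m′ v′) ≡ surplus l′ m + crossings⁻ (m ∸ m′) (Vec.zip v v′)
pairInv-crossings {m = m} {m′} v v′ l′≤l m′≤m el el′ = trans (pairInv-strips m m′ v v′)
  (inversions-crossings⁻ l′≤l (m ∸ m′) m m′ 1 v v′ (sym (m+[n∸m]≡n m′≤m)) (trans (+-comm m _) el) (trans (+-comm m′ _) el′))

stripFillings : ∀ {N n} → Vec ℕ n → Vec (Vec Bool N) n → Vec Filling n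
stripFillings = zipWith stripFilling

surplusSum : ∀ {n} → Vec ℕ n → Vec ℕ n → ℕ
surplusSum (l₁ ∷ l₂ ∷ ls) (m₁ ∷ m₂ ∷ ms) = surplus l₂ m₁ + surplusSum (l₂ ∷ ls) (m₂ ∷ ms)
surplusSum _              _              = 0

-- Strips at least two places later end at row m₀ or above, so the surplus is 0 and the path has too
-- few steps up to reach height 1.
crossInv-far : ∀ {N n} {ls ms : Vec ℕ n} {l₀ l₁ m₀ m₁} {V : Vec (Vec Bool N) n} (v : Vec Bool N) →
  l₁ ≤ l₀ → m₁ ≤ m₀ → head₀ ls ≤ m₀ → ones v + m₀ ≡ l₀ → Thin (l₁ ∷ ls) (m₁ ∷ ms) → HasRows ls ms V →
  crossInv (stripFilling m₀ v) (stripFillings ms V) ≡ 0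
crossInv-far v _ _ _ _ ([-] _) [] = refl
crossInv-far {m₀ = m₀} v l₁≤l₀ m₁≤m₀ l₂≤m₀ el (_∷_ {ls = ls} {ms} (_ , l₂≤l₁ , m₂≤m₁ , l₃≤m₁) t) (_∷_ {m = m₂} {v = v₂} el₂ hs) =
  cong₂ _+_
  (trans (pairInv-crossings v v₂ (≤-trans l₂≤l₁ l₁≤l₀) (≤-trans m₂≤m₁ m₁≤m₀) el el₂)
         (cong₂ _+_ (surplus-none (m≤n⇒m≤1+n l₂≤m₀)) (crossings-deep (m₀ ∸ m₂) (Vec.zip v v₂) deep)))
  (crossInv-far v (≤-trans l₂≤l₁ l₁≤l₀) (≤-trans m₂≤m₁ m₁≤m₀) (≤-trans l₃≤m₁ m₁≤m₀) el t hs)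
  where
  deep : ones (lowers (Vec.zip v v₂)) ≤ m₀ ∸ m₂
  deep =
    ≤-trans
      (≤-reflexive (trans (cong ones (lowers-zip v v₂)) (trans (sym (m+n∸n≡m (ones v₂) m₂)) (cong (_∸ m₂) el₂))))
        (∸-monoˡ-≤ m₂ l₂≤m₀)

inv-strips : ∀ {N n} {ls ms : Vec ℕ n} {V : Vec (Vec Bool N) n} → Thin ls ms → HasRows ls ms V →
  inv (stripFillings ms V) ≡ surplusSum ls ms + crossingSum ms V
inv-strips []      [] = refl
inv-strips {ms = m ∷ []} {V = v ∷ []} ([-] _) (_ ∷ []) = inv-∷ (stripFilling m v) []
inv-strips {ls = l₁ ∷ l₂ ∷ ls} {m₁ ∷ m₂ ∷ ms} {v₁ ∷ v₂ ∷ V} ((_ , l₂≤l₁ , m₂≤m₁ , l₃≤m₁) ∷ t) (e₁ ∷ e₂ ∷ hs) = begin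
  inv (stripFilling m₁ v₁ ∷ stripFilling m₂ v₂ ∷ stripFillings ms V)
    ≡⟨ inv-∷ (stripFilling m₁ v₁) (stripFilling m₂ v₂ ∷ stripFillings ms V) ⟩
  pairInv (stripFilling m₁ v₁) (stripFilling m₂ v₂) + crossInv (stripFilling m₁ v₁) (stripFillings ms V) + inv
    (stripFilling m₂ v₂ ∷ stripFillings ms V)
    ≡⟨ cong₂ _+_ (cong₂ _+_ (pairInv-crossings v₁ v₂ l₂≤l₁ m₂≤m₁ e₁ e₂) (crossInv-far v₁ l₂≤l₁ m₂≤m₁ l₃≤m₁ e₁ t hs))
      (inv-strips t (e₂ ∷ hs)) ⟩
  surplus l₂ m₁ + c + 0 + (surplusSum (l₂ ∷ ls) (m₂ ∷ ms) + crossingSum (m₂ ∷ ms) (v₂ ∷ V))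
    ≡⟨ exchange (surplus l₂ m₁) c (surplusSum (l₂ ∷ ls) (m₂ ∷ ms)) _ ⟩
  surplus l₂ m₁ + surplusSum (l₂ ∷ ls) (m₂ ∷ ms) + (c + crossingSum (m₂ ∷ ms) (v₂ ∷ V)) ∎
  where
  open ≡-Reasoning
  c = crossings⁻ (m₁ ∸ m₂) (Vec.zip v₁ v₂)
  exchange : ∀ a b c d → a + b + 0 + (c + d) ≡ a + c + (b + d)
  exchange = solve-∀

-- Vertical strips as rows of bits

cells-verticalStrip : ∀ r {l m} → m ≤ l →
  cellsFrom r (replicate l 1) (replicate m 1) ≡ reverse (map (_, 1) (up (r + m) (l ∸ m)))
cells-verticalStrip r {l} {zero} _ =
  trans (full-column r l) (cong (λ r → reverse (map (_, 1) (up r l))) (sym (+-identityʳ r)))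
  where
  full-column : ∀ r l → cellsFrom r (replicate l 1) [] ≡ reverse (map (_, 1) (up r l))
  full-column r zero    = refl
  full-column r (suc l) =
    trans (cong (_++ (r , 1) ∷ []) (full-column (suc r) l))
      (sym (List.unfold-reverse (r , 1) (map (_, 1) (up (suc r) l))))
cells-verticalStrip r {suc l} {suc m} (s≤s h) = trans (List.++-identityʳ _)
  (trans (cells-verticalStrip (suc r) h) (cong (λ r → reverse (map (_, 1) (up r (l ∸ m)))) (sym (+-suc r m))))

unzip-injective : ∀ {A B : Set} (xs ys : List (A × B)) → map proj₁ xs ≡ map proj₁ ys → map proj₂ xs ≡ map proj₂ ys →
  xs ≡ ys
unzip-injective []       []       _ _ = refl
unzip-injective (x ∷ xs) (y ∷ ys) e f =
  cong₂ _∷_ (cong₂ _,_ (List.∷-injectiveˡ e) (List.∷-injectiveˡ f))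
    (unzip-injective xs ys (List.∷-injectiveʳ e) (List.∷-injectiveʳ f))

allPairs-compare : ∀ {A : Set} {R : A → A → Set} {l x y} → AllPairs R l → x ∈ l → y ∈ l → R x y ⊎ x ≡ y ⊎ R y x
allPairs-compare (h ∷ _)  (here refl) (here refl) = inj₂ (inj₁ refl)
allPairs-compare (h ∷ _)  (here refl) (there y∈)  = inj₁ (All.lookup h y∈)
allPairs-compare (h ∷ _)  (there x∈)  (here refl) = inj₂ (inj₂ (All.lookup h x∈))
allPairs-compare (_ ∷ is) (there x∈)  (there y∈)  = allPairs-compare is x∈ y∈

Below : Entry → Entry → Set
Below x y = row (proj₁ x) < row (proj₁ y) × proj₂ x < proj₂ y

ascending-below : ∀ {n} m e (v : Vec Bool n) → AllPairs Below (ascending m e v)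
ascending-below m e []          = []
ascending-below m e (true ∷ v)  =
  All.zipWith id (rows-after (suc m) (suc e) v , later (suc m) e v) ∷ ascending-below (suc m) (suc e) v
  where
  rows-after : ∀ {n} m e (v : Vec Bool n) → All (λ x → m < row (proj₁ x)) (ascending m e v)
  rows-after m e []          = []
  rows-after m e (true ∷ v)  = ≤-refl ∷ All.map <⇒≤ (rows-after (suc m) (suc e) v)
  rows-after m e (false ∷ v) = rows-after m (suc e) v
ascending-below m e (false ∷ v) = ascending-below m (suc e) v

IsStrip : ℕ → ℕ → ℕ → Filling → Set
IsStrip N l m T = ∃ λ (v : Vec Bool N) → ones v + m ≡ l × T ≡ stripFilling m v

enumerates-strips : ∀ N {l m} → m ≤ l → Enumerates (ssyt N (verticalStrip l m)) (IsStrip N l m)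
enumerates-strips N {l} {m} m≤l = enumerates-resp (enumerates-ssyt N (verticalStrip l m)) into from
  where
  strip-cells = cells-verticalStrip 1 m≤l
  into : ∀ {T} → (map proj₁ T ≡ cells (verticalStrip l m) × All (Entries N) (readingWord T)) × Semistandard T →
    IsStrip N l m T
  into {T} ((c , b) , s) =
    build (lettersFrom-surjective N 1 (map proj₂ A) increasing (All.map (map₂ s≤s) letters-bounds))
    where
    A = reverse T
    A-cells : map proj₁ A ≡ map (_, 1) (up (suc m) (l ∸ m))
    A-cells =
      trans (List.reverse-map proj₁ T) (trans (cong reverse (trans c strip-cells)) (List.reverse-involutive _))
    letters-bounds : All (Entries N) (map proj₂ A)
    letters-bounds = subst (All (Entries N)) (sym (List.reverse-map proj₂ T)) (reverse-all b)
    compatible : ∀ {x y} → x ∈ A → y ∈ A → Compatible x y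
    compatible x∈ y∈ =
      All.lookup (All.lookup s (Perm.∈-resp-↭ (Perm.↭-reverse T) x∈)) (Perm.∈-resp-↭ (Perm.↭-reverse T) y∈)
    from-cells : ∀ r k (B : Filling) → map proj₁ B ≡ map (_, 1) (up r k) → (∀ {x} → x ∈ B → x ∈ A) →
      Increasing (map proj₂ B)
    from-cells r zero    []            e h = []
    from-cells r (suc k) ((u , a) ∷ B) e h with refl ← List.∷-injectiveˡ e =
      All.map⁺
        (All.tabulate λ {y} y∈ → larger y (h (there y∈)) (∈-map⁺ proj₁ y∈)) ∷ from-cells (suc r) k B (List.∷-injectiveʳ e) (h ∘ there)
      where
      up-above : ∀ {r k x} → x ∈ up r k → r ≤ x
      up-above {k = suc k} (here refl) = ≤-refl
      up-above {k = suc k} (there x∈)  = <⇒≤ (up-above x∈)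
      larger : ∀ y → y ∈ A → proj₁ y ∈ map proj₁ B → a < proj₂ y
      larger y y∈ u∈ with s , s∈ , refl ← ∈-map⁻ (_, 1) (subst (proj₁ y ∈_) (List.∷-injectiveʳ e) u∈) =
        proj₂ (compatible (h (here refl)) y∈) refl (up-above s∈)
    increasing : Increasing (map proj₂ A)
    increasing = from-cells (suc m) (l ∸ m) A A-cells id
    build : (∃ λ (v : Vec Bool N) → lettersFrom 1 v ≡ map proj₂ A) → IsStrip N l m T
    build (v , e) = v , trans (cong (_+ m) size-v) (m∸n+n≡m m≤l) ,
      trans (sym (List.reverse-involutive T)) (cong reverse (unzip-injective A (ascending m 1 v)
        (trans A-cells (sym (trans (ascending-rows m 1 v) (cong (λ k → map (_, 1) (up (suc m) k)) size-v)))) (trans (sym e) (sym (ascending-letters m 1 v)))))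
      where
      length-up : ∀ r k → length (up r k) ≡ k
      length-up r zero    = refl
      length-up r (suc k) = cong suc (length-up (suc r) k)
      size-v : ones v ≡ l ∸ m
      size-v = trans (sym (length-lettersFrom 1 v)) (trans (cong length e) (trans (List.length-map proj₂ A)
        (trans (sym (List.length-map proj₁ A)) (trans (cong length A-cells) (trans (List.length-map (_, 1) (up (suc m) (l ∸ m))) (length-up (suc m) (l ∸ m)))))))
  from : ∀ {T} → IsStrip N l m T →
    (map proj₁ T ≡ cells (verticalStrip l m) × All (Entries N) (readingWord T)) × Semistandard T
  from (v , refl , refl) = (cells-≡ , entries) , All.tabulate λ x∈ → All.tabulate λ y∈ → compatible x∈ y∈
    where
    A = ascending m 1 v
    cells-≡ : map proj₁ (reverse A) ≡ cells (verticalStrip (ones v + m) m)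
    cells-≡ = trans (List.reverse-map proj₁ A) (trans (cong reverse (ascending-rows m 1 v))
      (sym (trans strip-cells (cong (λ k → reverse (map (_, 1) (up (suc m) k))) (m+n∸n≡m (ones v) m)))))
    entries : All (Entries N) (readingWord (reverse A))
    entries =
      subst (All (Entries N)) (sym (trans (List.reverse-map proj₂ A) (cong reverse (ascending-letters m 1 v))))
      (reverse-all (All.map (map₂ s≤s⁻¹) (lettersFrom-bounds 1 v)))
    compatible : ∀ {x y} → x ∈ reverse A → y ∈ reverse A → Compatible x y
    compatible {x} {y} x∈ y∈ =
      (λ _ c< → contradiction c< (<-irrefl (trans (proj₁ (proj₂ (strip x∈′))) (sym (proj₁ (proj₂ (strip y∈′))))))) , λ _ → ordered (allPairs-compare (ascending-below m 1 v) x∈′ y∈′)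
      where
      x∈′ = Perm.∈-resp-↭ (Perm.↭-reverse A) x∈
      y∈′ = Perm.∈-resp-↭ (Perm.↭-reverse A) y∈
      strip : ∀ {x} → x ∈ A → StripEntry 1 x
      strip = All.lookup (ascending-entries m 1 v)
      ordered : Below x y ⊎ x ≡ y ⊎ Below y x → row (proj₁ x) < row (proj₁ y) → proj₂ x < proj₂ y
      ordered (inj₁ (_ , b))        r< = b
      ordered (inj₂ (inj₁ refl))    r< = contradiction r< (<-irrefl refl)
      ordered (inj₂ (inj₂ (q , _))) r< = contradiction r< (<-asym q)

stripFilling-injective : ∀ {N} m (v w : Vec Bool N) → stripFilling m v ≡ stripFilling m w → v ≡ w
stripFilling-injective m v w e = lettersFrom-injective 1 v w
  (trans (sym (ascending-letters m 1 v)) (trans (cong (map proj₂) (List.reverse-injective e)) (ascending-letters m 1 w)))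

stripFillings-injective : ∀ {N n} (ms : Vec ℕ n) (V W : Vec (Vec Bool N) n) →
  stripFillings ms V ≡ stripFillings ms W → V ≡ W
stripFillings-injective []       []      []      e = refl
stripFillings-injective (m ∷ ms) (v ∷ V) (w ∷ W) e =
  cong₂ _∷_ (stripFilling-injective m v w (Vec.∷-injectiveˡ e)) (stripFillings-injective ms V W (Vec.∷-injectiveʳ e))

IsTuple : ∀ {n} N → Vec ℕ n → Vec ℕ n → Vec Filling n → Set
IsTuple {n} N ls ms T = ∃ λ (V : Vec (Vec Bool N) n) → HasRows ls ms V × T ≡ stripFillings ms V

enumerates-tuples : ∀ {n} N {ls ms : Vec ℕ n} → Pointwise _≤_ ms ls →
  Enumerates (ssytTuples N (zipWith verticalStrip ls ms)) (IsTuple N ls ms)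
enumerates-tuples N [] = record
  { unique = [] ∷ [] ; sound = λ { (here refl) → [] , [] , refl } ; complete = λ { ([] , [] , refl) → here refl } }
enumerates-tuples N (h ∷ hs) = enumerates-resp
  (enumerates-product _∷_ Vec.∷-injective (enumerates-strips N h) (enumerates-tuples N hs))
  (λ { (image₂ (v , e , refl) (V , es , refl)) → v ∷ V , e ∷ es , refl })
  (λ { (v ∷ V , e ∷ es , refl) → image₂ (v , e , refl) (V , es , refl) })

bitVectors : ∀ N → List (Vec Bool N)
bitVectors zero    = [] ∷ []
bitVectors (suc N) = cartesianProductWith _∷_ (false ∷ true ∷ []) (bitVectors N)

enumerates-bitVectors : ∀ N → Enumerates (bitVectors N) (λ _ → ⊤)
enumerates-bitVectors zero    = record { unique = [] ∷ [] ; sound = λ _ → tt ; complete = λ { {[]} _ → here refl } }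
enumerates-bitVectors (suc N) = enumerates-resp
  (enumerates-product _∷_ Vec.∷-injective bits (enumerates-bitVectors N)) (λ _ → tt) (λ { {_ ∷ _} _ → image₂ tt tt })
  where
  bits : Enumerates (false ∷ true ∷ []) (λ _ → ⊤)
  bits = record
    { unique   = ((λ ()) ∷ []) ∷ [] ∷ []
    ; sound    = λ _ → tt
    ; complete = λ { {false} _ → here refl ; {true} _ → there (here refl) } }

rowVectors : ∀ {n} N → Vec ℕ n → Vec ℕ n → List (Vec (Vec Bool N) n)
rowVectors N []       []       = [] ∷ []
rowVectors N (l ∷ ls) (m ∷ ms) =
  cartesianProductWith _∷_ (filter (λ v → ones v + m ≟ l) (bitVectors N)) (rowVectors N ls ms)

enumerates-rowVectors : ∀ {n} N (ls ms : Vec ℕ n) → Enumerates (rowVectors N ls ms) (HasRows ls ms)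
enumerates-rowVectors N []       []       = record
  { unique = [] ∷ [] ; sound = λ { (here refl) → [] } ; complete = λ { [] → here refl } }
enumerates-rowVectors N (l ∷ ls) (m ∷ ms) = enumerates-resp
  (enumerates-product _∷_ Vec.∷-injective (enumerates-filter (λ v → ones v + m ≟ l) (enumerates-bitVectors N)) (enumerates-rowVectors N ls ms))
  (λ { (image₂ (_ , e) es) → e ∷ es }) (λ { (e ∷ es) → image₂ (tt , e) es })

weight-[] : ∀ N → weight N [] ≡ Vec.replicate N 0
weight-[] zero    = refl
weight-[] (suc N) = cong (0 ∷_) (weight-[] N)

zipWith-tabulate : ∀ {n} (f g : Fin n → ℕ) → zipWith _+_ (tabulate f) (tabulate g) ≡ tabulate (λ i → f i + g i)
zipWith-tabulate {zero}  f g = refl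
zipWith-tabulate {suc n} f g = cong (f zero + g zero ∷_) (zipWith-tabulate (f ∘ suc) (g ∘ suc))

weight-++ : ∀ N u v → weight N (u ++ v) ≡ zipWith _+_ (weight N u) (weight N v)
weight-++ N u v = trans (Vec.tabulate-cong (λ i → count-++ (suc (toℕ i)) u v)) (sym (zipWith-tabulate _ _))

weight-lettersFrom : ∀ {N} (v : Vec Bool N) → weight N (lettersFrom 1 v) ≡ Vec.map bit v
weight-lettersFrom v =
  trans
    (Vec.tabulate-cong (λ i → trans (count-lettersFrom 1 v i) (sym (Vec.lookup-map i bit v)))) (Vec.tabulate∘lookup (Vec.map bit v))

weight-strips : ∀ {N n} (ms : Vec ℕ n) (V : Vec (Vec Bool N) n) →
  weight N (concatMap readingWord (toList (stripFillings ms V))) ≡ letterTotals V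
weight-strips {N} []       []      = weight-[] N
weight-strips {N} (m ∷ ms) (v ∷ V) = trans (weight-++ N (readingWord (stripFilling m v)) _) (cong₂ (zipWith _+_)
  (trans (weight-↭ (↭-trans (Perm.map⁺ proj₂ (Perm.↭-reverse (ascending m 1 v))) (↭-reflexive (ascending-letters m 1 v)))) (weight-lettersFrom v))
  (weight-strips ms V))

-- The letters m + 1, …, l: every box of the row is filled with its column.
block : ∀ N → ℕ → ℕ → Vec Bool N
block zero    l       m       = []
block (suc N) l       (suc m) = false ∷ block N (pred l) m
block (suc N) (suc l) zero    = true ∷ block N l zero
block (suc N) zero    zero    = false ∷ block N zero zero

ones-block : ∀ {N l m} → m ≤ l → l ≤ N → ones (block N l m) + m ≡ l
ones-block {zero}  {zero}  {zero}  h       g       = refl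
ones-block {suc N} {suc l} {suc m} (s≤s h) (s≤s g) = trans (+-suc _ m) (cong suc (ones-block h g))
ones-block {suc N} {suc l} {zero}  h       (s≤s g) = cong suc (ones-block {N} {l} z≤n g)
ones-block {suc N} {zero}  {zero}  h       g       = ones-block {N} {zero} z≤n z≤n

-- As l₂ ≤ l₁, only letters from m₂ + 1 to m₁ can lie in the lower row alone, so the path has at
-- most d steps up.
crossings-block : ∀ N {l₁ l₂ m₁ m₂} d → l₂ ≤ l₁ → m₂ ≤ m₁ → m₁ ∸ m₂ ≤ d →
  crossings⁻ d (Vec.zip (block N l₁ m₁) (block N l₂ m₂)) ≡ 0
crossings-block zero    d h g e = refl
crossings-block (suc N) {m₁ = suc m₁} {suc m₂} d h (s≤s g) e = crossings-block N d (pred-mono-≤ h) g e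
crossings-block (suc N) {l₁} {suc l₂} {suc m₁} {zero} (suc d) h g (s≤s e) = crossings-block N d (pred-mono-≤ h) z≤n e
crossings-block (suc N) {l₁} {zero} {suc m₁} {zero} d h g e = crossings-block N d z≤n z≤n (<⇒≤ e)
crossings-block (suc N) {suc l₁} {suc l₂} {zero} {zero} d (s≤s h) g e = crossings-block N d h z≤n z≤n
crossings-block (suc N) {suc l₁} {zero} {zero} {zero} d h g e = crossings-block N (suc d) z≤n z≤n z≤n
crossings-block (suc N) {zero} {zero} {zero} {zero} d h g e = crossings-block N d z≤n z≤n z≤n

blocks : ∀ {n} N → Vec ℕ n → Vec ℕ n → Vec (Vec Bool N) n
blocks N = zipWith (block N)

crossingSum-blocks : ∀ {n} N {ls ms : Vec ℕ n} → Thin ls ms → crossingSum ms (blocks N ls ms) ≡ 0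
crossingSum-blocks N []                        = refl
crossingSum-blocks N ([-] _)                   = refl
crossingSum-blocks N ((_ , h , g , _) ∷ t)     = cong₂ _+_ (crossings-block N _ h g ≤-refl) (crossingSum-blocks N t)

hasRows-blocks : ∀ {n N} {ls ms : Vec ℕ n} → Pointwise _≤_ ms ls → largest (toList ls) ≤ N →
  HasRows ls ms (blocks N ls ms)
hasRows-blocks []       _ = []
hasRows-blocks {ls = l ∷ ls} (h ∷ hs) g =
  ones-block h (≤-trans (m≤m⊔n l _) g) ∷ hasRows-blocks hs (≤-trans (m≤n⊔m l _) g)

-- The expansion

length-interval : ∀ a b → length (interval a b) ≡ b ∸ a
length-interval a b = trans (List.length-map (λ k → suc (a + k)) (upTo (b ∸ a))) (List.length-applyUpTo id (b ∸ a))

length-cellsFrom : ∀ r o i → (∀ k → part i k ≤ part o k) → length (cellsFrom r o i) + sum i ≡ sum o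
length-cellsFrom r []      i       h = outside i (λ k → n≤0⇒n≡0 (h k))
  where
  outside : ∀ i → (∀ k → part i k ≡ 0) → sum i ≡ 0
  outside []      h = refl
  outside (b ∷ i) h = cong₂ _+_ (h 0) (outside i (h ∘ suc))
length-cellsFrom r (a ∷ o) []      h = trans (cong (_+ 0) (trans (List.length-++ (cellsFrom (suc r) o []))
  (cong (length (cellsFrom (suc r) o []) +_) (trans (List.length-map (r ,_) (interval 0 a)) (length-interval 0 a)))))
  (trans (+-identityʳ _) (trans (+-comm _ a) (cong (a +_) (trans (sym (+-identityʳ _)) (length-cellsFrom (suc r) o [] (λ _ → z≤n))))))
length-cellsFrom r (a ∷ o) (b ∷ i) h = begin
  length (cellsFrom (suc r) o i ++ map (r ,_) (interval b a)) + (b + sum i)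
    ≡⟨ cong (_+ (b + sum i)) (trans (List.length-++ (cellsFrom (suc r) o i))
         (cong (n +_) (trans (List.length-map (r ,_) (interval b a)) (length-interval b a)))) ⟩
  n + (a ∸ b) + (b + sum i)
    ≡⟨ exchange n (a ∸ b) b (sum i) ⟩
  (a ∸ b + b) + (n + sum i)
    ≡⟨ cong₂ _+_ (m∸n+n≡m (h 0)) (length-cellsFrom (suc r) o i (h ∘ suc)) ⟩
  a + sum o ∎
  where
  open ≡-Reasoning
  n = length (cellsFrom (suc r) o i)
  exchange : ∀ a b c d → a + b + (c + d) ≡ (b + c) + (a + d)
  exchange = solve-∀

sum-columnLengths : ∀ k ρ → (∀ i → part ρ i ≤ k) → sum (columnLengths k ρ) ≡ sum ρ
sum-columnLengths zero    ρ h = sym (vanishes ρ h)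
  where
  vanishes : ∀ ρ → (∀ i → part ρ i ≤ 0) → sum ρ ≡ 0
  vanishes []      h = refl
  vanishes (x ∷ ρ) h = cong₂ _+_ (n≤0⇒n≡0 (h 0)) (vanishes ρ (h ∘ suc))
sum-columnLengths (suc k) ρ h = trans
  (cong (atLeast 1 ρ +_) (sum-columnLengths k (map pred ρ) (λ i → ≤-trans (≤-reflexive (part-pred ρ i)) (pred-mono-≤ (h i))))) (first-column ρ)
  where
  exchange : ∀ a b c → a + (b + c) ≡ b + (a + c)
  exchange = solve-∀
  first-column : ∀ ρ → atLeast 1 ρ + sum (map pred ρ) ≡ sum ρ
  first-column []          = refl
  first-column (zero ∷ ρ)  = first-column ρ
  first-column (suc x ∷ ρ) = cong suc (trans (exchange (atLeast 1 ρ) x _) (cong (x +_) (first-column ρ)))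

sum-conjugate : ∀ ρ → sum (conjugate ρ) ≡ sum ρ
sum-conjugate ρ = trans (cong sum (conjugate-columnLengths ρ)) (sum-columnLengths (largest ρ) ρ (largest-part ρ))

conjugate-mono : ∀ σ ρ → (∀ i → part σ i ≤ part ρ i) → ∀ k → part (conjugate σ) k ≤ part (conjugate ρ) k
conjugate-mono σ ρ h k =
  subst₂ (λ x y → part x k ≤ part y k) (sym (conjugate-columnLengths σ)) (sym (conjugate-columnLengths ρ))
  (columns-mono (largest-mono σ ρ h) σ ρ h k)
  where
  atLeast-mono : ∀ σ ρ → (∀ i → part σ i ≤ part ρ i) → atLeast 1 σ ≤ atLeast 1 ρ
  atLeast-mono []          ρ           h = z≤n
  atLeast-mono (zero ∷ σ)  []          h = atLeast-mono σ [] (h ∘ suc)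
  atLeast-mono (suc x ∷ σ) []          h = contradiction (h 0) λ ()
  atLeast-mono (zero ∷ σ)  (zero ∷ ρ)  h = atLeast-mono σ ρ (h ∘ suc)
  atLeast-mono (zero ∷ σ)  (suc y ∷ ρ) h = m≤n⇒m≤1+n (atLeast-mono σ ρ (h ∘ suc))
  atLeast-mono (suc x ∷ σ) (zero ∷ ρ)  h = contradiction (h 0) λ ()
  atLeast-mono (suc x ∷ σ) (suc y ∷ ρ) h = s≤s (atLeast-mono σ ρ (h ∘ suc))
  largest-mono : ∀ σ ρ → (∀ i → part σ i ≤ part ρ i) → largest σ ≤ largest ρ
  largest-mono []      ρ       h = z≤n
  largest-mono (x ∷ σ) []      h = ⊔-lub (h 0) (largest-mono σ [] (h ∘ suc))
  largest-mono (x ∷ σ) (y ∷ ρ) h = ⊔-mono-≤ (h 0) (largest-mono σ ρ (h ∘ suc))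
  columns-mono : ∀ {j k} → j ≤ k → ∀ σ ρ → (∀ i → part σ i ≤ part ρ i) → ∀ i →
    part (columnLengths j σ) i ≤ part (columnLengths k ρ) i
  columns-mono z≤n       σ ρ h i       = z≤n
  columns-mono (s≤s j≤k) σ ρ h zero    = atLeast-mono σ ρ h
  columns-mono (s≤s j≤k) σ ρ h (suc i) = columns-mono j≤k (map pred σ) (map pred ρ)
    (λ i → subst₂ _≤_ (sym (part-pred σ i)) (sym (part-pred ρ i)) (pred-mono-≤ (h i))) i

sum-toList : ∀ {n} (ρ : Vec ℕ n) → sum (toList ρ) ≡ Vec.sum ρ
sum-toList []      = refl
sum-toList (x ∷ ρ) = cong (x +_) (sum-toList ρ)

pointwise-part : ∀ {n} {mu lam : Vec ℕ n} → Pointwise _≤_ mu lam → ∀ i → part (toList mu) i ≤ part (toList lam) i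
pointwise-part []       i       = z≤n
pointwise-part (h ∷ hs) zero    = h
pointwise-part (h ∷ hs) (suc i) = pointwise-part hs i

size-conjugate : ∀ {n} {lam mu : Vec ℕ n} → Pointwise _≤_ mu lam →
  size (conjugate (toList lam) ╱ conjugate (toList mu)) ≡ Vec.sum (zipWith _∸_ lam mu)
size-conjugate {lam = lam} {mu} h = +-cancelʳ-≡ (Vec.sum mu) _ _ (begin
  size (conjugate (toList lam) ╱ conjugate (toList mu)) + Vec.sum mu
    ≡⟨ cong (size (conjugate (toList lam) ╱ conjugate (toList mu)) +_)
      (trans (sum-conjugate (toList mu)) (sum-toList mu)) ⟨
  size (conjugate (toList lam) ╱ conjugate (toList mu)) + sum (conjugate (toList mu))
    ≡⟨ length-cellsFrom 1 (conjugate (toList lam)) (conjugate (toList mu))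
      (conjugate-mono (toList mu) (toList lam) (pointwise-part h)) ⟩
  sum (conjugate (toList lam))
    ≡⟨ trans (sum-conjugate (toList lam)) (sum-toList lam) ⟩
  Vec.sum lam
    ≡⟨ difference h ⟨
  Vec.sum (zipWith _∸_ lam mu) + Vec.sum mu ∎)
  where
  open ≡-Reasoning
  exchange : ∀ a b c d → a + b + (c + d) ≡ (a + c) + (b + d)
  exchange = solve-∀
  difference : ∀ {n} {lam mu : Vec ℕ n} → Pointwise _≤_ mu lam →
    Vec.sum (zipWith _∸_ lam mu) + Vec.sum mu ≡ Vec.sum lam
  difference []                                             = refl
  difference (_∷_ {x = m} {y = l} {xs = mu} h hs) =
    trans (exchange (l ∸ m) _ m (Vec.sum mu)) (cong₂ _+_ (m∸n+n≡m h) (difference hs))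

-- Columns with at most two boxes

columnCount : ℕ → ℕ → List ℕ → List ℕ → ℕ
columnCount c r o i = count c (map column (cellsFrom r o i))

columnCount-∷ : ∀ c r a o b i → columnCount c r (a ∷ o) (b ∷ i) ≡ columnCount c (suc r) o i + count c (interval b a)
columnCount-∷ c r a o b i = trans (cong (count c) (List.map-++ column (cellsFrom (suc r) o i) _))
  (trans (count-++ c (map column (cellsFrom (suc r) o i)) _)
         (cong (λ u → columnCount c (suc r) o i + count c u) (trans (sym (List.map-∘ (interval b a))) (List.map-id (interval b a)))))

occurs : ∀ {w x} → x ∈ w → 1 ≤ count x w
occurs {w} x∈ = n≢0⇒n>0 λ e → All.lookup (count≡0 w e) x∈ refl

interval-member : ∀ {c} b a → b < c → c ≤ a → 1 ≤ count c (interval b a)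
interval-member {c} b a b<c c≤a = subst (λ c → 1 ≤ count c (interval b a)) (m+[n∸m]≡n b<c)
  (occurs (∈-map⁺ (λ k → suc (b + k)) (∈-applyUpTo⁺ id (≤-trans (≤-reflexive (sym (+-∸-assoc 1 b<c))) (∸-monoˡ-≤ b c≤a)))))

thin-columns : ∀ {n} r {lam mu : Vec ℕ n} → Linked _≥_ lam → Linked _≥_ mu → Pointwise _≤_ mu lam →
               (∀ c → columnCount c r (toList lam) (toList mu) ≤ 2) → Thin lam mu
thin-columns r []       []       []             b = []
thin-columns r [-]      [-]      (h ∷ [])       b = [-] h
thin-columns r {l₁ ∷ l₂ ∷ ls} {m₁ ∷ m₂ ∷ ms} (p ∷ ps) (q ∷ qs) (h ∷ hs) b =
  (h , p , q , third ls ms ps qs b) ∷ thin-columns (suc r) ps qs hs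
    (λ c → ≤-trans (≤-trans (m≤m+n _ _) (≤-reflexive (sym (columnCount-∷ c r l₁ (toList (l₂ ∷ ls)) m₁ (toList (m₂ ∷ ms)))))) (b c))
  where
  third : ∀ {n} (ls ms : Vec ℕ n) → Linked _≥_ (l₂ ∷ ls) → Linked _≥_ (m₂ ∷ ms) →
          (∀ c → columnCount c r (l₁ ∷ l₂ ∷ toList ls) (m₁ ∷ m₂ ∷ toList ms) ≤ 2) → head₀ ls ≤ m₁
  third []        []        _          _          b = z≤n
  third (l₃ ∷ ls) (m₃ ∷ ms) (l₃≤l₂ ∷ _) (m₃≤m₂ ∷ _) b = ≮⇒≥ λ m₁<l₃ → 1+n≰n (≤-trans (three m₁<l₃) (b c))
    where
    open ≤-Reasoning
    -- If m₁ < l₃, then m₃ ≤ m₂ ≤ m₁ < l₃ ≤ l₂ ≤ l₁ puts a box of this column into each of the three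
    -- rows.
    c = suc m₁
    o₁ = l₃ ∷ toList ls
    i₁ = m₃ ∷ toList ms
    three : m₁ < l₃ → 3 ≤ columnCount c r (l₁ ∷ l₂ ∷ o₁) (m₁ ∷ m₂ ∷ i₁)
    three m₁<l₃ = begin
      3
        ≤⟨ +-mono-≤
          (+-mono-≤ (≤-trans (interval-member m₃ l₃ (s≤s (≤-trans m₃≤m₂ q)) m₁<l₃) (m≤n+m _ (columnCount c (3 + r) (toList ls) (toList ms))))
                              (interval-member m₂ l₂ (s≤s q) (≤-trans m₁<l₃ l₃≤l₂)))
                    (interval-member m₁ l₁ ≤-refl (≤-trans m₁<l₃ (≤-trans l₃≤l₂ p))) ⟩
      columnCount c (3 + r) (toList ls) (toList ms) + count c (interval m₃ l₃) + count c (interval m₂ l₂) + count c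
        (interval m₁ l₁)
        ≡⟨ cong
          (λ x → x + count c (interval m₂ l₂) + count c (interval m₁ l₁)) (columnCount-∷ c (2 + r) l₃ (toList ls) m₃ (toList ms)) ⟨
      columnCount c (2 + r) o₁ i₁ + count c (interval m₂ l₂) + count c (interval m₁ l₁)
        ≡⟨ cong (_+ count c (interval m₁ l₁)) (columnCount-∷ c (1 + r) l₂ o₁ m₂ i₁) ⟨
      columnCount c (1 + r) (l₂ ∷ o₁) (m₂ ∷ i₁) + count c (interval m₁ l₁)
        ≡⟨ columnCount-∷ c r l₁ (l₂ ∷ o₁) m₁ (m₂ ∷ i₁) ⟨
      columnCount c r (l₁ ∷ l₂ ∷ o₁) (m₁ ∷ m₂ ∷ i₁) ∎

-- Polynomials as lists of monomials up to permutation

↭⇒≈ : ∀ {N} {p r : Poly N} → p ↭ r → p ≈ r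
↭⇒≈ p t = Perm.↭-length (Perm.filter-↭ (Product.≡-dec _≟_ (Vec.≡-dec _≟_) t) p)

map-product : ∀ {A B C D E F : Set} (f : A → B → C) (a : D → A) (b : E → B) (g : F → C) (k : D → E → F) →
  (∀ x y → g (k x y) ≡ f (a x) (b y)) → ∀ xs ys →
  map g (cartesianProductWith k xs ys) ≡ cartesianProductWith f (map a xs) (concatMap (λ y → b y ∷ []) ys)
map-product f a b g k h []       ys = refl
map-product f a b g k h (x ∷ xs) ys =
  trans (List.map-++ g (map (k x) ys) _) (cong₂ _++_ (single ys) (map-product f a b g k h xs ys))
  where
  single : ∀ ys → map g (map (k x) ys) ≡ map (f (a x)) (concatMap (λ y → b y ∷ []) ys)
  single []       = refl
  single (y ∷ ys) = cong₂ _∷_ (h x y) (single ys)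

zipWith-zeroˡ : ∀ {n} (κ : Vec ℕ n) → zipWith _+_ (Vec.replicate n 0) κ ≡ κ
zipWith-zeroˡ = Vec.zipWith-identityˡ +-identityˡ

zipWith-zeroʳ : ∀ {n} (κ : Vec ℕ n) → zipWith _+_ κ (Vec.replicate n 0) ≡ κ
zipWith-zeroʳ = Vec.zipWith-identityʳ +-identityʳ

module Expansion {n} {lam mu : Vec ℕ n} (t : Thin lam mu) (mu≤lam : Pointwise _≤_ mu lam) (N : ℕ) where

  open Correspondence {N} t mu≤lam

  ν : Vec SkewShape n
  ν = zipWith verticalStrip lam mu

  minimum : ℕ
  minimum = surplusSum lam mu

  crossingMonomial peakMonomial : Vec (Vec Bool N) n → Monomial N
  crossingMonomial V = minimum + crossingSum mu V , letterTotals V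
  peakMonomial     V = minimum + peakSum mu V , letterTotals V

  tripleMonomial : Triple → Monomial N
  tripleMonomial (_ , P , T) = minimum + chargeTableau (toList mu) T , weight N (readingWord P)

  V₀ : List (Vec (Vec Bool N) n)
  V₀ = rowVectors N lam mu

  enum : Enumerates V₀ (HasRows lam mu)
  enum = enumerates-rowVectors N lam mu

  LLT-crossings : LLT N ν ↭ map crossingMonomial V₀
  LLT-crossings = correspond (λ T V → T ≡ stripFillings mu V) (enumerates-tuples N mu≤lam) enum
    (λ (V , h , e) → V , h , e)
    (λ {V} h → stripFillings mu V , (V , h , refl) , refl)
    (λ _ e e′ → stripFillings-injective mu _ _ (trans (sym e) e′))
    (λ _ _ e e′ → trans e (sym e′))
    value
    where
    value : ∀ {T V} → IsTuple N lam mu T → T ≡ stripFillings mu V →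
            (inv T , weight N (concatMap readingWord (toList T))) ≡ crossingMonomial V
    value {V = V} (W , h , e) refl with refl ← stripFillings-injective mu V W e =
      cong₂ _,_ (inv-strips t h) (weight-strips mu V)

  crossings-peaks : map crossingMonomial V₀ ↭ map peakMonomial V₀
  crossings-peaks =
    ↭-trans (↭-reflexive (trans (List.map-cong-local (All.tabulate λ V∈ → monomial (sound enum V∈))) (List.map-∘ V₀)))
    (Perm.map⁺ peakMonomial (map-injective-↭ (straightenRows mu) enum (straightenRows-hasRows t) (straightenRows-injective t)))
    where
    monomial : ∀ {V} → HasRows lam mu V → crossingMonomial V ≡ peakMonomial (straightenRows mu V)
    monomial {V} h = cong₂ _,_ (cong (minimum +_) (crossingSum≡peakSum t h)) (sym (letterTotals-straightenRows mu V))

  peaks-triples : map peakMonomial V₀ ↭ map tripleMonomial (triples (Vec.sum α))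
  peaks-triples = correspond Related enum (enumerates-triples (Vec.sum α)) related-total related-surjective
    (λ _ → related-deterministic) (λ _ _ → related-injective)
    (λ {_} {y} h r → cong₂ _,_ (cong (minimum +_) (sym (charge-T r h))) (sym (P-weight r)))

  right-hand-side : ℕ → Poly N
  right-hand-side s = q^ minimum ⊗
    (∑[ ρ ← partitions s ] (schur N (conjugate ρ) ⊗ (∑[ T ← ssytOfWeight ρ α ] q^ chargeTableau (toList mu) T)))

  -- The triples are listed in the order in which the products are expanded, so the lists are equal
  -- once the zero exponent vectors of the powers of q are removed.
  triples-expansion : ∀ s → map tripleMonomial (triples s) ≡ right-hand-side s
  triples-expansion s = begin
    map tripleMonomial (triples s)
      ≡⟨ List.map-cong (λ (ρ , P , T) → cong (minimum + chargeTableau (toList mu) T ,_)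
           (sym (trans (zipWith-zeroˡ _) (zipWith-zeroʳ (weight N (readingWord P)))))) (triples s) ⟩
    map (λ y → shift (unshifted y)) (triples s)
      ≡⟨ List.map-∘ (triples s) ⟩
    map shift (map unshifted (triples s))
      ≡⟨ cong (map shift) (List.map-concatMap unshifted fibre (partitions s)) ⟩
    map shift (concatMap (λ ρ → map unshifted (fibre ρ)) (partitions s))
      ≡⟨ cong (map shift)
        (List.concatMap-cong (λ ρ → map-product _ (λ P → 0 , weight N (readingWord P)) (λ T → chargeTableau (toList mu) T , Vec.replicate N 0)
           unshifted
             (λ P T → ρ , P , T) (λ _ _ → refl) (ssyt N (conjugate ρ ╱ [])) (ssytOfWeight ρ α)) (partitions s)) ⟩
    map shift
      (concatMap (λ ρ → schur N (conjugate ρ) ⊗ (∑[ T ← ssytOfWeight ρ α ] q^ chargeTableau (toList mu) T)) (partitions s))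
      ≡⟨ List.++-identityʳ _ ⟨
    right-hand-side s ∎
    where
    open ≡-Reasoning
    shift : Monomial N → Monomial N
    shift (e , η) = minimum + e , zipWith _+_ (Vec.replicate N 0) η
    unshifted : Triple → Monomial N
    unshifted (_ , P , T) = chargeTableau (toList mu) T , zipWith _+_ (weight N (readingWord P)) (Vec.replicate N 0)
    fibre : List ℕ → List Triple
    fibre ρ = cartesianProductWith (λ P T → ρ , P , T) (ssyt N (conjugate ρ ╱ [])) (ssytOfWeight ρ α)

  LLT-expansion : LLT N ν ≈ right-hand-side (size (conjugate (toList lam) ╱ conjugate (toList mu)))
  LLT-expansion = subst (λ s → LLT N ν ≈ right-hand-side s) (sym (size-conjugate mu≤lam))
    (↭⇒≈ (↭-trans LLT-crossings (↭-trans crossings-peaks (↭-trans peaks-triples (↭-reflexive (triples-expansion (Vec.sum α)))))))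

minimal-inv : ∀ {n} {lam mu : Vec ℕ n} → Thin lam mu → Pointwise _≤_ mu lam →
  IsMinInv (zipWith verticalStrip lam mu) (surplusSum lam mu)
minimal-inv {lam = lam} {mu} t mu≤lam =
  (N , stripFillings mu V , complete (enumerates-tuples N mu≤lam) (V , h , refl) ,
   trans (inv-strips t h) (trans (cong (surplusSum lam mu +_) (crossingSum-blocks N t)) (+-identityʳ _))) ,
  λ N T T∈ → bound (sound (enumerates-tuples N mu≤lam) T∈)
  where
  -- The filling of the boxes with their column numbers attains the minimum; it uses letters up to
  -- the largest part of λ.
  N = largest (toList lam)
  V = blocks N lam mu
  h = hasRows-blocks mu≤lam ≤-refl
  bound : ∀ {N T} → IsTuple N lam mu T → surplusSum lam mu ≤ inv T
  bound (V , h , refl) = ≤-trans (m≤m+n _ _) (≤-reflexive (sym (inv-strips t h)))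

theorem1 :
  ∀ (ℓ : ℕ) (lam mu : Vec ℕ ℓ) →
  Linked _≥_ lam → Linked _≥_ mu → Pointwise _≤_ mu lam →
  (∀ c → columnSize (toList lam ╱ toList mu) c ≤ 2) →
  let α : Vec ℕ ℓ
      α = zipWith _∸_ lam mu
      ν : Vec SkewShape ℓ
      ν = zipWith verticalStrip lam mu
      n : ℕ
      n = size (conjugate (toList lam) ╱ conjugate (toList mu))
  in
  ∃ λ (mininv : ℕ) → IsMinInv ν mininv ×
    (∀ (N : ℕ) →
      LLT N ν ≈
        q^ mininv ⊗
          (∑[ ρ ← partitions n ]
            (schur N (conjugate ρ) ⊗
              (∑[ T ← ssytOfWeight ρ α ] q^ chargeTableau (toList mu) T))))
theorem1 ℓ lam mu lam-decreasing mu-decreasing mu≤lam columns≤2 =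
  surplusSum lam mu , minimal-inv t mu≤lam , Expansion.LLT-expansion t mu≤lam
  where
  t : Thin lam mu
  t = thin-columns 1 lam-decreasing mu-decreasing mu≤lam columns≤2
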